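{- For every $\delta > 0$ there exist $n_0 \in \mathbb N$ and $\sigma > 0$ such that the following holds for all $n, t \in \mathbb{N}$ with $n \geq n_0$. If $\mathcal{H}$ is an $n$-vertex hypergraph with maximum degree at most $(1-\delta)tn$ and codegree at most $t$ such that the number of edges $e$ of $\mathcal{H}$ with $(1-\delta)\sqrt{n}\le |V(e)|\le (1+\delta)\sqrt n$ is at most $(1-\delta)tn$, then $\chi_\ell'(\mathcal{H}) \leq (1-\sigma)tn$.
   Context: A hypergraph $\mathcal H$ consists of a finite vertex set $V(\mathcal H)$ and a finite set of edges, each edge $e$ equipped with a non-empty set $V(e)\subseteq V(\mathcal H)$ (multiple edges with equal vertex sets allowed); $n$-vertex means $|V(\mathcal H)|=n$. Degree of $v$: number of edges containing $v$; maximum degree: maximum over vertices. Codegree of distinct $u,v$: number of edges containing both; codegree of $\mathcal H$: maximum over pairs of distinct vertices. A proper edge-colouring gives distinct colours to any two distinct edges whose vertex sets intersect. For a list assignment $C$ (a set $C(e)$ of colours for each edge $e$), a $C$-edge-colouring is a proper edge-colouring $\phi$ with $\phi(e)\in C(e)$. The list chromatic index $\chi'_\ell(\mathcal H)$ is the least $m$ such that $\mathcal H$ has a $C$-edge-colouring whenever $|C(e)|\ge m$ for all edges $e$. -}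

module Defs where

open import Data.Nat using (ℕ)
open import Data.Integer using (+_)
open import Data.Rational using (ℚ; _/_; _≤_; _*_; _-_; _+_; 0ℚ; 1ℚ)
open import Data.Rational.Properties using (_≤?_)
open import Data.Fin using (Fin)
open import Data.Fin.Subset using (Subset; _∈_; ∣_∣; Nonempty)
open import Data.Vec using (tabulate)
open import Data.Bool using (Bool; true; false; _∧_; _∨_)
open import Data.List using (List; length)
open import Data.List.Relation.Unary.Unique.Propositional using (Unique)
import Data.List.Membership.Propositional as LM
open import Data.Product using (Σ; ∃; _×_)
open import Data.Sum using (_⊎_)
open import Relation.Binary.PropositionalEquality using (_≡_; _≢_)
open import Relation.Nullary using (Dec; does)
open import Data.Fin.Subset.Properties using (_∈?_)

⟦_⟧ : ℕ → ℚ
⟦ k ⟧ = (+ k) / 1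

-- A hypergraph on vertex set Fin n with m edges (indexed by Fin m);
-- each edge e has a non-empty vertex set V e ⊆ Fin n (multi-edges allowed).
record Hypergraph (n : ℕ) : Set where
  field
    m        : ℕ
    V        : Fin m → Subset n
    nonempty : ∀ e → Nonempty (V e)
open Hypergraph public

degree : ∀ {n} (H : Hypergraph n) → Fin n → ℕ
degree H v = ∣ tabulate (λ e → does (v ∈? V H e)) ∣

codeg : ∀ {n} (H : Hypergraph n) → Fin n → Fin n → ℕ
codeg H u v = ∣ tabulate (λ e → does (u ∈? V H e) ∧ does (v ∈? V H e)) ∣

MaxDegreeAtMost : ∀ {n} → Hypergraph n → ℚ → Set
MaxDegreeAtMost H D = ∀ v → ⟦ degree H v ⟧ ≤ D

CodegreeAtMost : ∀ {n} → Hypergraph n → ℕ → Set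
CodegreeAtMost H t = ∀ u v → u ≢ v → Data.Nat._≤_ (codeg H u v) t
  where import Data.Nat

-- Comparisons of a natural number k with a·√n (a rational, n natural),
-- decided without real numbers:
--   a·√n ≤ k  iff  a ≤ 0  or  a²·n ≤ k²
--   k ≤ b·√n  iff  0 ≤ b  and  k² ≤ b²·n
sqrtLowerB : ℚ → ℕ → ℕ → Bool
sqrtLowerB a n k = does (a ≤? 0ℚ) ∨ does ((a * a) * ⟦ n ⟧ ≤? ⟦ k ⟧ * ⟦ k ⟧)

sqrtUpperB : ℕ → ℚ → ℕ → Bool
sqrtUpperB k b n = does (0ℚ ≤? b) ∧ does (⟦ k ⟧ * ⟦ k ⟧ ≤? (b * b) * ⟦ n ⟧)

windowCount : ∀ {n} → ℚ → Hypergraph n → ℕ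
windowCount {n} δ H =
  ∣ tabulate (λ e → sqrtLowerB (1ℚ - δ) n ∣ V H e ∣ ∧ sqrtUpperB ∣ V H e ∣ (1ℚ + δ) n) ∣

Proper : ∀ {n} (H : Hypergraph n) → (Fin (m H) → ℕ) → Set
Proper H φ = ∀ e e' → e ≢ e' → (∃ λ v → v ∈ V H e × v ∈ V H e') → φ e ≢ φ e'

-- H has a C-edge-colouring for every list assignment C with |C(e)| ≥ k
-- (a list assignment is represented by duplicate-free lists of colours)
ListColourable : ∀ {n} → Hypergraph n → ℕ → Set
ListColourable H k =
  (C : Fin (m H) → List ℕ) → (∀ e → Unique (C e)) → (∀ e → Data.Nat._≤_ k (length (C e))) →
  Σ (Fin (m H) → ℕ) λ φ → (∀ e → LM._∈_ (φ e) (C e)) × Proper H φ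
  where import Data.Nat

-- χ'_ℓ(H) ≤ X : some m ≤ X has the list-colouring property
-- (χ'_ℓ(H) is the least such m)
ListChromaticIndexAtMost : ∀ {n} → Hypergraph n → ℚ → Set
ListChromaticIndexAtMost H X = ∃ λ k → ⟦ k ⟧ ≤ X × ListColourable H k

{-# OPTIONS --safe #-}
module Submission where

-- The edges are split by size into small, medium and large ones, and the colours at random into many
-- classes of which every list contains its share. Small and medium edges have bounded size, so they
-- are coloured from their classes by a nibble: the colours are processed one by one, each taking a
-- nearly perfect fractional matching rounded to a matching, and the few edges left over are coloured
-- greedily from a reserved class. Large edges are coloured first. Removing large edges with few
-- neighbours leaves a core W in which every edge has about tn neighbours; if e₀ is a smallest edge of
-- W, counting pairs of vertices shows that the edges of size close to |e₀| cover almost all pairs.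
-- When |e₀| is in the window around √n this contradicts the bound on the number of such edges. When
-- it is below the window, the neighbourhoods are locally sparse, so that colouring a few edges at
-- random repeats many colours in each neighbourhood and makes the greedy colouring succeed; the
-- edges of W that are much larger than e₀ are degenerate and use reserved colours. All random choices
-- are replaced by averaging arguments with rational weights.

open import Data.Bool using (Bool; true; false; _∧_; _∨_; not; if_then_else_)
open import Data.Empty using (⊥; ⊥-elim)
import Data.Integer as ℤ
import Data.Integer.Properties as ℤₚ
open import Data.List using () renaming ([] to ∎; _∷_ to _⸴_)
open import Data.List using (List; []; _∷_; _++_; replicate; length; upTo)
open import Data.List.Membership.Propositional using (_∈_)
open import Data.List.Membership.Propositional.Properties using (∈-upTo⁺; ∈-upTo⁻)
open import Data.List.Properties using (length-upTo)
open import Data.List.Relation.Unary.All as All using (All; []; _∷_)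
import Data.List.Relation.Unary.All.Properties as Allₚ
open import Data.List.Relation.Unary.AllPairs using (AllPairs; []; _∷_)
import Data.List.Relation.Unary.AllPairs.Properties as AllPairsₚ
open import Data.List.Relation.Unary.Any using (here; there)
open import Data.Maybe using (Maybe; just; nothing)
import Data.Nat as ℕ
open import Data.Nat using (ℕ; zero; suc)
open import Data.Nat.Coprimality using (Coprime; 1-coprimeTo) renaming (sym to coprime-sym)
import Data.Nat.DivMod as ℕ/
import Data.Nat.Properties as ℕₚ
import Data.Nat.Tactic.RingSolver as ℕR
open import Data.Product using (Σ; ∃; _×_; _,_; proj₁; proj₂)
import Data.Rational
open import Data.Rational using (ℚ; ½; _+_; _*_; _-_; -_; _≤_; _<_; _⊔_; nonNegative; positive; Positive; 1/_; NonZero; mkℚ; toℚᵘ) renaming (0ℚ to 0#; 1ℚ to 1#)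
import Data.Rational.Properties as ℚₚ
open import Data.Rational.Properties using (≤-refl; ≤-trans; ≤-reflexive; ≤-total; +-mono-≤; *-monoˡ-≤-nonNeg; +-*-commutativeRing; _≟_; _≤?_; _<?_; <⇒≤; ≰⇒>; ≮⇒≥; <-≤-trans; ≤-<-trans; <-irrefl; p≤p⊔q; p≤q⊔p; ⊔-lub; p≤q⇒p⊔q≡q; p≥q⇒p⊔q≡p; +-inverseʳ; +-identityˡ; +-identityʳ; *-identityˡ; *-identityʳ; *-zeroˡ; *-zeroʳ; +-assoc; +-comm; *-comm; *-assoc; *-distribˡ-+)
import Data.Rational.Unnormalised as ℚᵘ
import Data.Rational.Unnormalised.Properties as ℚᵘₚ
open import Data.Sum using (_⊎_; inj₁; inj₂; [_,_]′)
open import Data.Unit using (tt)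
open import Defs using (⟦_⟧)
open import Level using (0ℓ)
open import Relation.Binary.Definitions using (DecidableEquality)
open import Relation.Binary.PropositionalEquality using (_≡_; _≢_; refl; sym; trans; cong; cong₂; subst; subst₂)
open import Relation.Nullary using (yes; no; does; ¬_; Dec)
open import Tactic.RingSolver using (solve; solve-∀)
open import Tactic.RingSolver.Core.AlmostCommutativeRing using (AlmostCommutativeRing; fromCommutativeRing)

-- A random choice enters only through the mean of one scalar, so an outcome at least as good as the
-- mean suffices, and neither concentration inequalities nor the local lemma are needed. Where a
-- union bound would be usual, the constraints at all vertices or lists are combined into a sum of
-- exponential potentials: the sum starts with a factor polynomial in `t * n`, while violating one
-- constraint would make its own term exponentially larger. For this the nibble has to serve an
-- arbitrary weight `y`; the weight used is the drop of the potential when an edge receives the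
-- current colour. The value √n comes from counting pairs. If the edges around `f` have size about
-- `k`, a neighbour of `f` meets at most about `t * k * k` other neighbours of `f`, one vertex being
-- taken on each of the two edges. This stays a constant factor below `t * n` when `k` is at most (1
-- - δ)√n. Far above √n no core exists, since `t * n` edges of size `k` contain about
-- `t * n * k * k` ordered pairs and at most `t * n * n` are available.

ring : AlmostCommutativeRing 0ℓ 0ℓ
ring = fromCommutativeRing +-*-commutativeRing isZero where
 isZero : ∀ x → Maybe (0# ≡ x)
 isZero x with 0# ≟ x
 ... | yes p = just p
 ... | no _ = nothing

-- Numerals with an opaque coprimality proof: the ring solver copies the normal forms of constants.
abstract
 coprime-1 : ∀ k → Coprime k 1
 coprime-1 k = coprime-sym (1-coprimeTo k)

 1-coprime : ∀ k → Coprime 1 k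
 1-coprime = 1-coprimeTo

⟪_⟫ : ℕ → ℚ
⟪ k ⟫ = mkℚ (ℤ.+ k) 0 (coprime-1 k)

¼ ⅛ : ℚ
¼ = mkℚ (ℤ.+ 1) 3 (1-coprime 4)
⅛ = mkℚ (ℤ.+ 1) 7 (1-coprime 8)

-- Reasoning with equations and inequalities in the rationals

infixl 0 _⨾_
_⨾_ : {A : Set} {a b c : A} → a ≡ b → b ≡ c → a ≡ c
_⨾_ = trans

≡≤ : ∀ {a b c} → a ≡ b → b ≤ c → a ≤ c
≡≤ refl h = h

infixl 6 _⊕_
infixl 7 _⊗_

_⊕_ : ∀ {a b} → 0# ≤ a → 0# ≤ b → 0# ≤ a + b
p ⊕ q = ≡≤ (sym (+-identityˡ 0#)) (+-mono-≤ p q)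

_⊗_ : ∀ {a b} → 0# ≤ a → 0# ≤ b → 0# ≤ a * b
_⊗_ {a} {b} p q = subst (_≤ a * b) (*-zeroʳ a) (*-monoˡ-≤-nonNeg a {{nonNegative p}} q)

-- Inequalities are proved by certificates: a nonnegative expression and a ring identity.
gap : ∀ {a b} → a ≤ b → 0# ≤ b - a
gap {a} {b} h = subst (_≤ b - a) (+-inverseʳ a) (+-mono-≤ h (≤-refl { - a}))

by : ∀ {a b p} → 0# ≤ p → b ≡ a + p → a ≤ b
by {a} {b} {p} h e = subst₂ _≤_ (+-identityʳ a) (sym e) (+-mono-≤ (≤-refl {a}) h)

0≤1 : 0# ≤ 1#
0≤1 = subst (λ q → 0# ≤ q) refl (ℚₚ.nonNegative⁻¹ 1#)

0≤⟦_⟧ : ∀ k → 0# ≤ ⟦ k ⟧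
0≤⟦ k ⟧ = ℚₚ.nonNegative⁻¹ ⟦ k ⟧ {{ℚₚ.normalize-nonNeg k 1}}

0≤⟪_⟫ : ∀ k → 0# ≤ ⟪ k ⟫
0≤⟪ k ⟫ = ℚₚ.nonNegative⁻¹ ⟪ k ⟫

0≤¼ : 0# ≤ ¼
0≤¼ = ℚₚ.nonNegative⁻¹ ¼

0≤⅛ : 0# ≤ ⅛
0≤⅛ = ℚₚ.nonNegative⁻¹ ⅛

0≤½ : 0# ≤ ½
0≤½ = ℚₚ.nonNegative⁻¹ ½

sq≥0-eq : ∀ a → (0# - a) * (0# - a) ≡ a * a
sq≥0-eq = solve-∀ ring

sq≥0 : ∀ a → 0# ≤ a * a
sq≥0 a with ≤-total 0# a
... | inj₁ p = p ⊗ p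
... | inj₂ p = subst (0# ≤_) (sq≥0-eq a) (gap p ⊗ gap p)

*-mono : ∀ {a b c d} → 0# ≤ a → 0# ≤ d → a ≤ b → c ≤ d → a * c ≤ b * d
*-mono {a} {b} {c} {d} p q h k = by (p ⊗ gap k ⊕ gap h ⊗ q) (solve (a ⸴ b ⸴ c ⸴ d ⸴ ∎) ring)

*-monoˡ : ∀ {a b c} → 0# ≤ a → b ≤ c → a * b ≤ a * c
*-monoˡ {a} {b} {c} p h = by (p ⊗ gap h) (solve (a ⸴ b ⸴ c ⸴ ∎) ring)

*-monoʳ : ∀ {a b c} → 0# ≤ a → b ≤ c → b * a ≤ c * a
*-monoʳ {a} {b} {c} p h = by (p ⊗ gap h) (solve (a ⸴ b ⸴ c ⸴ ∎) ring)

<⇒¬≥ : ∀ {a b} → a < b → ¬ (b ≤ a)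
<⇒¬≥ p q = <-irrefl refl (<-≤-trans p q)

infixr 0 _≤∘_
_≤∘_ : ∀ {a b c} → a ≤ b → b ≤ c → a ≤ c
_≤∘_ = ≤-trans

𝟙 : Bool → ℚ
𝟙 true = 1#
𝟙 false = 0#

0≤𝟙 : ∀ b → 0# ≤ 𝟙 b
0≤𝟙 true = 0≤1
0≤𝟙 false = ≤-refl

𝟙≤1 : ∀ b → 𝟙 b ≤ 1#
𝟙≤1 true = ≤-refl
𝟙≤1 false = 0≤1

𝟙-∧ : ∀ a b → 𝟙 (a ∧ b) ≡ 𝟙 a * 𝟙 b
𝟙-∧ true b = sym (*-identityˡ (𝟙 b))
𝟙-∧ false b = sym (*-zeroˡ (𝟙 b))

-- Sums and products over lists

infixr 6 ∑ ∏
syntax ∑ xs (λ x → e) = ∑[ x ∈ xs ] e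
syntax ∏ xs (λ x → e) = ∏[ x ∈ xs ] e

∑ : {A : Set} → List A → (A → ℚ) → ℚ
∑ [] f = 0#
∑ (x ∷ xs) f = f x + ∑ xs f

∏ : {A : Set} → List A → (A → ℚ) → ℚ
∏ [] f = 1#
∏ (x ∷ xs) f = f x * ∏ xs f

∑*∑-expand : ∀ a b s t → (a + s) * (b + t) ≡ a * b + (a * t + b * s) + s * t
∑*∑-expand = solve-∀ ring

prs≤∑∑-eq : ∀ a b c d e → (a + b) + (c + d) ≡ (b + e) + (a + c + (d - e))
prs≤∑∑-eq = solve-∀ ring

∑-∈-eq : ∀ a b c → a + b ≡ c + (a + (b - c))
∑-∈-eq = solve-∀ ring

module _ {A : Set} where

 ∑-cong : ∀ (xs : List A) {f g} → (∀ x → f x ≡ g x) → ∑ xs f ≡ ∑ xs g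
 ∑-cong [] h = refl
 ∑-cong (x ∷ xs) h = cong₂ _+_ (h x) (∑-cong xs h)

 ∑-mono∈ : ∀ (xs : List A) {f g} → (∀ x → x ∈ xs → f x ≤ g x) → ∑ xs f ≤ ∑ xs g
 ∑-mono∈ [] h = ≤-refl
 ∑-mono∈ (x ∷ xs) h = +-mono-≤ (h x (here refl)) (∑-mono∈ xs (λ y p → h y (there p)))

 ∑-mono : ∀ (xs : List A) {f g} → (∀ x → f x ≤ g x) → ∑ xs f ≤ ∑ xs g
 ∑-mono xs h = ∑-mono∈ xs (λ x _ → h x)

 ∑-0 : ∀ (xs : List A) → ∑ xs (λ _ → 0#) ≡ 0#
 ∑-0 [] = refl
 ∑-0 (x ∷ xs) = trans (+-identityˡ _) (∑-0 xs)

 ∑-nonneg : ∀ (xs : List A) {f} → (∀ x → 0# ≤ f x) → 0# ≤ ∑ xs f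
 ∑-nonneg [] h = ≤-refl
 ∑-nonneg (x ∷ xs) h = h x ⊕ ∑-nonneg xs h

 ∑-+ : ∀ (xs : List A) f g → ∑ xs (λ x → f x + g x) ≡ ∑ xs f + ∑ xs g
 ∑-+ [] f g = refl
 ∑-+ (x ∷ xs) f g = trans (cong (f x + g x +_) (∑-+ xs f g)) (rearrange (f x) (g x) (∑ xs f) (∑ xs g)) where
  rearrange : ∀ a b c d → (a + b) + (c + d) ≡ (a + c) + (b + d)
  rearrange = solve-∀ ring

 ∑-*ˡ : ∀ (xs : List A) c f → ∑ xs (λ x → c * f x) ≡ c * ∑ xs f
 ∑-*ˡ [] c f = sym (*-zeroʳ c)
 ∑-*ˡ (x ∷ xs) c f = trans (cong (c * f x +_) (∑-*ˡ xs c f)) (sym (*-distribˡ-+ c (f x) (∑ xs f)))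

 ∑-*ʳ : ∀ (xs : List A) c f → ∑ xs (λ x → f x * c) ≡ ∑ xs f * c
 ∑-*ʳ xs c f = trans (∑-cong xs (λ x → *-comm (f x) c)) (trans (∑-*ˡ xs c f) (*-comm c _))

 ∑-- : ∀ (xs : List A) f g → ∑ xs (λ x → f x - g x) ≡ ∑ xs f - ∑ xs g
 ∑-- [] f g = refl
 ∑-- (x ∷ xs) f g = trans (cong (f x - g x +_) (∑-- xs f g)) (rearrange (f x) (g x) (∑ xs f) (∑ xs g)) where
  rearrange : ∀ a b c d → (a - b) + (c - d) ≡ (a + c) - (b + d)
  rearrange = solve-∀ ring

 ∑-++ : ∀ (xs ys : List A) f → ∑ (xs ++ ys) f ≡ ∑ xs f + ∑ ys f
 ∑-++ [] ys f = sym (+-identityˡ _)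
 ∑-++ (x ∷ xs) ys f = trans (cong (f x +_) (∑-++ xs ys f)) (sym (+-assoc (f x) _ _))

 ∑-swap : ∀ {B : Set} (xs : List A) (ys : List B) (f : A → B → ℚ) →
      ∑[ x ∈ xs ] ∑[ y ∈ ys ] f x y ≡ ∑[ y ∈ ys ] ∑[ x ∈ xs ] f x y
 ∑-swap [] ys f = sym (zeros ys) where
  zeros : ∀ {B : Set} (ys : List B) → ∑ ys (λ _ → 0#) ≡ 0#
  zeros [] = refl
  zeros (y ∷ ys) = trans (+-identityˡ _) (zeros ys)
 ∑-swap (x ∷ xs) ys f = trans (cong (∑ ys (f x) +_) (∑-swap xs ys f)) (sym (plus ys (f x) _)) where
  plus : ∀ {B : Set} (xs : List B) f g → ∑ xs (λ x → f x + g x) ≡ ∑ xs f + ∑ xs g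
  plus [] f g = refl
  plus (x ∷ xs) f g = trans (cong (f x + g x +_) (plus xs f g)) (rearrange (f x) (g x) (∑ xs f) (∑ xs g)) where
   rearrange : ∀ a b c d → (a + b) + (c + d) ≡ (a + c) + (b + d)
   rearrange = solve-∀ ring

 ∑-∈ : ∀ {xs : List A} {x} f → (∀ x → 0# ≤ f x) → x ∈ xs → f x ≤ ∑ xs f
 ∑-∈ {y ∷ xs} f h (here refl) = by (∑-nonneg xs h) refl
 ∑-∈ {y ∷ xs} {x} f h (there p) = by (h y ⊕ gap (∑-∈ f h p)) (∑-∈-eq (f y) (∑ xs f) (f x))

 ∏-cong : ∀ (xs : List A) {f g} → (∀ x → f x ≡ g x) → ∏ xs f ≡ ∏ xs g
 ∏-cong [] h = refl
 ∏-cong (x ∷ xs) h = cong₂ _*_ (h x) (∏-cong xs h)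

 ∏-* : ∀ (xs : List A) f g → ∏ xs (λ x → f x * g x) ≡ ∏ xs f * ∏ xs g
 ∏-* [] f g = refl
 ∏-* (x ∷ xs) f g = trans (cong (f x * g x *_) (∏-* xs f g)) (rearrange (f x) (g x) (∏ xs f) (∏ xs g)) where
  rearrange : ∀ a b c d → (a * b) * (c * d) ≡ (a * c) * (b * d)
  rearrange = solve-∀ ring

 ∏-nonneg : ∀ (xs : List A) {f} → (∀ x → 0# ≤ f x) → 0# ≤ ∏ xs f
 ∏-nonneg [] h = 0≤1
 ∏-nonneg (x ∷ xs) h = h x ⊗ ∏-nonneg xs h

 ∏-mono : ∀ (xs : List A) {f g} → (∀ x → 0# ≤ f x) → (∀ x → f x ≤ g x) → ∏ xs f ≤ ∏ xs g
 ∏-mono [] p h = ≤-refl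
 ∏-mono (x ∷ xs) p h = *-mono (p x) (∏-nonneg xs (λ y → ≤-trans (p y) (h y))) (h x) (∏-mono xs p h)

-- Sums over pairs of positions i < j, and triples i < j < k

 prs : (A → A → ℚ) → List A → ℚ
 prs γ [] = 0#
 prs γ (x ∷ xs) = ∑ xs (γ x) + prs γ xs

 trs : (A → A → A → ℚ) → List A → ℚ
 trs γ [] = 0#
 trs γ (x ∷ xs) = prs (γ x) xs + trs γ xs

 prs-cong : ∀ (xs : List A) {γ γ'} → (∀ x y → γ x y ≡ γ' x y) → prs γ xs ≡ prs γ' xs
 prs-cong [] h = refl
 prs-cong (x ∷ xs) h = cong₂ _+_ (∑-cong xs (h x)) (prs-cong xs h)

 prs-nonneg : ∀ (xs : List A) {γ} → (∀ x y → 0# ≤ γ x y) → 0# ≤ prs γ xs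
 prs-nonneg [] h = ≤-refl
 prs-nonneg (x ∷ xs) h = ∑-nonneg xs (h x) ⊕ prs-nonneg xs h

 prs-mono : ∀ {R : A → A → Set} {xs : List A} {γ γ'} → AllPairs R xs →
       (∀ x y → R x y → γ x y ≤ γ' x y) → prs γ xs ≤ prs γ' xs
 prs-mono [] h = ≤-refl
 prs-mono {xs = x ∷ xs} {γ} {γ'} (p ∷ ps) h =
  +-mono-≤ (∑-mono∈ xs (λ y y∈ → h x y (All.lookup p y∈))) (prs-mono ps h)

 prs≤∑∑ : ∀ (xs : List A) {γ} → (∀ x y → 0# ≤ γ x y) → prs γ xs ≤ ∑[ x ∈ xs ] ∑[ y ∈ xs ] γ x y
 prs≤∑∑ [] h = ≤-refl
 prs≤∑∑ (x ∷ xs) {γ} h = by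
  (h x x ⊕ ∑-nonneg xs (λ y → h y x) ⊕ gap (prs≤∑∑ xs h))
  (trans (cong (γ x x + ∑ xs (γ x) +_) (∑-+ xs (λ y → γ y x) (λ y → ∑ xs (γ y))))
      (prs≤∑∑-eq (γ x x) (∑ xs (γ x)) (∑[ y ∈ xs ] γ y x) (∑[ y ∈ xs ] ∑ xs (γ y)) (prs γ xs)))

 -- (∑a)(∑b) splits into diagonal and off-diagonal parts.
 ∑*∑ : ∀ (xs : List A) a b → ∑ xs a * ∑ xs b ≡
    ∑ xs (λ x → a x * b x) + (prs (λ x y → a x * b y) xs + prs (λ x y → b x * a y) xs)
 ∑*∑ [] a b = refl
 ∑*∑ (x ∷ xs) a b = trans (∑*∑-expand (a x) (b x) (∑ xs a) (∑ xs b))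
  (trans (cong (λ z → a x * b x + (a x * ∑ xs b + b x * ∑ xs a) + z) (∑*∑ xs a b))
  (trans (cong₂ (λ u v → a x * b x + (u + v) +
       (∑ xs (λ x → a x * b x) + (prs (λ x y → a x * b y) xs + prs (λ x y → b x * a y) xs)))
       (sym (∑-*ˡ xs (a x) b)) (sym (∑-*ˡ xs (b x) a)))
   (regroup (a x * b x) (∑ xs (λ y → a x * b y)) (∑ xs (λ y → b x * a y)) (∑ xs (λ x → a x * b x))
    (prs (λ x y → a x * b y) xs) (prs (λ x y → b x * a y) xs)))) where
  regroup : ∀ p u v d e f → p + (u + v) + (d + (e + f)) ≡ (p + d) + ((u + e) + (v + f))
  regroup = solve-∀ ring

-- Expectation over a random sublist containing each e independently with probability p e

eq-eq : ∀ p a b → a ≡ (p * a + (1# - p) * b) + (1# - p) * (a - b)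
eq-eq = solve-∀ ring

solve-0-eq : ∀ p a b → b ≡ (p * a + (1# - p) * b) + p * (b - a)
solve-0-eq = solve-∀ ring

outcome-eq : ∀ p a b → p ≡ 0# → p * a + (1# - p) * b ≡ b
outcome-eq p a b refl = (λ a b → solve-0 a b) a b where
 solve-0 : ∀ a b → 0# * a + (1# - 0#) * b ≡ b
 solve-0 = solve-∀ ring

𝔼-trs-eq : ∀ p c m → p * (c + m) + (1# - p) * m ≡ p * c + m
𝔼-trs-eq = solve-∀ ring

𝔼-prs-eq : ∀ p c m → p * (c + m) + (1# - p) * m ≡ p * c + m
𝔼-prs-eq = solve-∀ ring

𝔼-lin-eq : ∀ p c m → p * (c + m) + (1# - p) * m ≡ p * c + m
𝔼-lin-eq = solve-∀ ring

𝔼-const-eq : ∀ p c → p * c + (1# - p) * c ≡ c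
𝔼-const-eq = solve-∀ ring

𝔼-*ˡ-eq : ∀ p c a b → p * (c * a) + (1# - p) * (c * b) ≡ c * (p * a + (1# - p) * b)
𝔼-*ˡ-eq = solve-∀ ring

𝔼-+-eq : ∀ p a b c d → p * (a + b) + (1# - p) * (c + d) ≡ (p * a + (1# - p) * c) + (p * b + (1# - p) * d)
𝔼-+-eq = solve-∀ ring

module _ {A : Set} (p : A → ℚ) where

 𝔼 : List A → (List A → ℚ) → ℚ
 𝔼 [] F = F []
 𝔼 (e ∷ es) F = p e * 𝔼 es (λ B → F (e ∷ B)) + (1# - p e) * 𝔼 es F

 𝔼-+ : ∀ es F G → 𝔼 es (λ B → F B + G B) ≡ 𝔼 es F + 𝔼 es G
 𝔼-+ [] F G = refl
 𝔼-+ (e ∷ es) F G = trans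
  (cong₂ (λ u v → p e * u + (1# - p e) * v) (𝔼-+ es (λ B → F (e ∷ B)) (λ B → G (e ∷ B))) (𝔼-+ es F G))
  (𝔼-+-eq (p e) _ _ _ _)

 𝔼-*ˡ : ∀ es c F → 𝔼 es (λ B → c * F B) ≡ c * 𝔼 es F
 𝔼-*ˡ [] c F = refl
 𝔼-*ˡ (e ∷ es) c F = trans
  (cong₂ (λ u v → p e * u + (1# - p e) * v) (𝔼-*ˡ es c (λ B → F (e ∷ B))) (𝔼-*ˡ es c F))
  (𝔼-*ˡ-eq (p e) c _ _)

 𝔼-const : ∀ es c → 𝔼 es (λ _ → c) ≡ c
 𝔼-const [] c = refl
 𝔼-const (e ∷ es) c = trans (cong₂ (λ u v → p e * u + (1# - p e) * v) (𝔼-const es c) (𝔼-const es c)) (𝔼-const-eq (p e) c)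

 𝔼-cong : ∀ es {F G} → (∀ B → F B ≡ G B) → 𝔼 es F ≡ 𝔼 es G
 𝔼-cong [] h = h []
 𝔼-cong (e ∷ es) h = cong₂ (λ u v → p e * u + (1# - p e) * v) (𝔼-cong es (λ B → h (e ∷ B))) (𝔼-cong es h)

 𝔼-∑ : ∀ {X : Set} es (xs : List X) (F : X → List A → ℚ) →
    𝔼 es (λ B → ∑[ x ∈ xs ] F x B) ≡ ∑[ x ∈ xs ] 𝔼 es (F x)
 𝔼-∑ es [] F = 𝔼-const es 0#
 𝔼-∑ es (x ∷ xs) F = trans (𝔼-+ es (F x) _) (cong (𝔼 es (F x) +_) (𝔼-∑ es xs F))

 𝔼-lin : ∀ es c → 𝔼 es (λ B → ∑ B c) ≡ ∑[ e ∈ es ] p e * c e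
 𝔼-lin [] c = refl
 𝔼-lin (e ∷ es) c = trans
  (cong (λ u → p e * u + (1# - p e) * 𝔼 es (λ B → ∑ B c))
     (trans (𝔼-+ es (λ _ → c e) (λ B → ∑ B c)) (cong (_+ 𝔼 es (λ B → ∑ B c)) (𝔼-const es (c e)))))
  (trans (𝔼-lin-eq (p e) (c e) (𝔼 es (λ B → ∑ B c))) (cong (p e * c e +_) (𝔼-lin es c)))

 𝔼-prs : ∀ es γ → 𝔼 es (prs γ) ≡ prs (λ x y → p x * (p y * γ x y)) es
 𝔼-prs [] γ = refl
 𝔼-prs (e ∷ es) γ = trans
  (cong (λ u → p e * u + (1# - p e) * 𝔼 es (prs γ))
     (trans (𝔼-+ es (λ B → ∑ B (γ e)) (prs γ)) (cong (_+ 𝔼 es (prs γ)) (𝔼-lin es (γ e)))))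
  (trans (𝔼-prs-eq (p e) (∑[ y ∈ es ] p y * γ e y) (𝔼 es (prs γ)))
      (cong₂ _+_ (sym (∑-*ˡ es (p e) _)) (𝔼-prs es γ)))

 𝔼-trs : ∀ es γ → 𝔼 es (trs γ) ≡ trs (λ x y z → p x * (p y * (p z * γ x y z))) es
 𝔼-trs [] γ = refl
 𝔼-trs (e ∷ es) γ = trans
  (cong (λ u → p e * u + (1# - p e) * 𝔼 es (trs γ))
     (trans (𝔼-+ es (prs (γ e)) (trs γ)) (cong (_+ 𝔼 es (trs γ)) (𝔼-prs es (γ e)))))
  (trans (𝔼-trs-eq (p e) (prs (λ y z → p y * (p z * γ e y z)) es) (𝔼 es (trs γ)))
      (cong₂ _+_ (sym (prs-*ˡ es (p e) _)) (𝔼-trs es γ))) where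
  prs-*ˡ : ∀ es c γ → prs (λ y z → c * γ y z) es ≡ c * prs γ es
  prs-*ˡ [] c γ = sym (*-zeroʳ c)
  prs-*ˡ (e ∷ es) c γ = trans (cong₂ _+_ (∑-*ˡ es c (γ e)) (prs-*ˡ es c γ)) (sym (*-distribˡ-+ c _ _))

 module _ (0≤p : ∀ e → 0# ≤ p e) (p≤1 : ∀ e → p e ≤ 1#) where

  𝔼-mono : ∀ es {F G} → (∀ B → F B ≤ G B) → 𝔼 es F ≤ 𝔼 es G
  𝔼-mono [] h = h []
  𝔼-mono (e ∷ es) h = +-mono-≤ (*-monoˡ (0≤p e) (𝔼-mono es (λ B → h (e ∷ B))))
                 (*-monoˡ (gap (p≤1 e)) (𝔼-mono es h))

  -- First-moment method: at each element the better of the two branches is kept. Elements of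
  -- probability 0 are never taken, so whatever is selected has positive weight; this is how
  -- membership in a support is known later.
  outcome : ∀ es F → ∃ λ B → 𝔼 es F ≤ F B × All (λ e → 0# < p e × e ∈ es) B
  outcome [] F = [] , ≤-refl , []
  outcome (e ∷ es) F with 0# <? p e
  ... | no ¬0<p = let B , h , q = outcome es F in B , ≡≤ (outcome-eq (p e) _ _ p≡0) h , All.map (λ (a , b) → a , there b) q where
   p≡0 : p e ≡ 0#
   p≡0 = ℚₚ.≤-antisym (≮⇒≥ ¬0<p) (0≤p e)
  ... | yes 0<p with ≤-total (𝔼 es (λ B → F (e ∷ B))) (𝔼 es F)
  ...   | inj₁ le = let B , h , q = outcome es F in
      B , ≤-trans (by (0≤p e ⊗ gap le) (solve-0-eq (p e) _ _)) h , All.map (λ (a , b) → a , there b) q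
  ...   | inj₂ le = let B , h , q = outcome es (λ B → F (e ∷ B)) in
      e ∷ B , ≤-trans (by (gap (p≤1 e) ⊗ gap le) (eq-eq (p e) _ _)) h , (0<p , here refl) ∷ All.map (λ (a , b) → a , there b) q

-- The embedding of ℕ, inverses, powers

⟦⟧-cancel-pure : ∀ a b → a ≤ b → 1# + b ≤ a → 1# ≤ 0#
⟦⟧-cancel-pure a b p q = by (gap p ⊕ gap q) (solve (a ⸴ b ⸴ ∎) ring)

module _ where
 open ℚᵘ using (mkℚᵘ; *≡*; *≤*)

 private
  toℚᵘ-⟦⟧ : ∀ k → toℚᵘ ⟦ k ⟧ ℚᵘ.≃ mkℚᵘ (ℤ.+ k) 0
  toℚᵘ-⟦⟧ k = ℚₚ.toℚᵘ-fromℚᵘ (mkℚᵘ (ℤ.+ k) 0)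

 ⟦⟧-+ : ∀ a b → ⟦ a ℕ.+ b ⟧ ≡ ⟦ a ⟧ + ⟦ b ⟧
 ⟦⟧-+ a b = ℚₚ.toℚᵘ-injective (ℚᵘₚ.≃-trans (toℚᵘ-⟦⟧ (a ℕ.+ b))
  (ℚᵘₚ.≃-trans (*≡* (cong (ℤ._* ℤ.1ℤ) (cong₂ ℤ._+_ (sym (ℤₚ.*-identityʳ (ℤ.+ a))) (sym (ℤₚ.*-identityʳ (ℤ.+ b))))))
  (ℚᵘₚ.≃-sym (ℚᵘₚ.≃-trans (ℚₚ.toℚᵘ-homo-+ ⟦ a ⟧ ⟦ b ⟧) (ℚᵘₚ.+-cong (toℚᵘ-⟦⟧ a) (toℚᵘ-⟦⟧ b))))))

 ⟦⟧-* : ∀ a b → ⟦ a ℕ.* b ⟧ ≡ ⟦ a ⟧ * ⟦ b ⟧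
 ⟦⟧-* a b = ℚₚ.toℚᵘ-injective (ℚᵘₚ.≃-trans (toℚᵘ-⟦⟧ (a ℕ.* b))
  (ℚᵘₚ.≃-trans (*≡* (cong (ℤ._* ℤ.1ℤ) (ℤₚ.pos-* a b)))
  (ℚᵘₚ.≃-sym (ℚᵘₚ.≃-trans (ℚₚ.toℚᵘ-homo-* ⟦ a ⟧ ⟦ b ⟧) (ℚᵘₚ.*-cong (toℚᵘ-⟦⟧ a) (toℚᵘ-⟦⟧ b))))))

 ⟦⟧-mono : ∀ {a b} → a ℕ.≤ b → ⟦ a ⟧ ≤ ⟦ b ⟧
 ⟦⟧-mono {a} {b} h = subst (λ t → ⟦ a ⟧ ≤ ⟦ t ⟧) (ℕₚ.m+[n∸m]≡n h) (by 0≤⟦ b ℕ.∸ a ⟧ (⟦⟧-+ a (b ℕ.∸ a)))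

 1+⟦_⟧ : ∀ k → ⟦ suc k ⟧ ≡ 1# + ⟦ k ⟧
 1+⟦ k ⟧ = ⟦⟧-+ 1 k

 ⟦⟧-cancel : ∀ {a b} → ⟦ a ⟧ ≤ ⟦ b ⟧ → a ℕ.≤ b
 ⟦⟧-cancel {a} {b} h with a ℕₚ.≤? b
 ... | yes p = p
 ... | no ¬p = ⊥-elim (<⇒¬≥ (ℚₚ.positive⁻¹ 1#) (⟦⟧-cancel-pure ⟦ a ⟧ ⟦ b ⟧ h (subst (_≤ ⟦ a ⟧) 1+⟦ b ⟧ (⟦⟧-mono (ℕₚ.≰⇒> ¬p)))))

 archimedean : ∀ q → ∃ λ k → q ≤ ⟦ k ⟧
 archimedean q@(mkℚ n d _) = ℤ.∣ n ∣ , ℚₚ.toℚᵘ-cancel-≤ (ℚᵘₚ.≤-respʳ-≃ (ℚᵘₚ.≃-sym (toℚᵘ-⟦⟧ ℤ.∣ n ∣))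
  (*≤* (ℤₚ.≤-trans (ℤₚ.≤-reflexive (ℤₚ.*-identityʳ n)) (ℤₚ.≤-trans (n≤∣n∣ n)
   (subst (ℤ.+ ℤ.∣ n ∣ ℤ.≤_) (ℤₚ.pos-* ℤ.∣ n ∣ (suc d)) (ℤ.+≤+ (ℕₚ.m≤m*n ℤ.∣ n ∣ (suc d)))))))) where
  n≤∣n∣ : ∀ n → n ℤ.≤ ℤ.+ ℤ.∣ n ∣
  n≤∣n∣ (ℤ.+ n) = ℤₚ.≤-refl
  n≤∣n∣ (ℤ.-[1+ n ]) = ℤ.-≤+

 inverse : ∀ {q} → 0# < q → ∃ λ q' → 0# < q' × q * q' ≡ 1#
 inverse {q} h = 1/ q , ℚₚ.positive⁻¹ (1/ q) {{ℚₚ.1/pos⇒pos q {{positive h}}}} , ℚₚ.*-inverseʳ q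
  where instance
   q≢0 : NonZero q
   q≢0 = ℚₚ.pos⇒nonZero q {{positive h}}

 <⊗ : ∀ {a b} → 0# < a → 0# < b → 0# < a * b
 <⊗ {a} {b} p q = ℚₚ.positive⁻¹ (a * b) {{ℚₚ.pos*pos⇒pos a {{positive p}} b {{positive q}}}}

 0<1 : 0# < 1#
 0<1 = ℚₚ.positive⁻¹ 1#

 0<½ : 0# < ½
 0<½ = ℚₚ.positive⁻¹ ½

 <⇒≢ : ∀ {a} → 0# < a → a ≢ 0#
 <⇒≢ p refl = <-irrefl refl p

 cancel-≤ : ∀ {a b c} → 0# < c → c * a ≤ c * b → a ≤ b
 cancel-≤ {a} {b} {c} p h = ℚₚ.*-cancelˡ-≤-pos c {{positive p}} h

infixr 8 _^_
_^_ : ℚ → ℕ → ℚ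
q ^ zero = 1#
q ^ suc k = q * q ^ k

^-nonneg : ∀ {q} k → 0# ≤ q → 0# ≤ q ^ k
^-nonneg zero h = 0≤1
^-nonneg (suc k) h = h ⊗ ^-nonneg k h

^-mono : ∀ {p q} k → 0# ≤ p → p ≤ q → p ^ k ≤ q ^ k
^-mono zero h k = ≤-refl
^-mono (suc n) h k = *-mono h (^-nonneg n (≤-trans h k)) k (^-mono n h k)

1≤^ : ∀ {q} k → 1# ≤ q → 1# ≤ q ^ k
1≤^ zero h = ≤-refl
1≤^ (suc k) h = *-mono 0≤1 (≤-trans 0≤1 (1≤^ k h)) h (1≤^ k h)

^-*-eq : ∀ a b c d → (a * b) * (c * d) ≡ (a * c) * (b * d)
^-*-eq = solve-∀ ring

^-* : ∀ p q k → (p * q) ^ k ≡ p ^ k * q ^ k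
^-* p q zero = refl
^-* p q (suc k) = trans (cong (p * q *_) (^-* p q k)) (^-*-eq p q (p ^ k) (q ^ k))

^-+ : ∀ q a b → q ^ (a ℕ.+ b) ≡ q ^ a * q ^ b
^-+ q zero b = sym (*-identityˡ _)
^-+ q (suc a) b = trans (cong (q *_) (^-+ q a b)) (sym (*-assoc q _ _))

^-*ℕ : ∀ q a b → q ^ (a ℕ.* b) ≡ (q ^ b) ^ a
^-*ℕ q zero b = refl
^-*ℕ q (suc a) b = trans (^-+ q b (a ℕ.* b)) (cong (q ^ b *_) (^-*ℕ q a b))

^-≤ : ∀ {q} {a b} → 1# ≤ q → a ℕ.≤ b → q ^ a ≤ q ^ b
^-≤ {q} {b = b} h Data.Nat.z≤n = 1≤^ b h
^-≤ h (ℕ.s≤s l) = *-monoˡ (≤-trans 0≤1 h) (^-≤ h l)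

bernoulli-pure : ∀ a k → 0# ≤ a → 0# ≤ k → 1# + (1# + k) * a ≤ (1# + a) * (1# + k * a)
bernoulli-pure a k p q = by (p ⊗ (q ⊗ p)) (solve (a ⸴ k ⸴ ∎) ring)

bernoulli : ∀ {a} k → 0# ≤ a → 1# + ⟦ k ⟧ * a ≤ (1# + a) ^ k
bernoulli {a} zero h = ≤-reflexive (trans (cong (1# +_) (*-zeroˡ a)) refl)
bernoulli {a} (suc k) h = ≤-trans (subst (λ t → 1# + t * a ≤ (1# + a) * (1# + ⟦ k ⟧ * a)) (sym 1+⟦ k ⟧) (bernoulli-pure a ⟦ k ⟧ h 0≤⟦ k ⟧))
 (*-monoˡ (0≤1 ⊕ h) (bernoulli k h))

-- Indicators of disjunctions and truncated differences

anyᵇ : {A : Set} → (A → Bool) → List A → Bool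
anyᵇ p [] = false
anyᵇ p (x ∷ xs) = p x ∨ anyᵇ p xs

any≤∑ : {A : Set} (p : A → Bool) (xs : List A) → 𝟙 (anyᵇ p xs) ≤ ∑[ x ∈ xs ] 𝟙 (p x)
any≤∑ p [] = ≤-refl
any≤∑ p (x ∷ xs) with p x
... | true = by (∑-nonneg xs (λ y → 0≤𝟙 (p y))) refl
... | false = ≤-trans (any≤∑ p xs) (≤-reflexive (sym (+-identityˡ _)))

eq-eq-3 : ∀ a q s → a + (0# + q) ≡ 0# + s + (a + q - s)
eq-eq-3 = solve-∀ ring

∑≤any-eq : ∀ a s q → a + (s + q) ≡ a + s + q
∑≤any-eq = solve-∀ ring

-- Bonferroni inequality: `m` true entries form `m(m - 1)/2` true pairs, and `m ≤ 1 + m(m - 1)/2`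
-- for `m ≥ 1`.
∑≤any : {A : Set} (p : A → Bool) (xs : List A) →
    ∑[ x ∈ xs ] 𝟙 (p x) ≤ 𝟙 (anyᵇ p xs) + prs (λ x y → 𝟙 (p x) * 𝟙 (p y)) xs
∑≤any p [] = ≤-refl
∑≤any p (x ∷ xs) with p x
... | true = by (prs-nonneg xs (λ y z → 0≤𝟙 (p y) ⊗ 0≤𝟙 (p z)))
    (trans (cong (λ s → 1# + (s + prs (λ x y → 𝟙 (p x) * 𝟙 (p y)) xs)) (∑-cong xs (λ y → *-identityˡ (𝟙 (p y)))))
     (∑≤any-eq 1# (∑ xs (λ y → 𝟙 (p y))) (prs (λ x y → 𝟙 (p x) * 𝟙 (p y)) xs)))
... | false = by (gap (∑≤any p xs))
    (trans (cong (λ s → 𝟙 (anyᵇ p xs) + (s + prs (λ x y → 𝟙 (p x) * 𝟙 (p y)) xs))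
     (trans (∑-cong xs (λ y → *-zeroˡ (𝟙 (p y)))) (∑-0 xs)))
     (eq-eq-3 (𝟙 (anyᵇ p xs)) (prs (λ x y → 𝟙 (p x) * 𝟙 (p y)) xs) (∑ xs (λ y → 𝟙 (p y)))))

any-true : {A : Set} (p : A → Bool) {xs : List A} {x : A} → x ∈ xs → p x ≡ true → anyᵇ p xs ≡ true
any-true p (here refl) h rewrite h = refl
any-true p {y ∷ xs} (there q) h with p y
... | true = refl
... | false = any-true p q h

any-witness : {A : Set} (p : A → Bool) (xs : List A) → anyᵇ p xs ≡ true → ∃ λ x → x ∈ xs × p x ≡ true
any-witness p (x ∷ xs) h with p x in eq
... | true = x , here refl , eq
... | false = let y , y∈ , q = any-witness p xs h in y , there y∈ , q

∑-prs : {A B : Set} (xs : List A) (ys : List B) (f : A → B → B → ℚ) →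
    ∑[ x ∈ xs ] prs (f x) ys ≡ prs (λ y z → ∑[ x ∈ xs ] f x y z) ys
∑-prs xs [] f = ∑-0 xs
∑-prs xs (y ∷ ys) f = trans (∑-+ xs _ _) (cong₂ _+_ (∑-swap xs ys _) (∑-prs xs ys f))

module _ {V : Set} (_≟ᵥ_ : DecidableEquality V) where

 ∑-delta : ∀ {vs} → AllPairs _≢_ vs → ∀ w → ∑[ v ∈ vs ] 𝟙 (does (v ≟ᵥ w)) ≤ 1#
 ∑-delta [] w = 0≤1
 ∑-delta {v ∷ vs} (p ∷ ps) w with v ≟ᵥ w
 ... | no _ = ≡≤ (+-identityˡ _) (∑-delta ps w)
 ... | yes refl = ≤-reflexive (trans (cong (1# +_) (zeros vs p)) (+-identityʳ 1#)) where
  zeros : ∀ us → All (v ≢_) us → ∑[ u ∈ us ] 𝟙 (does (u ≟ᵥ v)) ≡ 0#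
  zeros [] _ = refl
  zeros (u ∷ us) (q ∷ qs) with u ≟ᵥ v
  ... | yes refl = ⊥-elim (q refl)
  ... | no _ = trans (+-identityˡ _) (zeros us qs)

pos : ℚ → ℚ
pos q = 0# ⊔ q

0≤pos : ∀ q → 0# ≤ pos q
0≤pos q = p≤p⊔q 0# q

≤pos : ∀ q → q ≤ pos q
≤pos q = p≤q⊔p 0# q

pos-mono : ∀ {a b} → a ≤ b → pos a ≤ pos b
pos-mono {a} {b} h = ⊔-lub (0≤pos b) (≤-trans h (≤pos b))

pos≤1 : ∀ {a} → a ≤ 1# → pos a ≤ 1#
pos≤1 h = ⊔-lub 0≤1 h

-- Damping by `1# - o` undoes an overshoot by the factor `1# + o`; the truncation is needed because
-- `o` may exceed 1.
1+o*pos≤1 : ∀ o → 0# ≤ o → (1# + o) * pos (1# - o) ≤ 1#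
1+o*pos≤1 o h with ≤-total 0# (1# - o)
... | inj₁ p = subst (λ t → (1# + o) * t ≤ 1#) (sym (p≤q⇒p⊔q≡q p)) (by (h ⊗ h) (solve (o ⸴ ∎) ring))
... | inj₂ p = subst (λ t → (1# + o) * t ≤ 1#) (sym (p≥q⇒p⊔q≡p p)) (by 0≤1 (solve (o ⸴ ∎) ring))

-- Greedy selection of pairwise non-adjacent elements from a list

pure-pure : ∀ y s t p a → 0# ≤ a → s ≤ t + p → y + s ≤ (y + t) + (a + p)
pure-pure y s t p a k l = by (k ⊕ gap l) (solve (y ⸴ s ⸴ t ⸴ p ⸴ a ⸴ ∎) ring)

sel-weight-pure : ∀ y s t p a → 0# ≤ y → 1# ≤ a → s ≤ t + p → ∀ {q} → q ≡ y * a → y + s ≤ t + (q + p)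
sel-weight-pure y s t p a h k l refl = by (h ⊗ gap k ⊕ gap l) (solve (y ⸴ s ⸴ t ⸴ p ⸴ a ⸴ ∎) ring)

module Select {E : Set} (adj : E → E → Bool) where

 -- An element is dropped when it is adjacent to any later element, even to one that is dropped
 -- itself. This wastes elements but keeps the loss linear in the adjacent pairs, whose expected
 -- number is easy to compute.
 sel : List E → List E
 sel [] = []
 sel (e ∷ B) = if anyᵇ (adj e) B then sel B else e ∷ sel B

 sel-all : ∀ {P : E → Set} {B} → All P B → All P (sel B)
 sel-all [] = []
 sel-all {B = e ∷ B} (p ∷ ps) with anyᵇ (adj e) B
 ... | true = sel-all ps
 ... | false = p ∷ sel-all ps

 any-false : ∀ {A : Set} (p : A → Bool) B → anyᵇ p B ≡ false → All (λ f → p f ≡ false) B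
 any-false p [] h = []
 any-false p (x ∷ B) h with p x in eq
 ... | false = eq ∷ any-false p B h

 sel-matching : ∀ B → AllPairs (λ e f → adj e f ≡ false) (sel B)
 sel-matching [] = []
 sel-matching (e ∷ B) with anyᵇ (adj e) B in eq
 ... | true = sel-matching B
 ... | false = sel-all (any-false (adj e) B eq) ∷ sel-matching B

 -- A dropped `e` has a later neighbour, so the sum over pairs already contains `y e`.
 sel-weight : ∀ (y : E → ℚ) → (∀ e → 0# ≤ y e) → ∀ B → ∑ B y ≤ ∑ (sel B) y + prs (λ e f → y e * 𝟙 (adj e f)) B
 sel-weight y 0≤y [] = ≤-refl
 sel-weight y 0≤y (e ∷ B) with anyᵇ (adj e) B in eq
 ... | true = sel-weight-pure (y e) (∑ B y) (∑ (sel B) y) (prs (λ e f → y e * 𝟙 (adj e f)) B) (∑[ f ∈ B ] 𝟙 (adj e f)) (0≤y e)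
         (subst (λ t → 𝟙 t ≤ ∑[ f ∈ B ] 𝟙 (adj e f)) eq (any≤∑ (adj e) B)) (sel-weight y 0≤y B)
         (∑-*ˡ B (y e) (λ f → 𝟙 (adj e f)))
 ... | false = pure-pure (y e) (∑ B y) (∑ (sel B) y) (prs (λ e f → y e * 𝟙 (adj e f)) B) (∑[ f ∈ B ] y e * 𝟙 (adj e f)) (∑-nonneg B (λ f → 0≤y e ⊗ 0≤𝟙 (adj e f))) (sel-weight y 0≤y B)

-- Hypergraphs given by an incidence matrix

final-eq : ∀ θ S ν → (1# + θ * S - θ - θ * θ) * (1# - θ * (S - 1# - ν)) ≡ (1# + θ * (S - 1#) - θ * θ) * (1# - θ * (S - 1#) + θ * ν)
final-eq = solve-∀ ring

pure-eq₀ : ∀ u t → u + t * (1# - 1#) ≡ u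
pure-eq₀ = solve-∀ ring

pure-eq : ∀ r θ η b d c z → ⟪ 4 ⟫ * (r * r) * (θ * θ) ≡ θ * θ + b * d + z +
   (b * ((c - d) + (⟪ 4 ⟫ * (r * r * η) * θ - c) + ⟪ 4 ⟫ * θ * (θ * θ * θ - r * r * η))
   + (⟪ 2 ⟫ * (r * r) * (θ * θ) - z) + (θ * θ) * (⟪ 2 ⟫ * ((r - 1#) * (r - 1#) + ⟪ 2 ⟫ * (r - 1#)))) + (θ * θ) * (1# - ⟪ 4 ⟫ * (θ * θ) * b)
pure-eq = solve-∀ ring

prs≤-eq₂ : ∀ a b c d → a * (b * (c * d)) ≡ (a * c) * (b * d)
prs≤-eq₂ = solve-∀ ring

∑xc≤-pure₂ : ∀ i z x h t S r → 0# ≤ i → 0# ≤ z → z ≤ ⟪ 2 ⟫ * x → 0# ≤ x → 0# ≤ r → h ≤ t → t ≤ S → S ≤ r →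
    i * (z * h) ≤ ⟪ 2 ⟫ * r * (i * x)
∑xc≤-pure₂ i z x h t S r a b c d e k l m = by (a ⊗ (b ⊗ (gap k ⊕ gap l ⊕ gap m)) ⊕ a ⊗ (gap c ⊗ e))
 (solve (i ⸴ z ⸴ x ⸴ h ⸴ t ⸴ S ⸴ r ⸴ ∎) ring)

∑xc≤-pure₁ : ∀ w j → 0# ≤ w → 0# ≤ j → (1# - w) * j ≤ j
∑xc≤-pure₁ w j a b = by (a ⊗ b) (solve (w ⸴ j ⸴ ∎) ring)

pure-eq₄ : ∀ u d P → u + ((d + (P + P)) - (P + P)) ≡ u + d
pure-eq₄ = solve-∀ ring

pure-eq₃ : ∀ a P μ → a ≡ (a + (P + P)) + ((- (⟪ 2 ⟫ * μ)) * μ + μ * μ) + (μ * μ - (P + P))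
pure-eq₃ = solve-∀ ring

P≡-eq₂ : ∀ a b c d → a * (b * (c * d)) ≡ (a * c) * (b * d)
P≡-eq₂ = solve-∀ ring

pure₃-eq₀ : ∀ B C μ Z θ b → (B - C) + Z + ((1# + μ - B) + b * ((C - μ + ⟪ 2 ⟫ * (θ * θ)) * (C - μ + ⟪ 2 ⟫ * (θ * θ)))) + (1# - 1#) * (C - μ + θ * θ) ≡
   (B - C) + Z + ((1# + μ - B) + b * ((C - μ + ⟪ 2 ⟫ * (θ * θ)) * (C - μ + ⟪ 2 ⟫ * (θ * θ))))
pure₃-eq₀ = solve-∀ ring

pure₃-eq : ∀ B C μ Z θ b → 1# + (θ * θ + b * ((C - μ) * (C - μ)) + Z) ≡
   (B - C) + Z + ((1# + μ - B) + b * ((C - μ + ⟪ 2 ⟫ * (θ * θ)) * (C - μ + ⟪ 2 ⟫ * (θ * θ)))) + (1# - ⟪ 4 ⟫ * (θ * θ) * b) * (C - μ + θ * θ)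
pure₃-eq = solve-∀ ring

perVertex-pure₂ : ∀ w v c η → 0# ≤ w → w ≤ 1# → 0# ≤ v → c ≤ η → 0# ≤ η → (1# - w) * ((⟪ 2 ⟫ * v) * c) ≤ v * (⟪ 2 ⟫ * η)
perVertex-pure₂ w v c η a b d e f = by (gap b ⊗ (0≤⟪ 2 ⟫ ⊗ d ⊗ gap e) ⊕ a ⊗ (0≤⟪ 2 ⟫ ⊗ d ⊗ f)) (solve (w ⸴ v ⸴ c ⸴ η ⸴ ∎) ring)

eq₁-eq₁ : ∀ a η → (1# - 0#) * ((⟪ 2 ⟫ * 0#) * a) ≡ 0# * (⟪ 2 ⟫ * η)
eq₁-eq₁ = solve-∀ ring

perVertex-eq₁ : ∀ a → (1# - 1#) * ((⟪ 2 ⟫ * 1#) * a) ≡ 0#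
perVertex-eq₁ = solve-∀ ring

second≤-eq'' : ∀ r η → r * η * r ≡ r * r * η
second≤-eq'' = solve-∀ ring

second≤-eq' : ∀ a b c → (a * b) * c ≡ (a * c) * b
second≤-eq' = solve-∀ ring

second≤-eq : ∀ x a b c d → x * ((a * b) * (c * d)) ≡ (a * c) * (b * (d * x))
second≤-eq = solve-∀ ring

first≤-pure' : ∀ i η d s → i ≤ 1# → 0# ≤ d → 0# ≤ s → s ≤ 1# → i * (η + d * s) ≤ i * η + d
first≤-pure' i η d s a b c e = by (gap a ⊗ b ⊗ c ⊕ b ⊗ gap e) (solve (i ⸴ η ⸴ d ⸴ s ⸴ ∎) ring)

split-eq₂ : ∀ a b c d → (a * b) * (c * d) ≡ c * (d * (b * a))
split-eq₂ = solve-∀ ring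

split-eq₁ : ∀ a b c → a * (b * c) ≡ (a * b) * c
split-eq₁ = solve-∀ ring

expand-eq₁ : ∀ s l → 1# - (s + l) ≡ 1# + (- 1#) * (s + l)
expand-eq₁ = solve-∀ ring

vanish-pure : ∀ z h q q' → 0# ≤ z → 0# ≤ h → q ≤ q' → 1# * (z * (h * q)) ≤ 1# * (z * h) * q'
vanish-pure z h q q' a b c = by (a ⊗ (b ⊗ gap c)) (solve (z ⸴ h ⸴ q ⸴ q' ⸴ ∎) ring)

𝔼Z₂-pure : ∀ i z x t → 0# ≤ i → z ≤ ⟪ 2 ⟫ * x → 0# ≤ t → i * (z * (t * t)) ≤ ⟪ 2 ⟫ * (t * t) * (i * x)
𝔼Z₂-pure i z x t a b c = by (a ⊗ (gap b ⊗ (c ⊗ c))) (solve (i ⸴ z ⸴ x ⸴ t ⸴ ∎) ring)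

𝔼Z₂-eq : ∀ r θ → ⟪ 2 ⟫ * ((r * θ) * (r * θ)) * 1# ≡ ⟪ 2 ⟫ * (r * r) * (θ * θ)
𝔼Z₂-eq = solve-∀ ring

∑pc²-eq : ∀ r η θ → ⟪ 2 ⟫ * r * η * θ * (⟪ 2 ⟫ * r) ≡ ⟪ 4 ⟫ * (r * r * η) * θ
∑pc²-eq = solve-∀ ring

∑pc²-pure : ∀ θ x c r η → 0# ≤ θ → 0# ≤ x → 0# ≤ c → c ≤ ⟪ 2 ⟫ * r * η → (θ * x) * (c * c) ≤ ⟪ 2 ⟫ * r * η * θ * (x * c)
∑pc²-pure θ x c r η a b d e = by (a ⊗ b ⊗ (d ⊗ gap e)) (solve (θ ⸴ x ⸴ c ⸴ r ⸴ η ⸴ ∎) ring)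

𝔼dev²-eq₁ : ∀ s μ → (s - μ) * (s - μ) ≡ s * s + ((- (⟪ 2 ⟫ * μ)) * s + μ * μ)
𝔼dev²-eq₁ = solve-∀ ring

surviving≤-pure₂ : ∀ w j → 0# ≤ w → 0# ≤ j → (1# - w) * j ≤ j
surviving≤-pure₂ w j a b = by (a ⊗ b) (solve (w ⸴ j ⸴ ∎) ring)

surviving≤-pure : ∀ i z h N N' P → 0# ≤ i → 0# ≤ z → N ≤ h + P → N' ≤ N → i * (z * (1# - h)) ≤ (i * z - i * (z * N')) + i * (z * P)
surviving≤-pure i z h N N' P a b c d = by (a ⊗ (b ⊗ (gap c ⊕ gap d))) (solve (i ⸴ z ⸴ h ⸴ N ⸴ N' ⸴ P ⸴ ∎) ring)

∑z≤-pure : ∀ i x ψ h → 0# ≤ i → 0# ≤ x → ψ * (1# - h) ≤ 1# → i * (x * ψ) ≤ i * x + i * ((x * ψ) * h)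
∑z≤-pure i x ψ h a b c = by (a ⊗ b ⊗ gap c) (solve (i ⸴ x ⸴ ψ ⸴ h ⸴ ∎) ring)

μ≡-eq : ∀ a b c → (a * b) * c ≡ a * (b * c)
μ≡-eq = solve-∀ ring

∑c-eq₃ : ∀ a b c → (a * b) * c ≡ a * (b * c)
∑c-eq₃ = solve-∀ ring

∑c-eq₂ : ∀ a b c d e → (a * b) * (c * (d * e)) ≡ (c * e) * (a * (b * d))
∑c-eq₂ = solve-∀ ring

∑c-eq : ∀ a b c → a * (b * c) ≡ (a * b) * c
∑c-eq = solve-∀ ring

c≤-eq'' : ∀ r η → r * (⟪ 2 ⟫ * η) ≡ ⟪ 2 ⟫ * r * η
c≤-eq'' = solve-∀ ring

c≤-eq : ∀ w x v f → ⟪ 2 ⟫ * (w * x) * (v * f) ≡ (⟪ 2 ⟫ * f) * (v * (w * x))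
c≤-eq = solve-∀ ring

c≤-pure : ∀ w j z x t → 0# ≤ w → 0# ≤ j → 0# ≤ z → z ≤ ⟪ 2 ⟫ * x → j ≤ t → 0# ≤ x → w * (j * z) ≤ ⟪ 2 ⟫ * (w * x) * t
c≤-pure w j z x t a b c d e f = by (a ⊗ (b ⊗ gap d) ⊕ 0≤⟪ 2 ⟫ ⊗ (a ⊗ f) ⊗ gap e) (solve (w ⸴ j ⸴ z ⸴ x ⸴ t ⸴ ∎) ring)

z≤2x-pure : ∀ x ψ r θ → 0# ≤ x → ψ ≤ 1# + r * θ → ⟪ 4 ⟫ * (r * θ) ≤ 1# → 0# ≤ r * θ → x * ψ ≤ ⟪ 2 ⟫ * x
z≤2x-pure x ψ r θ a b c d = by (a ⊗ (gap b ⊕ gap c ⊕ 0≤⟪ 3 ⟫ ⊗ d)) (solve (x ⸴ ψ ⸴ r ⸴ θ ⸴ ∎) ring)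

h≥-pure : ∀ x s j p w → 0# ≤ x → 0# ≤ w → w ≤ 1# → 0# ≤ p → s ≤ j + p →
    x * s ≤ x * ((1# - w) * j) + (x * (w * s) + x * p)
h≥-pure x s j p w a b c d e = by (a ⊗ (gap c ⊗ gap e) ⊕ a ⊗ (b ⊗ d)) (solve (x ⸴ s ⸴ j ⸴ p ⸴ w ⸴ ∎) ring)

eq-eq-2 : ∀ a b → a + 1# * b ≡ b + a
eq-eq-2 = solve-∀ ring

cd≤-eq : ∀ a b → a + 0# * b ≡ a + 0#
cd≤-eq = solve-∀ ring

4ν≤θ-pure : ∀ r θ η → 0# ≤ θ → 0# ≤ η → 0# ≤ r → 1# ≤ r → ⟪ 4 ⟫ * θ ≤ 1# → r * r * η ≤ θ * θ * θ →
    ⟪ 4 ⟫ * ((r + r * r) * η) ≤ θ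
4ν≤θ-pure r θ η p q r0 h k l = by
 (0≤⟪ 4 ⟫ ⊗ (r0 ⊗ q ⊗ gap h) ⊕ 0≤⟪ 8 ⟫ ⊗ gap l ⊕ 0≤⟪ 2 ⟫ ⊗ (p ⊗ p ⊗ gap k) ⊕ (0≤½ ⊗ (p ⊗ gap k)) ⊕ 0≤½ ⊗ p)
 (solve (r ⸴ θ ⸴ η ⸴ ∎) ring)

𝔼x'≥-pure : ∀ x θ S r h l → 0# ≤ x → 0# ≤ θ → 0# ≤ 1# + θ * S - θ - θ * θ → 1# + θ * S - θ - θ * θ ≤ 1# + r * θ → 1# ≤ r → ⟪ 4 ⟫ * (r * θ) ≤ 1# →
    0# ≤ S → S ≤ r → h ≤ θ * S → l ≤ r * (⟪ 4 ⟫ * (r * r) * (θ * θ)) →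
    x * (1# - θ - ⟪ 10 ⟫ * (r * r * r) * (θ * θ)) ≤ (x * (1# + θ * S - θ - θ * θ)) * (1# + (- 1#) * (h + l))
𝔼x'≥-pure x θ S r h l x0 θ0 ψ0 ψ1 r1 rθ S0 Sr hS lr = ≤-trans (*-monoˡ x0 core)
 (by (x0 ⊗ ψ0 ⊗ (gap hS ⊕ gap lr)) (solve (x ⸴ θ ⸴ S ⸴ r ⸴ h ⸴ l ⸴ ∎) ring)) where
 r0 : 0# ≤ r
 r0 = ≤-trans 0≤1 r1
 core : 1# - θ - ⟪ 10 ⟫ * (r * r * r) * (θ * θ) ≤ (1# + θ * S - θ - θ * θ) * (1# + (- 1#) * (θ * S + r * (⟪ 4 ⟫ * (r * r) * (θ * θ))))
 core = by (θ0 ⊗ θ0 ⊗ (gap Sr ⊗ (r0 ⊕ S0) ⊕ S0 ⊕ S0 ⊗ θ0)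
       ⊕ (0≤⟪ 4 ⟫ ⊗ (r0 ⊗ r0 ⊗ r0) ⊗ (θ0 ⊗ θ0)) ⊗ (gap ψ1)
       ⊕ (r0 ⊗ r0 ⊗ r0 ⊗ (θ0 ⊗ θ0)) ⊗ gap rθ
       ⊕ (θ0 ⊗ θ0) ⊗ (gap r1 ⊗ (r0 ⊗ r0 ⊕ r0 ⊕ 0≤1) ⊕ gap r1 ⊗ (r0 ⊗ r0) ⊕ 0≤⟪ 3 ⟫ ⊗ (r0 ⊗ r0 ⊗ r0))) (solve (θ ⸴ S ⸴ r ⸴ ∎) ring)

eq₁-eq₁-2 : ∀ z s l q → z * ((1# - 0#) * q) ≡ z * (1# - (s + l)) + z * (s + (q - (1# - l)))
eq₁-eq₁-2 = solve-∀ ring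

x'≥-eq₁ : ∀ z s l q → z * ((1# - 1#) * q) ≡ z * (1# - (s + l)) + z * ((s - 1#) + l)
x'≥-eq₁ = solve-∀ ring

≤-trans-pure : ∀ x θ S → 0# ≤ x → x ≤ 1# → 0# ≤ θ → S ≡ 0# → x * (1# + θ * S - θ - θ * θ) ≤ 1#
≤-trans-pure x θ S a b c refl = by (gap b ⊕ a ⊗ (c ⊕ c ⊗ c)) (solve (x ⸴ θ ⸴ ∎) ring)

codeg'-pure : ∀ u v x' x ψ t → 0# ≤ u → 0# ≤ v → x' ≤ x * ψ → ψ ≤ 1# + t → 0# ≤ x → u * (v * x') ≤ (1# + t) * (u * (v * x))
codeg'-pure u v x' x ψ t a b c d e = by (a ⊗ (b ⊗ (gap c ⊕ e ⊗ gap d))) (solve (u ⸴ v ⸴ x' ⸴ x ⸴ ψ ⸴ t ⸴ ∎) ring)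

x'≤-pure : ∀ z h q → 0# ≤ z → 0# ≤ h → 0# ≤ q → q ≤ 1# → z * ((1# - h) * q) ≤ z
x'≤-pure z h q a b c d = by (a ⊗ (b ⊗ c ⊕ gap d)) (solve (z ⸴ h ⸴ q ⸴ ∎) ring)

1-loss≤1-pure : ∀ l → 0# ≤ l → 1# - l ≤ 1#
1-loss≤1-pure l h = by h (solve (l ⸴ ∎) ring)

p≤1-pure : ∀ θ x → ⟪ 4 ⟫ * θ ≤ 1# → 0# ≤ θ → x ≤ 1# → θ * x ≤ 1#
p≤1-pure θ x a b c = by (gap a ⊕ b ⊗ gap c ⊕ 0≤⟪ 3 ⟫ ⊗ b) (solve (θ ⸴ x ⸴ ∎) ring)

ψ≤-eq : ∀ θ r S → 1# + r * θ ≡ 1# + θ * S - θ - θ * θ + (θ * (r - S) + θ + θ * θ)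
ψ≤-eq = solve-∀ ring

0≤ψ-eq : ∀ θ S → 1# + θ * S - θ - θ * θ ≡
   0# + (θ * S + (1# - ⟪ 4 ⟫ * θ) * (¼ + ¼ * θ) + ⅛ * ½ * (1# - ⟪ 4 ⟫ * θ)
    + (½ + ⅛ + ⅛ * ½))
0≤ψ-eq = solve-∀ ring

∑x∑-eq : ∀ a b c → a * (b * c) ≡ b * (c * a)
∑x∑-eq = solve-∀ ring

θ≤¼-eq : ∀ r θ → ⟪ 4 ⟫ * (r * θ) ≡ ⟪ 4 ⟫ * θ + ⟪ 4 ⟫ * ((r - 1#) * θ)
θ≤¼-eq = solve-∀ ring

module Incidence {E V : Set} (_≟ᵥ_ : DecidableEquality V) (vs : List V) (vs! : AllPairs _≢_ vs)
         (inc : E → V → Bool) where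

 i : E → V → ℚ
 i e v = 𝟙 (inc e v)

 meet : E → E → Bool
 meet e f = anyᵇ (λ v → inc e v ∧ inc f v) vs

 j : E → E → ℚ
 j e f = 𝟙 (meet e f)

 size : E → ℚ
 size e = ∑[ v ∈ vs ] i e v

 0≤i : ∀ e v → 0# ≤ i e v
 0≤i e v = 0≤𝟙 (inc e v)

 0≤j : ∀ e f → 0# ≤ j e f
 0≤j e f = 0≤𝟙 (meet e f)

 0≤size : ∀ e → 0# ≤ size e
 0≤size e = ∑-nonneg vs (0≤i e)

 j≤∑ : ∀ e f → j e f ≤ ∑[ v ∈ vs ] i e v * i f v
 j≤∑ e f = ≤-trans (any≤∑ _ vs) (≤-reflexive (∑-cong vs (λ v → 𝟙-∧ (inc e v) (inc f v))))

 ∑≤j : ∀ e f → ∑[ v ∈ vs ] i e v * i f v ≤ j e f + prs (λ u v → (i e u * i f u) * (i e v * i f v)) vs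
 ∑≤j e f = subst₂ (λ a b → a ≤ j e f + b) (∑-cong vs (λ v → 𝟙-∧ (inc e v) (inc f v)))
  (prs-cong vs (λ u v → cong₂ _*_ (𝟙-∧ (inc e u) (inc f u)) (𝟙-∧ (inc e v) (inc f v)))) (∑≤any _ vs)

 -- One step of the nibble: every edge e is selected with probability θ x e, all touched
 -- vertices are deleted, and the weights of surviving edges are renormalised by ψ.
 module Step (es : List E) (es-all : ∀ e → e ∈ es) (vs-all : ∀ v → v ∈ vs)
       (x : E → ℚ) (0≤x : ∀ e → 0# ≤ x e) (x≤1 : ∀ e → x e ≤ 1#)
       (r θ η b : ℚ) (0≤θ : 0# ≤ θ) (0≤η : 0# ≤ η) (0≤b : 0# ≤ b)
       (1≤r : 1# ≤ r) (rθ : ⟪ 4 ⟫ * (r * θ) ≤ 1#) (rη : r * r * η ≤ θ * θ * θ)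
       (bθ : ⟪ 4 ⟫ * (θ * θ) * b ≡ 1#)
       (rank : ∀ e → size e ≤ r)
       (fract : ∀ v → ∑[ e ∈ es ] i e v * x e ≤ 1#)
       (codeg : ∀ u v → u ≢ v → ∑[ e ∈ es ] i e u * (i e v * x e) ≤ η) where

  0≤r : 0# ≤ r
  0≤r = ≤-trans 0≤1 1≤r

  θ≤¼ : ⟪ 4 ⟫ * θ ≤ 1#
  θ≤¼ = ≤-trans (by (0≤⟪ 4 ⟫ ⊗ (gap 1≤r ⊗ 0≤θ)) (θ≤¼-eq r θ)) rθ

  s : V → ℚ
  s v = ∑[ e ∈ es ] i e v * x e

  0≤s : ∀ v → 0# ≤ s v
  0≤s v = ∑-nonneg es (λ e → 0≤i e v ⊗ 0≤x e)

  S : E → ℚ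
  S g = ∑[ v ∈ vs ] i g v * s v

  0≤S : ∀ g → 0# ≤ S g
  0≤S g = ∑-nonneg vs (λ v → 0≤i g v ⊗ 0≤s v)

  S≤r : ∀ g → S g ≤ r
  S≤r g = ≤-trans (∑-mono vs (λ v → ≤-trans (*-monoˡ (0≤i g v) (fract v)) (≤-reflexive (*-identityʳ _)))) (rank g)

  ∑x∑ : ∀ g → ∑[ f ∈ es ] x f * (∑[ v ∈ vs ] i g v * i f v) ≡ S g
  ∑x∑ g = trans (∑-cong es (λ f → sym (∑-*ˡ vs (x f) _)))
   (trans (∑-swap es vs _) (∑-cong vs (λ v →
    trans (∑-cong es (λ f → ∑x∑-eq (x f) (i g v) (i f v))) (∑-*ˡ es (i g v) _))))

  ∑xj≤S : ∀ g → ∑[ f ∈ es ] x f * j g f ≤ S g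
  ∑xj≤S g = ≤-trans (∑-mono es (λ f → *-monoˡ (0≤x f) (j≤∑ g f))) (≤-reflexive (∑x∑ g))

  -- First-order inverse of a survival probability. Seen from a vertex `w` of `g`, only selected
  -- edges avoiding `w` matter, and these hit `g` at a rate of at least about `θ * (S g - 1#)`; the
  -- further `θ * θ` is a margin for second-order errors.
  ψ : E → ℚ
  ψ g = 1# + θ * S g - θ - θ * θ

  0≤ψ : ∀ g → 0# ≤ ψ g
  0≤ψ g = by (0≤θ ⊗ 0≤S g ⊕ gap θ≤¼ ⊗ (0≤¼ ⊕ 0≤¼ ⊗ 0≤θ) ⊕ 0≤⅛ ⊗ 0≤½ ⊗ gap θ≤¼
        ⊕ (0≤½ ⊕ 0≤⅛ ⊕ 0≤⅛ ⊗ 0≤½)) (0≤ψ-eq θ (S g))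

  ψ≤ : ∀ g → ψ g ≤ 1# + r * θ
  ψ≤ g = by (0≤θ ⊗ gap (S≤r g) ⊕ 0≤θ ⊕ 0≤θ ⊗ 0≤θ) (ψ≤-eq θ r (S g))

  module AtVertex (w : V) where

   ν : ℚ
   ν = (r + r * r) * η

   4ν≤θ : ⟪ 4 ⟫ * ν ≤ θ
   4ν≤θ = 4ν≤θ-pure r θ η 0≤θ 0≤η 0≤r 1≤r θ≤¼ rη

   cd : V → ℚ
   cd v = ∑[ f ∈ es ] i f v * (i f w * x f)

   cd≤ : ∀ v → cd v ≤ η + 𝟙 (does (v ≟ᵥ w)) * s w
   cd≤ v with v ≟ᵥ w
   ... | no v≢w = ≤-trans (codeg v w v≢w) (by ≤-refl (cd≤-eq η (s w)))
   ... | yes refl = ≤-trans (∑-mono es (λ f → ≤-trans (*-monoʳ (0≤i f v ⊗ 0≤x f) (𝟙≤1 (inc f v))) (≤-reflexive (*-identityˡ _))))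
             (by 0≤η (eq-eq-2 η (s w)))

   h : E → ℚ
   h g = ∑[ f ∈ es ] x f * ((1# - i f w) * j g f)

   -- Edges meeting g but avoiding w: the codegree bound makes double counting negligible.
   h≥ : ∀ g → S g ≤ h g + 1# + ν
   h≥ g = ≡≤ (sym (∑x∑ g))
    (≤-trans (∑-mono es pointwise) (≡≤ split (bound r η (h g) first second 0≤η second≤ first≤))) where
    γ : E → V → V → ℚ
    γ f u v = (i g u * i f u) * (i g v * i f v)
    first second : ℚ
    first = ∑[ v ∈ vs ] i g v * cd v
    second = prs (λ u v → ∑[ f ∈ es ] x f * γ f u v) vs
    pointwise : ∀ f → x f * (∑[ v ∈ vs ] i g v * i f v) ≤
          x f * ((1# - i f w) * j g f) + (x f * (i f w * (∑[ v ∈ vs ] i g v * i f v)) + x f * prs (γ f) vs)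
    pointwise f = h≥-pure (x f) _ (j g f) _ (i f w) (0≤x f) (0≤i f w) (𝟙≤1 (inc f w))
     (prs-nonneg vs (λ u v → (0≤i g u ⊗ 0≤i f u) ⊗ (0≤i g v ⊗ 0≤i f v))) (∑≤j g f)
    split : ∑[ f ∈ es ] (x f * ((1# - i f w) * j g f) + (x f * (i f w * (∑[ v ∈ vs ] i g v * i f v)) + x f * prs (γ f) vs))
        ≡ h g + (first + second)
    split = trans (∑-+ es _ _) (cong (h g +_) (trans (∑-+ es _ _) (cong₂ _+_
     (trans (∑-cong es (λ f → trans (split-eq₁ (x f) (i f w) _) (sym (∑-*ˡ vs (x f * i f w) _))))
      (trans (∑-swap es vs _) (∑-cong vs (λ v → trans (∑-cong es (λ f → split-eq₂ (x f) (i f w) (i g v) (i f v))) (∑-*ˡ es (i g v) _)))))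
     (trans (∑-cong es (λ f → sym (prs-*ˡ vs (x f) (γ f)))) (∑-prs es vs _))))) where
     prs-*ˡ : ∀ {A : Set} (es : List A) c γ → prs (λ y z → c * γ y z) es ≡ c * prs γ es
     prs-*ˡ [] c γ = sym (*-zeroʳ c)
     prs-*ˡ (e ∷ es) c γ = trans (cong₂ _+_ (∑-*ˡ es c (γ e)) (prs-*ˡ es c γ)) (sym (*-distribˡ-+ c _ _))
    first≤ : first ≤ r * η + 1#
    first≤ = ≤-trans (∑-mono vs (λ v → *-monoˡ (0≤i g v) (cd≤ v)))
     (≤-trans (∑-mono vs (λ v → first≤-pure' (i g v) η (𝟙 (does (v ≟ᵥ w))) (s w) (𝟙≤1 (inc g v)) (0≤𝟙 (does (v ≟ᵥ w))) (0≤s w) (fract w)))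
     (≡≤ (trans (∑-+ vs _ _) (cong (_+ _) (∑-*ʳ vs η (i g))))
      (+-mono-≤ (*-monoʳ 0≤η (rank g)) (∑-delta _≟ᵥ_ vs! w))))
    second≤ : second ≤ r * r * η
    second≤ = ≤-trans (prs-mono vs! (λ u v u≢v → ≤-trans (≤-reflexive
      (trans (∑-cong es (λ f → second≤-eq (x f) (i g u) (i f u) (i g v) (i f v))) (∑-*ˡ es (i g u * i g v) _)))
      (*-monoˡ (0≤i g u ⊗ 0≤i g v) (codeg u v u≢v))))
     (≤-trans (prs≤∑∑ vs (λ u v → 0≤i g u ⊗ 0≤i g v ⊗ 0≤η))
     (≡≤ (trans (∑-cong vs (λ u → trans (∑-cong vs (λ v → second≤-eq' (i g u) (i g v) η)) (∑-*ˡ vs (i g u * η) _)))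
       (trans (∑-*ʳ vs (size g) _) (cong (_* size g) (∑-*ʳ vs η _))))
      (≤-trans (*-mono (0≤size g ⊗ 0≤η) 0≤r (*-monoʳ 0≤η (rank g)) (rank g)) (≤-reflexive (second≤-eq'' r η)))))
    bound : ∀ r η h a b → 0# ≤ η → b ≤ r * r * η → a ≤ r * η + 1# → h + (a + b) ≤ h + 1# + (r + r * r) * η
    bound r η h a b _ p q = by (gap p ⊕ gap q) (solve (r ⸴ η ⸴ h ⸴ a ⸴ b ⸴ ∎) ring)

   -- With `t = θ * (S g - 1#)` the product is at most `(1# + t - θ * θ) * (1# - t + θ * ν)`, and
   -- the margin `θ * θ` pays for `θ * ν` because `4ν ≤ θ`.
   ψ*h≤1 : ∀ g → ψ g * (1# - θ * h g) ≤ 1#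
   ψ*h≤1 g = pure θ (S g) r (h g) ν (ψ g) refl 0≤θ (0≤ψ g) (0≤r ⊕ 0≤r ⊗ 0≤r) (S≤r g) (0≤S g) rθ (h≥ g) 4ν≤θ
         ((0≤r ⊕ 0≤r ⊗ 0≤r) ⊗ 0≤η) where
    pure : ∀ θ S r h ν ψ → ψ ≡ 1# + θ * S - θ - θ * θ → 0# ≤ θ → 0# ≤ ψ → 0# ≤ r + r * r → S ≤ r → 0# ≤ S → ⟪ 4 ⟫ * (r * θ) ≤ 1# →
        S ≤ h + 1# + ν → ⟪ 4 ⟫ * ν ≤ θ → 0# ≤ ν → ψ * (1# - θ * h) ≤ 1#
    pure θ S r h ν ψ refl p q _ Sr S0 rθ hS νθ ν0 = ≤-trans
     (*-monoˡ q mid)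
     (final θ S ν (θ * (S - 1#)) refl p νθ ν0 t≤ (sq≥0 (θ * (S - 1#)))) where
     mid : 1# - θ * h ≤ 1# - θ * (S - 1# - ν)
     mid = by (p ⊗ gap hS) (solve (θ ⸴ S ⸴ h ⸴ ν ⸴ ∎) ring)
     t≤ : ⟪ 4 ⟫ * (θ * (S - 1#)) ≤ 1#
     t≤ = by (0≤⟪ 4 ⟫ ⊗ (p ⊗ gap Sr) ⊕ 0≤⟪ 4 ⟫ ⊗ p ⊕ gap rθ) (solve (θ ⸴ S ⸴ r ⸴ ∎) ring)
     final : ∀ θ S ν t → t ≡ θ * (S - 1#) → 0# ≤ θ → ⟪ 4 ⟫ * ν ≤ θ → 0# ≤ ν → ⟪ 4 ⟫ * t ≤ 1# → 0# ≤ t * t →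
         (1# + θ * S - θ - θ * θ) * (1# - θ * (S - 1# - ν)) ≤ 1#
     final θ S ν t e p a n c d = subst (_≤ 1#) (sym (trans (final-eq θ S ν) (cong (λ t → (1# + t - θ * θ) * (1# - t + θ * ν)) (sym e))))
      (by (d ⊕ p ⊗ (gap a ⊗ (0≤¼ ⊗ gap c ⊕ (0≤½ ⊕ 0≤¼)) ⊕ n ⊗ (0≤⟪ 5 ⟫ ⊗ (0≤¼) ⊗ gap c ⊕ (1≤ ⊕ p ⊗ p))))
       (solve (θ ⸴ ν ⸴ t ⸴ ∎) ring)) where
      1≤ : 0# ≤ 1# + ½ + ¼
      1≤ = 0≤1 ⊕ 0≤½ ⊕ 0≤¼

   z : E → ℚ
   z g = x g * ψ g

   0≤z : ∀ g → 0# ≤ z g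
   0≤z g = 0≤x g ⊗ 0≤ψ g

   z≤2x : ∀ g → z g ≤ ⟪ 2 ⟫ * x g
   z≤2x g = z≤2x-pure (x g) (ψ g) r θ (0≤x g) (ψ≤ g) rθ (0≤r ⊗ 0≤θ)

   -- Expected loss at w caused by selecting f.
   c : E → ℚ
   c f = (1# - i f w) * (∑[ g ∈ es ] i g w * (j g f * z g))

   0≤c : ∀ f → 0# ≤ c f
   0≤c f = gap (𝟙≤1 (inc f w)) ⊗ ∑-nonneg es (λ g → 0≤i g w ⊗ (0≤j g f ⊗ 0≤z g))

   -- An edge `f` avoiding `w` harms `w` only through edges that join `w` to one of the at most `r`
   -- vertices of `f`; each such pair carries weight at most `η`, and `z ≤ 2x` gives the factor 2.
   c≤ : ∀ f → c f ≤ ⟪ 2 ⟫ * r * η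
   c≤ f = ≤-trans (*-monoˡ (gap (𝟙≤1 (inc f w))) (∑-mono es (λ g →
        c≤-pure (i g w) (j g f) (z g) (x g) _ (0≤i g w) (0≤j g f) (0≤z g) (z≤2x g) (j≤∑ g f) (0≤x g))))
    (≡≤ (cong ((1# - i f w) *_) (trans (∑-cong es (λ g → sym (∑-*ˡ vs (⟪ 2 ⟫ * (i g w * x g)) _)))
       (trans (∑-swap es vs _) (∑-cong vs (λ v → trans (∑-cong es (λ g → c≤-eq (i g w) (x g) (i g v) (i f v))) (∑-*ˡ es (⟪ 2 ⟫ * i f v) _))))))
    (≡≤ (sym (∑-*ˡ vs (1# - i f w) _))
    (≤-trans (∑-mono vs perVertex)
    (≡≤ (∑-*ʳ vs (⟪ 2 ⟫ * η) (i f))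
    (≤-trans (*-monoʳ (0≤⟪ 2 ⟫ ⊗ 0≤η) (rank f)) (≤-reflexive (c≤-eq'' r η))))))) where
    perVertex : ∀ v → (1# - i f w) * ((⟪ 2 ⟫ * i f v) * cd v) ≤ i f v * (⟪ 2 ⟫ * η)
    perVertex v with v ≟ᵥ w
    ... | yes refl with inc f v
    ...   | true = ≡≤ (perVertex-eq₁ (cd v)) (≤-trans (0≤1 ⊗ (0≤⟪ 2 ⟫ ⊗ 0≤η)) ≤-refl)
    ...   | false = ≤-reflexive (eq₁-eq₁ (cd v) η)
    perVertex v | no v≢w = perVertex-pure₂ (i f w) (i f v) (cd v) η (0≤i f w) (𝟙≤1 (inc f w)) (0≤i f v) (codeg v w v≢w) 0≤η

   ∑c : ∀ (B : List E) (q : E → ℚ) → ∑[ f ∈ B ] q f * c f ≡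
      ∑[ g ∈ es ] i g w * (z g * (∑[ f ∈ B ] q f * ((1# - i f w) * j g f)))
   ∑c B q = trans (∑-cong B (λ f → trans (∑c-eq (q f) (1# - i f w) _) (sym (∑-*ˡ es (q f * (1# - i f w)) _))))
    (trans (∑-swap B es _) (∑-cong es (λ g → trans (trans (∑-cong B (λ f → ∑c-eq₂ (q f) (1# - i f w) (i g w) (j g f) (z g)))
     (∑-*ˡ B (i g w * z g) _)) (∑c-eq₃ (i g w) (z g) _))))

   p : E → ℚ
   p f = θ * x f

   μ : ℚ
   μ = ∑[ f ∈ es ] p f * c f

   μ≡ : μ ≡ ∑[ g ∈ es ] i g w * (z g * (θ * h g))
   μ≡ = trans (∑c es p) (∑-cong es (λ g → cong (λ t → i g w * (z g * t))
       (trans (∑-cong es (λ f → μ≡-eq θ (x f) _)) (∑-*ˡ es θ _))))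

   ∑z≤ : ∑[ g ∈ es ] i g w * z g ≤ 1# + μ
   ∑z≤ = ≤-trans (∑-mono es (λ g → ∑z≤-pure (i g w) (x g) (ψ g) (θ * h g) (0≤i g w) (0≤x g) (ψ*h≤1 g)))
    (≡≤ (trans (∑-+ es _ _) (cong (s w +_) (sym μ≡))) (+-mono-≤ (fract w) ≤-refl))

   hit : E → List E → Bool
   hit g B = anyᵇ (meet g) B

   dev : List E → ℚ
   dev B = ∑ B c - μ

   Z₂ : List E → ℚ
   Z₂ B = ∑[ g ∈ es ] i g w * (z g * prs (λ f f' → j g f * j g f') B)

   0≤Z₂ : ∀ B → 0# ≤ Z₂ B
   0≤Z₂ B = ∑-nonneg es (λ g → 0≤i g w ⊗ (0≤z g ⊗ prs-nonneg B (λ f f' → 0≤j g f ⊗ 0≤j g f')))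

   -- `surviving≤` needs an upper bound for the negative of `dev B`, but only the variance is
   -- controlled. Since `4θ²b = 1`, this linear term is at most `θ * θ + b * (dev B * dev B)`; `Z₂`
   -- corrects for edges that are hit more than once.
   ov : List E → ℚ
   ov B = θ * θ + b * (dev B * dev B) + Z₂ B

   0≤ov : ∀ B → 0# ≤ ov B
   0≤ov B = 0≤θ ⊗ 0≤θ ⊕ 0≤b ⊗ sq≥0 (dev B) ⊕ 0≤Z₂ B

   -- Hits by selected edges through `w` are disregarded, which only weakens the bound. For the
   -- others Bonferroni replaces the event of being hit by a count, whose weighted total is `∑ B c`,
   -- up to the correction `Z₂ B`.
   surviving≤ : ∀ B → ∑[ g ∈ es ] i g w * (z g * (1# - 𝟙 (hit g B))) ≤ 1# + ov B
   surviving≤ B = ≤-trans (∑-mono es (λ g → surviving≤-pure (i g w) (z g) (𝟙 (hit g B)) _ _ _ (0≤i g w) (0≤z g) (∑≤any (meet g) B)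
      (∑-mono B (λ f → surviving≤-pure₂ (i f w) (j g f) (0≤i f w) (0≤j g f)))))
    (≡≤ (trans (∑-+ es _ _) (cong₂ _+_ (trans (∑-- es _ _) (cong (λ t → ∑ es (λ g → i g w * z g) - t) (sym ∑c'))) refl))
    (pure₃ (∑ es (λ g → i g w * z g)) (∑ B c) μ (Z₂ B) θ b bθ ∑z≤ (0≤b))) where
    ∑c' : ∑ B c ≡ ∑[ g ∈ es ] i g w * (z g * (∑[ f ∈ B ] (1# - i f w) * j g f))
    ∑c' = trans (∑-cong B (λ f → sym (*-identityˡ (c f)))) (trans (∑c B (λ _ → 1#))
     (∑-cong es (λ g → cong (λ t → i g w * (z g * t)) (∑-cong B (λ f → *-identityˡ _)))))
    pure₃ : ∀ B C μ Z θ b → ⟪ 4 ⟫ * (θ * θ) * b ≡ 1# → B ≤ 1# + μ → 0# ≤ b →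
        (B - C) + Z ≤ 1# + (θ * θ + b * ((C - μ) * (C - μ)) + Z)
    pure₃ B C μ Z θ b e f g = by (gap f ⊕ g ⊗ sq≥0 (C - μ + ⟪ 2 ⟫ * (θ * θ)))
     (trans (pure₃-eq B C μ Z θ b) (cong (λ t → (B - C) + Z + ((1# + μ - B) + b * ((C - μ + ⟪ 2 ⟫ * (θ * θ)) * (C - μ + ⟪ 2 ⟫ * (θ * θ)))) + (1# - t) * (C - μ + θ * θ)) e)
      ⨾ (pure₃-eq₀ B C μ Z θ b))

   -- Variance of a sum of independent terms: after expanding the square, the off-diagonal part of
   -- the mean is at most `μ * μ`.
   𝔼dev² : 𝔼 p es (λ B → dev B * dev B) ≤ ∑[ f ∈ es ] p f * (c f * c f)
   𝔼dev² = ≡≤ (trans (𝔼-cong p es (λ B → trans (𝔼dev²-eq₁ (∑ B c) μ) (cong (_+ ((- (⟪ 2 ⟫ * μ)) * ∑ B c + μ * μ)) (∑*∑ B c c))))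
     (trans (𝔼-+ p es _ _) (cong₂ _+_
      (trans (𝔼-+ p es _ _) (cong₂ _+_ (𝔼-lin p es (λ f → c f * c f)) (trans (𝔼-+ p es _ _) (cong₂ _+_ P≡ P≡))))
      (trans (𝔼-+ p es _ _) (cong₂ _+_ (trans (𝔼-*ˡ p es (- (⟪ 2 ⟫ * μ)) (λ B → ∑ B c)) (cong ((- (⟪ 2 ⟫ * μ)) *_) (𝔼-lin p es c))) (𝔼-const p es (μ * μ)))))))
    (pure _ _ P μ (∑*∑ es (λ f → p f * c f) (λ f → p f * c f)) (∑-nonneg es (λ f → sq≥0 (p f * c f)))) where
    P : ℚ
    P = prs (λ f g → (p f * c f) * (p g * c g)) es
    P≡ : 𝔼 p es (prs (λ f g → c f * c g)) ≡ P
    P≡ = trans (𝔼-prs p es _) (prs-cong es (λ f g → P≡-eq₂ (p f) (p g) (c f) (c g)))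
    pure : ∀ a d P μ → μ * μ ≡ d + (P + P) → 0# ≤ d → (a + (P + P)) + ((- (⟪ 2 ⟫ * μ)) * μ + μ * μ) ≤ a
    pure a d P μ e h = by h (trans (pure-eq₃ a P μ) (cong (λ t → (a + (P + P)) + ((- (⟪ 2 ⟫ * μ)) * μ + μ * μ) + (t - (P + P))) e
      ⨾ pure-eq₄ ((a + (P + P)) + ((- (⟪ 2 ⟫ * μ)) * μ + μ * μ)) d P))

   ∑pc² : ∑[ f ∈ es ] p f * (c f * c f) ≤ ⟪ 4 ⟫ * (r * r * η) * θ
   ∑pc² = ≤-trans (∑-mono es (λ f → ∑pc²-pure θ (x f) (c f) r η 0≤θ (0≤x f) (0≤c f) (c≤ f)))
    (≡≤ (∑-*ˡ es (⟪ 2 ⟫ * r * η * θ) (λ f → x f * c f))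
    (≤-trans (*-monoˡ (0≤⟪ 2 ⟫ ⊗ 0≤r ⊗ 0≤η ⊗ 0≤θ) ∑xc≤) (≤-reflexive (∑pc²-eq r η θ)))) where
    ∑xc≤ : ∑[ f ∈ es ] x f * c f ≤ ⟪ 2 ⟫ * r
    ∑xc≤ = ≡≤ (∑c es x) (≤-trans (∑-mono es (λ g →
      ∑xc≤-pure₂ (i g w) (z g) (x g) _ _ (S g) r (0≤i g w) (0≤z g) (z≤2x g) (0≤x g) 0≤r
       (∑-mono es (λ f → *-monoˡ (0≤x f) (∑xc≤-pure₁ (i f w) (j g f) (0≤i f w) (0≤j g f)))) (∑xj≤S g) (S≤r g)))
     (≡≤ (∑-*ˡ es (⟪ 2 ⟫ * r) _) (≤-trans (*-monoˡ (0≤⟪ 2 ⟫ ⊗ 0≤r) (fract w)) (≤-reflexive (*-identityʳ _)))))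

   𝔼Z₂ : 𝔼 p es Z₂ ≤ ⟪ 2 ⟫ * (r * r) * (θ * θ)
   𝔼Z₂ = ≡≤ (trans (𝔼-∑ p es es _) (∑-cong es (λ g → trans (𝔼-*ˡ p es (i g w) _)
       (cong (i g w *_) (trans (𝔼-*ˡ p es (z g) _) (cong (z g *_) (𝔼-prs p es _)))))))
    (≤-trans (∑-mono es (λ g → *-monoˡ (0≤i g w) (*-monoˡ (0≤z g) (prs≤ g))))
    (≤-trans (∑-mono es (λ g → 𝔼Z₂-pure (i g w) (z g) (x g) (r * θ) (0≤i g w) (z≤2x g) (0≤r ⊗ 0≤θ)))
    (≡≤ (∑-*ˡ es (⟪ 2 ⟫ * ((r * θ) * (r * θ))) _)
    (≤-trans (*-monoˡ (0≤⟪ 2 ⟫ ⊗ ((0≤r ⊗ 0≤θ) ⊗ (0≤r ⊗ 0≤θ))) (fract w)) (≤-reflexive (𝔼Z₂-eq r θ)))))) where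
    0≤p : ∀ f → 0# ≤ p f
    0≤p f = 0≤θ ⊗ 0≤x f
    ∑pj≤ : ∀ g → ∑[ f ∈ es ] p f * j g f ≤ r * θ
    ∑pj≤ g = ≡≤ (trans (∑-cong es (λ f → *-assoc θ (x f) (j g f))) (∑-*ˡ es θ _))
     (≤-trans (*-monoˡ 0≤θ (≤-trans (∑xj≤S g) (S≤r g))) (≤-reflexive (*-comm θ r)))
    prs≤ : ∀ g → prs (λ f f' → p f * (p f' * (j g f * j g f'))) es ≤ (r * θ) * (r * θ)
    prs≤ g = ≤-trans (prs≤∑∑ es (λ f f' → 0≤p f ⊗ (0≤p f' ⊗ (0≤j g f ⊗ 0≤j g f'))))
     (≡≤ (trans (∑-cong es (λ f → trans (∑-cong es (λ f' → prs≤-eq₂ (p f) (p f') (j g f) (j g f'))) (∑-*ˡ es (p f * j g f) _))) (∑-*ʳ es _ _))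
      (*-mono (∑-nonneg es (λ f → 0≤p f ⊗ 0≤j g f)) (0≤r ⊗ 0≤θ) (∑pj≤ g) (∑pj≤ g)))

   -- The small codegree enters here: `r * r * η ≤ θ * θ * θ` makes the variance at most `4θ⁴`, so
   -- that `b` times it is at most `θ * θ`.
   𝔼ov : 𝔼 p es ov ≤ ⟪ 4 ⟫ * (r * r) * (θ * θ)
   𝔼ov = ≡≤ (trans (𝔼-+ p es _ _) (cong (_+ 𝔼 p es Z₂) (trans (𝔼-+ p es _ _)
       (cong₂ _+_ (𝔼-const p es (θ * θ)) (𝔼-*ˡ p es b _)))))
    (pure r θ η b _ _ _ 0≤θ 0≤b 1≤r rη bθ 𝔼dev² ∑pc² 𝔼Z₂) where
    pure : ∀ r θ η b d c z → 0# ≤ θ → 0# ≤ b → 1# ≤ r → r * r * η ≤ θ * θ * θ → ⟪ 4 ⟫ * (θ * θ) * b ≡ 1# →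
        d ≤ c → c ≤ ⟪ 4 ⟫ * (r * r * η) * θ → z ≤ ⟪ 2 ⟫ * (r * r) * (θ * θ) →
        θ * θ + b * d + z ≤ ⟪ 4 ⟫ * (r * r) * (θ * θ)
    pure r θ η b d c z p q h k e f g l = by
     (q ⊗ (gap f ⊕ gap g ⊕ 0≤⟪ 4 ⟫ ⊗ p ⊗ gap k) ⊕ gap l ⊕ (p ⊗ p) ⊗ (0≤⟪ 2 ⟫ ⊗ (gap h ⊗ gap h ⊕ 0≤⟪ 2 ⟫ ⊗ gap h)))
     (trans (pure-eq r θ η b d c z) (cong (λ t → θ * θ + b * d + z + (b * ((c - d) + (⟪ 4 ⟫ * (r * r * η) * θ - c) + ⟪ 4 ⟫ * θ * (θ * θ * θ - r * r * η))
        + (⟪ 2 ⟫ * (r * r) * (θ * θ) - z) + (θ * θ) * (⟪ 2 ⟫ * ((r - 1#) * (r - 1#) + ⟪ 2 ⟫ * (r - 1#)))) + (θ * θ) * (1# - t)) e ⨾ pure-eq₀ _ (θ * θ)))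

  open AtVertex using (ov; 0≤ov; 𝔼ov; surviving≤)
  open Select meet

  p : E → ℚ
  p e = θ * x e

  0≤p : ∀ e → 0# ≤ p e
  0≤p e = 0≤θ ⊗ 0≤x e

  p≤1 : ∀ e → p e ≤ 1#
  p≤1 e = p≤1-pure θ (x e) θ≤¼ 0≤θ (x≤1 e)

  hit : E → List E → Bool
  hit g B = anyᵇ (meet g) B

  loss : List E → E → ℚ
  loss B e = ∑[ w ∈ vs ] i e w * ov w B

  0≤loss : ∀ B e → 0# ≤ loss B e
  0≤loss B e = ∑-nonneg vs (λ w → 0≤i e w ⊗ 0≤ov w B)

  1-loss≤1 : ∀ B e → 1# - loss B e ≤ 1#
  1-loss≤1 B e = 1-loss≤1-pure (loss B e) (0≤loss B e)

  -- Damping by the overshoot summed over all vertices of `e`, rather than by that of a single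
  -- vertex, yields one weight that respects the constraint at every vertex of `e`.
  x' : List E → E → ℚ
  x' B e = (x e * ψ e) * ((1# - 𝟙 (hit e B)) * pos (1# - loss B e))

  0≤x' : ∀ B e → 0# ≤ x' B e
  0≤x' B e = (0≤x e ⊗ 0≤ψ e) ⊗ (gap (𝟙≤1 (hit e B)) ⊗ 0≤pos (1# - loss B e))

  x'≤ : ∀ B e → x' B e ≤ x e * ψ e
  x'≤ B e = x'≤-pure (x e * ψ e) (𝟙 (hit e B)) (pos (1# - loss B e)) (0≤x e ⊗ 0≤ψ e) (0≤𝟙 (hit e B)) (0≤pos (1# - loss B e)) (pos≤1 (1-loss≤1 B e))

  fract' : ∀ B v → ∑[ e ∈ es ] i e v * x' B e ≤ 1#
  fract' B v = ≤-trans (∑-mono es perEdge)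
   (≡≤ (∑-*ʳ es (pos (1# - ov v B)) _)
   (≤-trans (*-monoʳ (0≤pos (1# - ov v B)) (surviving≤ v B)) (1+o*pos≤1 (ov v B) (0≤ov v B)))) where
   perEdge : ∀ e → i e v * x' B e ≤ i e v * ((x e * ψ e) * (1# - 𝟙 (hit e B))) * pos (1# - ov v B)
   perEdge e with inc e v in eq
   ... | false = ≤-reflexive (vanish (x' B e) ((x e * ψ e) * (1# - 𝟙 (hit e B))) (pos (1# - ov v B))) where
    vanish : ∀ a b c → 0# * a ≡ 0# * b * c
    vanish = solve-∀ ring
   ... | true = vanish-pure (x e * ψ e) (1# - 𝟙 (hit e B)) _ _ (0≤x e ⊗ 0≤ψ e) (gap (𝟙≤1 (hit e B)))
       (pos-mono (neg (loss B e) (ov v B) (≡≤ (sym (trans (cong (λ t → 𝟙 t * ov v B) eq) (*-identityˡ _)))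
         (∑-∈ (λ w → i e w * ov w B) (λ w → 0≤i e w ⊗ 0≤ov w B) (vs-all v))))) where
    neg : ∀ a b → b ≤ a → 1# - a ≤ 1# - b
    neg a b h = by (gap h) (solve (a ⸴ b ⸴ ∎) ring)

  codeg' : ∀ B u v → u ≢ v → ∑[ e ∈ es ] i e u * (i e v * x' B e) ≤ (1# + r * θ) * η
  codeg' B u v u≢v = ≤-trans (∑-mono es (λ e → codeg'-pure (i e u) (i e v) (x' B e) (x e) (ψ e) (r * θ) (0≤i e u) (0≤i e v) (x'≤ B e) (ψ≤ e) (0≤x e)))
   (≡≤ (∑-*ˡ es (1# + r * θ) _) (*-monoˡ (0≤1 ⊕ 0≤r ⊗ 0≤θ) (codeg u v u≢v)))

  -- The constraint at any vertex of `e` implies it. An edge of `inc` may also have no vertices;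
  -- then `S e` vanishes and `ψ e` is at most 1.
  x'≤1 : ∀ B e → x' B e ≤ 1#
  x'≤1 B e with anyᵇ (inc e) vs in eq
  ... | true = let v , _ , q = any-witness (inc e) vs eq in
    ≡≤ (sym (trans (cong (λ t → 𝟙 t * x' B e) q) (*-identityˡ _)))
     (≤-trans (∑-∈ (λ e → i e v * x' B e) (λ e → 0≤i e v ⊗ 0≤x' B e) (es-all e)) (fract' B v))
  ... | false = ≤-trans (x'≤ B e) (≤-trans-pure (x e) θ (S e) (0≤x e) (x≤1 e) 0≤θ S≡0) where
   zeros : ∀ us → All (λ v → inc e v ≡ false) us → ∑[ v ∈ us ] i e v * s v ≡ 0#
   zeros [] [] = refl
   zeros (u ∷ us) (q ∷ qs) rewrite q = trans (cong₂ _+_ (*-zeroˡ (s u)) (zeros us qs)) refl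
   S≡0 : S e ≡ 0#
   S≡0 = zeros vs (any-false (inc e) vs eq)

  C : ℚ
  C = ⟪ 10 ⟫ * (r * r * r)

  x'≥ : ∀ B e → (x e * ψ e) * (1# - ((∑[ f ∈ B ] j e f) + loss B e)) ≤ x' B e
  x'≥ B e with hit e B in eq
  ... | true = ≤-trans (by ((0≤x e ⊗ 0≤ψ e) ⊗ (gap (subst (λ t → 𝟙 t ≤ ∑ B (j e)) eq (any≤∑ (meet e) B)) ⊕ 0≤loss B e)) (x'≥-eq₁ (x e * ψ e) (∑ B (j e)) (loss B e) (pos (1# - loss B e)))) ≤-refl
  ... | false = ≤-trans (by ((0≤x e ⊗ 0≤ψ e) ⊗ (∑-nonneg B (0≤j e) ⊕ gap (≤pos (1# - loss B e)))) (eq₁-eq₁-2 (x e * ψ e) (∑ B (j e)) (loss B e) (pos (1# - loss B e)))) ≤-refl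

  -- The factor `ψ e` gains `θ * S e`, which also bounds the expected number of hits. What remains
  -- at first order is the loss `θ`, the share that passes to the matching.
  𝔼x'≥ : ∀ e → x e * (1# - θ - C * (θ * θ)) ≤ 𝔼 p es (λ B → x' B e)
  𝔼x'≥ e = ≤-trans (𝔼x'≥-pure (x e) θ (S e) r (𝔼 p es (λ B → ∑[ f ∈ B ] j e f)) (𝔼 p es (λ B → loss B e)) (0≤x e) 0≤θ (0≤ψ e) (ψ≤ e) 1≤r rθ (0≤S e) (S≤r e) hits≤ loss≤)
   (≡≤ (sym expand) (𝔼-mono p 0≤p p≤1 es (λ B → x'≥ B e))) where
   expand : 𝔼 p es (λ B → (x e * ψ e) * (1# - ((∑[ f ∈ B ] j e f) + loss B e))) ≡
        (x e * ψ e) * (1# + (- 1#) * (𝔼 p es (λ B → ∑[ f ∈ B ] j e f) + 𝔼 p es (λ B → loss B e)))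
   expand = trans (𝔼-*ˡ p es (x e * ψ e) _) (cong ((x e * ψ e) *_)
    (trans (𝔼-cong p es (λ B → expand-eq₁ (∑ B (j e)) (loss B e)))
    (trans (𝔼-+ p es _ _) (cong₂ _+_ (𝔼-const p es 1#) (trans (𝔼-*ˡ p es (- 1#) _) (cong ((- 1#) *_) (𝔼-+ p es _ _)))))))
   hits≤ : 𝔼 p es (λ B → ∑[ f ∈ B ] j e f) ≤ θ * S e
   hits≤ = ≡≤ (trans (𝔼-lin p es (j e)) (trans (∑-cong es (λ f → *-assoc θ (x f) (j e f))) (∑-*ˡ es θ _)))
        (*-monoˡ 0≤θ (∑xj≤S e))
   loss≤ : 𝔼 p es (λ B → loss B e) ≤ r * (⟪ 4 ⟫ * (r * r) * (θ * θ))
   loss≤ = ≡≤ (trans (𝔼-∑ p es vs _) (∑-cong vs (λ w → 𝔼-*ˡ p es (i e w) _)))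
    (≤-trans (∑-mono vs (λ w → *-monoˡ (0≤i e w) (𝔼ov w)))
    (≡≤ (∑-*ʳ vs _ (i e)) (*-monoʳ (0≤⟪ 4 ⟫ ⊗ (0≤r ⊗ 0≤r) ⊗ (0≤θ ⊗ 0≤θ)) (rank e))))

  private
   positive-factor : ∀ {a} → 0# ≤ a → a ≢ 0# → 0# < a
   positive-factor h k = ≰⇒> (λ l → k (ℚₚ.≤-antisym l h))

  x'-support : ∀ B e → 0# < x' B e → hit e B ≡ false × 0# < x e
  x'-support B e h = dead (hit e B) (pos (1# - loss B e)) h , positive-factor (0≤x e) (λ z → <⇒≢ h (trans (cong (λ t → (t * ψ e) * ((1# - 𝟙 (hit e B)) * pos (1# - loss B e))) z)
    (vanish (ψ e) ((1# - 𝟙 (hit e B)) * pos (1# - loss B e))))) where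
   vanish : ∀ a b → (0# * a) * b ≡ 0#
   vanish = solve-∀ ring
   vanish₂ : ∀ a b → a * ((1# - 1#) * b) ≡ 0#
   vanish₂ = solve-∀ ring
   dead : ∀ b q → 0# < (x e * ψ e) * ((1# - 𝟙 b) * q) → b ≡ false
   dead true q h = ⊥-elim (<⇒≢ h (vanish₂ (x e * ψ e) q))
   dead false q h = refl

  p-support : ∀ e → 0# < p e → 0# < x e
  p-support e h = positive-factor (0≤x e) (λ z → <⇒≢ h (trans (cong (θ *_) z) (*-zeroʳ θ)))

-- Iterating the nibble: rounding a fractional matching

¬true : ∀ {b} → (b ≡ true → ⊥) → b ≡ false
¬true {true} h = ⊥-elim (h refl)
¬true {false} h = refl

0≤q-pure' : ∀ r θ C → 0# ≤ θ → 1# ≤ r → ⟪ 4 ⟫ * (r * θ) ≤ 1# → C * θ ≤ 1# → 0# ≤ 1# - θ - C * (θ * θ)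
0≤q-pure' r θ C p h k l = by (p ⊗ gap l ⊕ 0≤½ ⊗ gap k ⊕ 0≤⟪ 2 ⟫ ⊗ (gap h ⊗ p) ⊕ 0≤½) (solve (r ⸴ θ ⸴ C ⸴ ∎) ring)

𝔼value-eq₂ : ∀ q x y → q * (x * y) ≡ y * (x * q)
𝔼value-eq₂ = solve-∀ ring

𝔼value-eq : ∀ a k q s → (a + k * q) * s ≡ a * s + k * (q * s)
𝔼value-eq = solve-∀ ring

𝔼sel-pure₃ : ∀ a b c → a ≤ b + c → a + (- 1#) * c ≤ b
𝔼sel-pure₃ a b c h = by (gap h) (solve (a ⸴ b ⸴ c ⸴ ∎) ring)

𝔼sel-pure₂ : ∀ a b c → c ≤ b → a - b ≤ a + (- 1#) * c
𝔼sel-pure₂ a b c h = by (gap h) (solve (a ⸴ b ⸴ c ⸴ ∎) ring)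

𝔼sel-eq : ∀ p y θ x j → (p * y) * (θ * (x * j)) ≡ p * ((θ * x) * (y * j))
𝔼sel-eq = solve-∀ ring

𝔼sel-pure : ∀ θ r x y s → 0# ≤ θ → 0# ≤ x → 0# ≤ y → s ≤ r → θ * (1# - r * θ) * (x * y) ≤ (θ * x) * y - ((θ * x) * y) * (θ * s)
𝔼sel-pure θ r x y s a b c d = by (a ⊗ (b ⊗ c) ⊗ (a ⊗ gap d)) (solve (θ ⸴ r ⸴ x ⸴ y ⸴ s ⸴ ∎) ring)

0≤γ-pure : ∀ t → ⟪ 4 ⟫ * t ≤ 1# → 0# ≤ t → 0# ≤ 1# - t
0≤γ-pure t h k = by (gap h ⊕ 0≤⟪ 3 ⟫ ⊗ k) (solve (t ⸴ ∎) ring)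

0≤q-pure : ∀ r θ C → 0# ≤ θ → 1# ≤ r → ⟪ 4 ⟫ * (r * θ) ≤ 1# → C * θ ≤ 1# → 0# ≤ 1# - θ - C * (θ * θ)
0≤q-pure r θ C p h k l = by (p ⊗ gap l ⊕ 0≤½ ⊗ gap k ⊕ 0≤⟪ 2 ⟫ ⊗ (gap h ⊗ p) ⊕ 0≤½) (solve (r ⸴ θ ⸴ C ⸴ ∎) ring)

γ-bound-pure : ∀ r C θ g t → 0# ≤ r → 0# ≤ C → 0# ≤ θ → 0# ≤ 1# - θ - C * (θ * θ) → 1# - (r + C) * θ ≤ g + t →
    1# - (r + C) * θ ≤ θ * (1# - r * θ) + g * (1# - θ - C * (θ * θ)) + (1# - θ - C * (θ * θ)) * t
γ-bound-pure r C θ g t a b c d e = by (d ⊗ gap e ⊕ (a ⊕ b) ⊗ b ⊗ (c ⊗ c ⊗ c)) (solve (r ⸴ C ⸴ θ ⸴ g ⸴ t ⸴ ∎) ring)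

γ-bound-eq : ∀ r C θ → 0# + 1# ≡ 1# - (r + C) * θ + (r + C) * θ
γ-bound-eq = solve-∀ ring

nibble-eq : ∀ r c d η → r * r * (d * (c * η)) ≡ r * r * (c * d * η)
nibble-eq = solve-∀ ring

module Matching {E V : Set} (_≟ᵥ_ : DecidableEquality V) (vs : List V) (vs! : AllPairs _≢_ vs) (vs-all : ∀ v → v ∈ vs)
        (es : List E) (es-all : ∀ e → e ∈ es) (inc : E → V → Bool) where

 open Incidence _≟ᵥ_ vs vs! inc
 open Select meet

 ∧-swap : ∀ a b → (a ∧ b) ≡ true → (b ∧ a) ≡ true
 ∧-swap true true h = refl

 meet-sym : ∀ e f → meet e f ≡ true → meet f e ≡ true
 meet-sym e f h = let v , v∈ , q = any-witness (λ v → inc e v ∧ inc f v) vs h in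
  any-true (λ v → inc f v ∧ inc e v) v∈ (∧-swap (inc e v) (inc f v) q)

 module _ (r θ b : ℚ) (0<θ : 0# < θ) (0≤b : 0# ≤ b) (1≤r : 1# ≤ r) (rθ : ⟪ 4 ⟫ * (r * θ) ≤ 1#)
      (bθ : ⟪ 4 ⟫ * (θ * θ) * b ≡ 1#) (rank : ∀ e → size e ≤ r)
      (y : E → ℚ) (0≤y : ∀ e → 0# ≤ y e) where

  0≤r : 0# ≤ r
  0≤r = ≤-trans 0≤1 1≤r

  C q : ℚ
  C = ⟪ 10 ⟫ * (r * r * r)
  q = 1# - θ - C * (θ * θ)

  -- Fraction of the weight guaranteed after k nibble steps.
  γ : ℕ → ℚ
  γ zero = 0#
  γ (suc k) = θ * (1# - r * θ) + γ k * q

  module OneStep (x : E → ℚ) (0≤x : ∀ e → 0# ≤ x e) (x≤1 : ∀ e → x e ≤ 1#) (η : ℚ) (0≤η : 0# ≤ η)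
          (rη : r * r * η ≤ θ * θ * θ)
          (fract : ∀ v → ∑[ e ∈ es ] i e v * x e ≤ 1#)
          (codeg : ∀ u v → u ≢ v → ∑[ e ∈ es ] i e u * (i e v * x e) ≤ η)
          (k : ℚ) (0≤k : 0# ≤ k) where
   open Step es es-all vs-all x 0≤x x≤1 r θ η b (<⇒≤ 0<θ) 0≤η 0≤b 1≤r rθ rη bθ rank fract codeg public
    using (x'; 0≤x'; x'≤1; fract'; codeg'; p; 0≤p; p≤1; 𝔼x'≥; ∑xj≤S; S≤r; hit; x'-support; p-support)

   -- Weight taken now plus the fraction `k` of the weight left over, `k` being what the later steps
   -- guarantee to recover. As a single scalar it lets one outcome be good for both.
   value : List E → ℚ
   value B = ∑ (sel B) y + k * (∑[ e ∈ es ] x' B e * y e)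

   ∑py : ℚ
   ∑py = ∑[ e ∈ es ] p e * y e

   conflicts : ℚ
   conflicts = prs (λ e f → p e * (p f * (y e * j e f))) es

   -- An edge is drawn with probability `θ * x e`, and the expected number of drawn edges in
   -- conflict with it is at most `r * θ`.
   𝔼sel : θ * (1# - r * θ) * (∑[ e ∈ es ] x e * y e) ≤ 𝔼 p es (λ B → ∑ (sel B) y)
   𝔼sel = ≡≤ (sym (∑-*ˡ es (θ * (1# - r * θ)) (λ e → x e * y e))) (≤-trans (∑-mono es (λ e →
      𝔼sel-pure θ r (x e) (y e) (∑[ f ∈ es ] x f * j e f) (<⇒≤ 0<θ) (0≤x e) (0≤y e) (≤-trans (∑xj≤S e) (S≤r e))))
    (≡≤ (trans (∑-- es (λ e → p e * y e) (λ e → (p e * y e) * (θ * (∑[ f ∈ es ] x f * j e f)))) (cong (λ t → ∑py - t) (∑-cong es (λ e →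
      trans (cong ((p e * y e) *_) (sym (∑-*ˡ es θ (λ f → x f * j e f)))) (trans (sym (∑-*ˡ es (p e * y e) (λ f → θ * (x f * j e f)))) (∑-cong es (λ f → 𝔼sel-eq (p e) (y e) θ (x f) (j e f))))))))
    (≤-trans (𝔼sel-pure₂ ∑py (∑[ e ∈ es ] ∑[ f ∈ es ] p e * (p f * (y e * j e f))) conflicts (prs≤∑∑ es (λ e f → 0≤p e ⊗ (0≤p f ⊗ (0≤y e ⊗ 0≤j e f)))))
    (≡≤ (sym (trans (𝔼-+ p es (λ B → ∑ B y) (λ B → (- 1#) * prs (λ e f → y e * j e f) B)) (cong₂ _+_ (𝔼-lin p es y) (trans (𝔼-*ˡ p es (- 1#) (prs (λ e f → y e * j e f))) (cong ((- 1#) *_) (𝔼-prs p es (λ e f → y e * j e f)))))))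
     (𝔼-mono p 0≤p p≤1 es (λ B → 𝔼sel-pure₃ (∑ B y) (∑ (sel B) y) (prs (λ e f → y e * j e f) B) (sel-weight y 0≤y B)))))))

   𝔼value : (θ * (1# - r * θ) + k * q) * (∑[ e ∈ es ] x e * y e) ≤ 𝔼 p es value
   𝔼value = ≡≤ (𝔼value-eq (θ * (1# - r * θ)) k q (∑[ e ∈ es ] x e * y e))
    (≤-trans (+-mono-≤ 𝔼sel (*-monoˡ 0≤k (≡≤ (sym (∑-*ˡ es q (λ e → x e * y e)))
      (≤-trans (∑-mono es (λ e → ≡≤ (𝔼value-eq₂ q (x e) (y e)) (*-monoˡ (0≤y e) (𝔼x'≥ e))))
       (≤-reflexive (trans (∑-cong es (λ e → trans (sym (𝔼-*ˡ p es (y e) (λ B → x' B e))) (𝔼-cong p es (λ B → *-comm (y e) (x' B e))))) (sym (𝔼-∑ p es es (λ e B → x' B e * y e)))))))))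
    (≤-reflexive (sym (trans (𝔼-+ p es (λ B → ∑ (sel B) y) (λ B → k * (∑[ e ∈ es ] x' B e * y e))) (cong (𝔼 p es (λ B → ∑ (sel B) y) +_) (𝔼-*ˡ p es k (λ B → ∑[ e ∈ es ] x' B e * y e)))))))

   record Result : Set where
    field
     B : List E
     z : E → ℚ
     0≤z : ∀ e → 0# ≤ z e
     z≤1 : ∀ e → z e ≤ 1#
     z-fract : ∀ v → ∑[ e ∈ es ] i e v * z e ≤ 1#
     z-codeg : ∀ u v → u ≢ v → ∑[ e ∈ es ] i e u * (i e v * z e) ≤ (1# + r * θ) * η
     z-hit : ∀ e → 0# < z e → anyᵇ (meet e) B ≡ false
     z-support : ∀ e → 0# < z e → 0# < x e
     B-support : All (λ e → 0# < x e) B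
     gain : (θ * (1# - r * θ) + k * q) * (∑[ e ∈ es ] x e * y e) ≤ ∑ (sel B) y + k * (∑[ e ∈ es ] z e * y e)

   result : Result
   result = build (proj₁ o) (proj₁ (proj₂ o)) (proj₂ (proj₂ o)) where
    o = outcome p 0≤p p≤1 es value
    build : ∀ B → 𝔼 p es value ≤ value B → All (λ e → 0# < p e × e ∈ es) B → Result
    build B h B-pos = record
     { B = B ; z = x' B ; 0≤z = 0≤x' B ; z≤1 = x'≤1 B ; z-fract = fract' B ; z-codeg = codeg' B
     ; z-hit = λ e l → proj₁ (x'-support B e l) ; z-support = λ e l → proj₂ (x'-support B e l)
     ; B-support = All.map (λ {e} l → p-support e (proj₁ l)) B-pos ; gain = ≤-trans 𝔼value h }

  -- The codegree weight may grow by the factor `1# + r * θ` in each step, so smallness is required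
  -- of its value after all `k` steps.
  nibble : ∀ k (x : E → ℚ) → (∀ e → 0# ≤ x e) → (∀ e → x e ≤ 1#) → ∀ η → 0# ≤ η →
       r * r * ((1# + r * θ) ^ k * η) ≤ θ * θ * θ →
       (∀ v → ∑[ e ∈ es ] i e v * x e ≤ 1#) →
       (∀ u v → u ≢ v → ∑[ e ∈ es ] i e u * (i e v * x e) ≤ η) → (∀ k → 0# ≤ γ k) →
       ∃ λ M → AllPairs (λ e f → meet e f ≡ false) M × All (λ e → 0# < x e) M ×
           γ k * (∑[ e ∈ es ] x e * y e) ≤ ∑ M y
  nibble zero x 0≤x x≤1 η 0≤η rη fract codeg 0≤γ = [] , [] , [] , ≤-reflexive (*-zeroˡ (∑[ e ∈ es ] x e * y e))
  nibble (suc k) x 0≤x x≤1 η 0≤η rη fract codeg 0≤γ =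
   finish (nibble k z 0≤z z≤1 ((1# + r * θ) * η) ((0≤1 ⊕ 0≤r ⊗ <⇒≤ 0<θ) ⊗ 0≤η)
        (≡≤ (nibble-eq r (1# + r * θ) ((1# + r * θ) ^ k) η) rη) z-fract z-codeg 0≤γ) where
   rη₀ : r * r * η ≤ θ * θ * θ
   rη₀ = ≤-trans (*-monoˡ (0≤r ⊗ 0≤r) (≡≤ (sym (*-identityˡ η))
       (*-monoʳ 0≤η (1≤^ (suc k) (by (0≤r ⊗ <⇒≤ 0<θ) refl))))) rη
   open OneStep x 0≤x x≤1 η 0≤η rη₀ fract codeg (γ k) (0≤γ k) using (Result; result)
   open Result result
   true≢false : true ≡ false → ⊥
   true≢false ()
   sel⊆ : ∀ B {e} → e ∈ sel B → e ∈ B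
   sel⊆ (f ∷ B) h with anyᵇ (meet f) B
   ... | true = there (sel⊆ B h)
   sel⊆ (f ∷ B) (here refl) | false = here refl
   sel⊆ (f ∷ B) (there h) | false = there (sel⊆ B h)
   finish : (∃ λ M → AllPairs (λ e f → meet e f ≡ false) M × All (λ e → 0# < z e) M × γ k * (∑[ e ∈ es ] z e * y e) ≤ ∑ M y) →
        ∃ λ M → AllPairs (λ e f → meet e f ≡ false) M × All (λ e → 0# < x e) M × γ (suc k) * (∑[ e ∈ es ] x e * y e) ≤ ∑ M y
   finish (M , M-match , M-pos , M-val) = sel B ++ M
    , AllPairsₚ.++⁺ (sel-matching B) M-match
      (All.tabulate (λ {e} e∈ → All.map (λ {f} f>0 → ¬true (λ m → true≢false
       (trans (sym (any-true (meet f) (sel⊆ B e∈) (meet-sym e f m))) (z-hit f f>0)))) M-pos))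
    , Allₚ.++⁺ (sel-all B-support) (All.map (λ {e} h → z-support e h) M-pos)
    , ≤-trans gain (≤-trans (+-mono-≤ (≤-refl {∑ (sel B) y}) M-val) (≤-reflexive (sym (∑-++ (sel B) M y))))

  -- The recursion for `γ` contracts by `q` towards `(1 - rθ)/(1 + Cθ)`, which is at least
  -- `1# - (r + C) * θ`.
  γ-bound : C * θ ≤ 1# → ∀ k → 1# - (r + C) * θ ≤ γ k + q ^ k
  γ-bound Cθ zero = by ((0≤r ⊕ 0≤C) ⊗ <⇒≤ 0<θ) (γ-bound-eq r C θ) where
   0≤C : 0# ≤ C
   0≤C = 0≤⟪ 10 ⟫ ⊗ (0≤r ⊗ 0≤r ⊗ 0≤r)
  γ-bound Cθ (suc k) = γ-bound-pure r C θ (γ k) (q ^ k) 0≤r 0≤C (<⇒≤ 0<θ) 0≤q (γ-bound Cθ k) where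
   0≤C : 0# ≤ C
   0≤C = 0≤⟪ 10 ⟫ ⊗ (0≤r ⊗ 0≤r ⊗ 0≤r)
   0≤q : 0# ≤ 1# - θ - C * (θ * θ)
   0≤q = 0≤q-pure' r θ C (<⇒≤ 0<θ) 1≤r rθ Cθ

  0≤q : C * θ ≤ 1# → 0# ≤ q
  0≤q Cθ = 0≤q-pure r θ C (<⇒≤ 0<θ) 1≤r rθ Cθ

  0≤γ : C * θ ≤ 1# → ∀ k → 0# ≤ γ k
  0≤γ Cθ zero = ≤-refl
  0≤γ Cθ (suc k) = <⇒≤ 0<θ ⊗ 0≤γ-pure (r * θ) rθ (0≤r ⊗ <⇒≤ 0<θ) ⊕ 0≤γ Cθ k ⊗ 0≤q Cθ

record NibbleConstants (r ε : ℚ) : Set where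
 field
  θ b η : ℚ
  T : ℕ
  0<θ : 0# < θ
  0≤b : 0# ≤ b
  0<η : 0# < η
  rθ : ⟪ 4 ⟫ * (r * θ) ≤ 1#
  bθ : ⟪ 4 ⟫ * (θ * θ) * b ≡ 1#
  Cθ : ⟪ 10 ⟫ * (r * r * r) * θ ≤ 1#
  rCθ : (r + ⟪ 10 ⟫ * (r * r * r)) * θ ≤ ½ * ε
  rη : r * r * ((1# + r * θ) ^ T * η) ≤ θ * θ * θ
  qT : (1# - θ - ⟪ 10 ⟫ * (r * r * r) * (θ * θ)) ^ T ≤ ½ * ε

0<⟦_⟧ : ∀ k → 0# < ⟦ suc k ⟧
0<⟦ k ⟧ = <-≤-trans 0<1 (by 0≤⟦ k ⟧ 1+⟦ k ⟧)

q*≤1-pure : ∀ θ C → 0# ≤ θ → 0# ≤ C → (1# + θ) * (1# - θ - C * (θ * θ)) ≤ 1#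
q*≤1-pure θ C p c = by (p ⊗ p ⊕ (0≤1 ⊕ p) ⊗ (c ⊗ (p ⊗ p))) (solve (θ ⸴ C ⸴ ∎) ring)

0≤q-pure-2 : ∀ r θ C → 0# ≤ θ → 1# ≤ r → ⟪ 4 ⟫ * (r + C) * θ ≤ 1# → 0# ≤ C → 0# ≤ 1# - θ - C * (θ * θ)
0≤q-pure-2 r θ C p h k c = by (p ⊗ (gap k ⊕ 0≤⟪ 4 ⟫ ⊗ (≤-trans 0≤1 h ⊗ p) ⊕ 0≤⟪ 3 ⟫ ⊗ (c ⊗ p)) ⊕ 0≤½ ⊗ (gap k ⊕ 0≤⟪ 4 ⟫ ⊗ (c ⊗ p) ⊕ 0≤⟪ 4 ⟫ ⊗ (gap h ⊗ p)) ⊕ 0≤½)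
 (solve (r ⸴ θ ⸴ C ⸴ ∎) ring)

Sθ-eq : ∀ a b c → a * (b * c) ≡ b * (a * c)
Sθ-eq = solve-∀ ring

nibbleConstants-eq₄ : ∀ a b → ⟪ 2 ⟫ * a * (½ * b) ≡ b * a
nibbleConstants-eq₄ = solve-∀ ring

nibbleConstants-eq₃ : ∀ r P t u → r * r * (P * (t * u)) ≡ t * (r * r * P * u)
nibbleConstants-eq₃ = solve-∀ ring

nibbleConstants-eq₂ : ∀ r C θ → ⟪ 4 ⟫ * (r + C) * θ ≡ C * θ + (⟪ 3 ⟫ * (C * θ) + ⟪ 4 ⟫ * (r * θ))
nibbleConstants-eq₂ = solve-∀ ring

nibbleConstants-eq₁ : ∀ r C θ → ⟪ 4 ⟫ * (r + C) * θ ≡ ⟪ 4 ⟫ * (r * θ) + ⟪ 4 ⟫ * (C * θ)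
nibbleConstants-eq₁ = solve-∀ ring

nibbleConstants : ∀ r ε → 1# ≤ r → 0# < ε → ε ≤ 1# → NibbleConstants r ε
nibbleConstants r ε 1≤r 0<ε ε≤1 = record
 { θ = θ ; b = proj₁ b* ; η = η ; T = T ; 0<θ = 0<θ ; 0≤b = <⇒≤ (proj₁ (proj₂ b*)) ; 0<η = <⊗ (<⊗ (<⊗ 0<θ 0<θ) 0<θ) (proj₁ (proj₂ u*))
 ; rθ = ≤-trans (by (0≤⟪ 4 ⟫ ⊗ (0≤C ⊗ <⇒≤ 0<θ)) (nibbleConstants-eq₁ r C θ)) S≤1
 ; bθ = proj₂ (proj₂ b*)
 ; Cθ = ≤-trans (by (0≤⟪ 3 ⟫ ⊗ (0≤C ⊗ <⇒≤ 0<θ) ⊕ 0≤⟪ 4 ⟫ ⊗ (0≤r ⊗ <⇒≤ 0<θ)) (nibbleConstants-eq₂ r C θ)) S≤1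
 ; rCθ = half ((r + C) * θ) ε (≤-reflexive (trans (sym (*-assoc ⟪ 4 ⟫ (r + C) θ)) Sθ)) (<⇒≤ 0<ε)
 ; rη = ≤-reflexive (trans (nibbleConstants-eq₃ r ((1# + r * θ) ^ T) (θ * θ * θ) (proj₁ u*)) (trans (cong (θ * θ * θ *_) (proj₂ (proj₂ u*))) (*-identityʳ _)))
 ; qT = cancel-≤ {c = ⟪ 2 ⟫ * ε'} (<⊗ 0<⟦ 1 ⟧ (proj₁ (proj₂ ε*))) (≤-trans (≤-trans (*-monoʳ (^-nonneg T 0≤q) 2ε'≤) q*≤1) (≤-reflexive (sym (trans (nibbleConstants-eq₄ ε' ε) (proj₂ (proj₂ ε*))))))
 } where
 C : ℚ
 C = ⟪ 10 ⟫ * (r * r * r)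
 0≤r : 0# ≤ r
 0≤r = ≤-trans 0≤1 1≤r
 0≤C : 0# ≤ C
 0≤C = 0≤⟪ 10 ⟫ ⊗ (0≤r ⊗ 0≤r ⊗ 0≤r)
 0<r : 0# < r
 0<r = <-≤-trans 0<1 1≤r
 S* = inverse {⟦ 4 ⟧ * (r + C)} (<⊗ 0<⟦ 3 ⟧ (<-≤-trans 0<r (by 0≤C refl)))
 ε* = inverse 0<ε
 ε' θ : ℚ
 ε' = proj₁ ε*
 -- Now `4(r + C)θ = ε`, so the first-order loss `(r + C) * θ` is within `½ * ε`.
 θ = ε * proj₁ S*
 0<θ : 0# < θ
 0<θ = <⊗ 0<ε (proj₁ (proj₂ S*))
 Sθ : ⟪ 4 ⟫ * (r + C) * θ ≡ ε
 Sθ = trans (Sθ-eq (⟪ 4 ⟫ * (r + C)) ε (proj₁ S*)) (trans (cong (ε *_) (proj₂ (proj₂ S*))) (*-identityʳ ε))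
 S≤1 : ⟪ 4 ⟫ * (r + C) * θ ≤ 1#
 S≤1 = ≡≤ Sθ ε≤1
 θ* = inverse 0<θ
 b* = inverse {⟦ 4 ⟧ * (θ * θ)} (<⊗ 0<⟦ 3 ⟧ (<⊗ 0<θ 0<θ))
 -- `T * θ ≥ 2/ε` together with `(1# + θ) * q ≤ 1#` gives `q ^ T ≤ ½ * ε` by Bernoulli's inequality.
 T* = archimedean (⟪ 2 ⟫ * ε' * proj₁ θ*)
 T : ℕ
 T = proj₁ T*
 -- `η` is fixed last, since it has to stay small through `T` steps of growth.
 u* = inverse {r * r * (1# + r * θ) ^ T} (<⊗ (<⊗ 0<r 0<r) (<-≤-trans 0<1 (1≤^ T (by (0≤r ⊗ <⇒≤ 0<θ) refl))))
 η q : ℚ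
 η = θ * θ * θ * proj₁ u*
 q = 1# - θ - C * (θ * θ)
 2ε'≤ : ⟪ 2 ⟫ * ε' ≤ 1# + ⟦ T ⟧ * θ
 2ε'≤ = ≤-trans (≡≤ (sym (trans (*-assoc (⟪ 2 ⟫ * ε') (proj₁ θ*) θ) (trans (cong (⟪ 2 ⟫ * ε' *_) (trans (*-comm (proj₁ θ*) θ) (proj₂ (proj₂ θ*)))) (*-identityʳ _))))
   (*-monoʳ (<⇒≤ 0<θ) (proj₂ T*))) (by 0≤1 (+-comm 1# (⟦ T ⟧ * θ)))
 0≤q : 0# ≤ q
 0≤q = 0≤q-pure-2 r θ C (<⇒≤ 0<θ) 1≤r S≤1 0≤C
 q*≤1 : (1# + ⟦ T ⟧ * θ) * q ^ T ≤ 1#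
 q*≤1 = ≤-trans (*-monoʳ (^-nonneg T 0≤q) (bernoulli T (<⇒≤ 0<θ))) (≡≤ (sym (^-* (1# + θ) q T))
   (≤-trans (^-mono T ((0≤1 ⊕ <⇒≤ 0<θ) ⊗ 0≤q) (q*≤1-pure θ C (<⇒≤ 0<θ) 0≤C)) (≤-reflexive (one T)))) where
  one : ∀ k → 1# ^ k ≡ 1#
  one zero = refl
  one (suc k) = trans (*-identityˡ _) (one k)
 half : ∀ a ε → ⟪ 4 ⟫ * a ≤ ε → 0# ≤ ε → a ≤ ½ * ε
 half a ε h k = by (0≤¼ ⊗ gap h ⊕ 0≤¼ ⊗ k) (solve (a ⸴ ε ⸴ ∎) ring)

matching-pure : ∀ a g t ε → 1# - a ≤ g + t → a ≤ ½ * ε → t ≤ ½ * ε → 1# - ε ≤ g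
matching-pure a g t ε h k l = by (gap h ⊕ gap k ⊕ gap l) (solve (a ⸴ g ⸴ t ⸴ ε ⸴ ∎) ring)

module _ {E V : Set} (_≟ᵥ_ : DecidableEquality V) (vs : List V) (vs! : AllPairs _≢_ vs) (vs-all : ∀ v → v ∈ vs)
     (es : List E) (es-all : ∀ e → e ∈ es) (inc : E → V → Bool)
     (r ε : ℚ) (1≤r : 1# ≤ r) (0<ε : 0# < ε) (ε≤1 : ε ≤ 1#) where
 open Incidence _≟ᵥ_ vs vs! inc
 open NibbleConstants (nibbleConstants r ε 1≤r 0<ε ε≤1)

 -- That `M` lies in the support of `x` transfers list membership and being uncoloured from `x` to
 -- `M`. The functional `y` is left free because it will be the change of a potential.
 matching : (∀ e → size e ≤ r) → (x : E → ℚ) → (∀ e → 0# ≤ x e) → (∀ e → x e ≤ 1#) →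
       (∀ v → ∑[ e ∈ es ] i e v * x e ≤ 1#) →
       (∀ u v → u ≢ v → ∑[ e ∈ es ] i e u * (i e v * x e) ≤ η) →
       (y : E → ℚ) → (∀ e → 0# ≤ y e) →
       ∃ λ M → AllPairs (λ e f → meet e f ≡ false) M × All (λ e → 0# < x e) M ×
           (1# - ε) * (∑[ e ∈ es ] x e * y e) ≤ ∑ M y
 matching rank x 0≤x x≤1 fract codeg y 0≤y = finish (nibble T x 0≤x x≤1 η (<⇒≤ 0<η) rη fract codeg (0≤γ Cθ)) where
  open Matching _≟ᵥ_ vs vs! vs-all es es-all inc using () renaming (nibble to nibble'; 0≤γ to 0≤γ'; γ to γ'; γ-bound to γ-bound')
  nibble = nibble' r θ b 0<θ 0≤b 1≤r rθ bθ rank y 0≤y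
  0≤γ = 0≤γ' r θ b 0<θ 0≤b 1≤r rθ bθ rank y 0≤y
  γ = γ' r θ b 0<θ 0≤b 1≤r rθ bθ rank y 0≤y
  finish : (∃ λ M → AllPairs (λ e f → meet e f ≡ false) M × All (λ e → 0# < x e) M × γ T * (∑[ e ∈ es ] x e * y e) ≤ ∑ M y) →
       ∃ λ M → AllPairs (λ e f → meet e f ≡ false) M × All (λ e → 0# < x e) M × (1# - ε) * (∑[ e ∈ es ] x e * y e) ≤ ∑ M y
  finish (M , a , b , c) = M , a , b , ≤-trans (*-monoʳ (∑-nonneg es (λ e → 0≤x e ⊗ 0≤y e))
   (matching-pure ((r + ⟪ 10 ⟫ * (r * r * r)) * θ) (γ T) ((1# - θ - ⟪ 10 ⟫ * (r * r * r) * (θ * θ)) ^ T) ε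
    (γ-bound' r θ (NibbleConstants.b (nibbleConstants r ε 1≤r 0<ε ε≤1)) 0<θ 0≤b 1≤r rθ bθ rank y 0≤y Cθ T) rCθ qT)) c

-- Convexity and classical product inequalities

convex-pure₃ : ∀ h φ m s → 1# + h + φ ≤ m + s → h + (1# + φ - m) ≤ s
convex-pure₃ h φ m s a = by (gap a) (solve (h ⸴ φ ⸴ m ⸴ s ⸴ ∎) ring)

convex-pure₂ : ∀ φ m → φ ≤ m → 1# + φ - m ≤ 1#
convex-pure₂ φ m a = by (gap a) (solve (φ ⸴ m ⸴ ∎) ring)

convex-pure₁ : ∀ φ m → 0# ≤ φ → m ≤ 1# → 0# ≤ 1# + φ - m
convex-pure₁ φ m a b = by (a ⊕ gap b) (solve (φ ⸴ m ⸴ ∎) ring)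

convex-pure : ∀ P c φ m → 0# ≤ P → 0# ≤ c → m ≤ 1# → φ ≤ m → (1# + c) * P * (1# + c * φ) ≤ (1# + c * m) * (P * (1# + c * (1# + φ - m)))
convex-pure P c φ m a b d e = by (a ⊗ (b ⊗ b ⊗ (gap d ⊗ gap e))) (solve (P ⸴ c ⸴ φ ⸴ m ⸴ ∎) ring)

convex-pure-2 : ∀ c φ m → 0# ≤ c → φ ≤ m → 1# * (1# + c * φ) ≤ (1# + c * m) * 1#
convex-pure-2 c φ m a b = by (a ⊗ gap b) (solve (c ⸴ φ ⸴ m ⸴ ∎) ring)

convex-pure₃-2 : ∀ h φ m s → h + φ ≤ m + s → h + (φ - m) ≤ s
convex-pure₃-2 h φ m s a = by (gap a) (solve (h ⸴ φ ⸴ m ⸴ s ⸴ ∎) ring)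

convex-pure₂-2 : ∀ φ m → φ ≤ 1# → 0# ≤ m → φ - m ≤ 1#
convex-pure₂-2 φ m a b = by (gap a ⊕ b) (solve (φ ⸴ m ⸴ ∎) ring)

convex-pure-3 : ∀ P c φ m → 0# ≤ P → 0# ≤ c → 0# ≤ m → m ≤ φ → P * (1# + c * φ) ≤ (1# + c * m) * (P * (1# + c * (φ - m)))
convex-pure-3 P c φ m a b d e = by (a ⊗ (b ⊗ b ⊗ (d ⊗ gap e))) (solve (P ⸴ c ⸴ φ ⸴ m ⸴ ∎) ring)

convex-pure-4 : ∀ h φ → 0# ≤ h → 0# ≤ φ → 1# + h + φ ≤ 0# → 1# ≤ 0#
convex-pure-4 h φ p q l = by (p ⊕ q ⊕ gap l) (solve (h ⸴ φ ⸴ ∎) ring)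

convex-pure-5 : ∀ c φ → 0# ≤ c → 0# + φ ≤ 0# → 1# * (1# + c * φ) ≤ 1#
convex-pure-5 c φ p h = by (p ⊗ gap h) (solve (c ⸴ φ ⸴ ∎) ring)

-- Among weights μ ∈ [0,1] of given sum, ∏ (1 + c μ) is smallest when all but one of them are 0 or 1.
convex : ∀ {A : Set} {c} → 0# ≤ c → (xs : List A) (μ : A → ℚ) → (∀ x → 0# ≤ μ x) → (∀ x → μ x ≤ 1#) →
     ∀ h φ → 0# ≤ φ → φ ≤ 1# → ⟦ h ⟧ + φ ≤ ∑ xs μ → (1# + c) ^ h * (1# + c * φ) ≤ ∏[ x ∈ xs ] (1# + c * μ x)
convex {c = c} 0≤c [] μ 0≤μ μ≤1 zero φ 0≤φ φ≤1 H = convex-pure-5 c φ 0≤c H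
convex {c = c} 0≤c [] μ 0≤μ μ≤1 (suc h) φ 0≤φ φ≤1 H = ⊥-elim (<⇒¬≥ 0<1 (convex-pure-4 ⟦ h ⟧ φ 0≤⟦ h ⟧ 0≤φ (subst (λ t → t + φ ≤ 0#) 1+⟦ h ⟧ H)))
convex {c = c} 0≤c (x ∷ xs) μ 0≤μ μ≤1 h φ 0≤φ φ≤1 H with ≤-total (μ x) φ
... | inj₁ μ≤φ = ≤-trans (convex-pure-3 ((1# + c) ^ h) c φ (μ x) (^-nonneg h (0≤1 ⊕ 0≤c)) 0≤c (0≤μ x) μ≤φ)
   (*-monoˡ (0≤1 ⊕ 0≤c ⊗ 0≤μ x) (convex 0≤c xs μ 0≤μ μ≤1 h (φ - μ x) (gap μ≤φ) (convex-pure₂-2 φ (μ x) φ≤1 (0≤μ x)) (convex-pure₃-2 ⟦ h ⟧ φ (μ x) (∑ xs μ) H)))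
convex {c = c} 0≤c (x ∷ xs) μ 0≤μ μ≤1 zero φ 0≤φ φ≤1 H | inj₂ φ≤μ =
 ≤-trans (convex-pure-2 c φ (μ x) 0≤c φ≤μ) (*-monoˡ (0≤1 ⊕ 0≤c ⊗ 0≤μ x) (1≤∏ xs)) where
 1≤∏ : ∀ xs → 1# ≤ ∏[ x ∈ xs ] (1# + c * μ x)
 1≤∏ [] = ≤-refl
 1≤∏ (y ∷ ys) = *-mono 0≤1 (≤-trans 0≤1 (1≤∏ ys)) (by (0≤c ⊗ 0≤μ y) refl) (1≤∏ ys)
convex {c = c} 0≤c (x ∷ xs) μ 0≤μ μ≤1 (suc h) φ 0≤φ φ≤1 H | inj₂ φ≤μ =
 ≤-trans (convex-pure ((1# + c) ^ h) c φ (μ x) (^-nonneg h (0≤1 ⊕ 0≤c)) 0≤c (μ≤1 x) φ≤μ)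
  (*-monoˡ (0≤1 ⊕ 0≤c ⊗ 0≤μ x) (convex 0≤c xs μ 0≤μ μ≤1 h (1# + φ - μ x) (convex-pure₁ φ (μ x) 0≤φ (μ≤1 x)) (convex-pure₂ φ (μ x) φ≤μ)
    (convex-pure₃ ⟦ h ⟧ φ (μ x) (∑ xs μ) (subst (λ t → t + φ ≤ μ x + ∑ xs μ) 1+⟦ h ⟧ H))))

convex₀-eq : ∀ P c → P ≡ P * (1# + c * 0#)
convex₀-eq = solve-∀ ring

convex₀ : ∀ {A : Set} {c} → 0# ≤ c → (xs : List A) (μ : A → ℚ) → (∀ x → 0# ≤ μ x) → (∀ x → μ x ≤ 1#) →
     ∀ h → ⟦ h ⟧ ≤ ∑ xs μ → (1# + c) ^ h ≤ ∏[ x ∈ xs ] (1# + c * μ x)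
convex₀ {c = c} 0≤c xs μ 0≤μ μ≤1 h H = ≡≤ (convex₀-eq ((1# + c) ^ h) c)
 (convex 0≤c xs μ 0≤μ μ≤1 h 0# ≤-refl 0≤1 (≡≤ (+-identityʳ ⟦ h ⟧) H))

abstract
 inv : ℕ → ℚ
 inv zero = 0#
 inv (suc k) = proj₁ (inverse 0<⟦ k ⟧)

 0≤inv : ∀ k → 0# ≤ inv k
 0≤inv zero = ≤-refl
 0≤inv (suc k) = <⇒≤ (proj₁ (proj₂ (inverse 0<⟦ k ⟧)))

 *inv : ∀ k → ⟦ suc k ⟧ * inv (suc k) ≡ 1#
 *inv k = proj₂ (proj₂ (inverse 0<⟦ k ⟧))

 *inv′ : ∀ {k} → 1 ℕ.≤ k → ⟦ k ⟧ * inv k ≡ 1#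
 *inv′ {suc k} _ = *inv k

pure-eq-2 : ∀ x s t y → s ≡ 1# → t ≡ 1# → x ≡ y + (x * s - y * t)
pure-eq-2 x s t y refl refl = solve (x ⸴ y ⸴ ∎) ring

pure-eq₂ : ∀ a b x y → x * y * (b - a) ≡ x * (b * y) - y * (a * x)
pure-eq₂ = solve-∀ ring

inv-anti : ∀ {a b} → 1 ℕ.≤ a → a ℕ.≤ b → inv b ≤ inv a
inv-anti {suc a} {suc b} _ h = pure ⟦ suc a ⟧ ⟦ suc b ⟧ (inv (suc a)) (inv (suc b)) (*inv a) (*inv b) (0≤inv (suc a)) (0≤inv (suc b)) (⟦⟧-mono h) where
 pure : ∀ a b x y → a * x ≡ 1# → b * y ≡ 1# → 0# ≤ x → 0# ≤ y → a ≤ b → y ≤ x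
 pure a b x y p q u v h = by (u ⊗ v ⊗ gap h) (trans (pure-eq-2 x (b * y) (a * x) y q p) (sym (cong (y +_) (pure-eq₂ a b x y))))

∑-rep-eq₃ : ∀ c n → c + n * c ≡ (1# + n) * c
∑-rep-eq₃ = solve-∀ ring

euler-mono-eq₂ : ∀ a b c → a * (b * c) ≡ (b * a) * c
euler-mono-eq₂ = solve-∀ ring

euler-mono-eq : ∀ a b c → a * (b * c) ≡ b * (a * c)
euler-mono-eq = solve-∀ ring

-- (1 + 1/k)^k is increasing in k.
euler-mono : ∀ k → (1# + inv (suc k)) ^ suc k ≤ (1# + inv (suc (suc k))) ^ suc (suc k)
-- `k + 2` equal weights `(k + 1)/(k + 2)` have the sum `k + 1`, so `convex₀` compares them with
-- `k + 1` weights equal to 1.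
euler-mono k = ≤-trans (convex₀ (0≤inv (suc k)) (replicate (suc (suc k)) tt) (λ _ → m) (λ _ → 0≤⟦ suc k ⟧ ⊗ 0≤inv (suc (suc k)))
   (λ _ → ≤-trans (*-monoʳ (0≤inv (suc (suc k))) (⟦⟧-mono (ℕₚ.n≤1+n (suc k)))) (≤-reflexive (*inv (suc k)))) (suc k)
   (≤-reflexive (trans (sym (trans (euler-mono-eq ⟦ suc (suc k) ⟧ ⟦ suc k ⟧ (inv (suc (suc k)))) (trans (cong (⟦ suc k ⟧ *_) (*inv (suc k))) (*-identityʳ _)))) (sym (∑-rep (suc (suc k)) m)))))
  (≤-reflexive (trans (∏-rep (suc (suc k)) (1# + inv (suc k) * m)) (cong (λ t → (1# + t) ^ suc (suc k))
   (trans (euler-mono-eq₂ (inv (suc k)) ⟦ suc k ⟧ (inv (suc (suc k)))) (trans (cong (_* inv (suc (suc k))) (*inv k)) (*-identityˡ (inv (suc (suc k))))))))) where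
 m : ℚ
 m = ⟦ suc k ⟧ * inv (suc (suc k))
 ∑-rep : ∀ n c → ∑ (replicate n tt) (λ _ → c) ≡ ⟦ n ⟧ * c
 ∑-rep zero c = sym (*-zeroˡ c)
 ∑-rep (suc n) c = trans (cong (c +_) (∑-rep n c)) (trans (∑-rep-eq₃ c ⟦ n ⟧) (cong (_* c) (sym 1+⟦ n ⟧)))
 ∏-rep : ∀ n c → ∏ (replicate n tt) (λ _ → c) ≡ c ^ n
 ∏-rep zero c = refl
 ∏-rep (suc n) c = cong (c *_) (∏-rep n c)

1-∑≤∏-pure : ∀ a s → 0# ≤ a → 0# ≤ s → 1# - (a + s) ≤ (1# - a) * (1# - s)
1-∑≤∏-pure a s p q = by (p ⊗ q) (solve (a ⸴ s ⸴ ∎) ring)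

-- Weierstrass product inequality
1-∑≤∏ : ∀ {A : Set} (xs : List A) (t : A → ℚ) → (∀ x → 0# ≤ t x) → (∀ x → t x ≤ 1#) → 1# - ∑ xs t ≤ ∏[ x ∈ xs ] (1# - t x)
1-∑≤∏ [] t 0≤t t≤1 = ≤-reflexive refl
1-∑≤∏ (x ∷ xs) t 0≤t t≤1 = ≤-trans (1-∑≤∏-pure (t x) (∑ xs t) (0≤t x) (∑-nonneg xs 0≤t)) (*-monoˡ (gap (t≤1 x)) (1-∑≤∏ xs t 0≤t t≤1))

∏-replace-eq : ∀ a d p → a * d * p ≡ a * p * d
∏-replace-eq = solve-∀ ring

∏-replace : ∀ {A : Set} {xs : List A} {e} (f f' : A → ℚ) d → (∀ x → 0# ≤ f' x) → (∀ x → f' x ≤ f x) → 0# ≤ d →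
      f' e ≤ f e * d → e ∈ xs → ∏ xs f' ≤ ∏ xs f * d
∏-replace {xs = x ∷ xs} f f' d 0≤f' f'≤f 0≤d h (here refl) =
 ≤-trans (*-mono (0≤f' x) (∏-nonneg xs (λ y → ≤-trans (0≤f' y) (f'≤f y))) h (∏-mono xs 0≤f' f'≤f)) (≤-reflexive (∏-replace-eq (f x) d (∏ xs f)))
∏-replace {xs = x ∷ xs} f f' d 0≤f' f'≤f 0≤d h (there m) =
 ≤-trans (*-mono (0≤f' x) (∏-nonneg xs (λ y → ≤-trans (0≤f' y) (f'≤f y)) ⊗ 0≤d) (f'≤f x) (∏-replace f f' d 0≤f' f'≤f 0≤d h m))
  (≤-reflexive (sym (*-assoc (f x) (∏ xs f) d)))

-- Processing the colours one by one

countᵇ : {A : Set} → (A → Bool) → List A → ℕ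
countᵇ p [] = 0
countᵇ p (x ∷ xs) = if p x then suc (countᵇ p xs) else countᵇ p xs

true≢false : true ≡ false → ⊥
true≢false ()

just-injective : {A : Set} {a b : A} → just a ≡ just b → a ≡ b
just-injective refl = refl

≟-refl : {E : Set} (_≟_ : DecidableEquality E) → ∀ e → does (e ≟ e) ≡ true
≟-refl _≟_ e with e ≟ e
... | yes _ = refl
... | no ¬p = ⊥-elim (¬p refl)

≟-true : {E : Set} (_≟_ : DecidableEquality E) → ∀ {e f} → does (e ≟ f) ≡ true → e ≡ f
≟-true _≟_ {e} {f} h with e ≟ f
... | yes p = p

isNothing : Maybe ℕ → Bool
isNothing nothing = true
isNothing (just _) = false

pure-eq₂-2 : ∀ w z y → w * (z * y) * 1# ≡ 1# * (w * (z * y))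
pure-eq₂-2 = solve-∀ ring

pure-eq-3 : ∀ w z s x y → 1# * (w * (z * x) * ((1# + s) * y - 1# * y)) ≡ w * (z * y) * (s * x)
pure-eq-3 = solve-∀ ring

-- Passing a colour of its list turns the weight 1/k of an edge into 1/(k-1), but the edge
-- survives the colour only with probability 1 - 1/k.
countdown : ∀ Z → 1 ℕ.≤ Z → ∀ w z u l k → let k' = if l then suc k else k in
 𝟙 u * (w * (z * inv (k ℕ.⊔ Z)) * (1# - 𝟙 (u ∧ (l ∧ does (Z ℕ.<? k'))) * inv (k' ℕ.⊔ Z))) ≡ 𝟙 u * (w * (z * inv (k' ℕ.⊔ Z)))
countdown Z 1≤Z w z false l k = trans (*-zeroˡ (w * (z * inv (k ℕ.⊔ Z)) * (1# - 0# * inv ((if l then suc k else k) ℕ.⊔ Z)))) (sym (*-zeroˡ (w * (z * inv ((if l then suc k else k) ℕ.⊔ Z)))))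
countdown Z 1≤Z w z true false k = unchanged (w * (z * inv (k ℕ.⊔ Z))) (inv (k ℕ.⊔ Z)) where
 unchanged : ∀ b q → 1# * (b * (1# - 0# * q)) ≡ 1# * b
 unchanged = solve-∀ ring
countdown Z 1≤Z w z true true k = go (Z ℕ.<? suc k) where
 unchanged : ∀ b q → 1# * (b * (1# - 0# * q)) ≡ 1# * b
 unchanged = solve-∀ ring
 pure : ∀ w z s x y → s * x ≡ 1# → (1# + s) * y ≡ 1# → 1# * (w * (z * x) * (1# - 1# * y)) ≡ 1# * (w * (z * y))
 pure w z s x y p q = cong (λ u → 1# * (w * (z * x) * (u - 1# * y))) (sym q) ⨾ pure-eq-3 w z s x y ⨾ cong (λ u → w * (z * y) * u) p ⨾ pure-eq₂-2 w z y
 lem : ∀ k → 1 ℕ.≤ k → 1# * (w * (z * inv k) * (1# - 1# * inv (suc k))) ≡ 1# * (w * (z * inv (suc k)))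
 lem (suc k) _ = pure w z ⟦ suc k ⟧ (inv (suc k)) (inv (suc (suc k))) (*inv k) (trans (cong (_* inv (suc (suc k))) (sym 1+⟦ suc k ⟧)) (*inv (suc k)))
 go : (d : Dec (Z ℕ.< suc k)) → 1# * (w * (z * inv (k ℕ.⊔ Z)) * (1# - 𝟙 (does d) * inv (suc k ℕ.⊔ Z))) ≡ 1# * (w * (z * inv (suc k ℕ.⊔ Z)))
 go (no ¬p) = trans (unchanged (w * (z * inv (k ℕ.⊔ Z))) (inv (suc k ℕ.⊔ Z))) (cong (λ m → 1# * (w * (z * inv m)))
  (trans (ℕₚ.m≤n⇒m⊔n≡n (ℕₚ.≤-trans (ℕₚ.n≤1+n k) (ℕₚ.≮⇒≥ ¬p))) (sym (ℕₚ.m≤n⇒m⊔n≡n (ℕₚ.≮⇒≥ ¬p)))))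
 go (yes (ℕ.s≤s p)) = subst₂ (λ k l → 1# * (w * (z * inv k) * (1# - 1# * inv l)) ≡ 1# * (w * (z * inv l)))
  (sym (ℕₚ.m≥n⇒m⊔n≡m p)) (sym (ℕₚ.m≥n⇒m⊔n≡m (ℕₚ.≤-trans p (ℕₚ.n≤1+n k)))) (lem k (ℕₚ.≤-trans 1≤Z p))

at-eq₂ : ∀ b s → (1# + b) * s ≡ (1# + 1# * 1# * b) * s
at-eq₂ = solve-∀ ring

d≤-pure : ∀ d s → s ≤ 1# - d → d ≤ 1# - s
d≤-pure d s h = by (gap h) (solve (d ⸴ s ⸴ ∎) ring)

build-eq : ∀ p s → p - p * s ≡ p * (1# - s)
build-eq = solve-∀ ring

build-pure : ∀ a b c → b ≤ c → a - c ≤ a - b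
build-pure a b c h = by (gap h) (solve (a ⸴ b ⸴ c ⸴ ∎) ring)

pure-eq₀-2 : ∀ z s → z ≡ s + (z - s * 1#)
pure-eq₀-2 = solve-∀ ring

∑xy-eq₂ : ∀ a i p → a * (i * p) ≡ p * (i * a)
∑xy-eq₂ = solve-∀ ring

∑xy-eq : ∀ f k s a p → f * ((k * s) * (a * p)) ≡ (f * k) * (a * s * p)
∑xy-eq = solve-∀ ring

x-codeg-pure : ∀ u v k s z → 0# ≤ u → 0# ≤ v → k ≤ ⟪ 2 ⟫ → 0# ≤ k → 0# ≤ s → s ≤ z → u * (v * (k * s)) ≤ (u * v) * (⟪ 2 ⟫ * z)
x-codeg-pure u v k s z a b c d e f = by (a ⊗ b ⊗ (gap c ⊗ e ⊕ 0≤⟪ 2 ⟫ ⊗ gap f)) (solve (u ⸴ v ⸴ k ⸴ s ⸴ z ⸴ ∎) ring)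

x-codeg-eq : ∀ t z → t * (⟪ 2 ⟫ * z) ≡ ⟪ 2 ⟫ * t * z
x-codeg-eq = solve-∀ ring

fract-pure : ∀ i k s u q → 0# ≤ i → 0# ≤ k → s ≤ u * q → i * (k * s) ≤ k * (i * u * q)
fract-pure i k s u q a b h = by (a ⊗ (b ⊗ gap h)) (solve (i ⸴ k ⸴ s ⸴ u ⸴ q ⸴ ∎) ring)

pure-eq₀-3 : ∀ (o : ℚ) → ⟪ 2 ⟫ ≡ ⟪ 2 ⟫ * 1#
pure-eq₀-3 o = refl

total-eq₂ : ∀ p i a → p * (i * a) ≡ a * (i * p)
total-eq₂ = solve-∀ ring

total-eq : ∀ p s → p * (1# - s) ≡ p - p * s
total-eq = solve-∀ ring

pure-e₄ : ∀ i u B' σ → 1# + i * (u * B') - i * (B' * (u * σ)) ≡ 1# + i * (u * (B' * (1# - σ)))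
pure-e₄ = solve-∀ ring

pure-e₃ : ∀ i u B' σ → 1# + i * u * B' - i * σ * ((1# + B') - 1#) ≡ 1# + i * (u * B') - i * (B' * σ)
pure-e₃ = solve-∀ ring

pure-e₂ : ∀ i u B' σ d → 1# + i * u * B' - i * ((1# - d) * σ) - i * B' * (1# - d) * σ ≡ 1# + i * u * B' - i * σ * ((1# + B') - (1# + B') * d)
pure-e₂ = solve-∀ ring

pure-e₁ : ∀ i u B' σ d → (1# + i * u * B') * (1# - i * ((1# - d) * σ)) ≡ 1# + i * u * B' - i * ((1# - d) * σ) - (i * i) * B' * (1# - d) * (u * σ)
pure-e₁ = solve-∀ ring

k*-pure : ∀ ε → ε ≤ ½ → ½ ≤ 1# - ε
k*-pure ε h = by (gap h) (solve (ε ⸴ ∎) ring)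

aσ≤1-pure : ∀ d → 0# ≤ d → 1# - d ≤ 1#
aσ≤1-pure d h = by h (solve (d ⸴ ∎) ring)

factor-idem : ∀ b → 𝟙 b * 𝟙 b ≡ 𝟙 b
factor-idem true = refl
factor-idem false = refl

0≤a-pure : ∀ b d → (1# + b) * d ≡ 1# → 0# ≤ b → 0# ≤ d → 0# ≤ 1# - d
0≤a-pure b d p h k = by (h ⊗ k) (trans (cong (_- d) (sym p)) (solve (b ⸴ d ⸴ ∎) ring))

load-eq₂ : ∀ a b c → a * (b * c) ≡ b * (a * c)
load-eq₂ = solve-∀ ring

load-eq : ∀ a b c → a * (b * c) ≡ b * (a * c)
load-eq = solve-∀ ring

module Process {E V : Set} (_≟ₑ_ : DecidableEquality E) (_≟ᵥ_ : DecidableEquality V)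
 (vs : List V) (vs! : AllPairs _≢_ vs) (vs-all : ∀ v → v ∈ vs) (es : List E) (es-all : ∀ e → e ∈ es) (inc : E → V → Bool)
 (r ε : ℚ) (1≤r : 1# ≤ r) (0<ε : 0# < ε) (ε≤½ : ε ≤ ½) (ε≤1 : ε ≤ 1#) where

 open Incidence _≟ᵥ_ vs vs! inc public
 open NibbleConstants (nibbleConstants r ε 1≤r 0<ε ε≤1) using (η) public

 module Run (rank : ∀ e → size e ≤ r) (L : E → ℕ → Bool) (Z : ℕ) (2≤Z : 2 ℕ.≤ Z) (ω Bnd : ℚ) (0≤ω : 0# ≤ ω)
       (h : ℕ) (h≤ : ⟦ h ⟧ ≤ (1# - ε) * ⟦ Z ⟧) (Bnd< : Bnd < (1# + ω) ^ h)
       (t : ℚ) (codeg : ∀ u v → u ≢ v → ∑[ e ∈ es ] i e u * i e v ≤ t)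
       (t≤ : ⟪ 2 ⟫ * t * inv Z ≤ η) where

  1≤Z : 1 ℕ.≤ Z
  1≤Z = ℕₚ.≤-trans (ℕ.s≤s ℕ.z≤n) 2≤Z

  -- Stopping the countdown at `Z` keeps every `ρ` at most `1/Z`, which bounds the codegree weights,
  -- and makes `ρ` equal to `1/Z` once no colours are left.
  cap : ℕ → ℕ
  cap k = k ℕ.⊔ Z


  rem : List ℕ → E → ℕ
  rem cs e = countᵇ (L e) cs

  ρ : List ℕ → E → ℚ
  ρ cs e = inv (cap (rem cs e))

  0≤ρ : ∀ cs e → 0# ≤ ρ cs e
  0≤ρ cs e = 0≤inv (cap (rem cs e))

  ρ≤invZ : ∀ cs e → ρ cs e ≤ inv Z
  ρ≤invZ cs e = inv-anti 1≤Z (ℕₚ.m≤n⊔m (rem cs e) Z)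

  B : List ℕ → E → ℚ
  B cs e = ω * (⟦ Z ⟧ * ρ cs e)

  0≤B : ∀ cs e → 0# ≤ B cs e
  0≤B cs e = 0≤ω ⊗ (0≤⟦ Z ⟧ ⊗ 0≤ρ cs e)

  iu : (E → Bool) → V → E → ℚ
  iu unc v e = i e v * 𝟙 (unc e)

  0≤iu : ∀ unc v e → 0# ≤ iu unc v e
  0≤iu unc v e = 0≤i e v ⊗ 0≤𝟙 (unc e)

  -- Smooth substitute for the constraint that the uncoloured edges at `v` have total `ρ` at most
  -- `1# - ε`: the product is exponential in that total, so it is enough to control its sum over the
  -- vertices.
  Φ : List ℕ → (E → Bool) → V → ℚ
  Φ cs unc v = ∏[ e ∈ es ] (1# + iu unc v e * B cs e)

  0≤Φ : ∀ cs unc v → 0# ≤ Φ cs unc v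
  0≤Φ cs unc v = ∏-nonneg es (λ e → 0≤1 ⊕ 0≤iu unc v e ⊗ 0≤B cs e)

  -- A larger load would make the numbers `Z * ρ`, all in [0,1], sum to at least `h`; by convexity
  -- `Φ` would reach `(1# + ω) ^ h`, which exceeds `Bnd`.
  load : ∀ cs unc v → Φ cs unc v ≤ Bnd → ∑[ e ∈ es ] iu unc v e * ρ cs e ≤ 1# - ε
  load cs unc v Φ≤ = ≮⇒≥ (λ exceeds → <⇒¬≥ Bnd< (≤-trans (≤-trans
     (convex₀ 0≤ω es μ (λ e → 0≤iu unc v e ⊗ (0≤⟦ Z ⟧ ⊗ 0≤ρ cs e)) μ≤1 h
      (≤-trans h≤ (≤-trans (≤-trans (*-monoʳ 0≤⟦ Z ⟧ (<⇒≤ exceeds)) (≤-reflexive (*-comm (∑[ e ∈ es ] iu unc v e * ρ cs e) ⟦ Z ⟧)))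
        (≤-reflexive (trans (sym (∑-*ˡ es ⟦ Z ⟧ (λ e → iu unc v e * ρ cs e))) (∑-cong es (λ e → load-eq ⟦ Z ⟧ (iu unc v e) (ρ cs e))))))))
     (≤-reflexive (∏-cong es (λ e → cong (1# +_) (load-eq₂ ω (iu unc v e) (⟦ Z ⟧ * ρ cs e)))))) Φ≤)) where
   μ : E → ℚ
   μ e = iu unc v e * (⟦ Z ⟧ * ρ cs e)
   μ≤1 : ∀ e → μ e ≤ 1#
   μ≤1 e = ≤-trans (*-mono (0≤iu unc v e) 0≤1 (*-mono (0≤i e v) 0≤1 (𝟙≤1 (inc e v)) (𝟙≤1 (unc e)))
         (≤-trans (*-monoˡ 0≤⟦ Z ⟧ (ρ≤invZ cs e)) (≤-reflexive (*inv′ 1≤Z)))) (≤-reflexive refl)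

  module ColourStep (c : ℕ) (cs : List ℕ) (unc : E → Bool) where

   act : E → Bool
   act e = unc e ∧ (L e c ∧ does (Z ℕ.<? rem (c ∷ cs) e))

   -- Probability with which an active edge should receive the current colour.
   σ : E → ℚ
   σ e = 𝟙 (act e) * ρ (c ∷ cs) e

   0≤σ : ∀ e → 0# ≤ σ e
   0≤σ e = 0≤𝟙 (act e) ⊗ 0≤ρ (c ∷ cs) e

   advance : ∀ e → 𝟙 (unc e) * (B cs e * (1# - σ e)) ≤ 𝟙 (unc e) * B (c ∷ cs) e
   advance e = ≤-reflexive (countdown Z 1≤Z ω ⟦ Z ⟧ (unc e) (L e c) (rem cs e))

   abstract
    d : E → ℚ
    d e = proj₁ (inverse (<-≤-trans 0<1 (by (0≤B cs e) refl)))

    0≤d : ∀ e → 0# ≤ d e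
    0≤d e = <⇒≤ (proj₁ (proj₂ (inverse (<-≤-trans 0<1 (by (0≤B cs e) refl)))))

    d-inverse : ∀ e → (1# + B cs e) * d e ≡ 1#
    d-inverse e = proj₂ (proj₂ (inverse (<-≤-trans 0<1 (by (0≤B cs e) refl))))

   -- Relative drop of the factor `1# + B cs e` when `e` is coloured and the factor becomes 1.
   a : E → ℚ
   a e = 1# - d e

   0≤a : ∀ e → 0# ≤ a e
   0≤a e = 0≤a-pure (B cs e) (d e) (d-inverse e) (0≤B cs e) (0≤d e)

   σ≤1 : ∀ e → σ e ≤ 1#
   σ≤1 e = ≤-trans (*-mono (0≤𝟙 (act e)) 0≤1 (𝟙≤1 (act e)) (≤-trans (ρ≤invZ (c ∷ cs) e)
        (≤-trans (inv-anti (ℕ.s≤s ℕ.z≤n) 1≤Z) (≤-reflexive inv1)))) (≤-reflexive refl) where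
    inv1 : inv 1 ≡ 1#
    inv1 = trans (sym (*-identityˡ (inv 1))) (*inv 0)

   -- Balance at one edge: passing the colour raises `B` by the factor `1/(1 - σ)`, while being
   -- coloured with probability `σ` removes the factor of `e` altogether. `countdown` makes the two
   -- effects cancel.
   factor : ∀ v e → (1# + iu unc v e * B cs e) * (1# - i e v * (a e * σ e)) ≤ 1# + iu unc v e * B (c ∷ cs) e
   factor v e = pure (i e v) (𝟙 (unc e)) (B cs e) (B (c ∷ cs) e) (σ e) (d e) (d-inverse e)
     (factor-idem (inc e v)) (σu (unc e) _) (0≤i e v) (advance e) where
    σu : ∀ b {c} q → 𝟙 (b ∧ c) * q ≡ 𝟙 b * (𝟙 (b ∧ c) * q)
    σu true q = sym (*-identityˡ _)
    σu false q = trans (*-zeroˡ q) (sym (*-zeroˡ (0# * q)))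
    -- with i² = i and σ = uσ the left side equals 1 + i·u·B'(1-σ)
    pure : ∀ i u B' B σ d → (1# + B') * d ≡ 1# → i * i ≡ i → σ ≡ u * σ → 0# ≤ i → u * (B' * (1# - σ)) ≤ u * B →
        (1# + i * u * B') * (1# - i * ((1# - d) * σ)) ≤ 1# + i * u * B
    pure i u B' B σ d p q s i0 l = ≡≤ eq (by (i0 ⊗ gap l) (solve (i ⸴ u ⸴ B' ⸴ B ⸴ σ ⸴ ∎) ring)) where
     eq : (1# + i * u * B') * (1# - i * ((1# - d) * σ)) ≡ 1# + i * (u * (B' * (1# - σ)))
     eq = pure-e₁ i u B' σ d ⨾ cong₂ (λ I S → 1# + i * u * B' - i * ((1# - d) * σ) - I * B' * (1# - d) * S) q (sym s)
       ⨾ pure-e₂ i u B' σ d ⨾ cong (λ w → 1# + i * u * B' - i * σ * ((1# + B') - w)) p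
       ⨾ pure-e₃ i u B' σ ⨾ cong (λ S → 1# + i * (u * B') - i * (B' * S)) s ⨾ pure-e₄ i u B' σ

   aσ≤1 : ∀ v e → i e v * (a e * σ e) ≤ 1#
   aσ≤1 v e = ≤-trans (*-mono (0≤i e v) 0≤1 (𝟙≤1 (inc e v)) (*-mono (0≤a e) 0≤1 (aσ≤1-pure (d e) (0≤d e)) (σ≤1 e))) (≤-reflexive refl)

   -- The Weierstrass inequality makes the edgewise balance linear in `σ`, the form in which it can
   -- be compared with the weight of a matching.
   drift : ∀ v → Φ cs unc v * (1# - (∑[ e ∈ es ] i e v * (a e * σ e))) ≤ Φ (c ∷ cs) unc v
   drift v = ≤-trans (*-monoˡ (0≤Φ cs unc v) (1-∑≤∏ es _ (λ e → 0≤i e v ⊗ (0≤a e ⊗ 0≤σ e)) (aσ≤1 v)))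
    (≡≤ (sym (∏-* es (λ e → 1# + iu unc v e * B cs e) (λ e → 1# - i e v * (a e * σ e))))
     (∏-mono es (λ e → (0≤1 ⊕ 0≤iu unc v e ⊗ 0≤B cs e) ⊗ gap (aσ≤1 v e)) (factor v)))

   module Coloured (M : List E) (M! : AllPairs (λ e f → meet e f ≡ false) M) (M-unc : ∀ {e} → e ∈ M → unc e ≡ true) where

    mem : E → Bool
    mem e = anyᵇ (λ f → does (f ≟ₑ e)) M

    unc' : E → Bool
    unc' e = unc e ∧ not (mem e)

    mem-∈ : ∀ {e} → e ∈ M → mem e ≡ true
    mem-∈ {e} p = any-true (λ f → does (f ≟ₑ e)) p (≟-refl _≟ₑ_ e)

    meets : ∀ {e f v} → inc e v ≡ true → inc f v ≡ true → meet e f ≡ true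
    meets {e} {f} {v} p q = any-true (λ v → inc e v ∧ inc f v) (vs-all v) (cong₂ _∧_ p q)

    one : ∀ v (a : E → ℚ) {M} → AllPairs (λ e f → meet e f ≡ false) M → ∀ {e} → e ∈ M → inc e v ≡ true → ∑[ f ∈ M ] i f v * a f ≤ a e
    one v a {e ∷ M} (p ∷ ps) (here refl) q = ≤-reflexive (trans (cong₂ _+_ (trans (cong (λ b → 𝟙 b * a e) q) (*-identityˡ (a e))) (none M p)) (+-identityʳ (a e))) where
     none : ∀ M → All (λ f → meet e f ≡ false) M → ∑[ f ∈ M ] i f v * a f ≡ 0#
     none [] [] = refl
     none (f ∷ M) (p ∷ ps) = trans (cong₂ _+_ (trans (cong (λ b → 𝟙 b * a f) (¬true (λ s → true≢false (trans (sym (meets {e} {f} {v} q s)) p)))) (*-zeroˡ (a f))) (none M ps)) refl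
    one v a {f ∷ M} (p ∷ ps) {e} (there m) q = subst (_≤ a e) (sym (trans (cong (_+ (∑[ f ∈ M ] i f v * a f))
      (trans (cong (λ b → 𝟙 b * a f) (¬true (λ s → true≢false (trans (sym (meets {f} {e} {v} s q)) (All.lookup p m))))) (*-zeroˡ (a f)))) (+-identityˡ (∑[ f ∈ M ] i f v * a f))))
      (one v a ps m q)

    iu'≤ : ∀ v e → iu unc' v e ≤ iu unc v e
    iu'≤ v e = *-monoˡ (0≤i e v) (lem (unc e) (mem e)) where
     lem : ∀ a b → 𝟙 (a ∧ not b) ≤ 𝟙 a
     lem true b = 𝟙≤1 (not b)
     lem false b = ≤-refl

    Φ'≤Φ : ∀ v → ∀ e → 1# + iu unc' v e * B cs e ≤ 1# + iu unc v e * B cs e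
    Φ'≤Φ v e = +-mono-≤ (≤-refl {1#}) (*-monoʳ (0≤B cs e) (iu'≤ v e))

    -- At most one edge of a matching contains `v`, so at most one factor of the product disappears
    -- and the sum on the right has at most one nonzero term.
    Φ'≤ : ∀ v → Φ cs unc' v ≤ Φ cs unc v * (1# - (∑[ e ∈ M ] i e v * a e))
    Φ'≤ v = go (anyᵇ (λ e → inc e v) M) refl where
     0≤f' : ∀ e → 0# ≤ 1# + iu unc' v e * B cs e
     0≤f' e = 0≤1 ⊕ 0≤iu unc' v e ⊗ 0≤B cs e
     go : ∀ b → anyᵇ (λ e → inc e v) M ≡ b → Φ cs unc' v ≤ Φ cs unc v * (1# - (∑[ e ∈ M ] i e v * a e))
     go false eq = ≤-trans (∏-mono es 0≤f' (Φ'≤Φ v)) (≤-reflexive (sym (trans (cong (λ t → Φ cs unc v * (1# - t)) (zeros M (Select.any-false meet (λ e → inc e v) M eq))) (*-identityʳ _)))) where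
      zeros : ∀ M → All (λ e → inc e v ≡ false) M → ∑[ e ∈ M ] i e v * a e ≡ 0#
      zeros [] [] = refl
      zeros (e ∷ M) (q ∷ qs) = trans (cong₂ _+_ (trans (cong (λ b → 𝟙 b * a e) q) (*-zeroˡ (a e))) (zeros M qs)) refl
     go true eq = let e , e∈ , q = any-witness (λ e → inc e v) M eq in
      ≤-trans (∏-replace (λ e → 1# + iu unc v e * B cs e) (λ e → 1# + iu unc' v e * B cs e) (1# - (∑[ e ∈ M ] i e v * a e)) 0≤f' (Φ'≤Φ v)
       (≤-trans (0≤d e) (d≤ e e∈ q)) (at e e∈ q) (es-all e)) ≤-refl where
      d≤ : ∀ e → e ∈ M → inc e v ≡ true → d e ≤ 1# - (∑[ e ∈ M ] i e v * a e)
      d≤ e e∈ q = d≤-pure (d e) (∑[ e ∈ M ] i e v * a e) (one v a M! e∈ q)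
      at : ∀ e → e ∈ M → inc e v ≡ true → 1# + iu unc' v e * B cs e ≤ (1# + iu unc v e * B cs e) * (1# - (∑[ e ∈ M ] i e v * a e))
      at e e∈ q = subst (λ b → 1# + (i e v * 𝟙 (unc e ∧ not b)) * B cs e ≤ (1# + (i e v * 𝟙 (unc e)) * B cs e) * (1# - (∑[ e ∈ M ] i e v * a e))) (sym (mem-∈ e∈))
       (subst₂ (λ b c → 1# + (𝟙 c * 𝟙 (b ∧ false)) * B cs e ≤ (1# + (𝟙 c * 𝟙 b) * B cs e) * (1# - (∑[ e ∈ M ] i e v * a e))) (sym (M-unc e∈)) (sym q)
        (≡≤ (trans (cancel₀ (B cs e)) (sym (d-inverse e))) (≤-trans (*-monoˡ (0≤1 ⊕ 0≤B cs e) (d≤ e e∈ q)) (≤-reflexive (at-eq₂ (B cs e) (1# - (∑[ e ∈ M ] i e v * a e))))))) where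
       cancel₀ : ∀ b → 1# + 1# * 0# * b ≡ 1#
       cancel₀ = solve-∀ ring

    total : ∑[ v ∈ vs ] Φ cs unc' v ≤ (∑[ v ∈ vs ] Φ cs unc v) - (∑[ e ∈ M ] a e * (∑[ v ∈ vs ] i e v * Φ cs unc v))
    total = ≤-trans (∑-mono vs Φ'≤) (≤-reflexive (trans (∑-cong vs (λ v → total-eq (Φ cs unc v) (∑[ e ∈ M ] i e v * a e)))
     (trans (∑-- vs (Φ cs unc) (λ v → Φ cs unc v * (∑[ e ∈ M ] i e v * a e))) (cong (λ s → (∑[ v ∈ vs ] Φ cs unc v) - s)
      (trans (∑-cong vs (λ v → sym (∑-*ˡ M (Φ cs unc v) (λ e → i e v * a e)))) (trans (∑-swap vs M (λ v e → Φ cs unc v * (i e v * a e)))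
       (∑-cong M (λ e → trans (∑-cong vs (λ v → total-eq₂ (Φ cs unc v) (i e v) (a e))) (∑-*ˡ vs (a e) (λ v → i e v * Φ cs unc v))))))))))

   -- Dividing `σ` by `1# - ε` turns the load bound into a fractional matching, and the same factor
   -- is lost when `matching` rounds. The slack in the load thus pays exactly for the rounding.
   k* : ∃ λ q → 0# < q × (1# - ε) * q ≡ 1#
   k* = inverse (<-≤-trans 0<½ (k*-pure ε ε≤½))

   k : ℚ
   k = proj₁ k*

   0≤k : 0# ≤ k
   0≤k = <⇒≤ (proj₁ (proj₂ k*))

   k≤2 : k ≤ ⟪ 2 ⟫
   k≤2 = pure ε k ε≤½ 0≤k (proj₂ (proj₂ k*)) where
    pure : ∀ ε k → ε ≤ ½ → 0# ≤ k → (1# - ε) * k ≡ 1# → k ≤ ⟪ 2 ⟫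
    pure ε k h p q = by (0≤⟪ 2 ⟫ ⊗ (gap h ⊗ p)) (trans (trans (pure-eq₀-3 1#) (cong (⟪ 2 ⟫ *_) (sym q))) (solve (ε ⸴ k ⸴ ∎) ring))

   x : E → ℚ
   x e = k * σ e

   0≤x : ∀ e → 0# ≤ x e
   0≤x e = 0≤k ⊗ 0≤σ e

   σ≤ : ∀ e → σ e ≤ 𝟙 (unc e) * ρ (c ∷ cs) e
   σ≤ e = *-monoʳ (0≤ρ (c ∷ cs) e) (lem (unc e)) where
    lem : ∀ b {c} → 𝟙 (b ∧ c) ≤ 𝟙 b
    lem true {c} = 𝟙≤1 c
    lem false = ≤-refl

   σ≤invZ : ∀ e → σ e ≤ inv Z
   σ≤invZ e = ≤-trans (*-mono (0≤𝟙 (act e)) (0≤inv Z) (𝟙≤1 (act e)) (ρ≤invZ (c ∷ cs) e)) (≤-reflexive (*-identityˡ (inv Z)))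

   x≤1 : ∀ e → x e ≤ 1#
   x≤1 e = ≤-trans (*-mono 0≤k (0≤inv 2) k≤2 (≤-trans (σ≤invZ e) (inv-anti (ℕ.s≤s ℕ.z≤n) 2≤Z))) (≤-reflexive (*inv 1))

   module _ (Φ≤ : ∀ v → Φ (c ∷ cs) unc v ≤ Bnd) where

    fract : ∀ v → ∑[ e ∈ es ] i e v * x e ≤ 1#
    fract v = ≤-trans (∑-mono es (λ e → fract-pure (i e v) k (σ e) (𝟙 (unc e)) (ρ (c ∷ cs) e) (0≤i e v) 0≤k (σ≤ e)))
     (≡≤ (∑-*ˡ es k (λ e → iu unc v e * ρ (c ∷ cs) e))
     (≤-trans (*-monoˡ 0≤k (load (c ∷ cs) unc v (Φ≤ v))) (≤-reflexive (trans (*-comm k (1# - ε)) (proj₂ (proj₂ k*))))))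

    x-codeg : ∀ u v → u ≢ v → ∑[ e ∈ es ] i e u * (i e v * x e) ≤ η
    x-codeg u v u≢v = ≤-trans (∑-mono es (λ e → x-codeg-pure (i e u) (i e v) k (σ e) (inv Z) (0≤i e u) (0≤i e v) k≤2 0≤k (0≤σ e) (σ≤invZ e)))
     (≡≤ (∑-*ʳ es (⟪ 2 ⟫ * inv Z) (λ e → i e u * i e v))
     (≤-trans (*-monoʳ (0≤⟪ 2 ⟫ ⊗ 0≤inv Z) (codeg u v u≢v)) (≡≤ (x-codeg-eq t (inv Z)) t≤)))

    -- The amount by which colouring `e` lowers the potentials, summed over the vertices of `e`.
    y : E → ℚ
    y e = a e * (∑[ v ∈ vs ] i e v * Φ cs unc v)

    0≤y : ∀ e → 0# ≤ y e
    0≤y e = 0≤a e ⊗ ∑-nonneg vs (λ v → 0≤i e v ⊗ 0≤Φ cs unc v)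

    ∑xy : (1# - ε) * (∑[ e ∈ es ] x e * y e) ≡ ∑[ v ∈ vs ] Φ cs unc v * (∑[ e ∈ es ] i e v * (a e * σ e))
    ∑xy = trans (sym (∑-*ˡ es (1# - ε) (λ e → x e * y e))) (trans (∑-cong es (λ e →
      trans (∑xy-eq (1# - ε) k (σ e) (a e) (∑[ v ∈ vs ] i e v * Φ cs unc v)) (trans (cong (_* (a e * σ e * (∑[ v ∈ vs ] i e v * Φ cs unc v))) (proj₂ (proj₂ k*)))
       (trans (*-identityˡ _) (sym (∑-*ˡ vs (a e * σ e) (λ v → i e v * Φ cs unc v)))))))
     (trans (∑-swap es vs (λ e v → a e * σ e * (i e v * Φ cs unc v))) (∑-cong vs (λ v → trans (∑-cong es (λ e → ∑xy-eq₂ (a e * σ e) (i e v) (Φ cs unc v))) (∑-*ˡ es (Φ cs unc v) (λ e → i e v * (a e * σ e)))))))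

    Next : Set
    Next = ∃ λ M → AllPairs (λ e f → meet e f ≡ false) M × (∀ e → e ∈ M → unc e ≡ true) × (∀ e → e ∈ M → L e c ≡ true) ×
        (∑[ v ∈ vs ] Φ cs (λ e → unc e ∧ not (anyᵇ (λ f → does (f ≟ₑ e)) M)) v ≤ ∑[ v ∈ vs ] Φ (c ∷ cs) unc v)

    next : Next
    next = build (matching _≟ᵥ_ vs vs! vs-all es es-all inc r ε 1≤r 0<ε ε≤1 rank x 0≤x x≤1 fract x-codeg y 0≤y) where
     pos⇒act : ∀ b {q} → 0# < k * (𝟙 b * q) → b ≡ true
     pos⇒act true h = refl
     pos⇒act false {q} h = ⊥-elim (<⇒≢ h (vanish k q)) where
      vanish : ∀ a b → a * (0# * b) ≡ 0#
      vanish = solve-∀ ring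
     ∧₁ : ∀ a {b} → a ∧ b ≡ true → a ≡ true
     ∧₁ true _ = refl
     ∧₂ : ∀ a {b} → a ∧ b ≡ true → b ≡ true
     ∧₂ true h = h
     build : (∃ λ M → AllPairs (λ e f → meet e f ≡ false) M × All (λ e → 0# < x e) M × (1# - ε) * (∑[ e ∈ es ] x e * y e) ≤ ∑ M y) → Next
     build (M , M! , M-pos , val) = M , M! , (λ e p → M-unc p) , (λ e p → ∧₁ (L e c) (∧₂ (unc e) (pos⇒act (act e) (All.lookup M-pos p)))) ,
       ≤-trans (Coloured.total M M! M-unc) (≤-trans (build-pure (∑[ v ∈ vs ] Φ cs unc v) ((1# - ε) * (∑[ e ∈ es ] x e * y e)) (∑ M y) val)
        (≡≤ (trans (cong (λ s → (∑[ v ∈ vs ] Φ cs unc v) - s) ∑xy) (trans (sym (∑-- vs (Φ cs unc) (λ v → Φ cs unc v * (∑[ e ∈ es ] i e v * (a e * σ e)))))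
          (∑-cong vs (λ v → build-eq (Φ cs unc v) (∑[ e ∈ es ] i e v * (a e * σ e))))))
         (∑-mono vs drift))) where
      M-unc : ∀ {e} → e ∈ M → unc e ≡ true
      M-unc {e} p = ∧₁ (unc e) (pos⇒act (act e) (All.lookup M-pos p))

  record Partial (cs : List ℕ) (unc : E → Bool) : Set where
   field
    φ : E → Maybe ℕ
    φ-unc : ∀ e c → φ e ≡ just c → unc e ≡ true
    φ-list : ∀ e c → φ e ≡ just c → L e c ≡ true
    φ-range : ∀ e c → φ e ≡ just c → c ∈ cs
    φ-proper : ∀ e f c → e ≢ f → φ e ≡ just c → φ f ≡ just c → meet e f ≡ false
    φ-left : ∀ v → ∑[ e ∈ es ] i e v * 𝟙 (unc e ∧ isNothing (φ e)) ≤ ⟦ Z ⟧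

  Φ≤Bnd : ∀ cs unc → ∑[ v ∈ vs ] Φ cs unc v ≤ Bnd → ∀ v → Φ cs unc v ≤ Bnd
  Φ≤Bnd cs unc h v = ≤-trans (∑-∈ (Φ cs unc) (0≤Φ cs unc) (vs-all v)) h

  -- The sum of the potentials never increases. After the last colour every `ρ` is `1/Z`, so the
  -- load bound says that at most `Z` edges are left at each vertex.
  process : ∀ cs → AllPairs _≢_ cs → ∀ unc → ∑[ v ∈ vs ] Φ cs unc v ≤ Bnd → Partial cs unc
  process [] [] unc Φ≤ = record { φ = λ _ → nothing ; φ-unc = λ _ _ () ; φ-list = λ _ _ () ; φ-range = λ _ _ () ; φ-proper = λ _ _ _ _ () ; φ-left = left } where
   left : ∀ v → ∑[ e ∈ es ] i e v * 𝟙 (unc e ∧ true) ≤ ⟦ Z ⟧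
   left v = ≡≤ (∑-cong es (λ e → cong (λ b → i e v * 𝟙 b) (∧-true (unc e))))
    (pure (∑[ e ∈ es ] iu unc v e) ⟦ Z ⟧ (inv Z) ε (*inv′ 1≤Z) 0≤⟦ Z ⟧ (<⇒≤ 0<ε)
     (≡≤ (sym (∑-*ʳ es (inv Z) (iu unc v))) (load [] unc v (Φ≤Bnd [] unc Φ≤ v)))) where
    ∧-true : ∀ b → b ∧ true ≡ b
    ∧-true true = refl
    ∧-true false = refl
    pure : ∀ s z y ε → z * y ≡ 1# → 0# ≤ z → 0# ≤ ε → s * y ≤ 1# - ε → s ≤ z
    pure s z y ε p h k l = by (h ⊗ gap l ⊕ h ⊗ k) (trans (pure-eq₀-2 z s) (trans (cong (λ w → s + (z - s * w)) (sym p)) (solve (s ⸴ z ⸴ y ⸴ ε ⸴ ∎) ring)))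
  process (c ∷ cs) (c∉ ∷ cs!) unc Φ≤ = extend (process cs cs! (unc' M) (≤-trans lower Φ≤)) where
   open ColourStep c cs unc using (next)
   n* = next (Φ≤Bnd (c ∷ cs) unc Φ≤)
   M = proj₁ n*
   M! = proj₁ (proj₂ n*)
   M-unc : ∀ {e} → e ∈ M → unc e ≡ true
   M-unc {e} = proj₁ (proj₂ (proj₂ n*)) e
   M-list : ∀ {e} → e ∈ M → L e c ≡ true
   M-list {e} = proj₁ (proj₂ (proj₂ (proj₂ n*))) e
   lower = proj₂ (proj₂ (proj₂ (proj₂ n*)))
   mem : E → Bool
   mem e = anyᵇ (λ f → does (f ≟ₑ e)) M
   unc' : List E → E → Bool
   unc' M e = unc e ∧ not (anyᵇ (λ f → does (f ≟ₑ e)) M)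
   extend : Partial cs (unc' M) → Partial (c ∷ cs) unc
   extend P = record { φ = φ' ; φ-unc = φ'-unc ; φ-list = φ'-list ; φ-range = φ'-range ; φ-proper = φ'-proper ; φ-left = φ'-left } where
    open Partial P
    φ' : E → Maybe ℕ
    φ' e = if mem e then just c else φ e
    ∈M : ∀ e → mem e ≡ true → e ∈ M
    ∈M e p = let f , f∈ , q = any-witness (λ f → does (f ≟ₑ e)) M p in subst (_∈ M) (≟-true _≟ₑ_ q) f∈
    ∧₁ : ∀ a {b} → a ∧ b ≡ true → a ≡ true
    ∧₁ true _ = refl
    cases : ∀ e c' → φ' e ≡ just c' → (e ∈ M × c ≡ c') ⊎ φ e ≡ just c'
    cases e c' = go (mem e) refl where
     go : ∀ b → mem e ≡ b → (if b then just c else φ e) ≡ just c' → (e ∈ M × c ≡ c') ⊎ φ e ≡ just c'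
     go true eq p = inj₁ (∈M e eq , just-injective p)
     go false eq p = inj₂ p
    φ'-unc : ∀ e c' → φ' e ≡ just c' → unc e ≡ true
    φ'-unc e c' p = [ (λ q → M-unc (proj₁ q)) , (λ q → ∧₁ (unc e) (φ-unc e c' q)) ]′ (cases e c' p)
    φ'-list : ∀ e c' → φ' e ≡ just c' → L e c' ≡ true
    φ'-list e c' p = [ (λ q → subst (λ c → L e c ≡ true) (proj₂ q) (M-list (proj₁ q))) , φ-list e c' ]′ (cases e c' p)
    φ'-range : ∀ e c' → φ' e ≡ just c' → c' ∈ c ∷ cs
    φ'-range e c' p = [ (λ q → here (sym (proj₂ q))) , (λ q → there (φ-range e c' q)) ]′ (cases e c' p)
    disjoint : ∀ {M} → AllPairs (λ e f → meet e f ≡ false) M → ∀ {e f} → e ∈ M → f ∈ M → e ≢ f → meet e f ≡ false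
    disjoint (p ∷ ps) (here refl) (here refl) e≢f = ⊥-elim (e≢f refl)
    disjoint (p ∷ ps) (here refl) (there q) e≢f = All.lookup p q
    disjoint (p ∷ ps) {e} {f} (there q) (here refl) e≢f =
     ¬true (λ m → true≢false (trans (sym (Matching.meet-sym _≟ᵥ_ vs vs! vs-all es es-all inc e f m)) (All.lookup p q)))
    disjoint (p ∷ ps) (there q) (there q') e≢f = disjoint ps q q' e≢f
    φ'-proper : ∀ e f c' → e ≢ f → φ' e ≡ just c' → φ' f ≡ just c' → meet e f ≡ false
    φ'-proper e f c' e≢f p q = go (cases e c' p) (cases f c' q) where
     go : (e ∈ M × c ≡ c') ⊎ φ e ≡ just c' → (f ∈ M × c ≡ c') ⊎ φ f ≡ just c' → meet e f ≡ false
     go (inj₁ (u , refl)) (inj₁ (w , _)) = disjoint M! u w e≢f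
     go (inj₁ (u , refl)) (inj₂ w) = ⊥-elim (All.lookup c∉ (φ-range f c' w) refl)
     go (inj₂ u) (inj₁ (w , refl)) = ⊥-elim (All.lookup c∉ (φ-range e c' u) refl)
     go (inj₂ u) (inj₂ w) = φ-proper e f c' e≢f u w
    φ'-left : ∀ v → ∑[ e ∈ es ] i e v * 𝟙 (unc e ∧ isNothing (φ' e)) ≤ ⟦ Z ⟧
    φ'-left v = ≤-trans (∑-mono es (λ e → *-monoˡ (0≤i e v) (lem (unc e) (mem e) (φ e)))) (φ-left v) where
     lem : ∀ u m q → 𝟙 (u ∧ isNothing (if m then just c else q)) ≤ 𝟙 ((u ∧ not m) ∧ isNothing q)
     lem true true q = ≤-refl
     lem true false q = ≤-refl
     lem false m q = ≤-refl

-- The numerical budget of the potential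

∑-const-eq : ∀ c n → c + n * c ≡ (1# + n) * c
∑-const-eq = solve-∀ ring

∑-const : {A : Set} (xs : List A) (c : ℚ) → ∑ xs (λ _ → c) ≡ ⟦ length xs ⟧ * c
∑-const [] c = sym (*-zeroˡ c)
∑-const (x ∷ xs) c = trans (cong (c +_) (∑-const xs c)) (trans (∑-const-eq c ⟦ length xs ⟧) (cong (_* c) (sym 1+⟦ length xs ⟧)))

∑-count : {A : Set} (p : A → Bool) (xs : List A) → ∑[ x ∈ xs ] 𝟙 (p x) ≡ ⟦ countᵇ p xs ⟧
∑-count p [] = refl
∑-count p (x ∷ xs) with p x
... | true = trans (cong (1# +_) (∑-count p xs)) (sym 1+⟦ countᵇ p xs ⟧)
... | false = trans (+-identityˡ _) (∑-count p xs)

∏-count : {A : Set} (p : A → Bool) (xs : List A) (c : ℚ) → ∏[ x ∈ xs ] (1# + 𝟙 (p x) * c) ≡ (1# + c) ^ countᵇ p xs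
∏-count p [] c = refl
∏-count p (x ∷ xs) c with p x
... | true = cong₂ _*_ (cong (1# +_) (*-identityˡ c)) (∏-count p xs c)
... | false = trans (cong₂ _*_ (trans (cong (1# +_) (*-zeroˡ c)) (+-identityʳ 1#)) (∏-count p xs c)) (*-identityˡ _)

unit'-e₂ : ∀ s w → w * (s + 1#) ≡ (1# + s) * w
unit'-e₂ = solve-∀ ring

unit'-e₁ : ∀ s w v → ((1# + s) * w - w) * (1# + v) ≡ w * (s + s * v)
unit'-e₁ = solve-∀ ring

eq₁-e₄ : ∀ P w v → P + (1# + v) - P * ((1# - w) * (1# + v)) ≡ P + (1# + v) * (1# - P * (1# - w))
eq₁-e₄ = solve-∀ ring

eq₁-e₃ : ∀ P v → 1# + v ≡ P + (1# + v) - P * 1#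
eq₁-e₃ = solve-∀ ring

go-step : ∀ P a n → 0# ≤ P → 0# ≤ a → 0# ≤ n → (1# + a) * P * (1# - (1# + n) * a) ≤ P * (1# - n * a)
go-step P a n p q h = by (p ⊗ (a0 ⊗ (0≤1 ⊕ h))) (solve (P ⸴ a ⸴ n ⸴ ∎) ring) where
 a0 : 0# ≤ a * a
 a0 = q ⊗ q

za-eq : ∀ a b c → a * (b * c) ≡ b * (a * c)
za-eq = solve-∀ ring

-- (1 + w/z)^z ≤ 1/(1-w), with w = 1/(k+1).
compound : ∀ z k → 1 ℕ.≤ z → (1# + inv (suc (suc k)) * inv z) ^ z ≤ 1# + inv (suc k)
compound z k 1≤z = pure ((1# + a) ^ z) w (inv (suc k)) ⟦ suc k ⟧ (*inv k) (trans (cong (_* w) (sym 1+⟦ suc k ⟧)) (*inv (suc k)))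
  (0≤⟦ suc k ⟧) (0≤inv (suc k)) (≡≤ (cong (λ t → (1# + a) ^ z * (1# - t)) (sym za)) (go z)) where
 w a : ℚ
 w = inv (suc (suc k))
 a = w * inv z
 0≤a : 0# ≤ a
 0≤a = 0≤inv (suc (suc k)) ⊗ 0≤inv z
 za : ⟦ z ⟧ * a ≡ w
 za = trans (za-eq ⟦ z ⟧ w (inv z)) (trans (cong (w *_) (*inv′ 1≤z)) (*-identityʳ w))
 go : ∀ n → (1# + a) ^ n * (1# - ⟦ n ⟧ * a) ≤ 1#
 go zero = ≤-reflexive (trans (*-identityˡ _) (trans (cong (λ t → 1# - t) (*-zeroˡ a)) refl))
 go (suc n) = ≤-trans (subst (λ t → (1# + a) * (1# + a) ^ n * (1# - t * a) ≤ (1# + a) ^ n * (1# - ⟦ n ⟧ * a)) (sym 1+⟦ n ⟧)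
   (go-step ((1# + a) ^ n) a ⟦ n ⟧ (^-nonneg n (0≤1 ⊕ 0≤a)) 0≤a 0≤⟦ n ⟧)) (go n)
 pure : ∀ P w v s → s * v ≡ 1# → (1# + s) * w ≡ 1# → 0# ≤ s → 0# ≤ v → P * (1# - w) ≤ 1# → P ≤ 1# + v
 pure P w v s p q s0 v0 h = by ((0≤1 ⊕ v0) ⊗ gap h) (eq₁ P w v s p q) where
  eq₁ : ∀ P w v s → s * v ≡ 1# → (1# + s) * w ≡ 1# → 1# + v ≡ P + (1# + v) * (1# - P * (1# - w))
  eq₁ P w v s p q = eq₁-e₃ P v ⨾ cong (λ o → P + (1# + v) - P * o) (sym (unit' w v s p q)) ⨾ eq₁-e₄ P w v where
   unit' : ∀ w v s → s * v ≡ 1# → (1# + s) * w ≡ 1# → (1# - w) * (1# + v) ≡ 1#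
   unit' w v s p q = cong (λ o → (o - w) * (1# + v)) (sym q) ⨾ unit'-e₁ s w v ⨾ cong (λ o → w * (s + o)) p ⨾ unit'-e₂ s w ⨾ q

-- (1 + 1/k)^s ≤ (1 + 1/(k+1))^((k+1)(s/k + 1))
rebase : ∀ k s → (1# + inv (suc k)) ^ s ≤ (1# + inv (suc (suc k))) ^ (suc (s ℕ/./ suc k) ℕ.* suc (suc k))
rebase k s = ≤-trans (^-≤ (by (0≤inv (suc k)) refl) s≤) (≡≤ (^-*ℕ (1# + inv (suc k)) q (suc k))
 (≤-trans (^-mono q (^-nonneg (suc k) (0≤1 ⊕ 0≤inv (suc k))) (euler-mono k)) (≤-reflexive (sym (^-*ℕ (1# + inv (suc (suc k))) q (suc (suc k))))))) where
 q : ℕ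
 q = suc (s ℕ/./ suc k)
 s≤ : s ℕ.≤ q ℕ.* suc k
 s≤ = ℕₚ.≤-trans (ℕₚ.≤-reflexive (ℕ/.m≡m%n+[m/n]*n s (suc k))) (ℕₚ.+-monoˡ-≤ _ (ℕₚ.<⇒≤ (ℕ/.m%n<n s (suc k))))

e₁-e₀ : ∀ c j w → (1# + j * w) * (1# + j * w) ≡ 1# + (⟪ 2 ⟫ * (j * w) + j * w * (j * w)) + c * j * (1# - 1# * 1#)
e₁-e₀ = solve-∀ ring

pure-e₁-2 : ∀ Z v z g E → Z * z - ⟪ 3 ⟫ * (z * (g * (E * v))) ≡ (1# - ⟪ 3 ⟫ * v) * (z * Z) + ⟪ 3 ⟫ * (z * (v * (Z - g * E)))
pure-e₁-2 = solve-∀ ring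

pure-e₀ : ∀ s g z → s * z ≡ (s + ⟪ 3 ⟫ * g) * z - ⟪ 3 ⟫ * (z * (g * 1#))
pure-e₀ = solve-∀ ring

pure-e₂-2 : ∀ c j w m → 1# + (⟪ 2 ⟫ * (j * w) + j * w * (j * w)) + c * j * (1# - (m * w) * (m * w)) ≡
   1# + c * j + (j * (w * w * (j - c * (m * m))) + ⟪ 2 ⟫ * (j * w))
pure-e₂-2 = solve-∀ ring

pure-e₁-3 : ∀ h g v E → h + (g * (E * v) - v * (h + g)) ≡ h + v * (g * E - (h + g))
pure-e₁-3 = solve-∀ ring

pure-e₀-2 : ∀ h g v → (1# - v) * (h + g) ≡ h + (g * 1# - v * (h + g))
pure-e₀-2 = solve-∀ ring

main-eq₃ : ∀ s g → s ℕ.+ (g ℕ.+ 2 ℕ.* g) ≡ s ℕ.+ 3 ℕ.* g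
main-eq₃ = ℕR.solve-∀

main-eq₂ : ∀ s w q g → s ℕ.+ w ℕ.+ q ℕ.+ g ℕ.+ suc g ≡ s ℕ.+ (w ℕ.+ q ℕ.+ 1 ℕ.+ 2 ℕ.* g)
main-eq₂ = ℕR.solve-∀

main-eq₁ : ∀ a w → suc a ℕ.* suc w ≡ a ℕ.* w ℕ.+ w ℕ.+ suc a
main-eq₁ = ℕR.solve-∀

half-eq₂ : ∀ g → g ℕ.+ g ≡ 2 ℕ.* g
half-eq₂ = ℕR.solve-∀

half-eq₁ : ∀ e a → 2 ℕ.* (suc (e ℕ.+ suc e) ℕ.+ suc a ℕ.+ 1) ≡ 4 ℕ.* suc e ℕ.+ 4 ℕ.+ 2 ℕ.* a
half-eq₁ = ℕR.solve-∀

AZ<-eq : ∀ A E j → A ℕ.* (4 ℕ.* E ℕ.* j) ≡ 4 ℕ.* A ℕ.* E ℕ.* j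
AZ<-eq = ℕR.solve-∀

Z≤4Ej-eq : ∀ j E → (j ℕ.+ j) ℕ.* 2 ℕ.* E ≡ 4 ℕ.* E ℕ.* j
Z≤4Ej-eq = ℕR.solve-∀

2sΩ≤g-eq : ∀ a e → 2 ℕ.* a ℕ.* suc e ≡ a ℕ.* suc (e ℕ.+ suc e)
2sΩ≤g-eq = ℕR.solve-∀

-- Bookkeeping of exponents of `1# + ω`. With `g` about `Z/E`, three times `g` is slack: `g + 1`
-- separates `h` from `Z`, the part `j * 2 ≤ g` absorbs the number of vertices, and the rest covers
-- rounding and the passage from base `1 + 1/Ω` to `1 + ω`, which is cheap because `Ω = 2E`.
module Budget (e z A : ℕ) (2≤e : 2 ℕ.≤ e) (1≤z : 1 ℕ.≤ z) where

 E Ω N₀ X Z₀ : ℕ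
 E = suc e
 Ω = suc (e ℕ.+ suc e)
 N₀ = suc (4 ℕ.* A ℕ.* E ℕ.* (suc Ω ℕ.* suc Ω))
 X = 4 ℕ.* E ℕ.+ 4 ℕ.+ 2 ℕ.* N₀
 Z₀ = X ℕ.* E

 ω : ℚ
 ω = inv (suc Ω)

 0≤ω : 0# ≤ ω
 0≤ω = 0≤inv (suc Ω)

 module _ (Z : ℕ) (Z₀≤Z : Z₀ ℕ.≤ Z) where

  g s q j h : ℕ
  g = Z ℕ/./ E
  s = Z ℕ.∸ 3 ℕ.* g
  q = suc (s ℕ/./ Ω)
  j = g ℕ/./ 2
  h = Z ℕ.∸ suc g

  gE≤Z : g ℕ.* E ℕ.≤ Z
  gE≤Z = ℕ/.m/n*n≤m Z E

  Z<gE : Z ℕ.< suc g ℕ.* E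
  Z<gE = ℕₚ.≤-trans (ℕₚ.≤-reflexive (cong suc (ℕ/.m≡m%n+[m/n]*n Z E))) (ℕₚ.+-monoˡ-≤ (g ℕ.* E) (ℕ/.m%n<n Z E))

  X≤g : X ℕ.≤ g
  X≤g = ℕₚ.≤-trans (ℕₚ.≤-reflexive (sym (ℕ/.m*n/n≡m X E))) (ℕ/./-monoˡ-≤ E Z₀≤Z)

  3g≤Z : 3 ℕ.* g ℕ.≤ Z
  3g≤Z = ℕₚ.≤-trans (ℕₚ.≤-trans (ℕₚ.≤-reflexive (ℕₚ.*-comm 3 g)) (ℕₚ.*-monoʳ-≤ g (ℕ.s≤s 2≤e))) gE≤Z

  2j≤g : j ℕ.* 2 ℕ.≤ g
  2j≤g = ℕ/.m/n*n≤m g 2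

  g<2j+2 : g ℕ.< suc j ℕ.* 2
  g<2j+2 = ℕₚ.≤-trans (ℕₚ.≤-reflexive (cong suc (ℕ/.m≡m%n+[m/n]*n g 2))) (ℕₚ.+-monoˡ-≤ (j ℕ.* 2) (ℕ/.m%n<n g 2))

  N₀≤j : N₀ ℕ.≤ j
  N₀≤j = ℕₚ.≤-trans (ℕₚ.≤-reflexive (sym (ℕ/.m*n/n≡m N₀ 2))) (ℕ/./-monoˡ-≤ 2 (ℕₚ.≤-trans
       (ℕₚ.≤-trans (ℕₚ.≤-reflexive (ℕₚ.*-comm N₀ 2)) (ℕₚ.m≤n+m (2 ℕ.* N₀) (4 ℕ.* E ℕ.+ 4))) X≤g))

  2sΩ≤g : 2 ℕ.* (s ℕ/./ Ω) ℕ.≤ g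
  2sΩ≤g = ℕₚ.≤-pred (ℕₚ.*-cancelʳ-< E (2 ℕ.* (s ℕ/./ Ω)) (suc g) (ℕₚ.≤-<-trans
    (ℕₚ.≤-trans (ℕₚ.≤-reflexive (2sΩ≤g-eq (s ℕ/./ Ω) e)) (ℕₚ.≤-trans (ℕ/.m/n*n≤m s Ω) (ℕₚ.m∸n≤m Z (3 ℕ.* g)))) Z<gE))

  room : q ℕ.* suc Ω ℕ.+ j ℕ.* 2 ℕ.≤ h
  room = ℕₚ.+-cancelʳ-≤ (suc g) (q ℕ.* suc Ω ℕ.+ j ℕ.* 2) h (ℕₚ.≤-trans main (ℕₚ.≤-reflexive (sym (ℕₚ.m∸n+n≡m suc-g≤Z)))) where
   suc-g≤Z : suc g ℕ.≤ Z
   suc-g≤Z = ℕₚ.≤-trans (ℕₚ.≤-trans (ℕₚ.+-monoˡ-≤ g (ℕₚ.≤-trans (ℕ.s≤s ℕ.z≤n) (ℕₚ.≤-trans (ℕₚ.≤-trans (ℕₚ.m≤n+m 4 (4 ℕ.* E)) (ℕₚ.m≤m+n _ (2 ℕ.* N₀))) X≤g)))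
         (ℕₚ.+-monoʳ-≤ g (ℕₚ.m≤m+n g (g ℕ.+ 0)))) 3g≤Z
   -- 2 (Ω + q + 1) ≤ 2 g
   half : Ω ℕ.+ q ℕ.+ 1 ℕ.≤ g
   half = ℕₚ.*-cancelˡ-≤ 2 (ℕₚ.≤-trans (ℕₚ.≤-reflexive (half-eq₁ e (s ℕ/./ Ω))) (ℕₚ.≤-trans (ℕₚ.+-mono-≤ (ℕₚ.≤-trans (ℕₚ.m≤m+n (4 ℕ.* E ℕ.+ 4) (2 ℕ.* N₀)) X≤g) 2sΩ≤g)
        (ℕₚ.≤-reflexive (half-eq₂ g))))
   main : q ℕ.* suc Ω ℕ.+ j ℕ.* 2 ℕ.+ suc g ℕ.≤ Z
   main = ℕₚ.≤-trans (ℕₚ.+-monoˡ-≤ (suc g) (ℕₚ.+-mono-≤ {q ℕ.* suc Ω} {s ℕ.+ Ω ℕ.+ q}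
        (ℕₚ.≤-trans (ℕₚ.≤-reflexive (main-eq₁ (s ℕ/./ Ω) Ω)) (ℕₚ.+-monoˡ-≤ q (ℕₚ.+-monoˡ-≤ Ω (ℕ/.m/n*n≤m s Ω)))) 2j≤g))
     (ℕₚ.≤-trans (ℕₚ.≤-reflexive (main-eq₂ s Ω q g)) (ℕₚ.≤-trans (ℕₚ.+-monoʳ-≤ s (ℕₚ.+-monoˡ-≤ (2 ℕ.* g) half)) (ℕₚ.≤-reflexive (trans (main-eq₃ s g) (ℕₚ.m∸n+n≡m 3g≤Z)))))

  -- Z ≤ 4 E j
  Z≤4Ej : Z ℕ.≤ 4 ℕ.* E ℕ.* j
  Z≤4Ej = ℕₚ.≤-trans (ℕₚ.<⇒≤ Z<gE) (ℕₚ.≤-trans (ℕₚ.*-monoˡ-≤ E g<2j+2) (ℕₚ.≤-trans (ℕₚ.*-monoˡ-≤ E (ℕₚ.*-monoˡ-≤ 2 (ℕₚ.+-monoˡ-≤ j 1≤j))) (ℕₚ.≤-reflexive (Z≤4Ej-eq j E)))) where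
   1≤j : 1 ℕ.≤ j
   1≤j = ℕₚ.≤-trans (ℕ.s≤s ℕ.z≤n) N₀≤j

  -- The left side is at most linear in `j`, while the square of Bernoulli's bound is quadratic;
  -- `N₀ ≤ j` places `j` where the square wins.
  AZ< : ⟦ A ℕ.* Z ⟧ < (1# + ω) ^ (j ℕ.* 2)
  AZ< = <-≤-trans (≤-<-trans (⟦⟧-mono (ℕₚ.≤-trans (ℕₚ.*-monoʳ-≤ A Z≤4Ej) (ℕₚ.≤-reflexive (AZ<-eq A E j)))) strict)
   (≡≤ (cong ((1# + ⟦ j ⟧ * ω) *_) (sym (*-identityʳ (1# + ⟦ j ⟧ * ω))))
   (≤-trans (^-mono 2 (0≤1 ⊕ 0≤⟦ j ⟧ ⊗ 0≤ω) (bernoulli j 0≤ω)) (≤-reflexive (sym (trans (cong ((1# + ω) ^_) (ℕₚ.*-comm j 2)) (^-*ℕ (1# + ω) 2 j)))))) where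
   strict : ⟦ 4 ℕ.* A ℕ.* E ℕ.* j ⟧ < (1# + ⟦ j ⟧ * ω) * (1# + ⟦ j ⟧ * ω)
   strict = <-≤-trans (plus1 ⟦ 4 ℕ.* A ℕ.* E ℕ.* j ⟧) (subst (λ t → 1# + t ≤ (1# + ⟦ j ⟧ * ω) * (1# + ⟦ j ⟧ * ω)) (sym (⟦⟧-* (4 ℕ.* A ℕ.* E) j))
    (pure ⟦ 4 ℕ.* A ℕ.* E ⟧ ⟦ j ⟧ ω ⟦ suc Ω ⟧ (*inv Ω) 0≤⟦ j ⟧ 0≤ω
     (≡≤ (sym (trans (⟦⟧-* (4 ℕ.* A ℕ.* E) (suc Ω ℕ.* suc Ω)) (cong (⟦ 4 ℕ.* A ℕ.* E ⟧ *_) (⟦⟧-* (suc Ω) (suc Ω))))) (⟦⟧-mono (ℕₚ.≤-trans (ℕₚ.n≤1+n _) N₀≤j))))) where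
    plus1 : ∀ a → a < 1# + a
    plus1 a = subst (_< 1# + a) (+-identityˡ a) (ℚₚ.+-monoˡ-< a 0<1)
    pure : ∀ c j w m → m * w ≡ 1# → 0# ≤ j → 0# ≤ w → c * (m * m) ≤ j → 1# + c * j ≤ (1# + j * w) * (1# + j * w)
    pure c j w m p a b h = by (a ⊗ (b ⊗ b ⊗ gap h) ⊕ 0≤⟪ 2 ⟫ ⊗ (a ⊗ b)) (e₁ j w ⨾ cong (λ o → 1# + (⟪ 2 ⟫ * (j * w) + j * w * (j * w)) + c * j * (1# - o * o)) (sym p) ⨾ pure-e₂-2 c j w m) where
     e₁ : ∀ j w → (1# + j * w) * (1# + j * w) ≡ 1# + (⟪ 2 ⟫ * (j * w) + j * w * (j * w)) + c * j * (1# - 1# * 1#)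
     e₁ j w = e₁-e₀ c j w

  Bnd : ℚ
  Bnd = ⟦ A ℕ.* Z ⟧ * (1# + ω) ^ (q ℕ.* suc Ω)

  Bnd< : Bnd < (1# + ω) ^ h
  Bnd< = <-≤-trans (subst (_< (1# + ω) ^ (j ℕ.* 2) * (1# + ω) ^ (q ℕ.* suc Ω)) refl
       (ℚₚ.*-monoˡ-<-pos ((1# + ω) ^ (q ℕ.* suc Ω)) {{positive (<-≤-trans 0<1 (1≤^ (q ℕ.* suc Ω) 1≤1+ω))}} AZ<))
   (≡≤ (trans (*-comm ((1# + ω) ^ (j ℕ.* 2)) ((1# + ω) ^ (q ℕ.* suc Ω))) (sym (^-+ (1# + ω) (q ℕ.* suc Ω) (j ℕ.* 2)))) (^-≤ 1≤1+ω room)) where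
   1≤1+ω : 1# ≤ 1# + ω
   1≤1+ω = by 0≤ω refl

  h≤ : ⟦ h ⟧ ≤ (1# - inv E) * ⟦ Z ⟧
  h≤ = pure ⟦ h ⟧ ⟦ suc g ⟧ ⟦ Z ⟧ ⟦ E ⟧ (inv E) (*inv e) (0≤inv E)
      (trans (sym (⟦⟧-+ h (suc g))) (cong ⟦_⟧ (ℕₚ.m∸n+n≡m suc-g≤Z))) (≤-trans (⟦⟧-mono (ℕₚ.<⇒≤ Z<gE)) (≤-reflexive (⟦⟧-* (suc g) E))) where
   suc-g≤Z : suc g ℕ.≤ Z
   suc-g≤Z = ℕₚ.≤-trans (ℕₚ.≤-trans (ℕₚ.+-monoˡ-≤ g (ℕₚ.≤-trans (ℕ.s≤s ℕ.z≤n) (ℕₚ.≤-trans (ℕₚ.≤-trans (ℕₚ.m≤n+m 4 (4 ℕ.* E)) (ℕₚ.m≤m+n _ (2 ℕ.* N₀))) X≤g)))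
         (ℕₚ.+-monoʳ-≤ g (ℕₚ.m≤m+n g (g ℕ.+ 0)))) 3g≤Z
   pure : ∀ h g Z E v → E * v ≡ 1# → 0# ≤ v → h + g ≡ Z → Z ≤ g * E → h ≤ (1# - v) * Z
   pure h g Z E v p a refl k = by (a ⊗ gap k) (pure-e₀-2 h g v ⨾ cong (λ o → h + (g * o - v * (h + g))) (sym p) ⨾ pure-e₁-3 h g v E)

  -- Groups of `z` factors `1 + ω/z` are at most `1 + 1/Ω` by `compound`, and `rebase` converts `s`
  -- such groups into powers of `1# + ω`.
  initial : ∀ d → ⟦ d ⟧ ≤ (1# - ⟪ 3 ⟫ * inv E) * (⟦ z ⟧ * ⟦ Z ⟧) → (1# + ω * inv z) ^ d ≤ (1# + ω) ^ (q ℕ.* suc Ω)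
  initial d d≤ =
   (≤-trans (^-≤ (by (0≤ω ⊗ 0≤inv z) refl) d≤sz) (≡≤ (^-*ℕ (1# + ω * inv z) s z)
    (≤-trans (^-mono s (^-nonneg z (0≤1 ⊕ 0≤ω ⊗ 0≤inv z)) (compound z (e ℕ.+ suc e) 1≤z)) (rebase (e ℕ.+ suc e) s)))) where
   d≤sz : d ℕ.≤ s ℕ.* z
   d≤sz = ⟦⟧-cancel (≤-trans d≤ (≤-trans (pure ⟦ s ⟧ ⟦ g ⟧ ⟦ Z ⟧ ⟦ E ⟧ (inv E) ⟦ z ⟧ (*inv e) (0≤inv E) 0≤⟦ z ⟧
     (trans (sym (trans (⟦⟧-+ s (3 ℕ.* g)) (cong (⟦ s ⟧ +_) (⟦⟧-* 3 g)))) (cong ⟦_⟧ (ℕₚ.m∸n+n≡m 3g≤Z))) (≡≤ (sym (⟦⟧-* g E)) (⟦⟧-mono gE≤Z)))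
     (≤-reflexive (sym (⟦⟧-* s z))))) where
    pure : ∀ s g Z E v z → E * v ≡ 1# → 0# ≤ v → 0# ≤ z → s + ⟪ 3 ⟫ * g ≡ Z → g * E ≤ Z → (1# - ⟪ 3 ⟫ * v) * (z * Z) ≤ s * z
    pure s g Z E v z p a b e k = by (0≤⟪ 3 ⟫ ⊗ (b ⊗ (a ⊗ gap k))) (pure-e₀ s g z ⨾ cong (λ o → (s + ⟪ 3 ⟫ * g) * z - ⟪ 3 ⟫ * (z * (g * o))) (sym p)
       ⨾ cong (λ o → o * z - ⟪ 3 ⟫ * (z * (g * (E * v)))) e ⨾ pure-e₁-2 Z v z g E)

inv≤1 : ∀ k → inv (suc k) ≤ 1#
inv≤1 k = ≤-trans (inv-anti (ℕ.s≤s ℕ.z≤n) (ℕ.s≤s ℕ.z≤n)) (≤-reflexive (trans (sym (*-identityˡ (inv 1))) (*inv 0)))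

pure-e₀-4 : ∀ a → a ≡ ½ * (⟪ 2 ⟫ * a)
pure-e₀-4 = solve-∀ ring

inv≤½ : ∀ k → inv (suc (suc k)) ≤ ½
inv≤½ k = ≤-trans (inv-anti (ℕ.s≤s ℕ.z≤n) (ℕ.s≤s (ℕ.s≤s ℕ.z≤n))) (≤-reflexive (pure (inv 2) (*inv 1))) where
 pure : ∀ a → ⟪ 2 ⟫ * a ≡ 1# → a ≡ ½
 pure a h = pure-e₀-4 a ⨾ cong (½ *_) h ⨾ refl

0<inv : ∀ k → 0# < inv (suc k)
0<inv k = ≰⇒> (λ h → <⇒¬≥ 0<1 (≡≤ (sym (*inv k)) (≤-trans (*-monoˡ 0≤⟦ suc k ⟧ h) (≤-reflexive (*-zeroʳ ⟦ suc k ⟧)))))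

pure-e₂-3 : ∀ y → y * 1# ≡ y
pure-e₂-3 = solve-∀ ring

pure-e₁-4 : ∀ z Z y w → z * y * (Z * w) ≡ y * (z * Z * w)
pure-e₁-4 = solve-∀ ring

pure-e₀-3 : ∀ a → a ≡ 1# * a
pure-e₀-3 = solve-∀ ring

-- Hypergraphs of bounded rank and small codegree: lists slightly larger than the degree suffice
-- for colouring all but z⁻¹ of the edges at every vertex.
module BoundedRank (r : ℚ) (1≤r : 1# ≤ r) (e : ℕ) (2≤e : 2 ℕ.≤ e) (z A : ℕ) (1≤z : 1 ℕ.≤ z) where

 private
  1≤e : 1 ℕ.≤ e
  1≤e = ℕₚ.≤-trans (ℕ.s≤s ℕ.z≤n) 2≤e

  ε≤½ : inv (suc e) ≤ ½
  ε≤½ = subst (λ k → inv (suc k) ≤ ½) (ℕₚ.m+[n∸m]≡n 1≤e) (inv≤½ (e ℕ.∸ 1))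

 open Budget e z A 2≤e 1≤z using (Z₀; ω; 0≤ω; Bnd; Bnd<; h; h≤; initial; q; Ω) public

 η : ℚ
 η = NibbleConstants.η (nibbleConstants r (inv (suc e)) 1≤r (0<inv e) (inv≤1 e))

 0<η : 0# < η
 0<η = NibbleConstants.0<η (nibbleConstants r (inv (suc e)) 1≤r (0<inv e) (inv≤1 e))

 module _ {E V : Set} (_≟ₑ_ : DecidableEquality E) (_≟ᵥ_ : DecidableEquality V)
  (vs : List V) (vs! : AllPairs _≢_ vs) (vs-all : ∀ v → v ∈ vs) (es : List E) (es-all : ∀ e → e ∈ es) (inc : E → V → Bool)
  (L : E → ℕ → Bool) (cs : List ℕ) (cs! : AllPairs _≢_ cs) (unc : E → Bool) (Z : ℕ) (2≤Z : 2 ℕ.≤ Z) (Z₀≤Z : Z₀ ℕ.≤ Z) (t : ℚ) where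

  open Incidence _≟ᵥ_ vs vs! inc

  -- A list with at least `z * Z` colours has initial `Z * ρ` at most `1/z`, so every edge
  -- contributes at most `1 + ω/z` to the potential, and the degree bound makes the sum at most
  -- `Bnd`.
  colour : (∀ f → size f ≤ r) → (∀ u v → u ≢ v → ∑[ f ∈ es ] i f u * i f v ≤ t) → ⟪ 2 ⟫ * t * inv Z ≤ η →
       length vs ℕ.≤ A ℕ.* Z →
       (∀ f → unc f ≡ true → z ℕ.* Z ℕ.≤ countᵇ (L f) cs) →
       (∀ v → ∑[ f ∈ es ] i f v * 𝟙 (unc f) ≤ (1# - ⟪ 3 ⟫ * inv (suc e)) * (⟦ z ⟧ * ⟦ Z ⟧)) →
       Σ (E → Maybe ℕ) λ φ →
        (∀ f c → φ f ≡ just c → unc f ≡ true) × (∀ f c → φ f ≡ just c → L f c ≡ true) × (∀ f c → φ f ≡ just c → c ∈ cs) ×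
        (∀ f g c → f ≢ g → φ f ≡ just c → φ g ≡ just c → meet f g ≡ false) ×
        (∀ v → ∑[ f ∈ es ] i f v * 𝟙 (unc f ∧ isNothing (φ f)) ≤ ⟦ Z ⟧)
  colour rank codeg t≤ n≤ lists deg = P.φ , P.φ-unc , P.φ-list , P.φ-range , P.φ-proper , P.φ-left where
   open Process _≟ₑ_ _≟ᵥ_ vs vs! vs-all es es-all inc r (inv (suc e)) 1≤r (0<inv e) ε≤½ (inv≤1 e) using (module Run)
   open Run rank L Z 2≤Z ω (Bnd Z Z₀≤Z) 0≤ω (h Z Z₀≤Z) (h≤ Z Z₀≤Z) (Bnd< Z Z₀≤Z) t codeg t≤ using (Φ; B; 0≤B; iu; 0≤iu; ρ; process; module Partial)
   both : V → E → Bool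
   both v f = inc f v ∧ unc f
   P : ℚ
   P = (1# + ω) ^ (q Z Z₀≤Z ℕ.* suc Ω)
   invK : ∀ k → z ℕ.* Z ℕ.≤ k → ⟦ Z ⟧ * inv (k ℕ.⊔ Z) ≤ inv z
   invK k h = ≤-trans (*-monoˡ 0≤⟦ Z ⟧ (inv-anti 1≤zZ (ℕₚ.≤-trans h (ℕₚ.m≤m⊔n k Z))))
    (≤-reflexive (pure ⟦ z ⟧ ⟦ Z ⟧ (inv z) (inv (z ℕ.* Z)) (*inv′ 1≤z) (trans (cong (_* inv (z ℕ.* Z)) (sym (⟦⟧-* z Z))) (*inv′ 1≤zZ)))) where
    1≤zZ : 1 ℕ.≤ z ℕ.* Z
    1≤zZ = ℕₚ.*-mono-≤ 1≤z (ℕₚ.≤-trans (ℕ.s≤s ℕ.z≤n) 2≤Z)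
    pure : ∀ z Z y w → z * y ≡ 1# → z * Z * w ≡ 1# → Z * w ≡ y
    pure z Z y w p q = pure-e₀-3 (Z * w) ⨾ cong (_* (Z * w)) (sym p) ⨾ pure-e₁-4 z Z y w ⨾ cong (y *_) q ⨾ pure-e₂-3 y
   factor : ∀ v f → 1# + iu unc v f * B cs f ≤ 1# + 𝟙 (both v f) * (ω * inv z)
   factor v f = go (unc f) refl where
    go : ∀ b → unc f ≡ b → 1# + iu unc v f * B cs f ≤ 1# + 𝟙 (both v f) * (ω * inv z)
    go true eq = subst (λ q → 1# + iu unc v f * B cs f ≤ 1# + q * (ω * inv z)) (sym (𝟙-∧ (inc f v) (unc f)))
     (+-mono-≤ (≤-refl {1#}) (*-monoˡ (0≤iu unc v f) (*-monoˡ 0≤ω (invK (countᵇ (L f) cs) (lists f eq)))))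
    go false eq = subst (λ b → 1# + (i f v * 𝟙 b) * B cs f ≤ 1# + 𝟙 (inc f v ∧ b) * (ω * inv z)) (sym eq) (≤-reflexive (lem (inc f v))) where
     lem : ∀ b → 1# + (𝟙 b * 0#) * B cs f ≡ 1# + 𝟙 (b ∧ false) * (ω * inv z)
     lem true = vanish 1# (B cs f) (ω * inv z) where
      vanish : ∀ a b c → 1# + (a * 0#) * b ≡ 1# + 0# * c
      vanish = solve-∀ ring
     lem false = vanish 0# (B cs f) (ω * inv z) where
      vanish : ∀ a b c → 1# + (a * 0#) * b ≡ 1# + 0# * c
      vanish = solve-∀ ring
   Φ≤ : ∀ v → Φ cs unc v ≤ P
   Φ≤ v = ≤-trans (∏-mono es (λ f → 0≤1 ⊕ 0≤iu unc v f ⊗ 0≤B cs f) (factor v)) (≡≤ (∏-count (both v) es (ω * inv z))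
    (initial Z Z₀≤Z (countᵇ (both v) es) (≡≤ (trans (sym (∑-count (both v) es)) (∑-cong es (λ f → 𝟙-∧ (inc f v) (unc f)))) (deg v))))
   total : ∑[ v ∈ vs ] Φ cs unc v ≤ Bnd Z Z₀≤Z
   total = ≤-trans (∑-mono vs Φ≤) (≡≤ (∑-const vs P) (*-monoʳ (^-nonneg (q Z Z₀≤Z ℕ.* suc Ω) (0≤1 ⊕ 0≤ω)) (⟦⟧-mono n≤)))
   module P = Partial (process cs cs! unc total)

-- Filtering and counting, and the list colourings built on them

filterᵇ : {A : Set} → (A → Bool) → List A → List A
filterᵇ p [] = []
filterᵇ p (x ∷ xs) = if p x then x ∷ filterᵇ p xs else filterᵇ p xs

∑-filter : {A : Set} (p : A → Bool) (xs : List A) (f : A → ℚ) → ∑ (filterᵇ p xs) f ≡ ∑[ x ∈ xs ] 𝟙 (p x) * f x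
∑-filter p [] f = refl
∑-filter p (x ∷ xs) f with p x
... | true = cong₂ _+_ (sym (*-identityˡ (f x))) (∑-filter p xs f)
... | false = trans (∑-filter p xs f) (sym (trans (cong (_+ (∑[ x ∈ xs ] 𝟙 (p x) * f x)) (*-zeroˡ (f x))) (+-identityˡ _)))

filter-All : {A : Set} {P : A → Set} (p : A → Bool) {xs : List A} → All P xs → All P (filterᵇ p xs)
filter-All p [] = []
filter-All p {x ∷ xs} (q ∷ qs) with p x
... | true = q ∷ filter-All p qs
... | false = filter-All p qs

filter-AllPairs : {A : Set} {R : A → A → Set} (p : A → Bool) {xs : List A} → AllPairs R xs → AllPairs R (filterᵇ p xs)
filter-AllPairs p [] = []
filter-AllPairs p {x ∷ xs} (q ∷ qs) with p x
... | true = filter-All p q ∷ filter-AllPairs p qs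
... | false = filter-AllPairs p qs

filter-true : {A : Set} (p : A → Bool) (xs : List A) → All (λ x → p x ≡ true) (filterᵇ p xs)
filter-true p [] = []
filter-true p (x ∷ xs) with p x in eq
... | true = eq ∷ filter-true p xs
... | false = filter-true p xs

filter-∈ : {A : Set} (p : A → Bool) {xs : List A} {x : A} → x ∈ xs → p x ≡ true → x ∈ filterᵇ p xs
filter-∈ p {x ∷ xs} (here refl) h rewrite h = here refl
filter-∈ p {y ∷ xs} (there m) h with p y
... | true = there (filter-∈ p m h)
... | false = filter-∈ p m h

count-mono : {A : Set} (p q : A → Bool) (xs : List A) → (∀ x → p x ≡ true → q x ≡ true) → countᵇ p xs ℕ.≤ countᵇ q xs
count-mono p q [] h = ℕ.z≤n
count-mono p q (x ∷ xs) h with p x in eq | q x in eq'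
... | true | true = ℕ.s≤s (count-mono p q xs h)
... | true | false = ⊥-elim (true≢false (trans (sym (h x eq)) eq'))
... | false | true = ℕₚ.m≤n⇒m≤1+n (count-mono p q xs h)
... | false | false = count-mono p q xs h

count-strict : {A : Set} (p q : A → Bool) {xs : List A} {y : A} → (∀ x → p x ≡ true → q x ≡ true) → y ∈ xs → p y ≡ false → q y ≡ true →
        countᵇ p xs ℕ.< countᵇ q xs
count-strict p q {x ∷ xs} h (here refl) a b rewrite a | b = ℕ.s≤s (count-mono p q xs h)
count-strict p q {x ∷ xs} h (there m) a b with p x in eq | q x in eq'
... | true | true = ℕ.s≤s (count-strict p q h m a b)
... | true | false = ⊥-elim (true≢false (trans (sym (h x eq)) eq'))
... | false | true = ℕₚ.m≤n⇒m≤1+n (count-strict p q h m a b)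
... | false | false = count-strict p q h m a b

∧-true₁ : ∀ a {b} → a ∧ b ≡ true → a ≡ true
∧-true₁ true _ = refl

∧-true₂ : ∀ a {b} → a ∧ b ≡ true → b ≡ true
∧-true₂ true h = h

∧-intro : ∀ {a b} → a ≡ true → b ≡ true → a ∧ b ≡ true
∧-intro refl refl = refl

not-true : ∀ {b} → not b ≡ true → b ≡ false
not-true {false} _ = refl

𝟙-mono : ∀ a b → (a ≡ true → b ≡ true) → 𝟙 a ≤ 𝟙 b
𝟙-mono true b h rewrite h refl = ≤-refl
𝟙-mono false b h = 0≤𝟙 b

bool-ext : ∀ {a b} → (a ≡ true → b ≡ true) → (b ≡ true → a ≡ true) → a ≡ b
bool-ext {true} {b} p q = sym (p refl)
bool-ext {false} {true} p q = q refl
bool-ext {false} {false} p q = refl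

does-true : ∀ {P : Set} (d : Dec P) → does d ≡ true → P
does-true (yes p) _ = p

does-false : ∀ {P : Set} (d : Dec P) → does d ≡ false → ¬ P
does-false (no p) _ = p

isColour : Maybe ℕ → ℕ → Bool
isColour nothing c = false
isColour (just d) c = does (d ℕ.≟ c)

isColour-true : ∀ m {c} → isColour m c ≡ true → m ≡ just c
isColour-true (just d) h = cong just (≟-true ℕ._≟_ h)

isColour-refl : ∀ {m c} → m ≡ just c → isColour m c ≡ true
isColour-refl {c = c} refl = ≟-refl ℕ._≟_ c

∑-isColour : ∀ {cs} → AllPairs _≢_ cs → ∀ m → ∑[ c ∈ cs ] 𝟙 (isColour m c) ≤ 𝟙 (not (isNothing m))
∑-isColour {cs} cs! nothing = ≤-reflexive (∑-0 cs)
∑-isColour {cs} cs! (just d) = ≡≤ (∑-cong cs (λ c → cong 𝟙 (flip d c))) (∑-delta ℕ._≟_ cs! d) where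
 flip : ∀ d c → does (d ℕ.≟ c) ≡ does (c ℕ.≟ d)
 flip d c = bool-ext (λ h → trans (cong (λ m → does (c ℕ.≟ m)) (≟-true ℕ._≟_ h)) (≟-refl ℕ._≟_ c)) (λ h → trans (cong (λ m → does (d ℕ.≟ m)) (≟-true ℕ._≟_ h)) (≟-refl ℕ._≟_ d))

∨-true : ∀ a {b} → a ∨ b ≡ true → a ≡ true ⊎ b ≡ true
∨-true true _ = inj₁ refl
∨-true false h = inj₂ h

∨-right : ∀ a {b} → b ≡ true → a ∨ b ≡ true
∨-right true h = refl
∨-right false h = h

-- List colourings of a finite graph

shift-pure : ∀ s b' a b → b' ≤ b + a → s + b' ≤ (a + s) + b
shift-pure s b' a b k = by (gap k) (solve (s ⸴ b' ⸴ a ⸴ b ⸴ ∎) ring)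

module Graph {E : Set} (_≟_ : DecidableEquality E) (es : List E) (es! : AllPairs _≢_ es) (es-all : ∀ e → e ∈ es)
       (meet : E → E → Bool) (meet-sym : ∀ e f → meet e f ≡ true → meet f e ≡ true)
       (cs : List ℕ) (cs! : AllPairs _≢_ cs) where

 adj : E → E → Bool
 adj e f = meet e f ∧ not (does (e ≟ f))

 adj-sym : ∀ e f → adj e f ≡ true → adj f e ≡ true
 adj-sym e f h = ∧-intro (meet-sym e f (∧-true₁ (meet e f) h)) (cong not (¬true (λ p → true≢false
   (trans (sym (trans (cong (λ g → does (e ≟ g)) (≟-true _≟_ p)) (≟-refl _≟_ e))) (not-true (∧-true₂ (meet e f) h))))))

 adj-intro : ∀ {e f} → meet e f ≡ true → e ≢ f → adj e f ≡ true
 adj-intro h e≢f = ∧-intro h (cong not (¬true (λ p → e≢f (≟-true _≟_ p))))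

 adj-irrefl : ∀ e f → adj e f ≡ true → e ≢ f
 adj-irrefl e f h refl = true≢false (trans (sym (≟-refl _≟_ e)) (not-true (∧-true₂ (meet e e) h)))

 Proper : (E → Maybe ℕ) → Set
 Proper φ = ∀ e f c → adj e f ≡ true → φ e ≡ just c → φ f ≡ just c → ⊥

 used : (E → Maybe ℕ) → E → ℕ → Bool
 used φ e c = anyᵇ (λ f → adj e f ∧ isColour (φ f) c) es

 used-intro : ∀ φ {e f c} → adj e f ≡ true → φ f ≡ just c → used φ e c ≡ true
 used-intro φ {e} {f} {c} p q = any-true (λ f → adj e f ∧ isColour (φ f) c) (es-all f) (∧-intro p (isColour-refl q))

 used-elim : ∀ φ {e c} → used φ e c ≡ true → ∃ λ f → adj e f ≡ true × φ f ≡ just c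
 used-elim φ {e} {c} h = let f , _ , q = any-witness (λ f → adj e f ∧ isColour (φ f) c) es h in
  f , ∧-true₁ (adj e f) q , isColour-true (φ f) (∧-true₂ (adj e f) q)

 nbrs : (E → Bool) → E → ℚ
 nbrs S e = ∑[ f ∈ es ] 𝟙 (S f ∧ adj e f)

 blocked : (E → ℕ → Bool) → (E → Maybe ℕ) → E → ℚ
 blocked Λ φ e = ∑[ c ∈ cs ] 𝟙 (Λ e c ∧ used φ e c)

 avail : (E → ℕ → Bool) → E → ℚ
 avail Λ e = ∑[ c ∈ cs ] 𝟙 (Λ e c)

 free : ∀ Λ φ e → blocked Λ φ e < avail Λ e → ∃ λ c → Λ e c ≡ true × used φ e c ≡ false
 free Λ φ e h = go (anyᵇ (λ c → Λ e c ∧ not (used φ e c)) cs) refl where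
  go : ∀ b → anyᵇ (λ c → Λ e c ∧ not (used φ e c)) cs ≡ b → ∃ λ c → Λ e c ≡ true × used φ e c ≡ false
  go true eq = let c , _ , q = any-witness (λ c → Λ e c ∧ not (used φ e c)) cs eq in c , ∧-true₁ (Λ e c) q , not-true (∧-true₂ (Λ e c) q)
  go false eq = ⊥-elim (<⇒¬≥ h (∑-mono∈ cs (λ c c∈ → 𝟙-mono (Λ e c) _ (λ l → ∧-intro l (¬false (λ u → true≢false
    (trans (sym (∧-intro l (cong not u))) (All.lookup (Select.any-false meet (λ c → Λ e c ∧ not (used φ e c)) cs eq) c∈)))))))) where
   ¬false : ∀ {b} → (b ≡ false → ⊥) → b ≡ true
   ¬false {true} h = refl
   ¬false {false} h = ⊥-elim (h refl)

 blocked≤ : ∀ Λ φ e S → (∀ f c → φ f ≡ just c → S f ≡ true) → blocked Λ φ e ≤ nbrs S e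
 blocked≤ Λ φ e S h = ≤-trans (∑-mono cs (λ c → ≤-trans (𝟙-mono _ (used φ e c) (∧-true₂ (Λ e c))) (any≤∑ (λ f → adj e f ∧ isColour (φ f) c) es)))
  (≡≤ (∑-swap cs es (λ c f → 𝟙 (adj e f ∧ isColour (φ f) c))) (∑-mono es perEdge)) where
  perEdge : ∀ f → ∑[ c ∈ cs ] 𝟙 (adj e f ∧ isColour (φ f) c) ≤ 𝟙 (S f ∧ adj e f)
  perEdge f = ≡≤ (trans (∑-cong cs (λ c → 𝟙-∧ (adj e f) (isColour (φ f) c))) (∑-*ˡ cs (𝟙 (adj e f)) (λ c → 𝟙 (isColour (φ f) c))))
   (≤-trans (*-monoˡ (0≤𝟙 (adj e f)) (≤-trans (∑-isColour cs! (φ f)) (𝟙-mono _ (S f) (coloured (φ f) refl))))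
    (≤-reflexive (trans (*-comm (𝟙 (adj e f)) (𝟙 (S f))) (sym (𝟙-∧ (S f) (adj e f)))))) where
   coloured : ∀ m → φ f ≡ m → not (isNothing m) ≡ true → S f ≡ true
   coloured (just c) eq _ = h f c eq

 assign : E → ℕ → (E → Maybe ℕ) → E → Maybe ℕ
 assign x c φ e = if does (x ≟ e) then just c else φ e

 assign-cases : ∀ x c φ e d → assign x c φ e ≡ just d → (x ≡ e × c ≡ d) ⊎ φ e ≡ just d
 assign-cases x c φ e d h with x ≟ e
 ... | yes p = inj₁ (p , just-injective h)
 ... | no _ = inj₂ h

 assign-same : ∀ x c φ → assign x c φ x ≡ just c
 assign-same x c φ rewrite ≟-refl _≟_ x = refl

 assign-other : ∀ x c φ e → x ≢ e → assign x c φ e ≡ φ e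
 assign-other x c φ e h with x ≟ e
 ... | yes p = ⊥-elim (h p)
 ... | no _ = refl

 assign-proper : ∀ x c φ → Proper φ → used φ x c ≡ false → Proper (assign x c φ)
 assign-proper x c φ P u e f d a p q = go (assign-cases x c φ e d p) (assign-cases x c φ f d q) where
  go : (x ≡ e × c ≡ d) ⊎ φ e ≡ just d → (x ≡ f × c ≡ d) ⊎ φ f ≡ just d → ⊥
  go (inj₁ (refl , refl)) (inj₁ (refl , _)) = adj-irrefl x x a refl
  go (inj₁ (refl , refl)) (inj₂ w) = true≢false (trans (sym (used-intro φ a w)) u)
  go (inj₂ w) (inj₁ (refl , refl)) = true≢false (trans (sym (used-intro φ (adj-sym e x a) w)) u)
  go (inj₂ v) (inj₂ w) = P e f d a v w

 record Extension (Λ : E → ℕ → Bool) (φ : E → Maybe ℕ) (us : List E) : Set where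
  field
   ψ : E → Maybe ℕ
   ψ-proper : Proper ψ
   ψ-total : ∀ e → e ∈ us → ∃ λ c → ψ e ≡ just c
   ψ-extends : ∀ e c → φ e ≡ just c → ψ e ≡ just c
   ψ-new : ∀ e c → ψ e ≡ just c → φ e ≡ just c ⊎ (e ∈ us × Λ e c ≡ true)

 -- Colouring an element takes it away from the uncoloured neighbours of another element and blocks
 -- at most one further colour there, so the sum in the hypothesis never grows.
 complete : ∀ Λ us → AllPairs _≢_ us → ∀ φ → Proper φ → All (λ e → φ e ≡ nothing) us →
       All (λ e → (∑[ f ∈ us ] 𝟙 (adj e f)) + blocked Λ φ e < avail Λ e) us → Extension Λ φ us
 complete Λ [] us! φ P un h = record { ψ = φ ; ψ-proper = P ; ψ-total = λ _ () ; ψ-extends = λ _ _ p → p ; ψ-new = λ _ _ p → inj₁ p }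
 complete Λ (x ∷ us) (x∉ ∷ us!) φ P (ux ∷ un) (hx ∷ h) = wrap (complete Λ us us! φ' (assign-proper x c φ P c-free)
   (All.zipWith (λ {e} (x≢e , u) → trans (assign-other x c φ e x≢e) u) (x∉ , un))
   (All.map (λ {e} k → ≤-<-trans (shift e) k) h)) where
  f* = free Λ φ x (≤-<-trans (by (∑-nonneg (x ∷ us) (λ f → 0≤𝟙 (adj x f))) (+-comm (∑[ f ∈ x ∷ us ] 𝟙 (adj x f)) (blocked Λ φ x))) hx)
  c : ℕ
  c = proj₁ f*
  c-free : used φ x c ≡ false
  c-free = proj₂ (proj₂ f*)
  φ' : E → Maybe ℕ
  φ' = assign x c φ
  shift : ∀ e → (∑[ f ∈ us ] 𝟙 (adj e f)) + blocked Λ φ' e ≤ (∑[ f ∈ x ∷ us ] 𝟙 (adj e f)) + blocked Λ φ e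
  shift e = shift-pure (∑[ f ∈ us ] 𝟙 (adj e f)) (blocked Λ φ' e) (𝟙 (adj e x)) (blocked Λ φ e) more where
   perColour : ∀ d → 𝟙 (Λ e d ∧ used φ' e d) ≤ 𝟙 (Λ e d ∧ used φ e d) + 𝟙 (adj e x) * 𝟙 (does (d ℕ.≟ c))
   perColour d = go (used φ' e d) refl where
    rest : 0# ≤ 𝟙 (Λ e d ∧ used φ e d) + 𝟙 (adj e x) * 𝟙 (does (d ℕ.≟ c))
    rest = 0≤𝟙 (Λ e d ∧ used φ e d) ⊕ 0≤𝟙 (adj e x) ⊗ 0≤𝟙 (does (d ℕ.≟ c))
    go : ∀ b → used φ' e d ≡ b → 𝟙 (Λ e d ∧ b) ≤ 𝟙 (Λ e d ∧ used φ e d) + 𝟙 (adj e x) * 𝟙 (does (d ℕ.≟ c))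
    go false eq = ≤-trans (𝟙-mono (Λ e d ∧ false) false (∧-true₂ (Λ e d))) rest
    go true eq = let f , a , q = used-elim φ' eq in split f a (assign-cases x c φ f d q) where
     split : ∀ f → adj e f ≡ true → (x ≡ f × c ≡ d) ⊎ φ f ≡ just d → 𝟙 (Λ e d ∧ true) ≤ 𝟙 (Λ e d ∧ used φ e d) + 𝟙 (adj e x) * 𝟙 (does (d ℕ.≟ c))
     split f a (inj₁ (refl , refl)) = ≤-trans (𝟙≤1 (Λ e d ∧ true)) (≡≤ (sym (cong₂ (λ p q → 𝟙 p * 𝟙 q) a (≟-refl ℕ._≟_ c)))
       (by (0≤𝟙 (Λ e d ∧ used φ e d)) (+-comm (𝟙 (Λ e d ∧ used φ e d)) (𝟙 (adj e x) * 𝟙 (does (d ℕ.≟ c))))))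
     split f a (inj₂ w) = ≡≤ (cong (λ b → 𝟙 (Λ e d ∧ b)) (sym (used-intro φ a w))) (by (0≤𝟙 (adj e x) ⊗ 0≤𝟙 (does (d ℕ.≟ c))) refl)
   more : blocked Λ φ' e ≤ blocked Λ φ e + 𝟙 (adj e x)
   more = ≤-trans (∑-mono cs perColour) (≡≤ (trans (∑-+ cs (λ d → 𝟙 (Λ e d ∧ used φ e d)) (λ d → 𝟙 (adj e x) * 𝟙 (does (d ℕ.≟ c))))
     (cong (blocked Λ φ e +_) (∑-*ˡ cs (𝟙 (adj e x)) (λ d → 𝟙 (does (d ℕ.≟ c))))))
    (+-mono-≤ (≤-refl {blocked Λ φ e}) (≤-trans (*-monoˡ (0≤𝟙 (adj e x)) (∑-delta ℕ._≟_ cs! c)) (≤-reflexive (*-identityʳ _)))))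
  wrap : Extension Λ φ' us → Extension Λ φ (x ∷ us)
  wrap X = record { ψ = ψ ; ψ-proper = ψ-proper ; ψ-total = tot ; ψ-extends = ext ; ψ-new = new } where
   open Extension X
   tot : ∀ e → e ∈ x ∷ us → ∃ λ c → ψ e ≡ just c
   tot e (here refl) = c , ψ-extends e c (assign-same e c φ)
   tot e (there m) = ψ-total e m
   just≢nothing : ∀ {d : ℕ} → just d ≡ nothing → ⊥
   just≢nothing ()
   ext : ∀ e d → φ e ≡ just d → ψ e ≡ just d
   ext e d p = ψ-extends e d (trans (assign-other x c φ e (λ q → just≢nothing (trans (sym p) (trans (cong φ (sym q)) ux)))) p)
   new : ∀ e d → ψ e ≡ just d → φ e ≡ just d ⊎ (e ∈ x ∷ us × Λ e d ≡ true)
   new e d p with ψ-new e d p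
   ... | inj₂ (m , l) = inj₂ (there m , l)
   ... | inj₁ q with assign-cases x c φ e d q
   ...   | inj₁ (refl , refl) = inj₂ (here refl , proj₁ (proj₂ f*))
   ...   | inj₂ w = inj₁ w

 record Colouring (S : E → Bool) (Λ : E → ℕ → Bool) : Set where
  field
   φ : E → Maybe ℕ
   φ-proper : Proper φ
   φ-total : ∀ e → S e ≡ true → ∃ λ c → φ e ≡ just c
   φ-only : ∀ e c → φ e ≡ just c → S e ≡ true
   φ-list : ∀ e c → φ e ≡ just c → Λ e c ≡ true

 -- Removing vertices of degree < T as long as possible reduces colouring to the T-core.
 reduceToCore : ∀ Λ T → (∀ e → T ≤ avail Λ e) → ∀ n S → countᵇ S es ℕ.≤ n →
         (∀ W → (∀ e → W e ≡ true → S e ≡ true) → (∀ e → W e ≡ true → T ≤ nbrs W e) → Colouring W Λ) → Colouring S Λ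
 reduceToCore Λ T lists n S bound cores = go (anyᵇ low es) refl where
  low : E → Bool
  low e = S e ∧ does (nbrs S e <? T)
  extend : ∀ x → S x ≡ true → nbrs S x < T → ∀ n → countᵇ S es ℕ.≤ n → Colouring S Λ
  -- `n` bounds the number of elements left and serves as fuel; it cannot be 0 while `x` is left.
  extend x Sx lowx zero b = ⊥-elim (ℕₚ.<⇒≱ (count-strict (λ _ → false) S (λ _ ()) (es-all x) refl Sx) (ℕₚ.≤-trans b ℕ.z≤n))
  extend x Sx lowx (suc n) b = wrap (reduceToCore Λ T lists n S' (ℕₚ.≤-pred (ℕₚ.≤-trans (count-strict S' S (λ e → ∧-true₁ (S e)) (es-all x) S'x Sx) b))
    (λ W sub → cores W (λ e w → ∧-true₁ (S e) (sub e w)))) where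
   S' : E → Bool
   S' e = S e ∧ not (does (x ≟ e))
   S'x : S' x ≡ false
   S'x = trans (cong (λ b → S x ∧ not b) (≟-refl _≟_ x)) (lem (S x)) where
    lem : ∀ b → b ∧ false ≡ false
    lem true = refl
    lem false = refl
   wrap : Colouring S' Λ → Colouring S Λ
   wrap C = record { φ = φ' ; φ-proper = assign-proper x c φ φ-proper (proj₂ (proj₂ f*)) ; φ-total = tot ; φ-only = only ; φ-list = list } where
    open Colouring C
    f* = free Λ φ x (<-≤-trans (≤-<-trans (blocked≤ Λ φ x S (λ f c p → ∧-true₁ (S f) (φ-only f c p))) lowx) (lists x))
    c : ℕ
    c = proj₁ f*
    φ' : E → Maybe ℕ
    φ' = assign x c φ
    tot : ∀ e → S e ≡ true → ∃ λ c → φ' e ≡ just c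
    tot e Se = go (x ≟ e) where
     go : Dec (x ≡ e) → ∃ λ c → φ' e ≡ just c
     go (yes p) = c , trans (cong φ' (sym p)) (assign-same x c φ)
     go (no p) = let d , q = φ-total e (∧-intro Se (cong not (¬true (λ q → p (≟-true _≟_ q))))) in d , trans (assign-other x c φ e p) q
    only : ∀ e d → φ' e ≡ just d → S e ≡ true
    only e d p = go (assign-cases x c φ e d p) where
     go : (x ≡ e × c ≡ d) ⊎ φ e ≡ just d → S e ≡ true
     go (inj₁ (q , _)) = subst (λ y → S y ≡ true) q Sx
     go (inj₂ w) = ∧-true₁ (S e) (φ-only e d w)
    list : ∀ e d → φ' e ≡ just d → Λ e d ≡ true
    list e d p = go (assign-cases x c φ e d p) where
     go : (x ≡ e × c ≡ d) ⊎ φ e ≡ just d → Λ e d ≡ true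
     go (inj₁ (q , r)) = subst₂ (λ y z → Λ y z ≡ true) q r (proj₁ (proj₂ f*))
     go (inj₂ w) = φ-list e d w
  go : ∀ b → anyᵇ low es ≡ b → Colouring S Λ
  go true eq = let x , _ , q = any-witness low es eq in extend x (∧-true₁ (S x) q) (does-true (nbrs S x <? T) (∧-true₂ (S x) q)) n bound
  go false eq = cores S (λ _ s → s) (λ e s → ≮⇒≥ (does-false (nbrs S e <? T) (¬true (λ d → true≢false (trans (sym (∧-intro s d)) (All.lookup (Select.any-false meet low es eq) (es-all e)))))))

 union : ∀ {S₁ S₂ Λ₁ Λ₂ Λ} → (C₁ : Colouring S₁ Λ₁) (C₂ : Colouring S₂ Λ₂) → (∀ e f c → adj e f ≡ true → Colouring.φ C₁ e ≡ just c → Colouring.φ C₂ f ≡ just c → ⊥) →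
     (∀ e c → Λ₁ e c ≡ true → Λ e c ≡ true) → (∀ e c → Λ₂ e c ≡ true → Λ e c ≡ true) → Colouring (λ e → S₁ e ∨ S₂ e) Λ
 union {S₁} {S₂} {Λ₁} {Λ₂} {Λ} C₁ C₂ sep sub₁ sub₂ = record { φ = φ ; φ-proper = proper ; φ-total = tot ; φ-only = only ; φ-list = list } where
  module C₁ = Colouring C₁
  module C₂ = Colouring C₂
  φ : E → Maybe ℕ
  φ e = if S₁ e then C₁.φ e else C₂.φ e
  cases : ∀ e c → φ e ≡ just c → C₁.φ e ≡ just c ⊎ C₂.φ e ≡ just c
  cases e c = go (S₁ e) where
   go : ∀ b → (if b then C₁.φ e else C₂.φ e) ≡ just c → C₁.φ e ≡ just c ⊎ C₂.φ e ≡ just c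
   go true p = inj₁ p
   go false p = inj₂ p
  proper : Proper φ
  proper e f c a p q = go (cases e c p) (cases f c q) where
   go : C₁.φ e ≡ just c ⊎ C₂.φ e ≡ just c → C₁.φ f ≡ just c ⊎ C₂.φ f ≡ just c → ⊥
   go (inj₁ u) (inj₁ w) = C₁.φ-proper e f c a u w
   go (inj₁ u) (inj₂ w) = sep e f c a u w
   go (inj₂ u) (inj₁ w) = sep f e c (adj-sym e f a) w u
   go (inj₂ u) (inj₂ w) = C₂.φ-proper e f c a u w
  tot : ∀ e → S₁ e ∨ S₂ e ≡ true → ∃ λ c → φ e ≡ just c
  tot e = go (S₁ e) refl where
   go : ∀ b → S₁ e ≡ b → b ∨ S₂ e ≡ true → ∃ λ c → (if b then C₁.φ e else C₂.φ e) ≡ just c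
   go true eq _ = C₁.φ-total e eq
   go false eq h = C₂.φ-total e h
  only : ∀ e c → φ e ≡ just c → S₁ e ∨ S₂ e ≡ true
  only e c p = go (cases e c p) where
   go : C₁.φ e ≡ just c ⊎ C₂.φ e ≡ just c → S₁ e ∨ S₂ e ≡ true
   go (inj₁ u) = cong (_∨ S₂ e) (C₁.φ-only e c u)
   go (inj₂ u) = ∨-right (S₁ e) (C₂.φ-only e c u)
  list : ∀ e c → φ e ≡ just c → Λ e c ≡ true
  list e c p = go (cases e c p) where
   go : C₁.φ e ≡ just c ⊎ C₂.φ e ≡ just c → Λ e c ≡ true
   go (inj₁ u) = sub₁ e c (C₁.φ-list e c u)
   go (inj₂ u) = sub₂ e c (C₂.φ-list e c u)

-- Splitting all lists evenly by colour classes

maximum : {A : Set} (x : A) (xs : List A) (a : A → ℚ) → ∃ λ y → y ∈ x ∷ xs × All (λ z → a z ≤ a y) (x ∷ xs)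
maximum x [] a = x , here refl , ≤-refl ∷ []
maximum x (y ∷ ys) a = go (maximum y ys a) where
 go : (∃ λ m → m ∈ y ∷ ys × All (λ z → a z ≤ a m) (y ∷ ys)) → ∃ λ m → m ∈ x ∷ y ∷ ys × All (λ z → a z ≤ a m) (x ∷ y ∷ ys)
 go (m , m∈ , h) with ≤-total (a x) (a m)
 ... | inj₁ p = m , there m∈ , p ∷ h
 ... | inj₂ p = x , here refl , ≤-refl ∷ All.map (λ q → ≤-trans q p) h

average : {A : Set} (xs : List A) → 1 ℕ.≤ length xs → (a : A → ℚ) → ∃ λ y → y ∈ xs × ∑ xs a ≤ ⟦ length xs ⟧ * a y
average (x ∷ xs) _ a = let y , y∈ , h = maximum x xs a in
 y , y∈ , ≤-trans (∑-mono∈ (x ∷ xs) (λ z z∈ → All.lookup h z∈)) (≤-reflexive (∑-const (x ∷ xs) (a y)))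

count-cong∈ : {A : Set} (p q : A → Bool) (xs : List A) → (∀ x → x ∈ xs → p x ≡ q x) → countᵇ p xs ≡ countᵇ q xs
count-cong∈ p q [] h = refl
count-cong∈ p q (x ∷ xs) h = trans (cong (λ b → if b then suc (countᵇ p xs) else countᵇ p xs) (h x (here refl)))
 (cong (λ k → if q x then suc k else k) (count-cong∈ p q xs (λ y m → h y (there m))))

lem-eq : ∀ w l v p q → w * (p * q) ≡ w * (1# + l * v * 0#) * (1# - l * (0# * 0#)) * (p * q)
lem-eq = solve-∀ ring

lem-eq-2 : ∀ w l v p q → w * (p * q) ≡ w * (1# + l * v * 0#) * (1# - l * (0# * 1#)) * (p * q)
lem-eq-2 = solve-∀ ring

lem-eq-3 : ∀ w l v p q → w * (p * ((1# + l * v) * q)) ≡ w * (1# + l * v * 1#) * (1# - l * (1# * 0#)) * (p * q)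
lem-eq-3 = solve-∀ ring

lem-eq-4 : ∀ w l v p q → w * ((1# - l) * p * ((1# + l * v) * q)) ≡ w * (1# + l * v * 1#) * (1# - l * (1# * 1#)) * (p * q)
lem-eq-4 = solve-∀ ring

∑w₂≤-pure₂ : ∀ w t x → 0# ≤ w → ∀ l v → t ≡ l * v → 0# ≤ x → w * (1# + t * x) - l * (v * (w * (1# + t * x) * x)) ≤ w
∑w₂≤-pure₂ w t x h l v refl k = by (h ⊗ sq≥0 (l * v * x)) (solve (w ⸴ x ⸴ l ⸴ v ⸴ ∎) ring)

∑w₂≤-pure : ∀ A B C l → 0# ≤ l → C ≤ B → A - l * B ≤ A - l * C
∑w₂≤-pure A B C l h k = by (h ⊗ gap k) (solve (A ⸴ B ⸴ C ⸴ l ⸴ ∎) ring)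

∑w₂≤-eq : ∀ w l x → w * (1# - l * x) ≡ w - l * (w * x)
∑w₂≤-eq = solve-∀ ring

mass-eq : ∀ a b c → a * (b * c) ≡ b * a * c
mass-eq = solve-∀ ring

sq-Lc-lem : ∀ b → 𝟙 b * 𝟙 b ≡ 𝟙 b
sq-Lc-lem true = refl
sq-Lc-lem false = refl

0≤w₂-pure : ∀ l a b → l ≤ 1# → 0# ≤ l → a ≤ 1# → 0# ≤ b → b ≤ 1# → 0# ≤ 1# - l * (a * b)
0≤w₂-pure l a b h h0 p q s = by (gap h ⊕ h0 ⊗ (gap s ⊕ gap p ⊗ q)) (solve (l ⸴ a ⸴ b ⸴ ∎) ring)

split-eq : ∀ a → a * (1# * 1#) ≡ a
split-eq = solve-∀ ring

-- A random partition of the colours into N classes splits every list evenly; the randomness is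
-- replaced by the potential ∑ (1-λ)^S (1+λ/N)^R over all lists and classes.
module Partition {E : Set} (es : List E) (es-all : ∀ e → e ∈ es) (L : E → ℕ → Bool) (N' Λ' : ℕ) where

 N : ℕ
 N = suc N'

 l v : ℚ
 l = inv (suc (suc Λ'))
 v = inv N

 0≤l : 0# ≤ l
 0≤l = 0≤inv (suc (suc Λ'))

 0≤v : 0# ≤ v
 0≤v = 0≤inv N

 js : List ℕ
 js = upTo N

 lenjs : length js ≡ N
 lenjs = length-upTo N

 S : List ℕ → (ℕ → ℕ) → E → ℕ → ℕ
 S cs κ e j = countᵇ (λ c → L e c ∧ does (κ c ℕ.≟ j)) cs

 pot : List ℕ → (ℕ → ℕ) → E → ℕ → ℚ
 pot cs κ e j = (1# - l) ^ S cs κ e j * (1# + l * v) ^ countᵇ (L e) cs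

 -- Method of conditional expectations. The colour goes to the class with the largest weight of
 -- lists containing it, which is at least `1/N` of the total, and `(1 + λ/N)(1 - λ/N) ≤ 1`. The
 -- weights `w` are arbitrary so that factors already fixed can be absorbed.
 split : ∀ cs → AllPairs _≢_ cs → (w : E → ℕ → ℚ) → (∀ e j → 0# ≤ w e j) →
     ∃ λ κ → (∀ c → κ c ∈ js) × ∑[ e ∈ es ] ∑[ j ∈ js ] w e j * pot cs κ e j ≤ ∑[ e ∈ es ] ∑[ j ∈ js ] w e j
 split [] [] w 0≤w = (λ _ → 0) , (λ _ → here refl) , ≤-reflexive (∑-cong es (λ e → ∑-cong js (λ j → split-eq (w e j))))
 split (c ∷ cs) (c∉ ∷ cs!) w 0≤w = finish (split cs cs! w₂ 0≤w₂) where
  Lc : E → ℚ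
  Lc e = 𝟙 (L e c)
  w₁ : E → ℕ → ℚ
  w₁ e j = w e j * (1# + l * v * Lc e)
  av = average js (subst (1 ℕ.≤_) (sym lenjs) (ℕ.s≤s ℕ.z≤n)) (λ j → ∑[ e ∈ es ] w₁ e j * Lc e)
  j₀ : ℕ
  j₀ = proj₁ av
  w₂ : E → ℕ → ℚ
  w₂ e j = w₁ e j * (1# - l * (Lc e * 𝟙 (does (j₀ ℕ.≟ j))))
  l≤1 : l ≤ 1#
  l≤1 = inv≤1 (suc Λ')
  0≤w₁ : ∀ e j → 0# ≤ w₁ e j
  0≤w₁ e j = 0≤w e j ⊗ (0≤1 ⊕ 0≤l ⊗ 0≤v ⊗ 0≤𝟙 (L e c))
  0≤w₂ : ∀ e j → 0# ≤ w₂ e j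
  0≤w₂ e j = 0≤w₁ e j ⊗ 0≤w₂-pure l (Lc e) (𝟙 (does (j₀ ℕ.≟ j))) l≤1 0≤l (𝟙≤1 (L e c)) (0≤𝟙 (does (j₀ ℕ.≟ j))) (𝟙≤1 (does (j₀ ℕ.≟ j)))
  chosen : ∑[ e ∈ es ] w₁ e j₀ * Lc e ≤ ∑[ e ∈ es ] ∑[ j ∈ js ] w₁ e j * (Lc e * 𝟙 (does (j₀ ℕ.≟ j)))
  chosen = ∑-mono es (λ e → ≡≤ (trans (cong (w₁ e j₀ *_) (sym (trans (cong (λ b → Lc e * 𝟙 b) (≟-refl ℕ._≟_ j₀)) (*-identityʳ (Lc e))))) refl)
    (∑-∈ (λ j → w₁ e j * (Lc e * 𝟙 (does (j₀ ℕ.≟ j)))) (λ j → 0≤w₁ e j ⊗ (0≤𝟙 (L e c) ⊗ 0≤𝟙 (does (j₀ ℕ.≟ j)))) (proj₁ (proj₂ av))))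
  mass : v * (∑[ e ∈ es ] ∑[ j ∈ js ] w₁ e j * Lc e) ≤ ∑[ e ∈ es ] w₁ e j₀ * Lc e
  mass = ≤-trans (*-monoˡ 0≤v (≡≤ (∑-swap es js (λ e j → w₁ e j * Lc e)) (proj₂ (proj₂ av))))
    (≤-reflexive (trans (cong (λ k → v * (⟦ k ⟧ * T)) lenjs) (trans (mass-eq v ⟦ N ⟧ T) (trans (cong (_* T) (*inv N')) (*-identityˡ T))))) where
   T : ℚ
   T = ∑[ e ∈ es ] w₁ e j₀ * Lc e
  ∑w₂≤ : ∑[ e ∈ es ] ∑[ j ∈ js ] w₂ e j ≤ ∑[ e ∈ es ] ∑[ j ∈ js ] w e j
  ∑w₂≤ = ≡≤ (trans (∑-cong es (λ e → trans (∑-cong js (λ j → ∑w₂≤-eq (w₁ e j) l (Lc e * 𝟙 (does (j₀ ℕ.≟ j))))) (trans (∑-- js (w₁ e) (λ j → l * (w₁ e j * (Lc e * 𝟙 (does (j₀ ℕ.≟ j))))))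
      (cong (λ t → ∑ js (w₁ e) - t) (∑-*ˡ js l (λ j → w₁ e j * (Lc e * 𝟙 (does (j₀ ℕ.≟ j)))))))))
     (trans (∑-- es (λ e → ∑ js (w₁ e)) (λ e → l * (∑[ j ∈ js ] w₁ e j * (Lc e * 𝟙 (does (j₀ ℕ.≟ j)))))) (cong (λ t → ∑ es (λ e → ∑ js (w₁ e)) - t) (∑-*ˡ es l (λ e → ∑[ j ∈ js ] w₁ e j * (Lc e * 𝟙 (does (j₀ ℕ.≟ j))))))))
   (≤-trans (∑w₂≤-pure A₁ B₁ C₁ l 0≤l (≤-trans mass chosen))
   (≡≤ (sym (trans (∑-cong es (λ e → trans (∑-- js (w₁ e) (λ j → l * (v * (w₁ e j * Lc e)))) (cong (λ t → ∑ js (w₁ e) - t) (trans (∑-*ˡ js l (λ j → v * (w₁ e j * Lc e))) (cong (l *_) (∑-*ˡ js v (λ j → w₁ e j * Lc e)))))))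
      (trans (∑-- es (λ e → ∑ js (w₁ e)) (λ e → l * (v * (∑[ j ∈ js ] w₁ e j * Lc e)))) (cong (λ t → A₁ - t) (trans (∑-*ˡ es l (λ e → v * (∑[ j ∈ js ] w₁ e j * Lc e))) (cong (l *_) (∑-*ˡ es v (λ e → ∑[ j ∈ js ] w₁ e j * Lc e))))))))
    (∑-mono es (λ e → ∑-mono js (λ j → ∑w₂≤-pure₂ (w e j) (l * v) (Lc e) (0≤w e j) l v refl (0≤𝟙 (L e c))))))) where
   A₁ B₁ C₁ : ℚ
   A₁ = ∑[ e ∈ es ] ∑ js (w₁ e)
   B₁ = ∑[ e ∈ es ] ∑[ j ∈ js ] w₁ e j * (Lc e * 𝟙 (does (j₀ ℕ.≟ j)))
   C₁ = v * (∑[ e ∈ es ] ∑[ j ∈ js ] w₁ e j * Lc e)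
  finish : (∃ λ κ → (∀ c → κ c ∈ js) × ∑[ e ∈ es ] ∑[ j ∈ js ] w₂ e j * pot cs κ e j ≤ ∑[ e ∈ es ] ∑[ j ∈ js ] w₂ e j) →
       ∃ λ κ → (∀ c → κ c ∈ js) × ∑[ e ∈ es ] ∑[ j ∈ js ] w e j * pot (c ∷ cs) κ e j ≤ ∑[ e ∈ es ] ∑[ j ∈ js ] w e j
  finish (κ , κ∈ , h) = κ' , κ'∈ , ≡≤ (∑-cong es (λ e → ∑-cong js (λ j → same e j))) (≤-trans h ∑w₂≤) where
   κ' : ℕ → ℕ
   κ' d = if does (c ℕ.≟ d) then j₀ else κ d
   κ'∈ : ∀ d → κ' d ∈ js
   κ'∈ d = lem (does (c ℕ.≟ d)) where
    lem : ∀ b → (if b then j₀ else κ d) ∈ js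
    lem true = proj₁ (proj₂ av)
    lem false = κ∈ d
   κ'c : κ' c ≡ j₀
   κ'c = cong (λ b → if b then j₀ else κ c) (≟-refl ℕ._≟_ c)
   κ'd : ∀ d → d ∈ cs → κ' d ≡ κ d
   κ'd d m = cong (λ b → if b then j₀ else κ d) (¬true (λ p → All.lookup c∉ m (≟-true ℕ._≟_ p)))
   S≡ : ∀ e j → S cs κ' e j ≡ S cs κ e j
   S≡ e j = count-cong∈ (λ c → L e c ∧ does (κ' c ℕ.≟ j)) (λ c → L e c ∧ does (κ c ℕ.≟ j)) cs (λ d m → cong (λ k → L e d ∧ does (k ℕ.≟ j)) (κ'd d m))
   same : ∀ e j → w e j * pot (c ∷ cs) κ' e j ≡ w₂ e j * pot cs κ e j
   same e j = trans (cong₂ (λ k s → w e j * ((1# - l) ^ (if L e c ∧ does (k ℕ.≟ j) then suc s else s) * (1# + l * v) ^ (if L e c then suc (countᵇ (L e) cs) else countᵇ (L e) cs))) κ'c (S≡ e j))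
     (lem (L e c) (does (j₀ ℕ.≟ j)) (S cs κ e j) (countᵇ (L e) cs)) where
    lem : ∀ a b s r → w e j * ((1# - l) ^ (if a ∧ b then suc s else s) * (1# + l * v) ^ (if a then suc r else r)) ≡
       w e j * (1# + l * v * 𝟙 a) * (1# - l * (𝟙 a * 𝟙 b)) * ((1# - l) ^ s * (1# + l * v) ^ r)
    lem true true s r = lem-eq-4 (w e j) l v ((1# - l) ^ s) ((1# + l * v) ^ r)
    lem true false s r = lem-eq-3 (w e j) l v ((1# - l) ^ s) ((1# + l * v) ^ r)
    lem false true s r = lem-eq-2 (w e j) l v ((1# - l) ^ s) ((1# + l * v) ^ r)
    lem false false s r = lem-eq (w e j) l v ((1# - l) ^ s) ((1# + l * v) ^ r)

pure-e₂-5 : ∀ s w → w * (s + 1#) ≡ (1# + s) * w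
pure-e₂-5 = solve-∀ ring

pure-e₁-6 : ∀ s w v → ((1# + s) * w - w) * (1# + v) ≡ w * (s + s * v)
pure-e₁-6 = solve-∀ ring

inv-unit : ∀ k → (1# - inv (suc (suc k))) * (1# + inv (suc k)) ≡ 1#
inv-unit k = pure (inv (suc (suc k))) (inv (suc k)) ⟦ suc k ⟧ (*inv k) (trans (cong (_* inv (suc (suc k))) (sym 1+⟦ suc k ⟧)) (*inv (suc k))) where
 pure : ∀ w v s → s * v ≡ 1# → (1# + s) * w ≡ 1# → (1# - w) * (1# + v) ≡ 1#
 pure w v s p q = cong (λ o → (o - w) * (1# + v)) (sym q) ⨾ pure-e₁-6 s w v ⨾ cong (λ o → w * (s + o)) p ⨾ pure-e₂-5 s w ⨾ q

1^ : ∀ k → 1# ^ k ≡ 1#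
1^ zero = refl
1^ (suc k) = trans (*-identityˡ (1# ^ k)) (1^ k)

P≡-eq : ∀ a b c → a * b * c ≡ a * c * b
P≡-eq = solve-∀ ring

-- Read off a lower bound for the number S of successes from the final value of the potential.
successes : ∀ k M P S h b → 0# ≤ M → (1# - inv (suc (suc k))) ^ S * P ≤ M → (1# + inv (suc (suc k))) ^ h ≤ P →
      M * (1# + inv (suc k)) ^ b < (1# + inv (suc (suc k))) ^ h → b ℕ.≤ S
successes k M P S h b 0≤M pot≤ P≥ M< = ℕₚ.≮⇒≥ (λ S<b → <⇒¬≥ M< (≤-trans P≥ (≡≤ P≡
  (≤-trans (*-monoʳ (^-nonneg S 0≤u) pot≤) (*-monoˡ 0≤M (^-≤ (by (0≤inv (suc k)) refl) (ℕₚ.<⇒≤ S<b))))))) where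
 0≤u : 0# ≤ 1# + inv (suc k)
 0≤u = 0≤1 ⊕ 0≤inv (suc k)
 P≡ : P ≡ (1# - inv (suc (suc k))) ^ S * P * (1# + inv (suc k)) ^ S
 P≡ = trans (sym (*-identityˡ P)) (trans (cong (_* P) (sym (trans (sym (^-* (1# - inv (suc (suc k))) (1# + inv (suc k)) S)) (trans (cong (_^ S) (inv-unit k)) (1^ S)))))
     (P≡-eq ((1# - inv (suc (suc k))) ^ S) ((1# + inv (suc k)) ^ S) P))

large-eq : ∀ a b c → a * (b * c) ≡ b * (a * c)
large-eq = solve-∀ ring

module _ {E : Set} (es : List E) (es-all : ∀ e → e ∈ es) (L : E → ℕ → Bool) (N' Λ' : ℕ) where
 open Partition es es-all L N' Λ'

 -- All weights start at 1, so the potential stays at most `length es * N`; a list with fewer than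
 -- `b` colours in some class would exceed this by its own term.
 partition : ∀ cs → AllPairs _≢_ cs → ∀ K h b → (∀ e → K ℕ.≤ countᵇ (L e) cs) → h ℕ.* N ℕ.≤ K →
       ⟦ length es ℕ.* N ⟧ * (1# + inv (suc Λ')) ^ b < (1# + l) ^ h →
       ∃ λ κ → (∀ c → κ c ∈ js) × (∀ e j → j ∈ js → b ℕ.≤ S cs κ e j)
 partition cs cs! K h b lists hN M< = go (split cs cs! (λ _ _ → 1#) (λ _ _ → 0≤1)) where
  M : ℚ
  M = ⟦ length es ℕ.* N ⟧
  go : (∃ λ κ → (∀ c → κ c ∈ js) × ∑[ e ∈ es ] ∑[ j ∈ js ] 1# * pot cs κ e j ≤ ∑[ e ∈ es ] ∑[ j ∈ js ] 1#) →
     ∃ λ κ → (∀ c → κ c ∈ js) × (∀ e j → j ∈ js → b ℕ.≤ S cs κ e j)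
  go (κ , κ∈ , h≤) = κ , κ∈ , λ e j j∈ → successes Λ' M ((1# + l * v) ^ countᵇ (L e) cs) (S cs κ e j) h b 0≤⟦ length es ℕ.* N ⟧ (pot≤ e j j∈) (large e) M< where
   0≤pot : ∀ e j → 0# ≤ pot cs κ e j
   0≤pot e j = ^-nonneg (S cs κ e j) (gap (inv≤1 (suc Λ'))) ⊗ ^-nonneg (countᵇ (L e) cs) (0≤1 ⊕ 0≤l ⊗ 0≤v)
   pot≤ : ∀ e j → j ∈ js → pot cs κ e j ≤ M
   pot≤ e j j∈ = ≡≤ (sym (*-identityˡ (pot cs κ e j)))
    (≤-trans (∑-∈ (λ j → 1# * pot cs κ e j) (λ j → 0≤1 ⊗ 0≤pot e j) j∈)
    (≤-trans (∑-∈ (λ e → ∑[ j ∈ js ] 1# * pot cs κ e j) (λ e → ∑-nonneg js (λ j → 0≤1 ⊗ 0≤pot e j)) (es-all e))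
    (≤-trans h≤ (≤-reflexive (trans (∑-const es (∑[ j ∈ js ] 1#)) (trans (cong (⟦ length es ⟧ *_) (trans (∑-const js 1#) (trans (*-identityʳ ⟦ length js ⟧) (cong ⟦_⟧ lenjs)))) (sym (⟦⟧-* (length es) N))))))))
   large : ∀ e → (1# + l) ^ h ≤ (1# + l * v) ^ countᵇ (L e) cs
   large e = ≤-trans (^-mono h (0≤1 ⊕ 0≤l) (≡≤ (cong (1# +_) (sym (trans (large-eq ⟦ N ⟧ l v) (trans (cong (l *_) (*inv N')) (*-identityʳ l))))) (bernoulli N (0≤l ⊗ 0≤v))))
    (≡≤ (sym (^-*ℕ (1# + l * v) h N)) (^-≤ (by (0≤l ⊗ 0≤v) refl) (ℕₚ.≤-trans hN (lists e))))

pure-e₂-4 : ∀ a i l m → (1# + i * l) * ((1# + i * l) * ((1# + i * l) * 1#)) + a * (i * i) * (1# - (m * l) * (m * l) * (m * l)) ≡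
   1# + a * (i * i) + (i * i * (l * l * l) * (i - a * (m * m * m)) + ⟪ 3 ⟫ * (i * l) + ⟪ 3 ⟫ * (i * l * (i * l)))
pure-e₂-4 = solve-∀ ring

pure-e₁-5 : ∀ a i l → (1# + i * l) * ((1# + i * l) * ((1# + i * l) * 1#)) ≡ (1# + i * l) * ((1# + i * l) * ((1# + i * l) * 1#)) + a * (i * i) * (1# - 1# * 1# * 1#)
pure-e₁-5 = solve-∀ ring

D≤6qi-eq₂ : ∀ i → i ℕ.* 3 ℕ.+ i ℕ.* 3 ≡ 6 ℕ.* i
D≤6qi-eq₂ = ℕR.solve-∀

proof-eq₁ : ∀ c q i → c ℕ.* ((q ℕ.* (6 ℕ.* i)) ℕ.* (q ℕ.* (6 ℕ.* i))) ≡ 36 ℕ.* c ℕ.* (q ℕ.* q) ℕ.* (i ℕ.* i)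
proof-eq₁ = ℕR.solve-∀

-- Exponential growth beats quadratic growth.
beats : ∀ k c q → ∃ λ D₀ → ∀ D j → D₀ ℕ.≤ D → D ℕ.≤ q ℕ.* j → ⟦ c ℕ.* (D ℕ.* D) ⟧ < (1# + inv (suc k)) ^ j
beats k c q = D₀ , proof where
 B I D₀ : ℕ
 B = suc k ℕ.* suc k ℕ.* suc k
 I = suc (36 ℕ.* c ℕ.* (q ℕ.* q) ℕ.* B)
 D₀ = suc (q ℕ.* (3 ℕ.* I))
 l : ℚ
 l = inv (suc k)
 proof : ∀ D j → D₀ ℕ.≤ D → D ℕ.≤ q ℕ.* j → ⟦ c ℕ.* (D ℕ.* D) ⟧ < (1# + l) ^ j
 -- The cube of Bernoulli's bound for `i = j / 3` grows cubically in `i`, whereas `D ≤ 6qi` makes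
 -- the left side quadratic.
 proof D j D₀≤ D≤ = <-≤-trans (≤-<-trans (⟦⟧-mono (ℕₚ.≤-trans (ℕₚ.*-monoʳ-≤ c (ℕₚ.*-mono-≤ D≤6qi D≤6qi)) (ℕₚ.≤-reflexive (proof-eq₁ c q i)))) strict)
   (≤-trans (^-mono 3 (0≤1 ⊕ 0≤⟦ i ⟧ ⊗ 0≤inv (suc k)) (bernoulli i (0≤inv (suc k)))) (≡≤ (sym (^-*ℕ (1# + l) 3 i)) (^-≤ (by (0≤inv (suc k)) refl)
     (ℕₚ.≤-trans (ℕₚ.≤-reflexive (ℕₚ.*-comm 3 i)) (ℕ/.m/n*n≤m j 3))))) where
  i : ℕ
  i = j ℕ/./ 3
  3I<j : 3 ℕ.* I ℕ.≤ j
  3I<j = ℕₚ.<⇒≤ (ℕₚ.*-cancelˡ-< q (3 ℕ.* I) j (ℕₚ.≤-trans D₀≤ D≤))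
  I≤i : I ℕ.≤ i
  I≤i = ℕₚ.≤-trans (ℕₚ.≤-reflexive (sym (ℕ/.m*n/n≡m I 3))) (ℕ/./-monoˡ-≤ 3 (ℕₚ.≤-trans (ℕₚ.≤-reflexive (ℕₚ.*-comm I 3)) 3I<j))
  D≤6qi : D ℕ.≤ q ℕ.* (6 ℕ.* i)
  D≤6qi = ℕₚ.≤-trans D≤ (ℕₚ.*-monoʳ-≤ q (ℕₚ.≤-trans (ℕₚ.<⇒≤ (ℕₚ.≤-trans (ℕₚ.≤-reflexive (cong suc (ℕ/.m≡m%n+[m/n]*n j 3))) (ℕₚ.+-monoˡ-≤ (i ℕ.* 3) (ℕ/.m%n<n j 3))))
    (ℕₚ.≤-trans (ℕₚ.+-monoˡ-≤ (i ℕ.* 3) (ℕₚ.*-monoˡ-≤ 3 (ℕₚ.≤-trans (ℕ.s≤s ℕ.z≤n) I≤i))) (ℕₚ.≤-reflexive (D≤6qi-eq₂ i)))))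
  a : ℕ
  a = 36 ℕ.* c ℕ.* (q ℕ.* q)
  strict : ⟦ a ℕ.* (i ℕ.* i) ⟧ < (1# + ⟦ i ⟧ * l) ^ 3
  strict = <-≤-trans (plus1 ⟦ a ℕ.* (i ℕ.* i) ⟧) (subst (λ t → 1# + t ≤ (1# + ⟦ i ⟧ * l) ^ 3) (sym (trans (⟦⟧-* a (i ℕ.* i)) (cong (⟦ a ⟧ *_) (⟦⟧-* i i))))
   (pure ⟦ a ⟧ ⟦ i ⟧ l ⟦ suc k ⟧ (*inv k) 0≤⟦ i ⟧ (0≤inv (suc k)) (≡≤ (sym (trans (⟦⟧-* a B) (cong (⟦ a ⟧ *_) (trans (⟦⟧-* (suc k ℕ.* suc k) (suc k)) (cong (_* ⟦ suc k ⟧) (⟦⟧-* (suc k) (suc k)))))))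
     (⟦⟧-mono (ℕₚ.≤-trans (ℕₚ.n≤1+n _) I≤i))))) where
   plus1 : ∀ a → a < 1# + a
   plus1 a = subst (_< 1# + a) (+-identityˡ a) (ℚₚ.+-monoˡ-< a 0<1)
   pure : ∀ a i l m → m * l ≡ 1# → 0# ≤ i → 0# ≤ l → a * (m * m * m) ≤ i → 1# + a * (i * i) ≤ (1# + i * l) * ((1# + i * l) * ((1# + i * l) * 1#))
   pure a i l m p i0 l0 h = by (i0 ⊗ i0 ⊗ (l0 ⊗ l0 ⊗ l0) ⊗ gap h ⊕ 0≤⟪ 3 ⟫ ⊗ (i0 ⊗ l0) ⊕ 0≤⟪ 3 ⟫ ⊗ (i0 ⊗ l0 ⊗ (i0 ⊗ l0)))
    (pure-e₁-5 a i l ⨾ cong (λ o → (1# + i * l) * ((1# + i * l) * ((1# + i * l) * 1#)) + a * (i * i) * (1# - o * o * o)) (sym p) ⨾ pure-e₂-4 a i l m)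

-- Marked elements in random independent sets

atLeast2 : {A : Set} → (A → Bool) → List A → Bool
atLeast2 p [] = false
atLeast2 p (x ∷ xs) = if p x then anyᵇ p xs else atLeast2 p xs

eq-pure : ∀ s P a t → s ≤ a + P → 0# ≤ t → s + P ≤ a + ⟪ 2 ⟫ * (P + t)
eq-pure s P a t h k = by (gap h ⊕ 0≤⟪ 2 ⟫ ⊗ k) (solve (s ⸴ P ⸴ a ⸴ t ⸴ ∎) ring)

two≥-eq : ∀ a t q → a + ⟪ 2 ⟫ * (q + t) ≡ (a + ⟪ 2 ⟫ * t) + ⟪ 2 ⟫ * q
two≥-eq = solve-∀ ring

∑∑-symmetric-eq : ∀ d s e p → (d + s) + (s + (e + (p + p))) ≡ (d + e) + ((s + p) + (s + p))
∑∑-symmetric-eq = solve-∀ ring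

trs-+-eq : ∀ a b c d → (a + b) + (c + d) ≡ (a + c) + (b + d)
trs-+-eq = solve-∀ ring

prs-+-eq : ∀ a b c d → (a + b) + (c + d) ≡ (a + c) + (b + d)
prs-+-eq = solve-∀ ring

module _ {A : Set} where

 trs-nonneg : ∀ (xs : List A) {γ} → (∀ x y z → 0# ≤ γ x y z) → 0# ≤ trs γ xs
 trs-nonneg [] h = ≤-refl
 trs-nonneg (x ∷ xs) h = prs-nonneg xs (h x) ⊕ trs-nonneg xs h

 trs≤∑∑∑ : ∀ (xs : List A) {γ} → (∀ x y z → 0# ≤ γ x y z) → trs γ xs ≤ ∑[ x ∈ xs ] ∑[ y ∈ xs ] ∑[ z ∈ xs ] γ x y z
 trs≤∑∑∑ xs₀ {γ} h = go xs₀ xs₀ (λ f k → ≤-refl) where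
  go : ∀ xs ys → (∀ (f : A → ℚ) → (∀ x → 0# ≤ f x) → ∑ xs f ≤ ∑ ys f) → trs γ xs ≤ ∑[ x ∈ xs ] ∑[ y ∈ ys ] ∑[ z ∈ ys ] γ x y z
  go [] ys s = ≤-refl
  go (x ∷ xs) ys s = +-mono-≤ (≤-trans (prs≤∑∑ xs (h x)) (≤-trans (∑-mono xs (λ y → s' (γ x y) (h x y))) (s' (λ y → ∑ ys (γ x y)) (λ y → ∑-nonneg ys (h x y)))))
                (go xs ys s') where
   s' : ∀ (f : A → ℚ) → (∀ x → 0# ≤ f x) → ∑ xs f ≤ ∑ ys f
   s' f k = ≤-trans (by (k x) (+-comm (f x) (∑ xs f))) (s f k)

 prs-+ : ∀ (xs : List A) γ δ → prs (λ x y → γ x y + δ x y) xs ≡ prs γ xs + prs δ xs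
 prs-+ [] γ δ = refl
 prs-+ (x ∷ xs) γ δ = trans (cong₂ _+_ (∑-+ xs (γ x) (δ x)) (prs-+ xs γ δ)) (prs-+-eq (∑ xs (γ x)) (∑ xs (δ x)) (prs γ xs) (prs δ xs))

 trs-+ : ∀ (xs : List A) γ δ → trs (λ x y z → γ x y z + δ x y z) xs ≡ trs γ xs + trs δ xs
 trs-+ [] γ δ = refl
 trs-+ (x ∷ xs) γ δ = trans (cong₂ _+_ (prs-+ xs (γ x) (δ x)) (trs-+ xs γ δ)) (trs-+-eq (prs (γ x) xs) (prs (δ x) xs) (trs γ xs) (trs δ xs))

 prs-*ˡ : ∀ (xs : List A) c γ → prs (λ x y → c * γ x y) xs ≡ c * prs γ xs
 prs-*ˡ [] c γ = sym (*-zeroʳ c)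
 prs-*ˡ (x ∷ xs) c γ = trans (cong₂ _+_ (∑-*ˡ xs c (γ x)) (prs-*ˡ xs c γ)) (sym (*-distribˡ-+ c (∑ xs (γ x)) (prs γ xs)))

 trs-*ˡ : ∀ (xs : List A) c γ → trs (λ x y z → c * γ x y z) xs ≡ c * trs γ xs
 trs-*ˡ [] c γ = sym (*-zeroʳ c)
 trs-*ˡ (x ∷ xs) c γ = trans (cong₂ _+_ (prs-*ˡ xs c (γ x)) (trs-*ˡ xs c γ)) (sym (*-distribˡ-+ c (prs (γ x) xs) (trs γ xs)))

 ∑-sel : ∀ (meet : A → A → Bool) xs (f : A → ℚ) → (∀ x → 0# ≤ f x) → ∑ (Select.sel meet xs) f ≤ ∑ xs f
 ∑-sel meet [] f k = ≤-refl
 ∑-sel meet (x ∷ xs) f k with anyᵇ (meet x) xs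
 ... | true = ≤-trans (∑-sel meet xs f k) (by (k x) (+-comm (f x) (∑ xs f)))
 ... | false = +-mono-≤ (≤-refl {f x}) (∑-sel meet xs f k)

 ∑∑-symmetric : ∀ (xs : List A) γ → (∀ x y → γ x y ≡ γ y x) → ∑[ x ∈ xs ] ∑[ y ∈ xs ] γ x y ≡ (∑[ x ∈ xs ] γ x x) + (prs γ xs + prs γ xs)
 ∑∑-symmetric [] γ s = refl
 ∑∑-symmetric (x ∷ xs) γ s = trans (cong (γ x x + ∑ xs (γ x) +_) (trans (∑-+ xs (λ y → γ y x) (λ y → ∑ xs (γ y)))
   (cong₂ _+_ (∑-cong xs (λ y → s y x)) (∑∑-symmetric xs γ s))))
  (∑∑-symmetric-eq (γ x x) (∑ xs (γ x)) (∑[ x ∈ xs ] γ x x) (prs γ xs))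

 -- Bonferroni one level up: for `m ≥ 2` true entries the number of pairs is at most 1 plus twice
 -- the number of triples.
 two≥ : ∀ (p : A → Bool) xs → prs (λ x y → 𝟙 (p x) * 𝟙 (p y)) xs ≤ 𝟙 (atLeast2 p xs) + ⟪ 2 ⟫ * trs (λ x y z → 𝟙 (p x) * (𝟙 (p y) * 𝟙 (p z))) xs
 two≥ p [] = ≤-refl
 two≥ p (x ∷ xs) with p x
 ... | false = ≡≤ (trans (cong (_+ prs (λ x y → 𝟙 (p x) * 𝟙 (p y)) xs) (trans (∑-cong xs (λ y → *-zeroˡ (𝟙 (p y)))) (∑-0 xs))) (+-identityˡ _))
    (≤-trans (two≥ p xs) (by (0≤⟪ 2 ⟫ ⊗ prs-nonneg xs (λ y z → ≤-reflexive (sym (*-zeroˡ (𝟙 (p y) * 𝟙 (p z))))))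
     (two≥-eq (𝟙 (atLeast2 p xs)) (trs (λ x y z → 𝟙 (p x) * (𝟙 (p y) * 𝟙 (p z))) xs) (prs (λ y z → 0# * (𝟙 (p y) * 𝟙 (p z))) xs))))
 ... | true = ≡≤ (cong (_+ P) (∑-cong xs (λ y → *-identityˡ (𝟙 (p y)))))
    (≤-trans (eq-pure (∑ xs (λ y → 𝟙 (p y))) P (𝟙 (anyᵇ p xs)) (trs (λ x y z → 𝟙 (p x) * (𝟙 (p y) * 𝟙 (p z))) xs) (∑≤any p xs)
      (trs-nonneg xs (λ x y z → 0≤𝟙 (p x) ⊗ (0≤𝟙 (p y) ⊗ 0≤𝟙 (p z)))))
     (≤-reflexive (cong (λ q → 𝟙 (anyᵇ p xs) + ⟪ 2 ⟫ * (q + trs (λ x y z → 𝟙 (p x) * (𝟙 (p y) * 𝟙 (p z))) xs)) (prs-cong xs (λ y z → sym (*-identityˡ (𝟙 (p y) * 𝟙 (p z)))))))) where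
  P = prs (λ x y → 𝟙 (p x) * 𝟙 (p y)) xs

-- Number of marked elements in a random independent set

lem-eq-5 : ∀ a → (a * (1# - 1#)) * 1# ≡ 0#
lem-eq-5 = solve-∀ ring

pointwise-pure₂ : ∀ P Q c t' t a → P ≤ Q + c → Q ≤ a + ⟪ 2 ⟫ * t' → t' ≤ t → P + (- 1#) * (c + ⟪ 2 ⟫ * t) ≤ a
pointwise-pure₂ P Q c t' t a h k l = by (gap h ⊕ gap k ⊕ 0≤⟪ 2 ⟫ ⊗ gap l) (solve (P ⸴ Q ⸴ c ⸴ t' ⸴ t ⸴ a ⸴ ∎) ring)

go-pure : ∀ f s t t' j q P C → 0# ≤ f → 0# ≤ s → 0# ≤ j → s ≤ t → t ≤ t' + q → f * s + (P + C) ≤ f * t' + P + (f * (s * j) + f * q + C)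
go-pure f s t t' j q P C a b c d e = by (a ⊗ (gap d ⊕ gap e) ⊕ a ⊗ (b ⊗ c)) (solve (f ⸴ s ⸴ t ⸴ t' ⸴ j ⸴ q ⸴ P ⸴ C ⸴ ∎) ring)

go-pure-2 : ∀ f s j q P C → 0# ≤ f → 0# ≤ s → 0# ≤ q → 1# ≤ j → f * s + (P + C) ≤ P + (f * (s * j) + f * q + C)
go-pure-2 f s j q P C a b c d = by (a ⊗ (b ⊗ gap d) ⊕ a ⊗ c) (solve (f ⸴ s ⸴ j ⸴ q ⸴ P ⸴ C ⸴ ∎) ring)

pointwise-pure₂-2 : ∀ s t c q q' a → s ≤ t + c → t ≤ a + q' → q' ≤ q → s + (- 1#) * (c + q) ≤ a
pointwise-pure₂-2 s t c q q' a h k l = by (gap h ⊕ gap k ⊕ gap l) (solve (s ⸴ t ⸴ c ⸴ q ⸴ q' ⸴ a ⸴ ∎) ring)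

two-bound-pure : ∀ κ P c t Y → 0# ≤ κ → c ≤ ⟪ 3 ⟫ * Y → t ≤ Y → κ * (κ * P) - ⟪ 5 ⟫ * (κ * (κ * (κ * Y))) ≤ κ * (κ * P) + (- 1#) * (κ * (κ * (κ * c)) + ⟪ 2 ⟫ * (κ * (κ * (κ * t))))
two-bound-pure κ P c t Y a h k = by (a ⊗ (a ⊗ (a ⊗ gap h)) ⊕ 0≤⟪ 2 ⟫ ⊗ (a ⊗ (a ⊗ (a ⊗ gap k)))) (solve (κ ⸴ P ⸴ c ⸴ t ⸴ Y ⸴ ∎) ring)

one-bound-pure : ∀ κ X Δ c q → 0# ≤ κ → c ≤ X * Δ → q ≤ X * Δ → κ * X * (1# - ⟪ 2 ⟫ * (κ * Δ)) ≤ κ * X + (- 1#) * (κ * (κ * c) + κ * (κ * q))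
one-bound-pure κ X Δ c q a b d = by (a ⊗ (a ⊗ gap b) ⊕ a ⊗ (a ⊗ gap d)) (solve (κ ⸴ X ⸴ Δ ⸴ c ⸴ q ⸴ ∎) ring)

J̄≤1-pure : ∀ j → 0# ≤ j → 1# - j ≤ 1#
J̄≤1-pure j h = by h (solve (j ⸴ ∎) ring)

module RandomSelect {E : Set} (meet : E → E → Bool) (p : E → Bool) (κ Δ : ℚ) (0≤κ : 0# ≤ κ) (κ≤1 : κ ≤ 1#) (es : List E)
          (deg : ∀ e → e ∈ es → ∑[ f ∈ es ] 𝟙 (meet e f) ≤ Δ) (X≤Δ : ∑[ f ∈ es ] 𝟙 (p f) ≤ Δ) where
 open Select meet

 φ : E → ℚ
 φ e = 𝟙 (p e)

 0≤φ : ∀ e → 0# ≤ φ e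
 0≤φ e = 0≤𝟙 (p e)

 J : E → E → ℚ
 J e f = 𝟙 (meet e f)

 0≤J : ∀ e f → 0# ≤ J e f
 0≤J e f = 0≤𝟙 (meet e f)

 J̄ : E → E → ℚ
 J̄ e f = 1# - J e f

 0≤J̄ : ∀ e f → 0# ≤ J̄ e f
 0≤J̄ e f = gap (𝟙≤1 (meet e f))

 J̄≤1 : ∀ e f → J̄ e f ≤ 1#
 J̄≤1 e f = J̄≤1-pure (J e f) (0≤J e f)

 X : ℚ
 X = ∑ es φ

 0≤X : 0# ≤ X
 0≤X = ∑-nonneg es 0≤φ

 0≤Δ : 0# ≤ Δ
 0≤Δ = ≤-trans 0≤X X≤Δ

 𝔼κ : (List E → ℚ) → ℚ
 𝔼κ = 𝔼 (λ _ → κ) es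

 𝔼κ-mono : ∀ {F G} → (∀ B → F B ≤ G B) → 𝔼κ F ≤ 𝔼κ G
 𝔼κ-mono h = 𝔼-mono (λ _ → κ) (λ _ → 0≤κ) (λ _ → κ≤1) es h

 𝔼κ-lin : ∀ c → 𝔼κ (λ B → ∑ B c) ≡ κ * ∑ es c
 𝔼κ-lin c = trans (𝔼-lin (λ _ → κ) es c) (∑-*ˡ es κ c)

 𝔼κ-prs : ∀ γ → 𝔼κ (prs γ) ≡ κ * (κ * prs γ es)
 𝔼κ-prs γ = trans (𝔼-prs (λ _ → κ) es γ) (trans (prs-*ˡ es κ _) (cong (κ *_) (prs-*ˡ es κ γ)))

 𝔼κ-trs : ∀ γ → 𝔼κ (trs γ) ≡ κ * (κ * (κ * trs γ es))
 𝔼κ-trs γ = trans (𝔼-trs (λ _ → κ) es γ) (trans (trs-*ˡ es κ _) (cong (κ *_) (trans (trs-*ˡ es κ _) (cong (κ *_) (trs-*ˡ es κ γ)))))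

 ∑∑φJ : ∑[ e ∈ es ] ∑[ f ∈ es ] φ e * J e f ≤ X * Δ
 ∑∑φJ = ≤-trans (∑-mono∈ es (λ e e∈ → ≡≤ (∑-*ˡ es (φ e) (J e)) (*-monoˡ (0≤φ e) (deg e e∈)))) (≤-reflexive (∑-*ʳ es Δ φ))

 -- A marked element drawn with probability `κ` counts unless it is in conflict or a second marked
 -- element is drawn. Both corrections need two drawn elements and cost at most `κ * (κ * (X * Δ))`
 -- each.
 one-bound : κ * X * (1# - ⟪ 2 ⟫ * (κ * Δ)) ≤ 𝔼κ (λ B → 𝟙 (anyᵇ p (sel B)))
 one-bound = ≤-trans (one-bound-pure κ X Δ _ _ 0≤κ conf pair) (≡≤ (sym expand) (𝔼κ-mono pointwise)) where
  ψ : List E → ℚ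
  ψ B = ∑ B φ + (- 1#) * (prs (λ e f → φ e * J e f) B + prs (λ e f → φ e * φ f) B)
  expand : 𝔼κ ψ ≡ κ * X + (- 1#) * (κ * (κ * prs (λ e f → φ e * J e f) es) + κ * (κ * prs (λ e f → φ e * φ f) es))
  expand = trans (𝔼-+ (λ _ → κ) es (λ B → ∑ B φ) (λ B → (- 1#) * (prs (λ e f → φ e * J e f) B + prs (λ e f → φ e * φ f) B)))
   (cong₂ _+_ (𝔼κ-lin φ) (trans (𝔼-*ˡ (λ _ → κ) es (- 1#) (λ B → prs (λ e f → φ e * J e f) B + prs (λ e f → φ e * φ f) B))
    (cong ((- 1#) *_) (trans (𝔼-+ (λ _ → κ) es (prs (λ e f → φ e * J e f)) (prs (λ e f → φ e * φ f))) (cong₂ _+_ (𝔼κ-prs _) (𝔼κ-prs _))))))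
  conf : prs (λ e f → φ e * J e f) es ≤ X * Δ
  conf = ≤-trans (prs≤∑∑ es (λ e f → 0≤φ e ⊗ 0≤J e f)) ∑∑φJ
  pair : prs (λ e f → φ e * φ f) es ≤ X * Δ
  pair = ≤-trans (prs≤∑∑ es (λ e f → 0≤φ e ⊗ 0≤φ f)) (≡≤ (trans (∑-cong es (λ e → ∑-*ˡ es (φ e) φ)) (∑-*ʳ es X φ)) (*-monoˡ 0≤X X≤Δ))
  pointwise : ∀ B → ψ B ≤ 𝟙 (anyᵇ p (sel B))
  pointwise B = pointwise-pure₂-2 (∑ B φ) (∑ (sel B) φ) _ _ _ (𝟙 (anyᵇ p (sel B))) (sel-weight φ 0≤φ B) (∑≤any p (sel B)) (prs-sel B) where
   prs-sel : ∀ B → prs (λ e f → φ e * φ f) (sel B) ≤ prs (λ e f → φ e * φ f) B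
   prs-sel [] = ≤-refl
   prs-sel (e ∷ B) with anyᵇ (meet e) B
   ... | true = ≤-trans (prs-sel B) (by (∑-nonneg B (λ f → 0≤φ e ⊗ 0≤φ f)) (+-comm (∑[ f ∈ B ] φ e * φ f) (prs (λ e f → φ e * φ f) B)))
   ... | false = +-mono-≤ (∑-sel meet B (λ f → φ e * φ f) (λ f → 0≤φ e ⊗ 0≤φ f)) (prs-sel B)

 -- The ways in which a third drawn element spoils a marked pair: it conflicts with the first member
 -- and comes after or before the second, or it conflicts with the second member.
 c₃ : E → E → E → ℚ
 c₃ e h k = φ e * ((φ h * J̄ e h) * J e k) + (φ e * (J e h * (φ k * J̄ e k)) + φ e * (φ h * J h k))

 0≤c₃ : ∀ e h k → 0# ≤ c₃ e h k
 0≤c₃ e h k = 0≤φ e ⊗ ((0≤φ h ⊗ 0≤J̄ e h) ⊗ 0≤J e k) ⊕ (0≤φ e ⊗ (0≤J e h ⊗ (0≤φ k ⊗ 0≤J̄ e k)) ⊕ 0≤φ e ⊗ (0≤φ h ⊗ 0≤J h k))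

 -- Pairs of selected elements survive unless a third selected element is in conflict with one of them.
 survive : ∀ B → prs (λ e h → φ e * (φ h * J̄ e h)) B ≤ prs (λ e h → φ e * φ h) (sel B) + trs c₃ B
 survive [] = ≤-refl
 survive (e ∷ B) = ≤-trans (+-mono-≤ (≤-reflexive (∑-*ˡ B (φ e) (λ h → φ h * J̄ e h))) (survive B)) (go (anyᵇ (meet e) B) refl) where
  s = ∑[ h ∈ B ] φ h * J̄ e h
  P = prs (λ e h → φ e * φ h) (sel B)
  C = trs c₃ B
  expand : prs (c₃ e) B ≡ φ e * (s * ∑ B (J e)) + φ e * prs (λ h k → φ h * J h k) B
  expand = trans (prs-+ B (λ h k → φ e * ((φ h * J̄ e h) * J e k)) (λ h k → φ e * (J e h * (φ k * J̄ e k)) + φ e * (φ h * J h k)))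
   (trans (cong₂ _+_ (prs-*ˡ B (φ e) (λ h k → (φ h * J̄ e h) * J e k)) (trans (prs-+ B (λ h k → φ e * (J e h * (φ k * J̄ e k))) (λ h k → φ e * (φ h * J h k)))
     (cong₂ _+_ (prs-*ˡ B (φ e) (λ h k → J e h * (φ k * J̄ e k))) (prs-*ˡ B (φ e) (λ h k → φ h * J h k)))))
   (trans (regroup (φ e) (prs (λ h k → (φ h * J̄ e h) * J e k) B) (prs (λ h k → J e h * (φ k * J̄ e k)) B) (prs (λ h k → φ h * J h k) B))
    (cong (λ t → φ e * t + φ e * prs (λ h k → φ h * J h k) B) (sym (trans (∑*∑ B (λ h → φ h * J̄ e h) (J e)) (trans (cong (_+ (prs (λ h k → (φ h * J̄ e h) * J e k) B + prs (λ h k → J e h * (φ k * J̄ e k)) B)) diag) (+-identityˡ _))))))) where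
   regroup : ∀ f a b c → f * a + (f * b + f * c) ≡ f * (a + b) + f * c
   regroup = solve-∀ ring
   diag : ∑[ h ∈ B ] (φ h * J̄ e h) * J e h ≡ 0#
   diag = trans (∑-cong B (λ h → lem (meet e h) (φ h))) (∑-0 B) where
    lem : ∀ b a → (a * (1# - 𝟙 b)) * 𝟙 b ≡ 0#
    lem true a = lem-eq-5 a
    lem false a = *-zeroʳ (a * (1# - 0#))
  0≤s : 0# ≤ s
  0≤s = ∑-nonneg B (λ h → 0≤φ h ⊗ 0≤J̄ e h)
  0≤Q : 0# ≤ prs (λ h k → φ h * J h k) B
  0≤Q = prs-nonneg B (λ h k → 0≤φ h ⊗ 0≤J h k)
  go : ∀ b → anyᵇ (meet e) B ≡ b → φ e * s + (P + C) ≤ prs (λ e h → φ e * φ h) (if b then sel B else e ∷ sel B) + (prs (c₃ e) B + C)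
  go true eq = subst (λ t → φ e * s + (P + C) ≤ P + (t + C)) (sym expand) (go-pure-2 (φ e) s (∑ B (J e)) (prs (λ h k → φ h * J h k) B) P C (0≤φ e) 0≤s 0≤Q
    (subst (λ t → 𝟙 t ≤ ∑ B (J e)) eq (any≤∑ (meet e) B)))
  go false eq = subst (λ t → φ e * s + (P + C) ≤ (∑[ h ∈ sel B ] φ e * φ h) + P + (t + C)) (sym expand)
    (subst (λ t → φ e * s + (P + C) ≤ t + P + (φ e * (s * ∑ B (J e)) + φ e * prs (λ h k → φ h * J h k) B + C)) (sym (∑-*ˡ (sel B) (φ e) φ))
     (go-pure (φ e) s (∑ B φ) (∑ (sel B) φ) (∑ B (J e)) (prs (λ h k → φ h * J h k) B) P C (0≤φ e) 0≤s (∑-nonneg B (0≤J e))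
       (∑-mono B (λ h → ≤-trans (*-monoˡ (0≤φ h) (J̄≤1 e h)) (≤-reflexive (*-identityʳ (φ h))))) (sel-weight φ 0≤φ B)))

 -- The main term comes from drawing two marked elements that do not meet. Every error involves a
 -- third drawn element; of the constant 5, three come from the shapes in `c₃` and two from `two≥`.
 two-bound : κ * (κ * prs (λ e h → φ e * (φ h * J̄ e h)) es) - ⟪ 5 ⟫ * (κ * (κ * (κ * (X * X * Δ)))) ≤ 𝔼κ (λ B → 𝟙 (atLeast2 p (sel B)))
 two-bound = ≤-trans (two-bound-pure κ (prs (λ e h → φ e * (φ h * J̄ e h)) es) (trs c₃ es) (trs t₃ es) (X * X * Δ) 0≤κ c₃≤ t₃≤)
  (≡≤ (sym expand) (𝔼κ-mono pointwise)) where
  t₃ : E → E → E → ℚ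
  t₃ e h k = φ e * (φ h * φ k)
  0≤t₃ : ∀ e h k → 0# ≤ t₃ e h k
  0≤t₃ e h k = 0≤φ e ⊗ (0≤φ h ⊗ 0≤φ k)
  ψ : List E → ℚ
  ψ B = prs (λ e h → φ e * (φ h * J̄ e h)) B + (- 1#) * (trs c₃ B + ⟪ 2 ⟫ * trs t₃ B)
  expand : 𝔼κ ψ ≡ κ * (κ * prs (λ e h → φ e * (φ h * J̄ e h)) es) + (- 1#) * (κ * (κ * (κ * trs c₃ es)) + ⟪ 2 ⟫ * (κ * (κ * (κ * trs t₃ es))))
  expand = trans (𝔼-+ (λ _ → κ) es (prs (λ e h → φ e * (φ h * J̄ e h))) (λ B → (- 1#) * (trs c₃ B + ⟪ 2 ⟫ * trs t₃ B)))
   (cong₂ _+_ (𝔼κ-prs (λ e h → φ e * (φ h * J̄ e h))) (trans (𝔼-*ˡ (λ _ → κ) es (- 1#) (λ B → trs c₃ B + ⟪ 2 ⟫ * trs t₃ B)) (cong ((- 1#) *_)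
    (trans (𝔼-+ (λ _ → κ) es (trs c₃) (λ B → ⟪ 2 ⟫ * trs t₃ B)) (cong₂ _+_ (𝔼κ-trs c₃) (trans (𝔼-*ˡ (λ _ → κ) es ⟪ 2 ⟫ (trs t₃)) (cong (⟪ 2 ⟫ *_) (𝔼κ-trs t₃))))))))
  t₃≤ : trs t₃ es ≤ X * X * Δ
  t₃≤ = ≤-trans (trs≤∑∑∑ es 0≤t₃) (≡≤ (trans (∑-cong es (λ e → trans (∑-cong es (λ h → trans (∑-*ˡ es (φ e) (λ k → φ h * φ k)) (cong (φ e *_) (∑-*ˡ es (φ h) φ))))
    (trans (∑-*ˡ es (φ e) (λ h → φ h * X)) (cong (φ e *_) (∑-*ʳ es X φ))))) (trans (∑-*ʳ es (X * X) φ) (*-comm X (X * X)))) (*-monoˡ (0≤X ⊗ 0≤X) X≤Δ))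
  c₃≤ : trs c₃ es ≤ ⟪ 3 ⟫ * (X * X * Δ)
  c₃≤ = ≤-trans (trs≤∑∑∑ es 0≤c₃) (≤-trans (∑-mono es (λ e → ∑-mono es (λ h → ∑-mono es (λ k → bound (φ e) (φ h) (φ k) (J e h) (J e k) (J h k) (0≤φ e) (0≤φ h) (0≤φ k) (0≤J e h) (0≤J e k) (J̄≤1 e h)))))
   (≡≤ sums (sum≤ X Δ A (0≤X) ∑∑φJ))) where
   A : ℚ
   A = ∑[ e ∈ es ] ∑[ f ∈ es ] φ e * J e f
   bound : ∀ a b c j k l → 0# ≤ a → 0# ≤ b → 0# ≤ c → 0# ≤ j → 0# ≤ k → 1# - j ≤ 1# →
       a * ((b * (1# - j)) * k) + (a * (j * (c * (1# - k))) + a * (b * l)) ≤ (a * k) * b + ((a * j) * c + a * (b * l))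
   bound a b c j k l p q r s t u = by (p ⊗ (q ⊗ (s ⊗ t)) ⊕ p ⊗ (s ⊗ (r ⊗ t))) (solve (a ⸴ b ⸴ c ⸴ j ⸴ k ⸴ l ⸴ ∎) ring)
   sums : ∑[ e ∈ es ] ∑[ h ∈ es ] ∑[ k ∈ es ] ((φ e * J e k) * φ h + ((φ e * J e h) * φ k + φ e * (φ h * J h k))) ≡ A * X + (A * X + X * A)
   sums = trans (∑-cong es (λ e → trans (∑-cong es (λ h → trans (∑-+ es (λ k → (φ e * J e k) * φ h) (λ k → (φ e * J e h) * φ k + φ e * (φ h * J h k)))
       (cong₂ _+_ (∑-*ʳ es (φ h) (λ k → φ e * J e k)) (trans (∑-+ es (λ k → (φ e * J e h) * φ k) (λ k → φ e * (φ h * J h k))) (cong₂ _+_ (∑-*ˡ es (φ e * J e h) φ) (∑-*ˡ es (φ e) (λ k → φ h * J h k)))))))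
      (trans (∑-+ es (λ h → (∑[ k ∈ es ] φ e * J e k) * φ h) (λ h → (φ e * J e h) * X + φ e * (∑[ k ∈ es ] φ h * J h k)))
       (cong₂ _+_ (∑-*ˡ es (∑[ k ∈ es ] φ e * J e k) φ) (trans (∑-+ es (λ h → (φ e * J e h) * X) (λ h → φ e * (∑[ k ∈ es ] φ h * J h k))) (cong₂ _+_ (∑-*ʳ es X (λ h → φ e * J e h)) (∑-*ˡ es (φ e) (λ h → ∑[ k ∈ es ] φ h * J h k))))))))
    (trans (∑-+ es (λ e → (∑[ k ∈ es ] φ e * J e k) * X) (λ e → (∑[ h ∈ es ] φ e * J e h) * X + φ e * A)) (cong₂ _+_ (∑-*ʳ es X (λ e → ∑[ k ∈ es ] φ e * J e k))
     (trans (∑-+ es (λ e → (∑[ h ∈ es ] φ e * J e h) * X) (λ e → φ e * A)) (cong₂ _+_ (∑-*ʳ es X (λ e → ∑[ h ∈ es ] φ e * J e h)) (∑-*ʳ es A φ)))))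
   sum≤ : ∀ X Δ A → 0# ≤ X → A ≤ X * Δ → A * X + (A * X + X * A) ≤ ⟪ 3 ⟫ * (X * X * Δ)
   sum≤ X Δ A p h = by (0≤⟪ 3 ⟫ ⊗ (p ⊗ gap h)) (solve (X ⸴ Δ ⸴ A ⸴ ∎) ring)
  trs-sel : ∀ B → trs t₃ (sel B) ≤ trs t₃ B
  trs-sel [] = ≤-refl
  trs-sel (e ∷ B) = go (anyᵇ (meet e) B) where
   prs-sel : ∀ (γ : E → E → ℚ) → (∀ x y → 0# ≤ γ x y) → ∀ B → prs γ (sel B) ≤ prs γ B
   prs-sel γ h [] = ≤-refl
   prs-sel γ h (e ∷ B) = step (anyᵇ (meet e) B) where
    step : ∀ b → prs γ (if b then sel B else e ∷ sel B) ≤ ∑ B (γ e) + prs γ B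
    step true = ≤-trans (prs-sel γ h B) (by (∑-nonneg B (h e)) (+-comm (∑ B (γ e)) (prs γ B)))
    step false = +-mono-≤ (∑-sel meet B (γ e) (h e)) (prs-sel γ h B)
   go : ∀ b → trs t₃ (if b then sel B else e ∷ sel B) ≤ prs (t₃ e) B + trs t₃ B
   go true = ≤-trans (trs-sel B) (by (prs-nonneg B (0≤t₃ e)) (+-comm (prs (t₃ e) B) (trs t₃ B)))
   go false = +-mono-≤ (prs-sel (t₃ e) (0≤t₃ e) B) (trs-sel B)
  pointwise : ∀ B → ψ B ≤ 𝟙 (atLeast2 p (sel B))
  pointwise B = pointwise-pure₂ (prs (λ e h → φ e * (φ h * J̄ e h)) B) (prs (λ e h → φ e * φ h) (sel B)) (trs c₃ B) (trs t₃ (sel B)) (trs t₃ B) (𝟙 (atLeast2 p (sel B))) (survive B) (two≥ p (sel B)) (trs-sel B)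

-- Saving colours in sparse neighbourhoods

∑-filter≤ : {A : Set} (p : A → Bool) (xs : List A) (f : A → ℚ) → (∀ x → 0# ≤ f x) → ∑ (filterᵇ p xs) f ≤ ∑ xs f
∑-filter≤ p xs f h = ≡≤ (∑-filter p xs f) (∑-mono xs (λ x → ≤-trans (*-monoʳ (h x) (𝟙≤1 (p x))) (≤-reflexive (*-identityˡ (f x)))))

perEdge-pure₂ : ∀ a b k → 0# ≤ a → b ≤ 1# → a * (b * (1# + k)) ≤ 1# * a + a * (b * k)
perEdge-pure₂ a b k p q = by (p ⊗ gap q) (solve (a ⸴ b ⸴ k ⸴ ∎) ring)

perEdge-eq : ∀ a b → 0# * a + a * b ≡ a * b + 0#
perEdge-eq = solve-∀ ring

perEdge-eq-2 : ∀ a b → a * (0# * b) ≡ 0#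
perEdge-eq-2 = solve-∀ ring

perEdge-eq-3 : ∀ a b c → a * (0# * b) ≡ 0# * a + a * (0# * c)
perEdge-eq-3 = solve-∀ ring

lem-eq-6 : ∀ w l m q s → w * (s * ((1# + l * m) * q)) ≡ w * (1# + l * m) * (1# - l * 0#) * (s * q)
lem-eq-6 = solve-∀ ring

lem-eq-7 : ∀ w l m q s → w * ((1# - l) * s * ((1# + l * m) * q)) ≡ w * (1# + l * m) * (1# - l * 1#) * (s * q)
lem-eq-7 = solve-∀ ring

saved'-pure : ∀ s' g s h h' t t' u m → s' ≡ g + s → h ≤ h' → t ≤ t' → s + t' ≤ u → g + h' ≤ m → s' + (h + t) ≤ m + u
saved'-pure s' g s h h' t t' u m refl a b c d = by (gap a ⊕ gap b ⊕ gap c ⊕ gap d) (solve (g ⸴ s ⸴ h ⸴ h' ⸴ t ⸴ t' ⸴ u ⸴ m ⸴ ∎) ring)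

musum'-pure : ∀ q a x b i n y → 0# ≤ q → a ≤ x + b → q * (a - (i + n) * y) ≤ q * (x - i * y) + q * (b - n * y)
musum'-pure q a x b i n y h k = by (h ⊗ gap k) (solve (q ⸴ a ⸴ x ⸴ b ⸴ i ⸴ n ⸴ y ⸴ ∎) ring)

pure-e₁-7 : ∀ κ Δ X N β A m → κ * (κ * (½ * (X * X - A))) - ⟪ 5 ⟫ * (κ * (κ * (κ * (X * X * Δ)))) ≡ κ * κ * Δ * (X - 1# * (N - ¼ * (β * Δ))) +
   κ * κ * (½ * ((m - A) + (N * N - (m + β * (Δ * Δ))) + (N - X) * ((Δ - N) + ((Δ - N) + (N - X)))) + ¼ * (Δ * Δ * (β - ⟪ 20 ⟫ * (κ * Δ))) + ⟪ 5 ⟫ * (κ * Δ * (((Δ - N) + (N - X)) * (Δ + X))))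
pure-e₁-7 = solve-∀ ring

∑w₂≤-pure₂-2 : ∀ w l m → 0# ≤ w → w * (1# + l * m) - l * (w * (1# + l * m) * m) ≤ w
∑w₂≤-pure₂-2 w l m h = by (h ⊗ sq≥0 (l * m)) (solve (w ⸴ l ⸴ m ⸴ ∎) ring)

∑w₂≤-pure-2 : ∀ A B C l → 0# ≤ l → C ≤ B → A - l * B ≤ A - l * C
∑w₂≤-pure-2 A B C l h k = by (h ⊗ gap k) (solve (A ⸴ B ⸴ C ⸴ l ⸴ ∎) ring)

∑w₂≤-eq-2 : ∀ w l x → w * (1# - l * x) ≡ w - l * (w * x)
∑w₂≤-eq-2 = solve-∀ ring

0≤w₂-pure-2 : ∀ l a → 0# ≤ l → l ≤ 1# → a ≤ 1# → 0# ≤ 1# - l * a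
0≤w₂-pure-2 l a p q r = by (gap q ⊕ p ⊗ gap r) (solve (l ⸴ a ⸴ ∎) ring)

go-pure-3 : ∀ κ Δ X y β → 0# ≤ κ → 0# ≤ X → ⟪ 20 ⟫ * (κ * Δ) ≤ β → β ≤ 1# → 0# ≤ Δ → κ * κ * Δ * (X - 0# * y) ≤ κ * X * (1# - ⟪ 2 ⟫ * (κ * Δ))
go-pure-3 κ Δ X y β a b c d e = by (a ⊗ b ⊗ (gap c ⊕ gap d ⊕ 0≤⟪ 17 ⟫ ⊗ (a ⊗ e))) (solve (κ ⸴ Δ ⸴ X ⸴ y ⸴ β ⸴ ∎) ring)

double-eq₂ : ∀ a → a * (a * (1# - 1#)) ≡ 0#
double-eq₂ = solve-∀ ring

double-eq : ∀ a b c → a * (b * c) ≡ b * (a * c)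
double-eq = solve-∀ ring

square-eq : ∀ a b j → a * (b * (1# - j)) ≡ a * b - a * (b * j)
square-eq = solve-∀ ring

save-eq₃ : ∀ a b → a * (0# - 0# * b) ≡ 0#
save-eq₃ = solve-∀ ring

save-eq₂ : ∀ a b → a * (b * 0#) ≡ 0#
save-eq₂ = solve-∀ ring

save-eq : ∀ a → a * (1# * 1#) ≡ a
save-eq = solve-∀ ring

module Saving {E : Set} (_≟_ : DecidableEquality E) (es : List E) (es! : AllPairs _≢_ es) (es-all : ∀ e → e ∈ es)
       (meet : E → E → Bool) (meet-sym : ∀ e f → meet e f ≡ true → meet f e ≡ true) (meet-refl : ∀ e → meet e e ≡ true)
       (adj : E → E → Bool) (adj⇒meet : ∀ e f → adj e f ≡ true → meet e f ≡ true)
       (T₀ tgt : E → Bool) (Λ LP : E → ℕ → Bool) (κ Δ β : ℚ)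
       (0≤κ : 0# ≤ κ) (κ≤1 : κ ≤ 1#) (0≤Δ : 0# ≤ Δ) (β≤1 : β ≤ 1#) (κΔ≤β : ⟪ 20 ⟫ * (κ * Δ) ≤ β)
       (deg : ∀ e → T₀ e ≡ true → ∑[ g ∈ es ] 𝟙 (T₀ g ∧ meet e g) ≤ Δ)
       (tgt-T₀ : ∀ f → tgt f ≡ true → T₀ f ≡ true) where

 open Select meet

 nb : E → E → Bool
 nb f g = T₀ g ∧ adj f g

 N : E → ℚ
 N f = ∑[ g ∈ es ] 𝟙 (nb f g)

 N≤Δ : ∀ f → T₀ f ≡ true → N f ≤ Δ
 N≤Δ f h = ≤-trans (∑-mono es (λ g → 𝟙-mono (nb f g) (T₀ g ∧ meet f g) (λ p → ∧-intro (∧-true₁ (T₀ g) p) (adj⇒meet f g (∧-true₂ (T₀ g) p))))) (deg f h)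

 meetings : E → ℚ
 meetings f = ∑[ g ∈ es ] ∑[ h ∈ es ] 𝟙 (nb f g) * (𝟙 (nb f h) * 𝟙 (meet g h))

 module _ (sparse : ∀ f → tgt f ≡ true → meetings f + β * (Δ * Δ) ≤ N f * N f) where

  -- What saves a unit for `f`: a colour of `Λ f` given to two neighbours blocks one colour instead
  -- of two, and a colour outside `Λ f` blocks nothing, so there one neighbour is enough.
  gain : Bool → (E → Bool) → List E → Bool
  gain b p M = if b then atLeast2 p M else anyᵇ p M

  module Draw (c : ℕ) (unc : E → Bool) (unc⊆T₀ : ∀ e → unc e ≡ true → T₀ e ≡ true) where

   elig : E → Bool
   elig g = unc g ∧ LP g c

   es' : List E
   es' = filterᵇ elig es

   X : E → ℚ
   X f = ∑[ g ∈ es' ] 𝟙 (nb f g)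

   -- A common lower bound for colours inside and outside `Λ f`. It is linear in `X f` because `X f`
   -- varies from colour to colour and only its sum over the colours is under control.
   lin : E → ℚ
   lin f = κ * κ * Δ * (X f - 𝟙 (Λ f c) * (N f - ¼ * (β * Δ)))

   es'-T₀ : ∀ e → e ∈ es' → T₀ e ≡ true
   es'-T₀ e m = unc⊆T₀ e (∧-true₁ (unc e) (All.lookup (filter-true elig es) m))

   deg' : ∀ e → e ∈ es' → ∑[ g ∈ es' ] 𝟙 (meet e g) ≤ Δ
   deg' e m = ≡≤ (∑-filter elig es (λ g → 𝟙 (meet e g))) (≤-trans (∑-mono es (λ g →
     ≡≤ (sym (𝟙-∧ (elig g) (meet e g))) (𝟙-mono (elig g ∧ meet e g) (T₀ g ∧ meet e g) (λ h → ∧-intro (unc⊆T₀ g (∧-true₁ (unc g) (∧-true₁ (elig g) h))) (∧-true₂ (elig g) h)))))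
    (deg e (es'-T₀ e m)))

   X≤N : ∀ f → X f ≤ N f
   X≤N f = ∑-filter≤ elig es (λ g → 𝟙 (nb f g)) (λ g → 0≤𝟙 (nb f g))

   -- For a colour of `Λ f` there are `½(X² - A)` pairs that do not meet, and `N² - X² ≤ 2Δ(N - X)`
   -- makes this linear. Sparsity contributes `½βΔ²`, half of which pays for the cubic error because
   -- `20κΔ ≤ β`. For other colours the first-order gain `κX` is ample.
   expect : ∀ f → tgt f ≡ true → lin f ≤ 𝔼 (λ _ → κ) es' (λ B → 𝟙 (gain (Λ f c) (nb f) (sel B)))
   expect f tf = go (Λ f c) where
    module R = RandomSelect meet (nb f) κ Δ 0≤κ κ≤1 es' deg' (≤-trans (X≤N f) (N≤Δ f (tgt-T₀ f tf)))
    open R using (φ; 0≤φ; J; 0≤J; J̄)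
    X₀ N₀ A P : ℚ
    X₀ = X f
    N₀ = N f
    A = ∑[ g ∈ es' ] ∑[ h ∈ es' ] φ g * (φ h * J g h)
    P = prs (λ g h → φ g * (φ h * J̄ g h)) es'
    A≤ : A ≤ meetings f
    A≤ = ≤-trans (∑-mono es' (λ g → ∑-filter≤ elig es (λ h → φ g * (φ h * J g h)) (λ h → 0≤φ g ⊗ (0≤φ h ⊗ 0≤J g h))))
        (∑-filter≤ elig es (λ g → ∑[ h ∈ es ] φ g * (φ h * J g h)) (λ g → ∑-nonneg es (λ h → 0≤φ g ⊗ (0≤φ h ⊗ 0≤J g h))))
    square : ∑[ g ∈ es' ] ∑[ h ∈ es' ] φ g * (φ h * J̄ g h) ≡ X₀ * X₀ - A
    square = trans (∑-cong es' (λ g → trans (∑-cong es' (λ h → square-eq (φ g) (φ h) (J g h))) (trans (∑-- es' (λ h → φ g * φ h) (λ h → φ g * (φ h * J g h))) (cong (_- (∑[ h ∈ es' ] φ g * (φ h * J g h))) (∑-*ˡ es' (φ g) φ)))))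
     (trans (∑-- es' (λ g → φ g * X₀) (λ g → ∑[ h ∈ es' ] φ g * (φ h * J g h))) (cong (_- A) (∑-*ʳ es' X₀ φ)))
    J-sym : ∀ g h → J g h ≡ J h g
    J-sym g h = cong 𝟙 (bool-ext (meet-sym g h) (meet-sym h g))
    double : X₀ * X₀ - A ≡ 0# + (P + P)
    double = trans (sym square) (trans (∑∑-symmetric es' (λ g h → φ g * (φ h * J̄ g h)) (λ g h → trans (cong (λ j → φ g * (φ h * (1# - j))) (J-sym g h)) (double-eq (φ g) (φ h) (1# - J h g))))
      (cong (_+ (P + P)) (trans (∑-cong es' (λ g → trans (cong (λ b → φ g * (φ g * (1# - 𝟙 b))) (meet-refl g)) (double-eq₂ (φ g)))) (∑-0 es'))))
    go : ∀ b → κ * κ * Δ * (X₀ - 𝟙 b * (N₀ - ¼ * (β * Δ))) ≤ 𝔼 (λ _ → κ) es' (λ B → 𝟙 (gain b (nb f) (sel B)))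
    go false = ≤-trans (go-pure-3 κ Δ X₀ (N₀ - ¼ * (β * Δ)) β 0≤κ R.0≤X κΔ≤β β≤1 0≤Δ) R.one-bound
    go true = ≤-trans (pure κ Δ X₀ N₀ β A P (meetings f) 0≤κ 0≤Δ R.0≤X (X≤N f) (N≤Δ f (tgt-T₀ f tf)) κΔ≤β A≤ (sparse f tf) double) R.two-bound where
     pure : ∀ κ Δ X N β A P m → 0# ≤ κ → 0# ≤ Δ → 0# ≤ X → X ≤ N → N ≤ Δ → ⟪ 20 ⟫ * (κ * Δ) ≤ β → A ≤ m → m + β * (Δ * Δ) ≤ N * N → X * X - A ≡ 0# + (P + P) →
         κ * κ * Δ * (X - 1# * (N - ¼ * (β * Δ))) ≤ κ * (κ * P) - ⟪ 5 ⟫ * (κ * (κ * (κ * (X * X * Δ))))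
     pure κ Δ X N β A P m κ0 Δ0 X0 XN NΔ κβ Am sp db = by
       (κ0 ⊗ κ0 ⊗ (0≤½ ⊗ (gap Am ⊕ gap sp ⊕ gap XN ⊗ (gap NΔ ⊕ (gap NΔ ⊕ gap XN))) ⊕ 0≤¼ ⊗ (Δ0 ⊗ Δ0 ⊗ gap κβ) ⊕ 0≤⟪ 5 ⟫ ⊗ (κ0 ⊗ Δ0 ⊗ ((gap NΔ ⊕ gap XN) ⊗ (Δ0 ⊕ X0)))))
       (cong (λ t → κ * (κ * t) - ⟪ 5 ⟫ * (κ * (κ * (κ * (X * X * Δ))))) (half db) ⨾ pure-e₁-7 κ Δ X N β A m) where
      half : X * X - A ≡ 0# + (P + P) → P ≡ ½ * (X * X - A)
      half e = h₀ P ⨾ cong (½ *_) (sym e) where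
       h₀ : ∀ P → P ≡ ½ * (0# + (P + P))
       h₀ = solve-∀ ring

   μ : E → ℚ
   μ f = 𝟙 (tgt f) * pos (lin f)

   0≤μ : ∀ f → 0# ≤ μ f
   0≤μ f = 0≤𝟙 (tgt f) ⊗ 0≤pos (lin f)

   μ≤𝔼 : ∀ f → μ f ≤ 𝔼 (λ _ → κ) es' (λ B → 𝟙 (gain (Λ f c) (nb f) (sel B)))
   μ≤𝔼 f = go (tgt f) refl where
    𝔼f = 𝔼 (λ _ → κ) es' (λ B → 𝟙 (gain (Λ f c) (nb f) (sel B)))
    0≤𝔼 : 0# ≤ 𝔼f
    0≤𝔼 = ≡≤ (sym (𝔼-const (λ _ → κ) es' 0#)) (𝔼-mono (λ _ → κ) (λ _ → 0≤κ) (λ _ → κ≤1) es' (λ B → 0≤𝟙 (gain (Λ f c) (nb f) (sel B))))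
    go : ∀ b → tgt f ≡ b → 𝟙 b * pos (lin f) ≤ 𝔼f
    go true eq = ≡≤ (*-identityˡ (pos (lin f))) (⊔-lub 0≤𝔼 (expect f eq))
    go false eq = ≡≤ (*-zeroˡ (pos (lin f))) 0≤𝔼

   μ≤1 : ∀ f → μ f ≤ 1#
   μ≤1 f = ≤-trans (μ≤𝔼 f) (≤-trans (𝔼-mono (λ _ → κ) (λ _ → 0≤κ) (λ _ → κ≤1) es' (λ B → 𝟙≤1 (gain (Λ f c) (nb f) (sel B)))) (≤-reflexive (𝔼-const (λ _ → κ) es' 1#)))

   draw : (w : E → ℚ) → (∀ f → 0# ≤ w f) → ∃ λ M → AllPairs (λ e f → meet e f ≡ false) M × All (λ e → elig e ≡ true) M ×
       ∑[ f ∈ es ] w f * μ f ≤ ∑[ f ∈ es ] w f * 𝟙 (gain (Λ f c) (nb f) M)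
   draw w 0≤w = build (outcome (λ _ → κ) (λ _ → 0≤κ) (λ _ → κ≤1) es' F) where
    F : List E → ℚ
    F B = ∑[ f ∈ es ] w f * 𝟙 (gain (Λ f c) (nb f) (sel B))
    build : (∃ λ B → 𝔼 (λ _ → κ) es' F ≤ F B × All (λ e → 0# < κ × e ∈ es') B) → _
    build (B , h , al) = sel B , sel-matching B , sel-all (All.map (λ q → All.lookup (filter-true elig es) (proj₂ q)) al) ,
     ≤-trans (∑-mono es (λ f → *-monoˡ (0≤w f) (μ≤𝔼 f))) (≡≤ (sym (trans (𝔼-∑ (λ _ → κ) es' es (λ f B → w f * 𝟙 (gain (Λ f c) (nb f) (sel B))))
      (∑-cong es (λ f → 𝔼-*ˡ (λ _ → κ) es' (w f) (λ B → 𝟙 (gain (Λ f c) (nb f) (sel B))))))) h)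

  module Sequence (k₀ : ℕ) where

   l : ℚ
   l = inv (suc (suc k₀))

   0≤l : 0# ≤ l
   0≤l = 0≤inv (suc (suc k₀))

   l≤1 : l ≤ 1#
   l≤1 = inv≤1 (suc k₀)

   rem : List ℕ → E → ℕ
   rem ps g = countᵇ (LP g) ps

   Z : List ℕ → (E → Maybe ℕ) → E → ℚ
   Z ps φ f = ∑[ c ∈ ps ] 𝟙 (Λ f c ∧ anyᵇ (λ g → nb f g ∧ isColour (φ g) c) es)

   U : (E → Maybe ℕ) → E → ℚ
   U φ f = ∑[ g ∈ es ] 𝟙 (nb f g ∧ not (isNothing (φ g)))

   -- List entries from `ps` at neighbours of `f` that stay uncoloured. Each entry made its
   -- neighbour eligible for that colour, so this bounds the sum of `X f` over the colours from
   -- below.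
   left : List ℕ → (E → Bool) → (E → Maybe ℕ) → E → ℚ
   left ps unc φ f = ∑[ g ∈ es ] 𝟙 (nb f g) * (𝟙 (unc g ∧ isNothing (φ g)) * ⟦ rem ps g ⟧)

   record Saved (ps : List ℕ) (unc : E → Bool) (w : E → ℚ) : Set where
    field
     φ : E → Maybe ℕ
     φ-unc : ∀ e c → φ e ≡ just c → unc e ≡ true
     φ-list : ∀ e c → φ e ≡ just c → LP e c ≡ true
     φ-range : ∀ e c → φ e ≡ just c → c ∈ ps
     φ-proper : ∀ e f c → e ≢ f → φ e ≡ just c → φ f ≡ just c → meet e f ≡ false
     S : E → ℕ
     mus : E → List ℚ
     mus≥0 : ∀ f → All (0# ≤_) (mus f)
     mus≤1 : ∀ f → All (_≤ 1#) (mus f)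
     potential : ∑[ f ∈ es ] w f * ((1# - l) ^ S f * ∏ (mus f) (λ m → 1# + l * m)) ≤ ∑ es w
     musum : ∀ f → tgt f ≡ true → κ * κ * Δ * (left ps unc φ f - ⟦ countᵇ (Λ f) ps ⟧ * (N f - ¼ * (β * Δ))) ≤ ∑ (mus f) (λ m → m)
     -- `U` counts the coloured neighbours and `Z` the colours of `Λ f` among them, so `S f` is an
     -- advantage over the plain greedy count.
     saved : ∀ f → ⟦ S f ⟧ + Z ps φ f ≤ U φ f

   -- The draw is made for the weights `w` multiplied by `1 + lμ`, and a gain then multiplies by
   -- `1 - l`. As the weighted gains are at least the weighted `μ`, the total does not increase,
   -- because `(1 + lμ)(1 - lμ) ≤ 1`.
   save : ∀ ps → AllPairs _≢_ ps → ∀ unc → (∀ e → unc e ≡ true → T₀ e ≡ true) → ∀ w → (∀ f → 0# ≤ w f) → Saved ps unc w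
   save [] [] unc sub w 0≤w = record
    { φ = λ _ → nothing ; φ-unc = λ _ _ () ; φ-list = λ _ _ () ; φ-range = λ _ _ () ; φ-proper = λ _ _ _ _ () ; S = λ _ → 0 ; mus = λ _ → []
    ; mus≥0 = λ _ → [] ; mus≤1 = λ _ → [] ; potential = ≤-reflexive (∑-cong es (λ f → save-eq (w f)))
    ; musum = λ f _ → ≤-reflexive (trans (cong (λ t → κ * κ * Δ * (t - ⟪ 0 ⟫ * (N f - ¼ * (β * Δ)))) (trans (∑-cong es (λ g → save-eq₂ (𝟙 (nb f g)) (𝟙 (unc g ∧ true)))) (∑-0 es))) (save-eq₃ (κ * κ * Δ) (N f - ¼ * (β * Δ))))
    ; saved = λ f → ∑-nonneg es (λ g → 0≤𝟙 (nb f g ∧ false)) }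
   save (c ∷ ps) (c∉ ∷ ps!) unc sub w 0≤w = extend (save ps ps! unc' (λ e h → sub e (∧-true₁ (unc e) h)) w₂ 0≤w₂) where
    open Draw c unc sub using (μ; 0≤μ; μ≤1; lin; X; elig; draw; es')
    w₁ : E → ℚ
    w₁ f = w f * (1# + l * μ f)
    0≤w₁ : ∀ f → 0# ≤ w₁ f
    0≤w₁ f = 0≤w f ⊗ (0≤1 ⊕ 0≤l ⊗ 0≤μ f)
    M* = draw w₁ 0≤w₁
    M : List E
    M = proj₁ M*
    M! : AllPairs (λ e f → meet e f ≡ false) M
    M! = proj₁ (proj₂ M*)
    M-elig : All (λ e → elig e ≡ true) M
    M-elig = proj₁ (proj₂ (proj₂ M*))
    G : E → Bool
    G f = gain (Λ f c) (nb f) M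
    w₂ : E → ℚ
    w₂ f = w₁ f * (1# - l * 𝟙 (G f))
    0≤w₂ : ∀ f → 0# ≤ w₂ f
    0≤w₂ f = 0≤w₁ f ⊗ 0≤w₂-pure-2 l (𝟙 (G f)) 0≤l l≤1 (𝟙≤1 (G f))
    ∑w₂≤ : ∑ es w₂ ≤ ∑ es w
    ∑w₂≤ = ≡≤ (trans (∑-cong es (λ f → ∑w₂≤-eq-2 (w₁ f) l (𝟙 (G f)))) (trans (∑-- es w₁ (λ f → l * (w₁ f * 𝟙 (G f)))) (cong (λ t → ∑ es w₁ - t) (∑-*ˡ es l (λ f → w₁ f * 𝟙 (G f))))))
     (≤-trans (∑w₂≤-pure-2 (∑ es w₁) (∑[ f ∈ es ] w₁ f * 𝟙 (G f)) (∑[ f ∈ es ] w₁ f * μ f) l 0≤l (proj₂ (proj₂ (proj₂ M*))))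
     (≡≤ (sym (trans (∑-- es w₁ (λ f → l * (w₁ f * μ f))) (cong (λ t → ∑ es w₁ - t) (∑-*ˡ es l (λ f → w₁ f * μ f)))))
      (∑-mono es (λ f → ∑w₂≤-pure₂-2 (w f) l (μ f) (0≤w f)))))
    mem : E → Bool
    mem e = anyᵇ (λ f → does (f ≟ e)) M
    ∈M : ∀ e → mem e ≡ true → e ∈ M
    ∈M e p = let f , f∈ , q = any-witness (λ f → does (f ≟ e)) M p in subst (_∈ M) (≟-true _≟_ q) f∈
    M-unc : ∀ e → e ∈ M → unc e ≡ true
    M-unc e m = ∧-true₁ (unc e) (All.lookup M-elig m)
    M-list : ∀ e → e ∈ M → LP e c ≡ true
    M-list e m = ∧-true₂ (unc e) (All.lookup M-elig m)
    unc' : E → Bool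
    unc' e = unc e ∧ not (mem e)
    extend : Saved ps unc' w₂ → Saved (c ∷ ps) unc w
    extend R = record
     { φ = φ' ; φ-unc = φ'-unc ; φ-list = φ'-list ; φ-range = φ'-range ; φ-proper = φ'-proper ; S = S' ; mus = λ f → μ f ∷ mus f
     ; mus≥0 = λ f → 0≤μ f ∷ mus≥0 f ; mus≤1 = λ f → μ≤1 f ∷ mus≤1 f
     ; potential = ≡≤ (∑-cong es same) (≤-trans potential ∑w₂≤) ; musum = musum' ; saved = saved' } where
     open Saved R
     φ' : E → Maybe ℕ
     φ' e = if mem e then just c else φ e
     cases : ∀ e c' → φ' e ≡ just c' → (e ∈ M × c ≡ c') ⊎ φ e ≡ just c'
     cases e c' = go (mem e) refl where
      go : ∀ b → mem e ≡ b → (if b then just c else φ e) ≡ just c' → (e ∈ M × c ≡ c') ⊎ φ e ≡ just c'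
      go true eq p = inj₁ (∈M e eq , just-injective p)
      go false eq p = inj₂ p
     φ'-unc : ∀ e c' → φ' e ≡ just c' → unc e ≡ true
     φ'-unc e c' p = [ (λ q → M-unc e (proj₁ q)) , (λ q → ∧-true₁ (unc e) (φ-unc e c' q)) ]′ (cases e c' p)
     φ'-list : ∀ e c' → φ' e ≡ just c' → LP e c' ≡ true
     φ'-list e c' p = [ (λ q → subst (λ c → LP e c ≡ true) (proj₂ q) (M-list e (proj₁ q))) , φ-list e c' ]′ (cases e c' p)
     φ'-range : ∀ e c' → φ' e ≡ just c' → c' ∈ c ∷ ps
     φ'-range e c' p = [ (λ q → here (sym (proj₂ q))) , (λ q → there (φ-range e c' q)) ]′ (cases e c' p)
     disjoint : ∀ {M} → AllPairs (λ e f → meet e f ≡ false) M → ∀ {e f} → e ∈ M → f ∈ M → e ≢ f → meet e f ≡ false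
     disjoint (p ∷ ps) (here refl) (here refl) e≢f = ⊥-elim (e≢f refl)
     disjoint (p ∷ ps) (here refl) (there q) e≢f = All.lookup p q
     disjoint (p ∷ ps) {e} {f} (there q) (here refl) e≢f = ¬true (λ m → true≢false (trans (sym (meet-sym e f m)) (All.lookup p q)))
     disjoint (p ∷ ps) (there q) (there q') e≢f = disjoint ps q q' e≢f
     φ'-proper : ∀ e f c' → e ≢ f → φ' e ≡ just c' → φ' f ≡ just c' → meet e f ≡ false
     φ'-proper e f c' e≢f p q = go (cases e c' p) (cases f c' q) where
      go : (e ∈ M × c ≡ c') ⊎ φ e ≡ just c' → (f ∈ M × c ≡ c') ⊎ φ f ≡ just c' → meet e f ≡ false
      go (inj₁ (u , refl)) (inj₁ (w , _)) = disjoint M! u w e≢f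
      go (inj₁ (u , refl)) (inj₂ w) = ⊥-elim (All.lookup c∉ (φ-range f c' w) refl)
      go (inj₂ u) (inj₁ (w , refl)) = ⊥-elim (All.lookup c∉ (φ-range e c' u) refl)
      go (inj₂ u) (inj₂ w) = φ-proper e f c' e≢f u w
     S' : E → ℕ
     S' f = if G f then suc (S f) else S f
     same : ∀ f → w f * ((1# - l) ^ S' f * ((1# + l * μ f) * ∏ (mus f) (λ m → 1# + l * m))) ≡ w₂ f * ((1# - l) ^ S f * ∏ (mus f) (λ m → 1# + l * m))
     same f = lem (G f) (w f) (μ f) (∏ (mus f) (λ m → 1# + l * m)) where
      lem : ∀ b w m q → w * ((1# - l) ^ (if b then suc (S f) else S f) * ((1# + l * m) * q)) ≡ w * (1# + l * m) * (1# - l * 𝟙 b) * ((1# - l) ^ S f * q)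
      lem true w m q = lem-eq-7 w l m q ((1# - l) ^ S f)
      lem false w m q = lem-eq-6 w l m q ((1# - l) ^ S f)
     musum' : ∀ f → tgt f ≡ true → κ * κ * Δ * (left (c ∷ ps) unc φ' f - ⟦ countᵇ (Λ f) (c ∷ ps) ⟧ * (N f - ¼ * (β * Δ))) ≤ μ f + ∑ (mus f) (λ m → m)
     musum' f tf = ≤-trans (subst (λ t → κ * κ * Δ * (left (c ∷ ps) unc φ' f - t * (N f - ¼ * (β * Δ))) ≤ lin f + κ * κ * Δ * (left ps unc' φ f - ⟦ countᵇ (Λ f) ps ⟧ * (N f - ¼ * (β * Δ)))) (sym count-step)
        (musum'-pure (κ * κ * Δ) (left (c ∷ ps) unc φ' f) (X f) (left ps unc' φ f) (𝟙 (Λ f c)) ⟦ countᵇ (Λ f) ps ⟧ (N f - ¼ * (β * Δ)) (0≤κ ⊗ 0≤κ ⊗ 0≤Δ) left-step))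
       (+-mono-≤ (≤-trans (≤pos (lin f)) (≤-reflexive (sym (trans (cong (λ b → 𝟙 b * pos (lin f)) tf) (*-identityˡ (pos (lin f))))))) (musum f tf)) where
      count-step : ⟦ countᵇ (Λ f) (c ∷ ps) ⟧ ≡ 𝟙 (Λ f c) + ⟦ countᵇ (Λ f) ps ⟧
      count-step = lem (Λ f c) (countᵇ (Λ f) ps) where
       lem : ∀ b k → ⟦ if b then suc k else k ⟧ ≡ 𝟙 b + ⟦ k ⟧
       lem true k = 1+⟦ k ⟧
       lem false k = sym (+-identityˡ ⟦ k ⟧)
      left-step : left (c ∷ ps) unc φ' f ≤ X f + left ps unc' φ f
      left-step = ≤-trans (∑-mono es (λ g → perEdge g (unc g) (mem g) (φ g) (LP g c) (rem ps g)))
       (≤-reflexive (trans (∑-+ es (λ g → 𝟙 (elig g) * 𝟙 (nb f g)) (λ g → 𝟙 (nb f g) * (𝟙 (unc' g ∧ isNothing (φ g)) * ⟦ rem ps g ⟧))) (cong (_+ left ps unc' φ f) (sym (∑-filter elig es (λ g → 𝟙 (nb f g))))))) where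
       perEdge : ∀ g u m q b k → 𝟙 (nb f g) * (𝟙 (u ∧ isNothing (if m then just c else q)) * ⟦ if b then suc k else k ⟧) ≤ 𝟙 (u ∧ b) * 𝟙 (nb f g) + 𝟙 (nb f g) * (𝟙 ((u ∧ not m) ∧ isNothing q) * ⟦ k ⟧)
       perEdge g false m q b k = ≤-reflexive (perEdge-eq-3 (𝟙 (nb f g)) ⟦ if b then suc k else k ⟧ ⟦ k ⟧)
       perEdge g true true q b k = ≡≤ (perEdge-eq-2 (𝟙 (nb f g)) ⟦ if b then suc k else k ⟧) (0≤𝟙 b ⊗ 0≤𝟙 (nb f g) ⊕ 0≤𝟙 (nb f g) ⊗ (≤-refl {0#} ⊗ 0≤⟦ k ⟧))
       perEdge g true false q false k = by ≤-refl (perEdge-eq (𝟙 (nb f g)) (𝟙 (isNothing q) * ⟦ k ⟧))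
       perEdge g true false q true k = subst (λ t → 𝟙 (nb f g) * (𝟙 (isNothing q) * t) ≤ 1# * 𝟙 (nb f g) + 𝟙 (nb f g) * (𝟙 (isNothing q) * ⟦ k ⟧)) (sym 1+⟦ k ⟧) (perEdge-pure₂ (𝟙 (nb f g)) (𝟙 (isNothing q)) ⟦ k ⟧ (0≤𝟙 (nb f g)) (𝟙≤1 (isNothing q)))
     saved' : ∀ f → ⟦ S' f ⟧ + Z (c ∷ ps) φ' f ≤ U φ' f
     saved' f = ≤-trans (saved'-pure ⟦ S' f ⟧ (𝟙 (G f)) ⟦ S f ⟧ (𝟙 (Λ f c ∧ anyᵇ (λ g → nb f g ∧ isColour (φ' g) c) es)) (𝟙 (Λ f c ∧ anyᵇ (nb f) M)) (∑[ d ∈ ps ] 𝟙 (Λ f d ∧ anyᵇ (λ g → nb f g ∧ isColour (φ' g) d) es)) (Z ps φ f) (U φ f) m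
        S-step head-colour tail-colours (saved f) (gain≤ (Λ f c) M)) U-step where
      m : ℚ
      m = ∑[ g ∈ M ] 𝟙 (nb f g)
      S-step : ⟦ S' f ⟧ ≡ 𝟙 (G f) + ⟦ S f ⟧
      S-step = lem (G f) (S f) where
       lem : ∀ b k → ⟦ if b then suc k else k ⟧ ≡ 𝟙 b + ⟦ k ⟧
       lem true k = 1+⟦ k ⟧
       lem false k = sym (+-identityˡ ⟦ k ⟧)
      head-colour : 𝟙 (Λ f c ∧ anyᵇ (λ g → nb f g ∧ isColour (φ' g) c) es) ≤ 𝟙 (Λ f c ∧ anyᵇ (nb f) M)
      head-colour = 𝟙-mono _ _ (λ h → ∧-intro (∧-true₁ (Λ f c) h) (witness (any-witness (λ g → nb f g ∧ isColour (φ' g) c) es (∧-true₂ (Λ f c) h)))) where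
       witness : (∃ λ g → g ∈ es × nb f g ∧ isColour (φ' g) c ≡ true) → anyᵇ (nb f) M ≡ true
       witness (g , _ , q) = [ (λ r → any-true (nb f) (proj₁ r) (∧-true₁ (nb f g) q)) , (λ r → ⊥-elim (All.lookup c∉ (φ-range g c r) refl)) ]′ (cases g c (isColour-true (φ' g) (∧-true₂ (nb f g) q)))
      tail-colours : ∑[ d ∈ ps ] 𝟙 (Λ f d ∧ anyᵇ (λ g → nb f g ∧ isColour (φ' g) d) es) ≤ Z ps φ f
      tail-colours = ∑-mono∈ ps (λ d d∈ → 𝟙-mono _ _ (λ h → ∧-intro (∧-true₁ (Λ f d) h) (witness d d∈ (any-witness (λ g → nb f g ∧ isColour (φ' g) d) es (∧-true₂ (Λ f d) h))))) where
       witness : ∀ d → d ∈ ps → (∃ λ g → g ∈ es × nb f g ∧ isColour (φ' g) d ≡ true) → anyᵇ (λ g → nb f g ∧ isColour (φ g) d) es ≡ true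
       witness d d∈ (g , g∈ , q) = [ (λ r → ⊥-elim (All.lookup c∉ d∈ (proj₂ r))) , (λ r → any-true (λ g → nb f g ∧ isColour (φ g) d) g∈ (∧-intro (∧-true₁ (nb f g) q) (isColour-refl r))) ]′ (cases g d (isColour-true (φ' g) (∧-true₂ (nb f g) q)))
      gain≤ : ∀ b M → 𝟙 (gain b (nb f) M) + 𝟙 (b ∧ anyᵇ (nb f) M) ≤ ∑[ g ∈ M ] 𝟙 (nb f g)
      gain≤ false M = ≡≤ (+-identityʳ (𝟙 (anyᵇ (nb f) M))) (any≤∑ (nb f) M)
      gain≤ true [] = ≤-refl
      gain≤ true (g ∷ M) = go (nb f g) where
       go : ∀ b → 𝟙 (if b then anyᵇ (nb f) M else atLeast2 (nb f) M) + 𝟙 (b ∨ anyᵇ (nb f) M) ≤ 𝟙 b + (∑[ g ∈ M ] 𝟙 (nb f g))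
       go true = ≡≤ (+-comm (𝟙 (anyᵇ (nb f) M)) 1#) (+-mono-≤ (≤-refl {1#}) (any≤∑ (nb f) M))
       go false = ≤-trans (gain≤ true M) (≤-reflexive (sym (+-identityˡ (∑[ g ∈ M ] 𝟙 (nb f g)))))
      U-step : m + U φ f ≤ U φ' f
      U-step = ≤-trans (+-mono-≤ (members M M!) (≤-refl {U φ f})) (≡≤ (sym (∑-+ es (λ g → 𝟙 (nb f g) * 𝟙 (mem g)) (λ g → 𝟙 (nb f g ∧ not (isNothing (φ g)))))) (∑-mono es (λ g → perEdge g (mem g) refl (φ g) refl))) where
       members : ∀ M → AllPairs (λ e f → meet e f ≡ false) M → ∑[ g ∈ M ] 𝟙 (nb f g) ≤ ∑[ g ∈ es ] 𝟙 (nb f g) * 𝟙 (anyᵇ (λ h → does (h ≟ g)) M)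
       members [] [] = ∑-nonneg es (λ g → 0≤𝟙 (nb f g) ⊗ ≤-refl {0#})
       members (x ∷ M) (p ∷ ps) = ≤-trans (+-mono-≤ (∑-∈′ x) (members M ps)) (≡≤ (sym (∑-+ es (λ g → 𝟙 (nb f g) * 𝟙 (does (x ≟ g))) (λ g → 𝟙 (nb f g) * 𝟙 (anyᵇ (λ h → does (h ≟ g)) M))))
         (∑-mono es (λ g → ≡≤ (sym (*-distribˡ-+ (𝟙 (nb f g)) (𝟙 (does (x ≟ g))) (𝟙 (anyᵇ (λ h → does (h ≟ g)) M)))) (*-monoˡ (0≤𝟙 (nb f g)) (disj g (does (x ≟ g)) refl))))) where
        ∑-∈′ : ∀ x → 𝟙 (nb f x) ≤ ∑[ g ∈ es ] 𝟙 (nb f g) * 𝟙 (does (x ≟ g))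
        ∑-∈′ x = ≡≤ (sym (trans (cong (λ b → 𝟙 (nb f x) * 𝟙 b) (≟-refl _≟_ x)) (*-identityʳ (𝟙 (nb f x))))) (∑-∈ (λ g → 𝟙 (nb f g) * 𝟙 (does (x ≟ g))) (λ g → 0≤𝟙 (nb f g) ⊗ 0≤𝟙 (does (x ≟ g))) (es-all x))
        disj : ∀ g b → does (x ≟ g) ≡ b → 𝟙 b + 𝟙 (anyᵇ (λ h → does (h ≟ g)) M) ≤ 𝟙 (b ∨ anyᵇ (λ h → does (h ≟ g)) M)
        disj g false eq = ≤-reflexive (+-identityˡ (𝟙 (anyᵇ (λ h → does (h ≟ g)) M)))
        disj g true eq = ≤-reflexive (trans (cong (λ b → 1# + 𝟙 b) (¬true (λ t → absurd (any-witness (λ h → does (h ≟ g)) M t)))) (+-identityʳ 1#)) where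
         absurd : (∃ λ h → h ∈ M × does (h ≟ g) ≡ true) → ⊥
         absurd (h , h∈ , q) = true≢false (trans (sym (meet-refl x)) (trans (cong (meet x) (trans (≟-true _≟_ eq) (sym (≟-true _≟_ q)))) (All.lookup p h∈)))
       perEdge : ∀ g b → mem g ≡ b → ∀ q → φ g ≡ q → 𝟙 (nb f g) * 𝟙 b + 𝟙 (nb f g ∧ not (isNothing q)) ≤ 𝟙 (nb f g ∧ not (isNothing (if b then just c else q)))
       perEdge g false eq q eq' = ≤-reflexive (trans (cong (_+ 𝟙 (nb f g ∧ not (isNothing q))) (*-zeroʳ (𝟙 (nb f g)))) (+-identityˡ _))
       perEdge g true eq nothing eq' = ≤-reflexive (lem (nb f g)) where
        lem : ∀ b → 𝟙 b * 1# + 𝟙 (b ∧ false) ≡ 𝟙 (b ∧ true)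
        lem true = refl
        lem false = refl
       perEdge g true eq (just d) eq' = ⊥-elim (true≢false (trans (sym eq) (not-true (∧-true₂ (unc g) (φ-unc g d eq')))))

sixteenth : ℚ
sixteenth = ⅛ * ½

sum≥-pure : ∀ k ℓ b n N U Z L β Δ K → 0# ≤ k → 0# ≤ β → 0# ≤ Δ → β ≤ 1# → ½ * Δ ≤ K → K ≤ N → N ≤ Δ → ℓ ≤ k * (1# + ⅛ * ½ * β) → ℓ + b ≤ ⅛ * ½ * (β * Δ) → n ≤ ℓ → Z ≤ ℓ → U - Z ≤ b → k * (N - U) ≤ L →
    ⅛ * (k * (β * Δ)) ≤ L - n * (N - ¼ * (β * Δ))
sum≥-pure k ℓ b n N U Z L β Δ K k0 β0 Δ0 β1 ΔK KN NΔ ℓk ℓb nℓ Zℓ UZ kL = by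
 (gap kL ⊕ k0 ⊗ (gap UZ ⊕ gap Zℓ ⊕ gap ℓb) ⊕ (gap nℓ ⊕ gap ℓk) ⊗ (gap KN ⊕ gap ΔK ⊕ 0≤¼ ⊗ (Δ0 ⊗ gap β1) ⊕ 0≤¼ ⊗ Δ0)
  ⊕ k0 ⊗ (0≤⅛ ⊗ 0≤½ ⊗ β0) ⊗ (gap NΔ ⊕ 0≤¼ ⊗ (β0 ⊗ Δ0)))
 (solve (k ⸴ ℓ ⸴ b ⸴ n ⸴ N ⸴ U ⸴ Z ⸴ L ⸴ β ⸴ Δ ⸴ K ⸴ ∎) ring)

fits-pure₃ : ∀ s Z U → s + Z ≤ U → s ≤ U - Z
fits-pure₃ s Z U h = by (gap h) (solve (s ⸴ Z ⸴ U ⸴ ∎) ring)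

fits-pure₂ : ∀ N U Z Δ b → N ≤ Δ → b ≤ U - Z → (N - U) + Z ≤ Δ - b
fits-pure₂ N U Z Δ b h k = by (gap h ⊕ gap k) (solve (N ⸴ U ⸴ Z ⸴ Δ ⸴ b ⸴ ∎) ring)

fits-pure₁ : ∀ N U Z → Z ≤ U → (N - U) + Z ≤ N
fits-pure₁ N U Z h = by (gap h) (solve (N ⸴ U ⸴ Z ⸴ ∎) ring)

module SparseColouring {E : Set} (_≟_ : DecidableEquality E) (es : List E) (es! : AllPairs _≢_ es) (es-all : ∀ e → e ∈ es)
       (meet : E → E → Bool) (meet-sym : ∀ e f → meet e f ≡ true → meet f e ≡ true) (meet-refl : ∀ e → meet e e ≡ true)
       (cs : List ℕ) (cs! : AllPairs _≢_ cs) where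

 open Graph _≟_ es es! es-all meet meet-sym cs cs!

 module _ (T₀ : E → Bool) (Λ : E → ℕ → Bool) (inP : ℕ → Bool) (κ Δ β K' : ℚ)
      (0≤κ : 0# ≤ κ) (κ≤1 : κ ≤ 1#) (0≤Δ : 0# ≤ Δ) (0≤β : 0# ≤ β) (β≤1 : β ≤ 1#) (κΔ≤β : ⟪ 20 ⟫ * (κ * Δ) ≤ β) (Δ≤2K' : ½ * Δ ≤ K')
      (deg : ∀ e → T₀ e ≡ true → ∑[ g ∈ es ] 𝟙 (T₀ g ∧ meet e g) ≤ Δ)
      (k₀ b h k ℓ : ℕ) where

  ps : List ℕ
  ps = filterᵇ inP cs

  LP : E → ℕ → Bool
  LP e c = Λ e c ∧ inP c

  tgt : E → Bool
  tgt f = T₀ f ∧ does (K' ≤? nbrs T₀ f)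

  tgt-T₀ : ∀ f → tgt f ≡ true → T₀ f ≡ true
  tgt-T₀ f = ∧-true₁ (T₀ f)

  open Saving _≟_ es es! es-all meet meet-sym meet-refl adj (λ e f → ∧-true₁ (meet e f)) T₀ tgt Λ LP κ Δ β 0≤κ κ≤1 0≤Δ β≤1 κΔ≤β deg tgt-T₀

  sparseColouring : (∀ f → T₀ f ≡ true → K' ≤ N f → meetings f + β * (Δ * Δ) ≤ N f * N f) →
           (∀ e → T₀ e ≡ true → k ℕ.≤ countᵇ (LP e) ps) → (∀ e → T₀ e ≡ true → countᵇ (Λ e) ps ℕ.≤ ℓ) → (∀ e → T₀ e ≡ true → K' ≤ avail Λ e) →
           ⟦ ℓ ⟧ ≤ ⟦ k ⟧ * (1# + sixteenth * β) → ⟦ ℓ ⟧ + ⟦ b ⟧ ≤ sixteenth * (β * Δ) →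
           ⟦ h ⟧ ≤ κ * κ * Δ * (⅛ * (⟦ k ⟧ * (β * Δ))) →
           ⟦ length es ⟧ * (1# + inv (suc k₀)) ^ b < (1# + inv (suc (suc k₀))) ^ h →
           Δ - ⟦ b ⟧ < K' → Colouring T₀ Λ
  sparseColouring sparse lists lists≤ enough ℓ≤ ℓb h≤ M< room = finish (complete Λ us (filter-AllPairs pending es!) φ proper (All.map (λ {e} p → nothing-of (φ e) (∧-true₂ (T₀ e) p)) (filter-true pending es))
     (All.map (λ {e} p → fits e (∧-true₁ (T₀ e) p)) (filter-true pending es))) where
   sparse' : ∀ f → tgt f ≡ true → meetings f + β * (Δ * Δ) ≤ N f * N f
   sparse' f p = sparse f (∧-true₁ (T₀ f) p) (does-true (K' ≤? nbrs T₀ f) (∧-true₂ (T₀ f) p))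
   open Sequence sparse' k₀ using (Saved; save; Z; U; left; l; 0≤l; l≤1)
   open Saved (save ps (filter-AllPairs inP cs!) T₀ (λ _ p → p) (λ _ → 1#) (λ _ → 0≤1))
   pending : E → Bool
   pending e = T₀ e ∧ isNothing (φ e)
   us : List E
   us = filterᵇ pending es
   nothing-of : ∀ (m : Maybe ℕ) → isNothing m ≡ true → m ≡ nothing
   nothing-of nothing _ = refl
   proper : Proper φ
   proper e f c a p q = true≢false (trans (sym (∧-true₁ (meet e f) a)) (φ-proper e f c (adj-irrefl e f a) p q))
   ∑us : ∀ f → ∑[ g ∈ us ] 𝟙 (adj f g) ≡ N f - U φ f
   ∑us f = trans (∑-filter pending es (λ g → 𝟙 (adj f g))) (trans (∑-cong es (λ g → lem (T₀ g) (isNothing (φ g)) (adj f g))) (∑-- es (λ g → 𝟙 (nb f g)) (λ g → 𝟙 (nb f g ∧ not (isNothing (φ g)))))) where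
    lem : ∀ t n a → 𝟙 (t ∧ n) * 𝟙 a ≡ 𝟙 (t ∧ a) - 𝟙 ((t ∧ a) ∧ not n)
    lem false n a = *-zeroˡ (𝟙 a)
    lem true true true = refl
    lem true true false = refl
    lem true false true = refl
    lem true false false = refl
   blocked≤Z : ∀ f → blocked Λ φ f ≤ Z ps φ f
   blocked≤Z f = ≤-trans (∑-mono cs (λ c → perColour c (used φ f c) refl)) (≤-reflexive (sym (∑-filter inP cs (λ c → 𝟙 (Λ f c ∧ anyᵇ (λ g → nb f g ∧ isColour (φ g) c) es))))) where
    perColour : ∀ c u → used φ f c ≡ u → 𝟙 (Λ f c ∧ u) ≤ 𝟙 (inP c) * 𝟙 (Λ f c ∧ anyᵇ (λ g → nb f g ∧ isColour (φ g) c) es)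
    perColour c false eq = ≤-trans (𝟙-mono (Λ f c ∧ false) false (∧-true₂ (Λ f c))) (0≤𝟙 (inP c) ⊗ 0≤𝟙 (Λ f c ∧ anyᵇ (λ g → nb f g ∧ isColour (φ g) c) es))
    perColour c true eq = witness (used-elim φ eq) where
     witness : (∃ λ g → adj f g ≡ true × φ g ≡ just c) → 𝟙 (Λ f c ∧ true) ≤ 𝟙 (inP c) * 𝟙 (Λ f c ∧ anyᵇ (λ g → nb f g ∧ isColour (φ g) c) es)
     witness (g , a , q) = ≤-reflexive (sym (trans (cong₂ (λ x y → 𝟙 x * 𝟙 (Λ f c ∧ y)) (All.lookup (filter-true inP cs) (φ-range g c q))
       (any-true (λ g → nb f g ∧ isColour (φ g) c) (es-all g) (∧-intro (∧-intro (φ-unc g c q) a) (isColour-refl q)))) (*-identityˡ (𝟙 (Λ f c ∧ true)))))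
   Z≤U : ∀ f → Z ps φ f ≤ U φ f
   Z≤U f = ≤-trans (by 0≤⟦ S f ⟧ (+-comm ⟦ S f ⟧ (Z ps φ f))) (saved f)
   Z≤ℓ : ∀ f → T₀ f ≡ true → Z ps φ f ≤ ⟦ ℓ ⟧
   Z≤ℓ f tf = ≤-trans (∑-mono ps (λ c → 𝟙-mono (Λ f c ∧ anyᵇ (λ g → nb f g ∧ isColour (φ g) c) es) (Λ f c) (∧-true₁ (Λ f c)))) (≡≤ (∑-count (Λ f) ps) (⟦⟧-mono (lists≤ f tf)))
   left≥ : ∀ f → ⟦ k ⟧ * (N f - U φ f) ≤ left ps T₀ φ f
   left≥ f = ≡≤ (trans (cong (⟦ k ⟧ *_) (sym (∑-- es (λ g → 𝟙 (nb f g)) (λ g → 𝟙 (nb f g ∧ not (isNothing (φ g))))))) (sym (∑-*ˡ es ⟦ k ⟧ (λ g → 𝟙 (nb f g) - 𝟙 (nb f g ∧ not (isNothing (φ g)))))))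
     (∑-mono es (λ g → perEdge g (T₀ g) refl (isNothing (φ g)) (adj f g))) where
    perEdge : ∀ g t → T₀ g ≡ t → ∀ n a → ⟦ k ⟧ * (𝟙 (t ∧ a) - 𝟙 ((t ∧ a) ∧ not n)) ≤ 𝟙 (t ∧ a) * (𝟙 (t ∧ n) * ⟦ countᵇ (LP g) ps ⟧)
    perEdge g false eq n a = ≤-reflexive (vanish ⟦ k ⟧ ⟦ countᵇ (LP g) ps ⟧) where
     vanish : ∀ k c → k * (0# - 0#) ≡ 0# * (0# * c)
     vanish = solve-∀ ring
    perEdge g true eq n false = ≤-reflexive (vanish ⟦ k ⟧ (𝟙 n * ⟦ countᵇ (LP g) ps ⟧)) where
     vanish : ∀ k c → k * (0# - 0#) ≡ 0# * c
     vanish = solve-∀ ring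
    perEdge g true eq false true = ≤-reflexive (vanish ⟦ k ⟧ ⟦ countᵇ (LP g) ps ⟧) where
     vanish : ∀ k c → k * (1# - 1#) ≡ 1# * (0# * c)
     vanish = solve-∀ ring
    perEdge g true eq true true = ≡≤ (unit ⟦ k ⟧) (≤-trans (⟦⟧-mono (lists g eq)) (≤-reflexive (unit' ⟦ countᵇ (LP g) ps ⟧))) where
     unit : ∀ k → k * (1# - 0#) ≡ k
     unit = solve-∀ ring
     unit' : ∀ k → k ≡ 1# * (1# * k)
     unit' = solve-∀ ring
   -- If `U - Z` is below `b`, few neighbours of `f` are coloured, since `Z ≤ ℓ`. Then `left` is
   -- large, the accumulated means reach `h`, and the potential forces `S f` up to `b`.
   many : ∀ f → T₀ f ≡ true → K' ≤ N f → U φ f - Z ps φ f < ⟦ b ⟧ → b ℕ.≤ S f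
   many f tf big few = successes k₀ ⟦ length es ⟧ (∏ (mus f) (λ m → 1# + l * m)) (S f) h b 0≤⟦ length es ⟧ pot≤ (convexℓ (mus f) (mus≥0 f) (mus≤1 f) (≤-trans h≤ sum≥)) M< where
    tf' : tgt f ≡ true
    tf' = ∧-intro tf (dec-true (K' ≤? nbrs T₀ f) big) where
     dec-true : ∀ {P : Set} (d : Dec P) → P → does d ≡ true
     dec-true (yes _) _ = refl
     dec-true (no ¬p) p = ⊥-elim (¬p p)
    0≤term : ∀ f → 0# ≤ 1# * ((1# - l) ^ S f * ∏ (mus f) (λ m → 1# + l * m))
    0≤term f = 0≤1 ⊗ (^-nonneg (S f) (gap l≤1) ⊗ ∏-nonneg′ (mus f) (mus≥0 f)) where
     ∏-nonneg′ : ∀ ms → All (0# ≤_) ms → 0# ≤ ∏ ms (λ m → 1# + l * m)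
     ∏-nonneg′ [] [] = 0≤1
     ∏-nonneg′ (m ∷ ms) (p ∷ ps) = (0≤1 ⊕ 0≤l ⊗ p) ⊗ ∏-nonneg′ ms ps
    pot≤ : (1# - l) ^ S f * ∏ (mus f) (λ m → 1# + l * m) ≤ ⟦ length es ⟧
    pot≤ = ≡≤ (sym (*-identityˡ _)) (≤-trans (∑-∈ (λ f → 1# * ((1# - l) ^ S f * ∏ (mus f) (λ m → 1# + l * m))) 0≤term (es-all f))
     (≤-trans potential (≤-reflexive (trans (∑-const es 1#) (*-identityʳ ⟦ length es ⟧)))))
    convexℓ : ∀ ms → All (0# ≤_) ms → All (_≤ 1#) ms → ⟦ h ⟧ ≤ ∑ ms (λ m → m) → (1# + l) ^ h ≤ ∏ ms (λ m → 1# + l * m)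
    convexℓ ms p q s = ≤-trans (convex₀ 0≤l ms clip (λ m → 0≤pos (m Data.Rational.⊓ 1#)) (λ m → pos≤1 (ℚₚ.p⊓q≤q m 1#)) h (≤-trans s (≤-reflexive (∑-clip ms p q))))
      (≤-reflexive (∏-clip ms p q)) where
     -- `convex₀` asks for bounds valid on the whole type; clipping to [0,1] supplies them and
     -- leaves the entries of the list unchanged.
     clip : ℚ → ℚ
     clip m = pos (m Data.Rational.⊓ 1#)
     clip≡ : ∀ m → 0# ≤ m → m ≤ 1# → clip m ≡ m
     clip≡ m p q = trans (cong pos (ℚₚ.p≤q⇒p⊓q≡p q)) (p≤q⇒p⊔q≡q p)
     ∑-clip : ∀ ms → All (0# ≤_) ms → All (_≤ 1#) ms → ∑ ms (λ m → m) ≡ ∑ ms clip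
     ∑-clip [] [] [] = refl
     ∑-clip (m ∷ ms) (p ∷ ps) (q ∷ qs) = cong₂ _+_ (sym (clip≡ m p q)) (∑-clip ms ps qs)
     ∏-clip : ∀ ms → All (0# ≤_) ms → All (_≤ 1#) ms → ∏ ms (λ m → 1# + l * clip m) ≡ ∏ ms (λ m → 1# + l * m)
     ∏-clip [] [] [] = refl
     ∏-clip (m ∷ ms) (p ∷ ps) (q ∷ qs) = cong₂ _*_ (cong (λ t → 1# + l * t) (clip≡ m p q)) (∏-clip ms ps qs)
    sum≥ : κ * κ * Δ * (⅛ * (⟦ k ⟧ * (β * Δ))) ≤ ∑ (mus f) (λ m → m)
    sum≥ = ≤-trans (*-monoˡ (0≤κ ⊗ 0≤κ ⊗ 0≤Δ) (sum≥-pure ⟦ k ⟧ ⟦ ℓ ⟧ ⟦ b ⟧ ⟦ countᵇ (Λ f) ps ⟧ (N f) (U φ f) (Z ps φ f) (left ps T₀ φ f) β Δ K' 0≤⟦ k ⟧ 0≤β 0≤Δ β≤1 Δ≤2K' big (N≤Δ f tf)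
       ℓ≤ ℓb (⟦⟧-mono (lists≤ f tf)) (Z≤ℓ f tf) (<⇒≤ few) (left≥ f))) (musum f tf')
   -- With fewer than `K'` neighbours the list is long enough by itself. Otherwise `U - Z` is at
   -- least `b`, as the contrary assumption contradicts `many`, and `room` says that `Δ - b` is
   -- below `K'`.
   fits : ∀ f → T₀ f ≡ true → (∑[ g ∈ us ] 𝟙 (adj f g)) + blocked Λ φ f < avail Λ f
   fits f tf = <-≤-trans (≤-<-trans (+-mono-≤ (≤-reflexive (∑us f)) (blocked≤Z f)) (go (K' ≤? N f))) (enough f tf) where
    go : Dec (K' ≤ N f) → (N f - U φ f) + Z ps φ f < K'
    go (no small) = ≤-<-trans (fits-pure₁ (N f) (U φ f) (Z ps φ f) (Z≤U f)) (≰⇒> small)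
    go (yes big) = ≤-<-trans (fits-pure₂ (N f) (U φ f) (Z ps φ f) Δ ⟦ b ⟧ (N≤Δ f tf) (≮⇒≥ (λ few → <⇒¬≥ few (≤-trans (⟦⟧-mono (many f tf big few)) (fits-pure₃ ⟦ S f ⟧ (Z ps φ f) (U φ f) (saved f)))))) room
   finish : Extension Λ φ us → Colouring T₀ Λ
   finish X = record { φ = ψ ; φ-proper = ψ-proper ; φ-total = tot ; φ-only = only ; φ-list = list } where
    open Extension X
    tot : ∀ e → T₀ e ≡ true → ∃ λ c → ψ e ≡ just c
    tot e te = go (φ e) refl where
     go : ∀ m → φ e ≡ m → ∃ λ c → ψ e ≡ just c
     go (just c) eq = c , ψ-extends e c eq
     go nothing eq = ψ-total e (filter-∈ pending (es-all e) (∧-intro te (cong isNothing eq)))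
    only : ∀ e c → ψ e ≡ just c → T₀ e ≡ true
    only e c p = go (ψ-new e c p) where
     go : φ e ≡ just c ⊎ (e ∈ us × Λ e c ≡ true) → T₀ e ≡ true
     go (inj₁ q) = φ-unc e c q
     go (inj₂ (m , _)) = ∧-true₁ (T₀ e) (All.lookup (filter-true pending es) m)
    list : ∀ e c → ψ e ≡ just c → Λ e c ≡ true
    list e c p = go (ψ-new e c p) where
     go : φ e ≡ just c ⊎ (e ∈ us × Λ e c ≡ true) → Λ e c ≡ true
     go (inj₁ q) = ∧-true₁ (Λ e c) (φ-list e c q)
     go (inj₂ (_ , l)) = l

-- Double counting under a codegree bound

go-eq₃ : ∀ a b c → a * b * c ≡ a * (1# * (b * c))
go-eq₃ = solve-∀ ring

bound-eq₅ : ∀ a b d → a * b * d ≡ a * d * (1# * b)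
bound-eq₅ = solve-∀ ring

bound-eq₅-2 : ∀ a b → a * 0# + b ≡ b + 0#
bound-eq₅-2 = solve-∀ ring

diag-eq₄ : ∀ a t d b → a * (t + 0# * d) ≡ a * t + 0# * b
diag-eq₄ = solve-∀ ring

diag-eq₄-2 : ∀ a t d → a * (t + 1# * d) ≡ a * t + 1# * (a * d)
diag-eq₄-2 = solve-∀ ring

diag-eq₄-3 : ∀ a t d b → a * (t + 0# * d) ≡ a * t + 0# * (b * d)
diag-eq₄-3 = solve-∀ ring

diag-eq₄-4 : ∀ a t d → a * (t + 1# * d) ≡ a * t + 1# * (a * d)
diag-eq₄-4 = solve-∀ ring

perEdge-eq₁ : ∀ a b t → a * b * t ≡ t * a * b
perEdge-eq₁ = solve-∀ ring

perPair-eq : ∀ w a b c d → w * (a * b) * (c * d) ≡ a * c * (w * (b * d))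
perPair-eq = solve-∀ ring

last-pure₂ : ∀ i g m D → 0# ≤ i → 0# ≤ g → 0# ≤ m → 0# ≤ D → g * m ≤ D → i * (g * g) * (m * m) ≤ i * (D * D)
last-pure₂ i g m D a b c d h = by (a ⊗ (gap h ⊗ (d ⊕ b ⊗ c))) (solve (i ⸴ g ⸴ m ⸴ D ⸴ ∎) ring)

perVertex-pure : ∀ d g m kt i D → 0# ≤ d → 0# ≤ i → 0# ≤ m → g ≤ kt + i * g → d ≤ D → g * m ≤ D → 0# ≤ g → 0# ≤ D → d * g * m ≤ kt * m * d + i * (D * D)
perVertex-pure d g m kt i D d0 i0 m0 h k l g0 D0 = by (d0 ⊗ m0 ⊗ gap h ⊕ i0 ⊗ (gap k ⊗ (g0 ⊗ m0) ⊕ D0 ⊗ gap l)) (solve (d ⸴ g ⸴ m ⸴ kt ⸴ i ⸴ D ⸴ ∎) ring)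

lower-eq₂ : ∀ m i d → m * (i * d) ≡ d * (m * i)
lower-eq₂ = solve-∀ ring

total-eq₂-2 : ∀ w i j → w * i * j ≡ w * (j * i)
total-eq₂-2 = solve-∀ ring

total-eq-2 : ∀ w i s → w * (i * (s - 1#)) + w * i ≡ w * i * s
total-eq-2 = solve-∀ ring

go-eq : ∀ t d → t + 0# * d ≡ t + 0#
go-eq = solve-∀ ring

go-eq-2 : ∀ t d → t + 1# * d ≡ d + t
go-eq-2 = solve-∀ ring

pairs-pure : ∀ t s c n m D q → q * (m * m) ≤ s * (D * D) → (t * s * c * n + q) * (m * m) ≤ t * s * c * n * (m * m) + s * (D * D)
pairs-pure t s c n m D q h = by (gap h) (solve (t ⸴ s ⸴ c ⸴ n ⸴ m ⸴ D ⸴ q ⸴ ∎) ring)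

volume-eq : ∀ k t m v → k * t * m * v ≡ k * t * v * m
volume-eq = solve-∀ ring

dg≤-pure : ∀ w i s k → 0# ≤ w → 0# ≤ i → k ≤ s → w * i * (k - 1#) ≤ w * (i * (s - 1#))
dg≤-pure w i s k a b h = by (a ⊗ b ⊗ gap h) (solve (w ⸴ i ⸴ s ⸴ k ⸴ ∎) ring)

meeting≤-eq₂ : ∀ w s a b → w * s * (a * b) ≡ a * (w * (b * s))
meeting≤-eq₂ = solve-∀ ring

meeting≤-eq : ∀ w j s → w * (j * s) ≡ w * s * j
meeting≤-eq = solve-∀ ring

dW≤D-pure : ∀ a b D → a + b ≤ D + b → a ≤ D
dW≤D-pure a b D h = by (gap h) (solve (a ⸴ b ⸴ D ⸴ ∎) ring)

idem-lem : ∀ b → 𝟙 b * 𝟙 b ≡ 𝟙 b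
idem-lem true = refl
idem-lem false = refl

module Counting {E V : Set} (_≟ᵥ_ : DecidableEquality V) (vs : List V) (vs! : AllPairs _≢_ vs) (vs-all : ∀ v → v ∈ vs)
        (es : List E) (inc : E → V → Bool) where

 open Incidence _≟ᵥ_ vs vs! inc public

 module _ (nonempty : ∀ e → 1# ≤ size e) (t : ℚ) (0≤t : 0# ≤ t)
      (codeg : ∀ u v → u ≢ v → ∑[ e ∈ es ] i e u * i e v ≤ t) where

  n D : ℚ
  n = ⟦ length vs ⟧
  D = t * n

  0≤D : 0# ≤ D
  0≤D = 0≤t ⊗ 0≤⟦ length vs ⟧

  0≤size-1 : ∀ e → 0# ≤ size e - 1#
  0≤size-1 e = gap (nonempty e)

  dg : (E → Bool) → V → ℚ
  dg W v = ∑[ e ∈ es ] 𝟙 (W e) * i e v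

  0≤dg : ∀ W v → 0# ≤ dg W v
  0≤dg W v = ∑-nonneg es (λ e → 0≤𝟙 (W e) ⊗ 0≤i e v)

  dW : (E → Bool) → V → ℚ
  dW W v = ∑[ e ∈ es ] 𝟙 (W e) * (i e v * (size e - 1#))

  0≤dW : ∀ W v → 0# ≤ dW W v
  0≤dW W v = ∑-nonneg es (λ e → 0≤𝟙 (W e) ⊗ (0≤i e v ⊗ 0≤size-1 e))

  idem : ∀ e v → i e v * i e v ≡ i e v
  idem e v = idem-lem (inc e v)

  cd : (E → Bool) → V → V → ℚ
  cd W u v = ∑[ e ∈ es ] 𝟙 (W e) * (i e u * i e v)

  cd≤ : ∀ W u v → cd W u v ≤ t + 𝟙 (does (u ≟ᵥ v)) * dg W v
  cd≤ W u v = go (u ≟ᵥ v) where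
   go : (d : Dec (u ≡ v)) → cd W u v ≤ t + 𝟙 (does d) * dg W v
   go (yes refl) = ≡≤ (∑-cong es (λ e → cong (𝟙 (W e) *_) (idem e u))) (by 0≤t (go-eq-2 t (dg W v)))
   go (no u≢v) = ≤-trans (∑-mono es (λ e → ≤-trans (*-monoʳ (0≤i e u ⊗ 0≤i e v) (𝟙≤1 (W e))) (≤-reflexive (*-identityˡ (i e u * i e v))))) (≤-trans (codeg u v u≢v) (by ≤-refl (go-eq t (dg W v))))

  -- Summing the codegrees of `v` with all vertices counts an edge at `v` once per vertex; the term
  -- of `v` itself is cancelled on both sides, which leaves `size e - 1#`.
  dW≤D : ∀ W v → dW W v ≤ D
  dW≤D W v = dW≤D-pure (dW W v) (dg W v) D (≡≤ total (≤-trans (∑-mono vs (λ u → cd≤ W u v))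
    (≡≤ (trans (∑-+ vs (λ _ → t) (λ u → 𝟙 (does (u ≟ᵥ v)) * dg W v)) (cong₂ _+_ (trans (∑-const vs t) (*-comm n t)) (∑-*ʳ vs (dg W v) (λ u → 𝟙 (does (u ≟ᵥ v))))))
     (+-mono-≤ (≤-refl {D}) (≤-trans (*-monoʳ (0≤dg W v) (∑-delta _≟ᵥ_ vs! v)) (≤-reflexive (*-identityˡ (dg W v)))))))) where
   total : dW W v + dg W v ≡ ∑[ u ∈ vs ] cd W u v
   total = trans (sym (∑-+ es (λ e → 𝟙 (W e) * (i e v * (size e - 1#))) (λ e → 𝟙 (W e) * i e v)))
    (trans (∑-cong es (λ e → trans (total-eq-2 (𝟙 (W e)) (i e v) (size e)) (trans (sym (∑-*ˡ vs (𝟙 (W e) * i e v) (i e))) (∑-cong vs (λ u → total-eq₂-2 (𝟙 (W e)) (i e v) (i e u))))))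
     (∑-swap es vs (λ e u → 𝟙 (W e) * (i e u * i e v))))

  -- Edges of W meeting e, weighted by size minus one.
  meeting≤ : ∀ W e → ∑[ f ∈ es ] 𝟙 (W f) * (j e f * (size f - 1#)) ≤ ∑[ v ∈ vs ] i e v * dW W v
  meeting≤ W e = ≤-trans (∑-mono es (λ f → *-monoˡ (0≤𝟙 (W f)) (*-monoʳ (0≤size-1 f) (j≤∑ e f))))
   (≤-reflexive (trans (∑-cong es (λ f → trans (meeting≤-eq (𝟙 (W f)) (∑[ v ∈ vs ] i e v * i f v) (size f - 1#)) (sym (∑-*ˡ vs (𝟙 (W f) * (size f - 1#)) (λ v → i e v * i f v)))))
    (trans (∑-swap es vs (λ f v → 𝟙 (W f) * (size f - 1#) * (i e v * i f v))) (∑-cong vs (λ v → trans (∑-cong es (λ f → meeting≤-eq₂ (𝟙 (W f)) (size f - 1#) (i e v) (i f v))) (∑-*ˡ es (i e v) (λ f → 𝟙 (W f) * (i f v * (size f - 1#)))))))))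

  meeting≤sizeD : ∀ W e → ∑[ f ∈ es ] 𝟙 (W f) * (j e f * (size f - 1#)) ≤ size e * D
  meeting≤sizeD W e = ≤-trans (meeting≤ W e) (≤-trans (∑-mono vs (λ v → *-monoˡ (0≤i e v) (dW≤D W v))) (≤-reflexive (∑-*ʳ vs D (i e))))

  vol : (E → Bool) → ℚ
  vol W = ∑[ v ∈ vs ] dW W v

  vol≡ : ∀ W → vol W ≡ ∑[ e ∈ es ] 𝟙 (W e) * (size e * (size e - 1#))
  vol≡ W = trans (∑-swap vs es (λ v e → 𝟙 (W e) * (i e v * (size e - 1#)))) (∑-cong es (λ e → trans (∑-*ˡ vs (𝟙 (W e)) (λ v → i e v * (size e - 1#))) (cong (𝟙 (W e) *_) (∑-*ʳ vs (size e - 1#) (i e)))))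

  vol≤ : ∀ W → vol W ≤ n * D
  vol≤ W = ≤-trans (∑-mono vs (dW≤D W)) (≤-reflexive (∑-const vs D))

  dg≤ : ∀ W k → (∀ e → W e ≡ true → k ≤ size e) → ∀ v → dg W v * (k - 1#) ≤ D
  dg≤ W k big v = ≡≤ (sym (∑-*ʳ es (k - 1#) (λ e → 𝟙 (W e) * i e v))) (≤-trans (∑-mono es perEdge) (dW≤D W v)) where
   perEdge : ∀ e → 𝟙 (W e) * i e v * (k - 1#) ≤ 𝟙 (W e) * (i e v * (size e - 1#))
   perEdge e = go (W e) refl where
    go : ∀ b → W e ≡ b → 𝟙 b * i e v * (k - 1#) ≤ 𝟙 b * (i e v * (size e - 1#))
    go true eq = dg≤-pure 1# (i e v) (size e) k 0≤1 (0≤i e v) (big e eq)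
    go false eq = ≤-reflexive (vanish (i e v) (k - 1#) (size e - 1#)) where
     vanish : ∀ a b c → 0# * a * b ≡ 0# * (a * c)
     vanish = solve-∀ ring

  -- If the elements of M meet e₀ and each of them meets edges of T of total weight at least b,
  -- then T has large volume.
  volume : ∀ M T e₀ b k → 0# ≤ b → 1# ≤ k → size e₀ ≡ k → (∀ g → M g ≡ true → meet e₀ g ≡ true) → (∀ e → M e ≡ true → k ≤ size e) →
       (∀ g → M g ≡ true → b ≤ ∑[ f ∈ es ] 𝟙 (T f) * (j g f * (size f - 1#))) →
       (∑[ g ∈ es ] 𝟙 (M g)) * b * (k - 1#) ≤ k * t * vol T * (k - 1#) + k * (D * D)
  volume M T e₀ b k 0≤b 1≤k sz meets big heavy = ≤-trans (*-monoʳ (gap 1≤k) lower) (≡≤ (sym (∑-*ʳ vs (k - 1#) (λ y → dW T y * dg M y))) (≤-trans (∑-mono vs perVertex)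
    (≤-reflexive (trans (∑-+ vs (λ y → k * t * (k - 1#) * dW T y) (λ y → i e₀ y * (D * D))) (cong₂ _+_ (trans (∑-*ˡ vs (k * t * (k - 1#)) (dW T)) (volume-eq k t (k - 1#) (vol T))) (trans (∑-*ʳ vs (D * D) (i e₀)) (cong (_* (D * D)) sz))))))) where
   lower : (∑[ g ∈ es ] 𝟙 (M g)) * b ≤ ∑[ y ∈ vs ] dW T y * dg M y
   lower = ≡≤ (sym (∑-*ʳ es b (λ g → 𝟙 (M g)))) (≤-trans (∑-mono es perEdge) (≤-reflexive (trans (∑-cong es (λ g → sym (∑-*ˡ vs (𝟙 (M g)) (λ v → i g v * dW T v))))
     (trans (∑-swap es vs (λ g v → 𝟙 (M g) * (i g v * dW T v))) (∑-cong vs (λ v → trans (∑-cong es (λ g → lower-eq₂ (𝟙 (M g)) (i g v) (dW T v))) (∑-*ˡ es (dW T v) (λ g → 𝟙 (M g) * i g v)))))))) where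
    perEdge : ∀ g → 𝟙 (M g) * b ≤ 𝟙 (M g) * (∑[ v ∈ vs ] i g v * dW T v)
    perEdge g = go (M g) refl where
     go : ∀ c → M g ≡ c → 𝟙 c * b ≤ 𝟙 c * (∑[ v ∈ vs ] i g v * dW T v)
     go true volume-eq = *-monoˡ 0≤1 (≤-trans (heavy g volume-eq) (meeting≤ T g))
     go false volume-eq = ≤-reflexive (trans (*-zeroˡ b) (sym (*-zeroˡ (∑[ v ∈ vs ] i g v * dW T v))))
   -- An edge of `M` through `y` reaches `e₀` in one of its `k` vertices. Off `e₀` the codegree
   -- allows `t` edges for each of them; on `e₀` the degree itself is added.
   covered : ∀ y → dg M y ≤ k * t + i e₀ y * dg M y
   covered y = ≤-trans (∑-mono es perEdge) (≡≤ (trans (∑-swap es vs (λ g x → i e₀ x * (𝟙 (M g) * (i g x * i g y)))) (∑-cong vs (λ x → ∑-*ˡ es (i e₀ x) (λ g → 𝟙 (M g) * (i g x * i g y)))))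
    (≤-trans (∑-mono vs (λ x → ≤-trans (*-monoˡ (0≤i e₀ x) (cd≤ M x y)) (diag x (x ≟ᵥ y))))
     (≡≤ (trans (∑-+ vs (λ x → i e₀ x * t) (λ x → 𝟙 (does (x ≟ᵥ y)) * (i e₀ y * dg M y))) (cong₂ _+_ (trans (∑-*ʳ vs t (i e₀)) (cong (_* t) sz)) (∑-*ʳ vs (i e₀ y * dg M y) (λ x → 𝟙 (does (x ≟ᵥ y))))))
      (+-mono-≤ (≤-refl {k * t}) (≤-trans (*-monoʳ (0≤i e₀ y ⊗ 0≤dg M y) (∑-delta _≟ᵥ_ vs! y)) (≤-reflexive (*-identityˡ (i e₀ y * dg M y)))))))) where
    perEdge : ∀ g → 𝟙 (M g) * i g y ≤ ∑[ x ∈ vs ] i e₀ x * (𝟙 (M g) * (i g x * i g y))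
    perEdge g = go (M g) refl where
     go : ∀ c → M g ≡ c → 𝟙 c * i g y ≤ ∑[ x ∈ vs ] i e₀ x * (𝟙 c * (i g x * i g y))
     go false volume-eq = ≡≤ (*-zeroˡ (i g y)) (∑-nonneg vs (λ x → 0≤i e₀ x ⊗ (≤-refl {0#} ⊗ (0≤i g x ⊗ 0≤i g y))))
     go true volume-eq = ≤-trans (*-monoʳ (0≤i g y) (≡≤ (sym (cong 𝟙 (meets g volume-eq))) (j≤∑ e₀ g))) (≤-reflexive (trans (sym (∑-*ʳ vs (i g y) (λ x → i e₀ x * i g x))) (∑-cong vs (λ x → go-eq₃ (i e₀ x) (i g x) (i g y)))))
    diag : ∀ x (d : Dec (x ≡ y)) → i e₀ x * (t + 𝟙 (does d) * dg M y) ≤ i e₀ x * t + 𝟙 (does d) * (i e₀ y * dg M y)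
    diag x (yes refl) = ≤-reflexive (diag-eq₄-4 (i e₀ x) t (dg M y))
    diag x (no _) = ≤-reflexive (diag-eq₄-3 (i e₀ x) t (dg M y) (i e₀ y))
   perVertex : ∀ y → dW T y * dg M y * (k - 1#) ≤ k * t * (k - 1#) * dW T y + i e₀ y * (D * D)
   perVertex y = perVertex-pure (dW T y) (dg M y) (k - 1#) (k * t) (i e₀ y) D (0≤dW T y) (0≤i e₀ y) (gap 1≤k) (covered y) (dW≤D T y) (dg≤ M k big y) (0≤dg M y) 0≤D

  -- Meeting pairs among the edges of T that meet f.
  pairs : ∀ T f k c → 1# ≤ k → (∀ e → T e ≡ true → k ≤ size e) → (∀ e → T e ≡ true → size e ≤ c) →
      (∑[ g ∈ es ] ∑[ h ∈ es ] 𝟙 (T g ∧ meet f g) * (𝟙 (T h ∧ meet f h) * j g h)) * ((k - 1#) * (k - 1#)) ≤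
      t * size f * c * (∑[ g ∈ es ] 𝟙 (T g ∧ meet f g)) * ((k - 1#) * (k - 1#)) + size f * (D * D)
  pairs T f k c 1≤k big small = ≤-trans (*-monoʳ (gap 1≤k ⊗ gap 1≤k) total) (pairs-pure t (size f) c (∑[ g ∈ es ] 𝟙 (N g)) (k - 1#) D (∑[ x ∈ vs ] i f x * (dg T x * dg T x)) last) where
   N : E → Bool
   N g = T g ∧ meet f g
   last : (∑[ x ∈ vs ] i f x * (dg T x * dg T x)) * ((k - 1#) * (k - 1#)) ≤ size f * (D * D)
   last = ≡≤ (sym (∑-*ʳ vs ((k - 1#) * (k - 1#)) (λ x → i f x * (dg T x * dg T x)))) (≤-trans (∑-mono vs (λ x → last-pure₂ (i f x) (dg T x) (k - 1#) D (0≤i f x) (0≤dg T x) (gap 1≤k) 0≤D (dg≤ T k big x))) (≤-reflexive (∑-*ʳ vs (D * D) (i f))))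
   perPair : ∀ g h → 𝟙 (N h) * j g h ≤ ∑[ x ∈ vs ] ∑[ y ∈ vs ] i f x * i g y * (𝟙 (T h) * (i h x * i h y))
   perPair g h = ≡≤ (trans (cong (_* j g h) (𝟙-∧ (T h) (meet f h))) (*-assoc (𝟙 (T h)) (j f h) (j g h))) (≤-trans (*-monoˡ (0≤𝟙 (T h)) (*-mono (0≤j f h) (∑-nonneg vs (λ y → 0≤i g y ⊗ 0≤i h y)) (j≤∑ f h) (j≤∑ g h)))
    (≤-reflexive (trans (cong (𝟙 (T h) *_) (sym (∑-*ʳ vs (∑[ y ∈ vs ] i g y * i h y) (λ x → i f x * i h x)))) (trans (sym (∑-*ˡ vs (𝟙 (T h)) (λ x → i f x * i h x * (∑[ y ∈ vs ] i g y * i h y)))) (∑-cong vs (λ x → trans (sym (*-assoc (𝟙 (T h)) (i f x * i h x) (∑[ y ∈ vs ] i g y * i h y))) (trans (sym (∑-*ˡ vs (𝟙 (T h) * (i f x * i h x)) (λ y → i g y * i h y))) (∑-cong vs (λ y → perPair-eq (𝟙 (T h)) (i f x) (i h x) (i g y) (i h y))))))))))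
   -- An edge `h` meeting both `f` and `g` contains a vertex `x` of `f` and a vertex `y` of `g`.
   -- Different `x` and `y` contribute at most `t`; equal ones are charged to the degree of `x`.
   perEdge : ∀ g → ∑[ h ∈ es ] 𝟙 (N h) * j g h ≤ t * size f * size g + (∑[ x ∈ vs ] i f x * i g x * dg T x)
   perEdge g = ≤-trans (∑-mono es (perPair g)) (≡≤ (trans (∑-swap es vs (λ h x → ∑[ y ∈ vs ] i f x * i g y * (𝟙 (T h) * (i h x * i h y)))) (∑-cong vs (λ x → trans (∑-swap es vs (λ h y → i f x * i g y * (𝟙 (T h) * (i h x * i h y)))) (∑-cong vs (λ y → ∑-*ˡ es (i f x * i g y) (λ h → 𝟙 (T h) * (i h x * i h y)))))))
    (≤-trans (∑-mono vs (λ x → ∑-mono vs (λ y → ≤-trans (*-monoˡ (0≤i f x ⊗ 0≤i g y) (cd≤′ x y)) (diag x y (y ≟ᵥ x)))))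
    (≡≤ (trans (∑-cong vs (λ x → trans (∑-+ vs (λ y → i f x * i g y * t) (λ y → 𝟙 (does (y ≟ᵥ x)) * (i f x * i g x * dg T x))) (cong₂ _+_ (trans (∑-cong vs (λ y → perEdge-eq₁ (i f x) (i g y) t)) (∑-*ˡ vs (t * i f x) (i g))) (∑-*ʳ vs (i f x * i g x * dg T x) (λ y → 𝟙 (does (y ≟ᵥ x)))))))
       (trans (∑-+ vs (λ x → t * i f x * size g) (λ x → (∑[ y ∈ vs ] 𝟙 (does (y ≟ᵥ x))) * (i f x * i g x * dg T x))) (cong (_+ (∑[ x ∈ vs ] (∑[ y ∈ vs ] 𝟙 (does (y ≟ᵥ x))) * (i f x * i g x * dg T x))) (trans (∑-*ʳ vs (size g) (λ x → t * i f x)) (cong (_* size g) (∑-*ˡ vs t (i f)))))))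
     (+-mono-≤ (≤-refl {t * size f * size g}) (∑-mono vs (λ x → ≤-trans (*-monoʳ (0≤i f x ⊗ 0≤i g x ⊗ 0≤dg T x) (∑-delta _≟ᵥ_ vs! x)) (≤-reflexive (*-identityˡ (i f x * i g x * dg T x))))))))) where
    cd≤′ : ∀ x y → cd T x y ≤ t + 𝟙 (does (y ≟ᵥ x)) * dg T x
    cd≤′ x y = ≡≤ (∑-cong es (λ h → cong (𝟙 (T h) *_) (*-comm (i h x) (i h y)))) (cd≤ T y x)
    diag : ∀ x y (d : Dec (y ≡ x)) → i f x * i g y * (t + 𝟙 (does d) * dg T x) ≤ i f x * i g y * t + 𝟙 (does d) * (i f x * i g x * dg T x)
    diag x y (yes refl) = ≤-reflexive (diag-eq₄-2 (i f x * i g x) t (dg T x))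
    diag x y (no _) = ≤-reflexive (diag-eq₄ (i f x * i g y) t (dg T x) (i f x * i g x * dg T x))
   total : ∑[ g ∈ es ] ∑[ h ∈ es ] 𝟙 (N g) * (𝟙 (N h) * j g h) ≤ t * size f * c * (∑[ g ∈ es ] 𝟙 (N g)) + (∑[ x ∈ vs ] i f x * (dg T x * dg T x))
   total = ≡≤ (∑-cong es (λ g → ∑-*ˡ es (𝟙 (N g)) (λ h → 𝟙 (N h) * j g h))) (≤-trans (∑-mono es (λ g → ≤-trans (*-monoˡ (0≤𝟙 (N g)) (perEdge g)) (bound g (T g) refl (meet f g))))
    (≤-reflexive (trans (∑-+ es (λ g → t * size f * c * 𝟙 (N g)) (λ g → ∑[ x ∈ vs ] i f x * dg T x * (𝟙 (T g) * i g x))) (cong₂ _+_ (∑-*ˡ es (t * size f * c) (λ g → 𝟙 (N g)))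
     (trans (∑-swap es vs (λ g x → i f x * dg T x * (𝟙 (T g) * i g x))) (∑-cong vs (λ x → trans (∑-*ˡ es (i f x * dg T x) (λ g → 𝟙 (T g) * i g x)) (*-assoc (i f x) (dg T x) (dg T x))))))))) where
    0≤ts : 0# ≤ t * size f
    0≤ts = 0≤t ⊗ 0≤size f
    bound : ∀ g b → T g ≡ b → ∀ m → 𝟙 (b ∧ m) * (t * size f * size g + (∑[ x ∈ vs ] i f x * i g x * dg T x)) ≤ t * size f * c * 𝟙 (b ∧ m) + (∑[ x ∈ vs ] i f x * dg T x * (𝟙 b * i g x))
    bound g false eq m = ≤-reflexive (trans (*-zeroˡ (t * size f * size g + (∑[ x ∈ vs ] i f x * i g x * dg T x))) (sym (trans (cong₂ _+_ (*-zeroʳ (t * size f * c)) (trans (∑-cong vs (λ x → vanish (i f x * dg T x) (i g x))) (∑-0 vs))) refl))) where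
     vanish : ∀ a b → a * (0# * b) ≡ 0#
     vanish = solve-∀ ring
    bound g true eq false = ≡≤ (*-zeroˡ (t * size f * size g + (∑[ x ∈ vs ] i f x * i g x * dg T x))) (≤-trans (∑-nonneg vs (λ x → 0≤i f x ⊗ 0≤dg T x ⊗ (0≤1 ⊗ 0≤i g x))) (by ≤-refl (bound-eq₅-2 (t * size f * c) (∑[ x ∈ vs ] i f x * dg T x * (1# * i g x)))))
    bound g true eq true = ≡≤ (*-identityˡ (t * size f * size g + (∑[ x ∈ vs ] i f x * i g x * dg T x))) (+-mono-≤ (≤-trans (*-monoˡ 0≤ts (small g eq)) (≤-reflexive (sym (*-identityʳ (t * size f * c))))) (≤-reflexive (∑-cong vs (λ x → bound-eq₅ (i f x) (i g x) (dg T x)))))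

-- Structure of the core of large edges

s≤1-pure₄ : ∀ s ν → ⟪ 32 ⟫ * s ≤ ν → ν ≤ 1# → 0# ≤ s → s ≤ 1#
s≤1-pure₄ s ν p q r = by (gap p ⊕ gap q ⊕ 0≤⟪ 31 ⟫ ⊗ r) (solve (s ⸴ ν ⸴ ∎) ring)

x≤1-pure₀ : ∀ x δ → ⟪ 64 ⟫ * x ≡ δ → δ ≤ 1# → 0# ≤ x → x ≤ 1#
x≤1-pure₀ x δ refl h k = by (gap h ⊕ 0≤⟪ 63 ⟫ ⊗ k) (solve (x ⸴ ∎) ring)

inside-eq : ∀ d s k → d * s * k * (d * s * k) ≡ d * d * (s * s * (k * k))
inside-eq = solve-∀ ring

k²≤n-pure₃ : ∀ s k D n N → 0# ≤ 1# → 0# ≤ D → 0# ≤ k → 1# ≤ s * k → s ≤ 1# → (1# - s) * D ≤ N → N * (k * (k - 1#)) ≤ n * D → 0# ≤ k - 1# → D * ((1# - s) * (1# - s) * (k * k)) ≤ D * n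
k²≤n-pure₃ s k D n N _ D0 k0 sk s1 c h m0 = by (gap h ⊕ gap c ⊗ (k0 ⊗ m0) ⊕ D0 ⊗ (gap s1 ⊗ (k0 ⊗ gap sk))) (solve (s ⸴ k ⸴ D ⸴ n ⸴ N ⸴ ∎) ring)

near₀-pure₂ : ∀ a k → 0# ≤ a → 0# ≤ k → k ≤ (1# + a) * k
near₀-pure₂ a k p q = by (p ⊗ q) (solve (a ⸴ k ⸴ ∎) ring)

window-impossible-pure : ∀ ν δ D w → 0# ≤ D → 0# ≤ ν → ν ≤ δ → w ≤ (1# - δ) * D → (1# - (¼ + ⅛) * ν) * D ≤ w → δ * D ≤ 0#
window-impossible-pure ν δ D w D0 ν0 h k l = cancel-≤ {c = ½ + ⅛} (<-≤-trans 0<½ (by (0≤⅛) refl)) (by (gap k ⊕ gap l ⊕ (0≤¼ ⊕ 0≤⅛) ⊗ (gap h ⊗ D0)) (solve (ν ⸴ δ ⸴ D ⸴ w ⸴ ∎) ring))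

perEdge-pure₂-2 : ∀ k z → k ≤ z → 1# * (k - 1#) ≤ 1# * (1# * (z - 1#))
perEdge-pure₂-2 k z h = by (gap h) (solve (k ⸴ z ⸴ ∎) ring)

none-pure : ∀ D ξ ν k N A → 0# < D → 0# ≤ ν → ν ≤ 1# → ⟪ 2 ⟫ * ν ≤ ξ * ξ → ⟪ 32 ⟫ ≤ ν * k → ⟪ 32 ⟫ ≤ k → ξ * D ≤ N → 0# ≤ ξ * D → A ≤ ν * (D * D) →
    N * (ξ * D * (k - 1#)) * (k - 1#) ≤ k * (k - 1#) * A + k * (D * D) → 1# ≤ 0#
none-pure D ξ ν k N A D0 ν0 ν1 ξν νk k32 N≥ ξD A≤ h = cancel-≤ (<⊗ D0 D0) (by
  (gap h ⊕ gap N≥ ⊗ (ξD ⊗ m0 ⊗ m0) ⊕ (k0 ⊗ m0) ⊗ gap A≤ ⊕ d0 ⊗ d0 ⊗ (gap ξν ⊗ (m0 ⊗ m0) ⊕ m0 ⊗ (gap νk ⊕ gap ν1) ⊕ gap ν1 ⊗ m0 ⊕ 0≤⟪ 29 ⟫ ⊗ (gap k32 ⊕ 0≤⟪ 30 ⟫) ⊕ 0≤⟪ 27 ⟫))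
  (solve (D ⸴ ξ ⸴ ν ⸴ k ⸴ N ⸴ A ⸴ ∎) ring)) where
 d0 : 0# ≤ D
 d0 = <⇒≤ D0
 k0 : 0# ≤ k
 k0 = ≤-trans 0≤⟪ 32 ⟫ k32
 m0 : 0# ≤ k - 1#
 m0 = by (gap k32 ⊕ 0≤⟪ 31 ⟫) (solve (k ⸴ ∎) ring)

none-eq : ∀ k t v m d → k * t * v * m + k * d ≡ k * m * (t * v) + k * d
none-eq = solve-∀ ring

0≤b₀-pure₀ : ∀ ν → ν ≤ 1# → 0# ≤ 1# - (¼ + ⅛) * ν
0≤b₀-pure₀ ν h = by ((0≤¼ ⊕ 0≤⅛) ⊗ gap h ⊕ 0≤½ ⊕ 0≤⅛) (solve (ν ⸴ ∎) ring)

T₀-degree-pure : ∀ D k a z X → 0# ≤ D → z ≤ (1# + a) * k → ⟪ 8 ⟫ ≤ a * k → a ≤ 1# → X * (k - 1#) ≤ z * D → (k - 1#) * X ≤ (k - 1#) * ((1# + ⟪ 2 ⟫ * a) * D)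
T₀-degree-pure D k a z X D0 zk ak a1 h = by (gap h ⊕ gap zk ⊗ D0 ⊕ D0 ⊗ (gap ak ⊕ 0≤⟪ 2 ⟫ ⊗ gap a1 ⊕ 0≤⟪ 5 ⟫)) (solve (D ⸴ k ⸴ a ⸴ z ⸴ X ⸴ ∎) ring)

0<k-1-pure : ∀ k → ⟪ 32 ⟫ ≤ k → ⟪ 31 ⟫ ≤ k - 1#
0<k-1-pure k h = by (gap h) (solve (k ⸴ ∎) ring)

8≤ak-pure : ∀ s a' a ν k → 0# ≤ a' → 0# ≤ a → 0# ≤ k → ν ≤ 1# → ⟪ 4 ⟫ * (a' + ⟪ 2 ⟫ * s) ≤ ν * a → 1# ≤ s * k → ⟪ 8 ⟫ ≤ a * k
8≤ak-pure s a' a ν k p q r u h l = by (0≤⟪ 8 ⟫ ⊗ gap l ⊕ gap h ⊗ r ⊕ 0≤⟪ 4 ⟫ ⊗ (p ⊗ r) ⊕ gap u ⊗ (q ⊗ r)) (solve (s ⸴ a' ⸴ a ⸴ ν ⸴ k ⸴ ∎) ring)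

W₁-volume-eq : ∀ k t v m d → k * t * v * m + k * d ≡ k * m * (t * v) + k * d
W₁-volume-eq = solve-∀ ring

T₀-nbrs≥-pure : ∀ N A B D s ν → N ≡ A + B → 0# ≤ D → ⟪ 32 ⟫ * s ≤ ν → 0# ≤ ν → (1# - s) * D ≤ N → B ≤ ¼ * (ν * D) → (1# - (¼ + ⅛) * ν) * D ≤ A
T₀-nbrs≥-pure N A B D s ν refl D0 h ν0 c b = by (gap c ⊕ gap b ⊕ 0≤⅛ ⊗ 0≤½ ⊗ 0≤½ ⊗ (gap h ⊗ D0) ⊕ (0≤⅛ ⊗ 0≤½ ⊕ 0≤⅛ ⊗ 0≤½ ⊗ 0≤½) ⊗ (ν0 ⊗ D0)) (solve (A ⸴ B ⸴ D ⸴ s ⸴ ν ⸴ ∎) ring)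

T₀-nbrs≥-pure₂ : ∀ s a' a ν D → 0# ≤ D → ⟪ 4 ⟫ * (a' + ⟪ 2 ⟫ * s) ≤ ν * a → (a' + ⟪ 2 ⟫ * s) * D ≤ a * (¼ * (ν * D))
T₀-nbrs≥-pure₂ s a' a ν D p h = by (0≤¼ ⊗ (gap h ⊗ p)) (solve (s ⸴ a' ⸴ a ⸴ ν ⸴ D ⸴ ∎) ring)

near≥-pure : ∀ N A B D s ν → N ≡ A + B → 0# ≤ D → ⟪ 32 ⟫ * s ≤ ν → 0# ≤ ν → (1# - s) * D ≤ N → B ≤ ⅛ * (ν * D) → (1# - ¼ * ν) * D ≤ A
near≥-pure N A B D s ν refl D0 h ν0 c b = by (gap c ⊕ gap b ⊕ 0≤⅛ ⊗ 0≤½ ⊗ 0≤½ ⊗ (gap h ⊗ D0) ⊕ (0≤⅛ ⊗ 0≤½ ⊕ 0≤⅛ ⊗ 0≤½ ⊗ 0≤½) ⊗ (ν0 ⊗ D0)) (solve (A ⸴ B ⸴ D ⸴ s ⸴ ν ⸴ ∎) ring)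

near≥-pure₂ : ∀ s a ν D → 0# ≤ D → ⟪ 16 ⟫ * s ≤ ν * a → (0# + ⟪ 2 ⟫ * s) * D ≤ a * (⅛ * (ν * D))
near≥-pure₂ s a ν D p h = by (0≤⅛ ⊗ (gap h ⊗ p)) (solve (s ⸴ a ⸴ ν ⸴ D ⸴ ∎) ring)

near≥-eq : ∀ k → k ≡ (1# + 0#) * k
near≥-eq = solve-∀ ring

rare-pure : ∀ N B k c x s D z → 0# ≤ D → 0# ≤ s → 0# ≤ k - 1# → z ≤ (1# + x) * k → 1# ≤ s * k → (1# - s) * D ≤ N → N * (k - 1#) + B * (c * k) ≤ z * D → k * (B * c) ≤ k * ((x + ⟪ 2 ⟫ * s) * D)
rare-pure N B k c x s D z D0 s0 m0 sz sk co h = by (gap h ⊕ gap sz ⊗ D0 ⊕ gap co ⊗ m0 ⊕ D0 ⊗ (gap sk ⊕ s0)) (solve (N ⸴ B ⸴ k ⸴ c ⸴ x ⸴ s ⸴ D ⸴ z ⸴ ∎) ring)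

32≤k-pure : ∀ ν k → ν ≤ 1# → 0# ≤ k → ⟪ 32 ⟫ ≤ ν * k → ⟪ 32 ⟫ ≤ k
32≤k-pure ν k a b c = by (gap c ⊕ gap a ⊗ b) (solve (ν ⸴ k ⸴ ∎) ring)

32≤νk-pure : ∀ s k ν → 0# ≤ k → 1# ≤ s * k → ⟪ 32 ⟫ * s ≤ ν → ⟪ 32 ⟫ ≤ ν * k
32≤νk-pure s k ν a b c = by (0≤⟪ 32 ⟫ ⊗ gap b ⊕ gap c ⊗ a) (solve (s ⸴ k ⸴ ν ⸴ ∎) ring)

lem-eq-8 : ∀ x → 1# * x ≡ 0# * x + 1# * x
lem-eq-8 = solve-∀ ring

lem-eq-9 : ∀ x → 1# * x ≡ 1# * x + 0# * x
lem-eq-9 = solve-∀ ring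

lem-eq-10 : ∀ x → 0# * x ≡ 0# * x + 0# * x
lem-eq-10 = solve-∀ ring

perEdge-pure : ∀ k s c → (1# + c) * k ≤ s → 1# * (k - 1#) + 1# * (c * k) ≤ 1# * (1# * (s - 1#))
perEdge-pure k s c h = by (gap h) (solve (k ⸴ s ⸴ c ⸴ ∎) ring)

perEdge-pure-2 : ∀ k s x → k ≤ s → 1# * (k - 1#) + 0# * x ≤ 1# * (1# * (s - 1#))
perEdge-pure-2 k s x h = by (gap h) (solve (k ⸴ s ⸴ x ⸴ ∎) ring)

perEdge-pure-3 : ∀ k s → k ≤ s → 1# * (k - 1#) ≤ 1# * (1# * (s - 1#))
perEdge-pure-3 k s h = by (gap h) (solve (k ⸴ s ⸴ ∎) ring)

tvol≤-eq : ∀ t n D → t * (n * D) ≡ t * n * D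
tvol≤-eq = solve-∀ ring

module LargeEdges {E V : Set} (_≟ₑ_ : DecidableEquality E) (_≟ᵥ_ : DecidableEquality V)
 (vs : List V) (vs! : AllPairs _≢_ vs) (vs-all : ∀ v → v ∈ vs) (es : List E) (es! : AllPairs _≢_ es) (es-all : ∀ e → e ∈ es)
 (inc : E → V → Bool) (cs : List ℕ) (cs! : AllPairs _≢_ cs)
 (meet-refl : ∀ e → Incidence.meet _≟ᵥ_ vs vs! inc e e ≡ true) (nonempty : ∀ e → 1# ≤ Incidence.size _≟ᵥ_ vs vs! inc e)
 (t : ℚ) (0≤t : 0# ≤ t) (codeg : ∀ u v → u ≢ v → ∑[ e ∈ es ] Incidence.i _≟ᵥ_ vs vs! inc e u * Incidence.i _≟ᵥ_ vs vs! inc e v ≤ t) where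

 open Incidence _≟ᵥ_ vs vs! inc
 open Counting _≟ᵥ_ vs vs! vs-all es inc using (n; D; vol; vol≡; vol≤; meeting≤sizeD; volume; pairs; dW; 0≤dW)
 private
  D₀ n₀ : ℚ
  n₀ = n nonempty t 0≤t codeg
  D₀ = D nonempty t 0≤t codeg
  vol₀ : (E → Bool) → ℚ
  vol₀ = vol nonempty t 0≤t codeg

 open Graph _≟ₑ_ es es! es-all meet (Matching.meet-sym _≟ᵥ_ vs vs! vs-all es es-all inc) cs cs! public

 emptyColouring : ∀ {S Λ} → (∀ e → S e ≡ true → ⊥) → Colouring S Λ
 emptyColouring none = record { φ = λ _ → nothing ; φ-proper = λ _ _ _ _ () ; φ-total = λ e p → ⊥-elim (none e p) ; φ-only = λ _ _ () ; φ-list = λ _ _ () }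

 smallest : ∀ (W : E → Bool) → (∀ e → W e ≡ true → ⊥) ⊎ (∃ λ e₀ → W e₀ ≡ true × (∀ e → W e ≡ true → size e₀ ≤ size e))
 smallest W = go (filterᵇ W es) (filter-true W es) (λ e p → filter-∈ W (es-all e) p) where
  go : ∀ ws → All (λ e → W e ≡ true) ws → (∀ e → W e ≡ true → e ∈ ws) → (∀ e → W e ≡ true → ⊥) ⊎ (∃ λ e₀ → W e₀ ≡ true × (∀ e → W e ≡ true → size e₀ ≤ size e))
  go [] _ mem = inj₁ (λ e p → absurd (mem e p)) where
   absurd : ∀ {e : E} → e ∈ [] → ⊥
   absurd ()
  go (w ∷ ws) all mem = inj₂ (pick (maximum w ws (λ e → - size e))) where
   flip : ∀ a b → - a ≤ - b → b ≤ a
   flip a b h = by (gap h) (solve (a ⸴ b ⸴ ∎) ring)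
   pick : (∃ λ e → e ∈ w ∷ ws × All (λ z → - size z ≤ - size e) (w ∷ ws)) → ∃ λ e₀ → W e₀ ≡ true × (∀ e → W e ≡ true → size e₀ ≤ size e)
   pick (e₀ , m , h) = e₀ , All.lookup all m , λ e p → flip (size e) (size e₀) (All.lookup h (mem e p))

 weighted : ∀ (W : E → Bool) f k → (∀ e → W e ≡ true → k ≤ size e) → nbrs W f * (k - 1#) ≤ ∑[ g ∈ es ] 𝟙 (W g) * (j f g * (size g - 1#))
 weighted W f k big = ≡≤ (sym (∑-*ʳ es (k - 1#) (λ g → 𝟙 (W g ∧ adj f g)))) (∑-mono es (λ g → perEdge g (W g) refl (adj f g) refl)) where
  perEdge : ∀ g b → W g ≡ b → ∀ c → adj f g ≡ c → 𝟙 (b ∧ c) * (k - 1#) ≤ 𝟙 b * (j f g * (size g - 1#))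
  perEdge g false _ c _ = ≤-reflexive (vanish (k - 1#) (j f g * (size g - 1#))) where
   vanish : ∀ a b → 0# * a ≡ 0# * b
   vanish = solve-∀ ring
  perEdge g true eq false _ = ≡≤ (*-zeroˡ (k - 1#)) (0≤1 ⊗ (0≤j f g ⊗ gap (nonempty g)))
  perEdge g true eq true a = subst (λ m → 1# * (k - 1#) ≤ 1# * (𝟙 m * (size g - 1#))) (sym (∧-true₁ (meet f g) a)) (perEdge-pure-3 k (size g) (big g eq))

 large : ℚ → E → Bool
 large x g = not (does (size g ≤? x))

 -- Neighbours of f that are a factor 1 + c larger than the smallest edge are rare.
 big-nbrs : ∀ (W : E → Bool) f k c → 0# ≤ c * k → (∀ e → W e ≡ true → k ≤ size e) →
       nbrs W f * (k - 1#) + nbrs (λ g → W g ∧ large ((1# + c) * k) g) f * (c * k) ≤ size f * D₀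
 big-nbrs W f k c 0≤ck big = ≡≤ (trans (cong₂ _+_ (sym (∑-*ʳ es (k - 1#) (λ g → 𝟙 (W g ∧ adj f g)))) (sym (∑-*ʳ es (c * k) (λ g → 𝟙 ((W g ∧ large ((1# + c) * k) g) ∧ adj f g)))))
    (sym (∑-+ es (λ g → 𝟙 (W g ∧ adj f g) * (k - 1#)) (λ g → 𝟙 ((W g ∧ large ((1# + c) * k) g) ∧ adj f g) * (c * k)))))
   (≤-trans (∑-mono es (λ g → perEdge g (W g) refl (adj f g) refl (size g ≤? (1# + c) * k))) (meeting≤sizeD nonempty t 0≤t codeg W f)) where
  perEdge : ∀ g b → W g ≡ b → ∀ a → adj f g ≡ a → (d : Dec (size g ≤ (1# + c) * k)) → 𝟙 (b ∧ a) * (k - 1#) + 𝟙 ((b ∧ not (does d)) ∧ a) * (c * k) ≤ 𝟙 b * (j f g * (size g - 1#))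
  perEdge g false _ a _ d = ≤-reflexive (vanish (k - 1#) (c * k) (j f g * (size g - 1#))) where
   vanish : ∀ a b c → 0# * a + 0# * b ≡ 0# * c
   vanish = solve-∀ ring
  perEdge g true eq false _ (yes _) = ≡≤ (vanish (k - 1#) (c * k)) (0≤1 ⊗ (0≤j f g ⊗ gap (nonempty g))) where
   vanish : ∀ a b → 0# * a + 0# * b ≡ 0#
   vanish = solve-∀ ring
  perEdge g true eq false _ (no _) = ≡≤ (vanish (k - 1#) (c * k)) (0≤1 ⊗ (0≤j f g ⊗ gap (nonempty g))) where
   vanish : ∀ a b → 0# * a + 0# * b ≡ 0#
   vanish = solve-∀ ring
  perEdge g true eq true a (yes _) = subst (λ m → 1# * (k - 1#) + 0# * (c * k) ≤ 1# * (𝟙 m * (size g - 1#))) (sym (∧-true₁ (meet f g) a)) (perEdge-pure-2 k (size g) (c * k) (big g eq))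
  perEdge g true eq true a (no bigger) = subst (λ m → 1# * (k - 1#) + 1# * (c * k) ≤ 1# * (𝟙 m * (size g - 1#))) (sym (∧-true₁ (meet f g) a)) (perEdge-pure k (size g) c (<⇒≤ (≰⇒> bigger)))

 -- Splitting the neighbourhood into edges of size at most x and the rest.
 nbrs-split : ∀ (W : E → Bool) x f → nbrs W f ≡ nbrs (λ g → W g ∧ does (size g ≤? x)) f + nbrs (λ g → W g ∧ large x g) f
 nbrs-split W x f = trans (∑-cong es (λ g → lem (W g) (does (size g ≤? x)) (adj f g))) (∑-+ es (λ g → 𝟙 ((W g ∧ does (size g ≤? x)) ∧ adj f g)) (λ g → 𝟙 ((W g ∧ large x g) ∧ adj f g))) where
  lem : ∀ a b c → 𝟙 (a ∧ c) ≡ 𝟙 ((a ∧ b) ∧ c) + 𝟙 ((a ∧ not b) ∧ c)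
  lem false b c = refl
  lem true true true = refl
  lem true true false = refl
  lem true false true = refl
  lem true false false = refl

 vol-mono : ∀ (W W' : E → Bool) → (∀ e → W e ≡ true → W' e ≡ true) → vol₀ W ≤ vol₀ W'
 vol-mono W W' h = ∑-mono vs (λ v → ∑-mono es (λ e → *-monoʳ (0≤i e v ⊗ gap (nonempty e)) (𝟙-mono (W e) (W' e) (h e))))

 vol-split : ∀ (W p : E → Bool) → vol₀ W ≡ vol₀ (λ e → W e ∧ p e) + vol₀ (λ e → W e ∧ not (p e))
 vol-split W p = trans (∑-cong vs (λ v → trans (∑-cong es (λ e → lem (W e) (p e) (i e v * (size e - 1#)))) (∑-+ es (λ e → 𝟙 (W e ∧ p e) * (i e v * (size e - 1#))) (λ e → 𝟙 (W e ∧ not (p e)) * (i e v * (size e - 1#))))))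
   (∑-+ vs (dW nonempty t 0≤t codeg (λ e → W e ∧ p e)) (dW nonempty t 0≤t codeg (λ e → W e ∧ not (p e)))) where
  lem : ∀ a b x → 𝟙 a * x ≡ 𝟙 (a ∧ b) * x + 𝟙 (a ∧ not b) * x
  lem false b x = lem-eq-10 x
  lem true true x = lem-eq-9 x
  lem true false x = lem-eq-8 x

 tvol≤ : ∀ W → t * vol₀ W ≤ D₀ * D₀
 tvol≤ W = ≤-trans (*-monoˡ 0≤t (vol≤ nonempty t 0≤t codeg W)) (≤-reflexive (tvol≤-eq t n₀ D₀))

 -- Two size scales are needed, because the neighbours of `e₀` collected in `near` must in turn have
 -- almost all their neighbours in `T₀`. Hence `s` is small against `a'` and `a'` against `a`, each
 -- by a factor of order `ν`.
 module Core (s a' a ν : ℚ) (0<s : 0# < s) (0<a' : 0# < a') (0<a : 0# < a) (h₁ : ⟪ 16 ⟫ * s ≤ ν * a') (h₂ : ⟪ 4 ⟫ * (a' + ⟪ 2 ⟫ * s) ≤ ν * a)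
       (h₃ : ⟪ 32 ⟫ * s ≤ ν) (ν≤1 : ν ≤ 1#) (0<D : 0# < D₀)
       (W : E → Bool) (core : ∀ e → W e ≡ true → (1# - s) * D₀ ≤ nbrs W e)
       (e₀ : E) (W₀ : W e₀ ≡ true) (least : ∀ e → W e ≡ true → size e₀ ≤ size e) (sk : 1# ≤ s * size e₀) where

  k : ℚ
  k = size e₀

  0≤s : 0# ≤ s
  0≤s = <⇒≤ 0<s

  0≤D : 0# ≤ D₀
  0≤D = <⇒≤ 0<D

  0<k : 0# < k
  0<k = <-≤-trans 0<1 (nonempty e₀)

  0≤k : 0# ≤ k
  0≤k = <⇒≤ 0<k

  0≤ν : 0# ≤ ν
  0≤ν = ≤-trans (0≤⟪ 32 ⟫ ⊗ 0≤s) h₃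

  32≤νk : ⟪ 32 ⟫ ≤ ν * k
  32≤νk = 32≤νk-pure s k ν 0≤k sk h₃

  32≤k : ⟪ 32 ⟫ ≤ k
  32≤k = 32≤k-pure ν k ν≤1 0≤k 32≤νk

  -- The neighbours of `f` have total weight at most `size f * D₀`. Being at least `(1# - s) * D₀`
  -- many, of weight at least `k - 1#` each, they nearly exhaust it, and every larger neighbour uses
  -- an excess `c * k`.
  rare : ∀ f x c → W f ≡ true → 0# ≤ c → size f ≤ (1# + x) * k → nbrs (λ g → W g ∧ large ((1# + c) * k) g) f * c ≤ (x + ⟪ 2 ⟫ * s) * D₀
  rare f x c Wf 0≤c sz = cancel-≤ 0<k (rare-pure (nbrs W f) (nbrs (λ g → W g ∧ large ((1# + c) * k) g) f) k c x s D₀ (size f) 0≤D (<⇒≤ 0<s) (gap (nonempty e₀)) sz sk (core f Wf) (big-nbrs W f k c (0≤c ⊗ 0≤k) least))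

  near : E → Bool
  near g = W g ∧ does (size g ≤? (1# + a') * k)

  T₀ W₁ : E → Bool
  T₀ g = W g ∧ does (size g ≤? (1# + a) * k)
  W₁ g = W g ∧ large ((1# + a) * k) g

  near≥ : (1# - ¼ * ν) * D₀ ≤ nbrs near e₀
  near≥ = near≥-pure (nbrs W e₀) (nbrs near e₀) (nbrs (λ g → W g ∧ large ((1# + a') * k) g) e₀) D₀ s ν (nbrs-split W ((1# + a') * k) e₀) 0≤D h₃ 0≤ν (core e₀ W₀)
    (cancel-≤ 0<a' (≡≤ (*-comm a' (nbrs (λ g → W g ∧ large ((1# + a') * k) g) e₀)) (≤-trans (rare e₀ 0# a' W₀ (<⇒≤ 0<a') (≤-reflexive (near≥-eq k))) (near≥-pure₂ s a' ν D₀ 0≤D h₁))))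

  T₀-nbrs≥ : ∀ g → near g ≡ true → (1# - (¼ + ⅛) * ν) * D₀ ≤ nbrs T₀ g
  T₀-nbrs≥ g ng = T₀-nbrs≥-pure (nbrs W g) (nbrs T₀ g) (nbrs W₁ g) D₀ s ν (nbrs-split W ((1# + a) * k) g) 0≤D h₃ 0≤ν (core g Wg)
    (cancel-≤ 0<a (≡≤ (*-comm a (nbrs W₁ g)) (≤-trans (rare g a' a Wg (<⇒≤ 0<a) (does-true (size g ≤? (1# + a') * k) (∧-true₂ (W g) ng))) (T₀-nbrs≥-pure₂ s a' a ν D₀ 0≤D h₂)))) where
   Wg : W g ≡ true
   Wg = ∧-true₁ (W g) ng

  -- The edges of nearly minimal size cover almost all pairs of vertices.
  W₁-volume : t * vol₀ W₁ ≤ ν * (D₀ * D₀)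
  W₁-volume = pure (t * vol₀ T₀) (t * vol₀ W₁) D₀ ν k (nbrs near e₀) (<⇒≤ 0<D) 0≤ν ν≤1 32≤νk 32≤k
    (≡≤ (trans (sym (*-distribˡ-+ t (vol₀ T₀) (vol₀ W₁))) (cong (t *_) (sym (vol-split W (λ g → does (size g ≤? (1# + a) * k)))))) (tvol≤ W))
    near≥ (≤-trans (volume nonempty t 0≤t codeg (λ g → near g ∧ adj e₀ g) T₀ e₀ b₀ k 0≤b₀ (nonempty e₀) refl (λ g p → ∧-true₁ (meet e₀ g) (∧-true₂ (near g) p))
      (λ e p → least e (∧-true₁ (W e) (∧-true₁ (near e) p))) heavy) (≤-reflexive (W₁-volume-eq k t (vol₀ T₀) (k - 1#) (D₀ * D₀)))) where
   b₀ : ℚ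
   b₀ = (1# - (¼ + ⅛) * ν) * D₀ * (k - 1#)
   0≤b₀ : 0# ≤ b₀
   0≤b₀ = 0≤b₀-pure₀ ν ν≤1 ⊗ 0≤D ⊗ gap (nonempty e₀)
   heavy : ∀ g → near g ∧ adj e₀ g ≡ true → b₀ ≤ ∑[ f ∈ es ] 𝟙 (T₀ f) * (j g f * (size f - 1#))
   heavy g p = ≤-trans (*-monoʳ (gap (nonempty e₀)) (T₀-nbrs≥ g (∧-true₁ (near g) p))) (weighted T₀ g k (λ e q → least e (∧-true₁ (W e) q)))
   pure : ∀ A B D ν k M → 0# ≤ D → 0# ≤ ν → ν ≤ 1# → ⟪ 32 ⟫ ≤ ν * k → ⟪ 32 ⟫ ≤ k → A + B ≤ D * D → (1# - ¼ * ν) * D ≤ M →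
       M * ((1# - (¼ + ⅛) * ν) * D * (k - 1#)) * (k - 1#) ≤ k * (k - 1#) * A + k * (D * D) → B ≤ ν * (D * D)
   pure A B D ν k M D0 ν0 ν1 νk k32 AB M≥ h = by (gap AB ⊕ gap A≥) (solve (A ⸴ B ⸴ D ⸴ ν ⸴ ∎) ring) where
    m0 : 0# ≤ k - 1#
    m0 = by (gap k32 ⊕ 0≤⟪ 31 ⟫) (solve (k ⸴ ∎) ring)
    0<km : 0# < k * (k - 1#)
    0<km = <⊗ (<-≤-trans 0<⟦ 31 ⟧ k32) (<-≤-trans 0<⟦ 30 ⟧ (by (gap k32) (solve (k ⸴ ∎) ring)))
    c0 : 0# ≤ 1# - (¼ + ⅛) * ν
    c0 = by ((0≤¼ ⊕ 0≤⅛) ⊗ gap ν1 ⊕ 0≤½ ⊕ 0≤⅛) (solve (ν ⸴ ∎) ring)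
    A≥ : (1# - ν) * (D * D) ≤ A
    A≥ = cancel-≤ 0<km (by (gap h ⊕ gap M≥ ⊗ (c0 ⊗ D0 ⊗ m0 ⊗ m0) ⊕ D0 ⊗ D0 ⊗ (m0 ⊗ m0 ⊗ (0≤⅛ ⊗ (0≤½ ⊕ 0≤¼) ⊗ (ν0 ⊗ ν0)) ⊕ (0≤⅛ ⊗ 0≤⟪ 3 ⟫) ⊗ (m0 ⊗ (gap νk ⊕ gap ν1)) ⊕ ν0 ⊗ m0 ⊕ 0≤⟪ 9 ⟫ ⊗ m0 ⊕ (0≤½ ⊕ 0≤⅛) ⊗ gap k32 ⊕ 0≤⅛ ⊗ 0≤⟪ 147 ⟫)) (solve (A ⸴ D ⸴ ν ⸴ k ⸴ M ⸴ ∎) ring))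

  -- Hence the remaining edges are degenerate.
  W₁-degenerate : ∀ ξ → 0# ≤ ξ → ⟪ 2 ⟫ * ν ≤ ξ * ξ → ∀ Λ → (∀ e → ξ * D₀ ≤ avail Λ e) → Colouring W₁ Λ
  W₁-degenerate ξ 0≤ξ ξ² Λ lists = reduceToCore Λ (ξ * D₀) lists (countᵇ W₁ es) W₁ ℕₚ.≤-refl (λ W* sub core* → emptyColouring (λ e p → none W* sub core* (smallest W*) e p)) where
   -- By `volume` applied to its smallest edge, a nonempty set of minimum degree `ξ * D₀` would have
   -- `t` times its volume at least about `ξ * ξ * (D₀ * D₀)`, which `W₁-volume` and `2ν ≤ ξ²`
   -- exclude.
   none : ∀ W* → (∀ e → W* e ≡ true → W₁ e ≡ true) → (∀ e → W* e ≡ true → ξ * D₀ ≤ nbrs W* e) →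
       (∀ e → W* e ≡ true → ⊥) ⊎ (∃ λ e₁ → W* e₁ ≡ true × (∀ e → W* e ≡ true → size e₁ ≤ size e)) → ∀ e → W* e ≡ true → ⊥
   none W* sub core* (inj₁ empty) = empty
   none W* sub core* (inj₂ (e₁ , W*e₁ , least₁)) = λ _ _ → <⇒¬≥ 0<1 (none-pure D₀ ξ ν (size e₁) (nbrs W* e₁) (t * vol₀ W*) 0<D 0≤ν ν≤1 ξ²
      (≤-trans 32≤νk (*-monoˡ 0≤ν k≤)) (≤-trans 32≤k k≤) (core* e₁ W*e₁) (0≤ξ ⊗ 0≤D)
      (≤-trans (*-monoˡ 0≤t (vol-mono W* W₁ sub)) W₁-volume)
      (≤-trans (volume nonempty t 0≤t codeg (λ g → W* g ∧ adj e₁ g) W* e₁ (ξ * D₀ * (size e₁ - 1#)) (size e₁) (0≤ξ ⊗ 0≤D ⊗ gap (nonempty e₁)) (nonempty e₁) refl (λ g p → ∧-true₁ (meet e₁ g) (∧-true₂ (W* g) p))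
       (λ e p → least₁ e (∧-true₁ (W* e) p)) (λ g p → ≤-trans (*-monoʳ (gap (nonempty e₁)) (core* g (∧-true₁ (W* g) p))) (weighted W* g (size e₁) least₁))) (≤-reflexive (none-eq (size e₁) t (vol₀ W*) (size e₁ - 1#) (D₀ * D₀))))) where
    k≤ : k ≤ size e₁
    k≤ = least e₁ (∧-true₁ (W e₁) (sub e₁ W*e₁))

  8≤ak : ⟪ 8 ⟫ ≤ a * k
  8≤ak = 8≤ak-pure s a' a ν k (<⇒≤ 0<a') (<⇒≤ 0<a) 0≤k ν≤1 h₂ sk

  0<k-1 : 0# < k - 1#
  0<k-1 = <-≤-trans 0<⟦ 30 ⟧ (0<k-1-pure k 32≤k)

  T₀⇒W : ∀ e → T₀ e ≡ true → W e ≡ true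
  T₀⇒W e = ∧-true₁ (W e)

  T₀-size : ∀ e → T₀ e ≡ true → size e ≤ (1# + a) * k
  T₀-size e p = does-true (size e ≤? (1# + a) * k) (∧-true₂ (W e) p)

  Δ : ℚ
  Δ = (1# + ⟪ 2 ⟫ * a) * D₀

  -- The weight bound `size e * D₀` is divided by the least weight `k - 1#`; since `8 ≤ a * k`, a
  -- second `a` absorbs the difference between `k` and `k - 1#`.
  T₀-degree : a ≤ 1# → ∀ e → T₀ e ≡ true → ∑[ g ∈ es ] 𝟙 (T₀ g ∧ meet e g) ≤ Δ
  T₀-degree a≤1 e p = cancel-≤ 0<k-1 (T₀-degree-pure D₀ k a (size e) (∑[ g ∈ es ] 𝟙 (T₀ g ∧ meet e g)) 0≤D (T₀-size e p) 8≤ak a≤1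
    (≤-trans (≡≤ (sym (∑-*ʳ es (k - 1#) (λ g → 𝟙 (T₀ g ∧ meet e g)))) (∑-mono es (λ g → perEdge g (T₀ g) refl (meet e g)))) (meeting≤sizeD nonempty t 0≤t codeg T₀ e))) where
   perEdge : ∀ g b → T₀ g ≡ b → ∀ m → 𝟙 (b ∧ m) * (k - 1#) ≤ 𝟙 b * (𝟙 m * (size g - 1#))
   perEdge g false eq m = ≤-reflexive (vanish (k - 1#) (𝟙 m * (size g - 1#))) where
    vanish : ∀ a b → 0# * a ≡ 0# * b
    vanish = solve-∀ ring
   perEdge g true eq false = ≤-reflexive (vanish (k - 1#) (size g - 1#)) where
    vanish : ∀ a b → 0# * a ≡ 1# * (0# * b)
    vanish = solve-∀ ring
   perEdge g true eq true = perEdge-pure₂-2 k (size g) (least g (T₀⇒W g eq))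

  module _ (δ : ℚ) (0<δ : 0# < δ) (δ≤1 : δ ≤ 1#) where

   -- If the smallest size is at least (1-δ)√n, nearly all neighbours of e₀ lie in the window.
   window-impossible : ν ≤ δ → 1# + a ≤ (1# + δ) * (1# - s) → (1# - δ) * (1# - δ) * n₀ ≤ k * k → ∀ (win : E → Bool) →
        (∀ e → (1# - δ) * (1# - δ) * n₀ ≤ size e * size e → size e * size e ≤ (1# + δ) * (1# + δ) * n₀ → win e ≡ true) →
        ∑[ e ∈ es ] 𝟙 (win e) ≤ (1# - δ) * D₀ → ⊥
   window-impossible ν≤δ aδ k² win win-intro count = <⇒¬≥ (<⊗ 0<δ 0<D) (window-impossible-pure ν δ D₀ (∑[ e ∈ es ] 𝟙 (win e)) 0≤D 0≤ν ν≤δ count (≤-trans (T₀-nbrs≥ e₀ near₀) (∑-mono es (λ g → 𝟙-mono (T₀ g ∧ adj e₀ g) (win g) (λ p → inside g (∧-true₁ (T₀ g) p)))))) where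
    near₀ : near e₀ ≡ true
    near₀ = ∧-intro W₀ (dec-true (size e₀ ≤? (1# + a') * k) (near₀-pure₂ a' k (<⇒≤ 0<a') 0≤k)) where
     dec-true : ∀ {P : Set} (d : Dec P) → P → does d ≡ true
     dec-true (yes _) _ = refl
     dec-true (no ¬p) p = ⊥-elim (¬p p)
    sq-mono : ∀ x y → 0# ≤ x → x ≤ y → x * x ≤ y * y
    sq-mono x y p h = *-mono p (≤-trans p h) h h
    -- The neighbours of `e₀` alone contain about `(1# - s) * D₀ * (k * k)` ordered pairs of
    -- vertices, and `vol≤` allows `n₀ * D₀`.
    k²≤n : (1# - s) * (1# - s) * (k * k) ≤ n₀
    k²≤n = cancel-≤ 0<D (k²≤n-pure₃ s k D₀ n₀ (nbrs W e₀) (≤-trans 0≤s s≤1) 0≤D 0≤k sk s≤1 (core e₀ W₀) (≤-trans vol-lower (≡≤ (sym (vol≡ nonempty t 0≤t codeg W)) (vol≤ nonempty t 0≤t codeg W))) (gap (nonempty e₀))) where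
     s≤1 : s ≤ 1#
     s≤1 = s≤1-pure₄ s ν h₃ ν≤1 0≤s
     vol-lower : nbrs W e₀ * (k * (k - 1#)) ≤ ∑[ e ∈ es ] 𝟙 (W e) * (size e * (size e - 1#))
     vol-lower = ≡≤ (sym (∑-*ʳ es (k * (k - 1#)) (λ g → 𝟙 (W g ∧ adj e₀ g)))) (∑-mono es (λ g → perEdge g (W g) refl (adj e₀ g))) where
      perEdge : ∀ g b → W g ≡ b → ∀ c → 𝟙 (b ∧ c) * (k * (k - 1#)) ≤ 𝟙 b * (size g * (size g - 1#))
      perEdge g false eq c = ≤-reflexive (trans (*-zeroˡ (k * (k - 1#))) (sym (*-zeroˡ (size g * (size g - 1#)))))
      perEdge g true eq c = *-mono (0≤𝟙 c) (0≤size g ⊗ gap (nonempty g)) (𝟙≤1 c) (*-mono 0≤k (gap (nonempty g)) (least g eq) (+-mono-≤ (least g eq) (≤-refl { - 1#})))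
    inside : ∀ g → T₀ g ≡ true → win g ≡ true
    inside g p = win-intro g (≤-trans k² (sq-mono k (size g) 0≤k (least g (T₀⇒W g p))))
     (≤-trans (sq-mono (size g) ((1# + a) * k) (0≤size g) (T₀-size g p)) (≤-trans (sq-mono ((1# + a) * k) ((1# + δ) * (1# - s) * k) ((0≤1 ⊕ <⇒≤ 0<a) ⊗ 0≤k) (*-monoʳ 0≤k aδ))
      (≡≤ (inside-eq (1# + δ) (1# - s) k) (*-monoˡ ((0≤1 ⊕ <⇒≤ 0<δ) ⊗ (0≤1 ⊕ <⇒≤ 0<δ)) k²≤n))))

   β : ℚ
   β = ¼ * δ

   -- Below the window, the neighbourhood of an edge contains many disjoint pairs.
   T₀-sparse : a ≤ 1# → ⟪ 64 ⟫ * a ≤ δ → ⟪ 64 ⟫ * s ≤ δ → k * k ≤ (1# - δ) * (1# - δ) * n₀ → ∀ K' → (1# - inv 64 * δ) * D₀ ≤ K' → ∀ f → T₀ f ≡ true → ∀ N m → K' ≤ N → 0# ≤ N →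
         m ≤ (∑[ g ∈ es ] ∑[ h ∈ es ] 𝟙 (T₀ g ∧ meet f g) * (𝟙 (T₀ h ∧ meet f h) * j g h)) → m + β * (Δ * Δ) ≤ N * N
   T₀-sparse a≤1 64a 64s k² K' K'≥ f p N m K'≤N 0≤N m≤ = ≤-trans (+-mono-≤ (≤-trans m≤ P≤) (≤-refl {β * (Δ * Δ)})) (≤-trans numeric (*-mono 0≤x (0≤N) (≤-trans K'≥ K'≤N) (≤-trans K'≥ K'≤N))) where
    P A : ℚ
    P = ∑[ g ∈ es ] ∑[ h ∈ es ] 𝟙 (T₀ g ∧ meet f g) * (𝟙 (T₀ h ∧ meet f h) * j g h)
    A = 1# + a
    x : ℚ
    x = inv 64 * δ
    x64 : ⟪ 64 ⟫ * x ≡ δ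
    x64 = trans (sym (*-assoc ⟪ 64 ⟫ (inv 64) δ)) (trans (cong (_* δ) (*inv 63)) (*-identityˡ δ))
    x≤1 : x ≤ 1#
    x≤1 = x≤1-pure₀ x δ x64 δ≤1 (0≤inv 64 ⊗ <⇒≤ 0<δ)
    0≤x : 0# ≤ (1# - x) * D₀
    0≤x = gap x≤1 ⊗ 0≤D
    -- `pairs` allows about `t * k * k` meetings for each neighbour, and the bound on `k * k` turns
    -- this into `(1 - δ)²D₀`. Lower-order terms are collected in the summand with `s`, by
    -- `1 ≤ s * k`.
    P≤ : P ≤ A * A * ((1# - δ) * (1# - δ)) * (D₀ * Δ) + ⟪ 4 ⟫ * s * A * (D₀ * D₀)
    P≤ = cancel-≤ (<⊗ 0<k-1 0<k-1) (pure P t (size f) A k (∑[ g ∈ es ] 𝟙 (T₀ g ∧ meet f g)) D₀ Δ s ((1# - δ) * (1# - δ)) n₀ 0≤t (0≤size f) (0≤1 ⊕ <⇒≤ 0<a) 0≤k 0≤D (0≤1 ⊕ 0≤⟪ 2 ⟫ ⊗ <⇒≤ 0<a) 0≤s (sq≥0 (1# - δ))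
      (∑-nonneg es (λ g → 0≤𝟙 (T₀ g ∧ meet f g))) (T₀-size f p) (T₀-degree a≤1 f p) k² sk 32≤k (pairs nonempty t 0≤t codeg T₀ f k (A * k) (nonempty e₀) (λ e q → least e (T₀⇒W e q)) T₀-size)) where
     pure : ∀ P t z A k X D Δ s d n → 0# ≤ t → 0# ≤ z → 0# ≤ A → 0# ≤ k → 0# ≤ D → 0# ≤ 1# + ⟪ 2 ⟫ * a → 0# ≤ s → 0# ≤ d → 0# ≤ X → z ≤ A * k → X ≤ Δ → k * k ≤ d * n → 1# ≤ s * k → ⟪ 32 ⟫ ≤ k →
         P * ((k - 1#) * (k - 1#)) ≤ t * z * (A * k) * X * ((k - 1#) * (k - 1#)) + z * (D * D) →
         (k - 1#) * (k - 1#) * P ≤ (k - 1#) * (k - 1#) * (A * A * d * (t * n * Δ) + ⟪ 4 ⟫ * s * A * (D * D))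
     pure P t z A k X D Δ s d n t0 z0 A0 k0 D0 _ s0 d0 X0 zk XΔ kd sk k32 h = by
       (gap h ⊕ t0 ⊗ (gap zk ⊗ (A0 ⊗ k0 ⊗ X0)) ⊗ (m0 ⊗ m0) ⊕ t0 ⊗ (A0 ⊗ A0 ⊗ (k0 ⊗ k0) ⊗ gap XΔ) ⊗ (m0 ⊗ m0) ⊕ t0 ⊗ (A0 ⊗ A0 ⊗ (gap kd ⊗ Δ0)) ⊗ (m0 ⊗ m0)
        ⊕ gap zk ⊗ (D0 ⊗ D0) ⊕ A0 ⊗ (D0 ⊗ D0) ⊗ (k0 ⊗ gap sk ⊕ (0≤⟪ 2 ⟫ ⊗ k0 ⊗ s0) ⊗ (gap k32 ⊕ 0≤⟪ 28 ⟫) ⊕ s0 ⊗ (k0 ⊗ k0 ⊕ 0≤⟪ 4 ⟫))) (solve (P ⸴ t ⸴ z ⸴ A ⸴ k ⸴ X ⸴ D ⸴ Δ ⸴ s ⸴ d ⸴ n ⸴ ∎) ring) where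
      m0 : 0# ≤ k - 1#
      m0 = by (gap k32 ⊕ 0≤⟪ 31 ⟫) (solve (k ⸴ ∎) ring)
      Δ0 : 0# ≤ Δ
      Δ0 = ≤-trans X0 XΔ
    numeric : A * A * ((1# - δ) * (1# - δ)) * (D₀ * Δ) + ⟪ 4 ⟫ * s * A * (D₀ * D₀) + β * (Δ * Δ) ≤ (1# - x) * D₀ * ((1# - x) * D₀)
    numeric = pure a s x δ D₀ (<⇒≤ 0<a) 0≤s (0≤inv 64 ⊗ <⇒≤ 0<δ) x64 64a 64s δ≤1 (0≤D ⊗ 0≤D) where
     pure : ∀ a s x δ D → 0# ≤ a → 0# ≤ s → 0# ≤ x → ⟪ 64 ⟫ * x ≡ δ → ⟪ 64 ⟫ * a ≤ δ → ⟪ 64 ⟫ * s ≤ δ → δ ≤ 1# → 0# ≤ D * D →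
         (1# + a) * (1# + a) * ((1# - δ) * (1# - δ)) * (D * ((1# + ⟪ 2 ⟫ * a) * D)) + ⟪ 4 ⟫ * s * (1# + a) * (D * D) + ¼ * δ * ((1# + ⟪ 2 ⟫ * a) * D * ((1# + ⟪ 2 ⟫ * a) * D)) ≤ (1# - x) * D * ((1# - x) * D)
     pure a s x δ D a0 s0 x0 refl ha hs h1 d0 = by
       (d0 ⊗ (gap t₁ ⊗ (gap h1 ⊗ gap h1) ⊕ (0≤1 ⊕ 0≤⟪ 5 ⟫ ⊗ x0) ⊗ (gap h1 ⊗ (0≤⟪ 64 ⟫ ⊗ x0)) ⊕ 0≤⟪ 4 ⟫ ⊗ (gap s≤x ⊗ (0≤1 ⊕ a0)) ⊕ 0≤⟪ 4 ⟫ ⊗ (x0 ⊗ gap a≤x)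
        ⊕ 0≤⟪ 16 ⟫ ⊗ (x0 ⊗ (0≤⟪ 2 ⟫ ⊗ gap a≤x ⊗ (0≤⟪ 2 ⟫ ⊕ 0≤⟪ 2 ⟫ ⊗ a0 ⊕ 0≤⟪ 2 ⟫ ⊗ x0))) ⊕ 0≤⟪ 37 ⟫ ⊗ x0 ⊕ 0≤⟪ 252 ⟫ ⊗ (x0 ⊗ x0) ⊕ x0 ⊗ x0 ⊗ gap h1))
       (solve (a ⸴ s ⸴ x ⸴ D ⸴ ∎) ring) where
      a≤x : a ≤ x
      a≤x = cancel-≤ 0<⟦ 63 ⟧ ha
      s≤x : s ≤ x
      s≤x = cancel-≤ 0<⟦ 63 ⟧ hs
      t₁ : (1# + a) * (1# + a) * (1# + ⟪ 2 ⟫ * a) ≤ 1# + ⟪ 5 ⟫ * x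
      t₁ = small a x a0 a≤x (≤-trans ha h1) where
       small : ∀ a x → 0# ≤ a → a ≤ x → ⟪ 64 ⟫ * a ≤ 1# → (1# + a) * (1# + a) * (1# + ⟪ 2 ⟫ * a) ≤ 1# + ⟪ 5 ⟫ * x
       small a x p q r = by (0≤⟪ 5 ⟫ ⊗ gap q ⊕ p ⊗ (gap r ⊗ (0≤⅛ ⊗ 0≤½ ⊗ 0≤½ ⊗ p) ⊕ 0≤⅛ ⊗ gap r ⊕ 0≤⟪ 7 ⟫ ⊗ (0≤⅛)
         ⊕ (0≤⟪ 2 ⟫ ⊕ (0≤½ ⊕ 0≤¼ ⊕ 0≤⅛ ⊕ 0≤⅛ ⊗ 0≤½ ⊕ 0≤⅛ ⊗ 0≤½ ⊗ 0≤½)) ⊗ p)) (solve (a ⸴ x ⸴ ∎) ring)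

-- Colouring the large edges

β≤1-pure : ∀ δ → δ ≤ 1# → ¼ * δ ≤ 1#
β≤1-pure δ h = by (0≤¼ ⊗ gap h ⊕ (0≤½ ⊕ 0≤¼)) (solve (δ ⸴ ∎) ring)

module LargeColouring {E V : Set} (_≟ₑ_ : DecidableEquality E) (_≟ᵥ_ : DecidableEquality V)
 (vs : List V) (vs! : AllPairs _≢_ vs) (vs-all : ∀ v → v ∈ vs) (es : List E) (es! : AllPairs _≢_ es) (es-all : ∀ e → e ∈ es)
 (inc : E → V → Bool) (cs : List ℕ) (cs! : AllPairs _≢_ cs)
 (meet-refl : ∀ e → Incidence.meet _≟ᵥ_ vs vs! inc e e ≡ true) (nonempty : ∀ e → 1# ≤ Incidence.size _≟ᵥ_ vs vs! inc e)
 (t : ℚ) (0≤t : 0# ≤ t) (codeg : ∀ u v → u ≢ v → ∑[ e ∈ es ] Incidence.i _≟ᵥ_ vs vs! inc e u * Incidence.i _≟ᵥ_ vs vs! inc e v ≤ t) where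

 open Incidence _≟ᵥ_ vs vs! inc
 open LargeEdges _≟ₑ_ _≟ᵥ_ vs vs! vs-all es es! es-all inc cs cs! meet-refl nonempty t 0≤t codeg

 n₀ D₀ : ℚ
 n₀ = ⟦ length vs ⟧
 D₀ = t * n₀

 -- Colours in `inR` are kept for the edges of `W₁`; the others form the lists `Λ₂` for `T₀`, and
 -- `inP` is the palette of the random saving step. The palette parts of the lists are bounded on
 -- both sides by the close numbers `k` and `ℓ`, because the expected repetitions depend on
 -- comparing the list of `f` with those of its neighbours.
 record Setup (Λ : E → ℕ → Bool) (inR inP : ℕ → Bool) : Set where
  field
   δ s a' a ν ξ κ K' : ℚ
   k₀ b h k ℓ : ℕ
   0<D : 0# < D₀
   0<δ : 0# < δ
   δ≤1 : δ ≤ 1#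
   0<s : 0# < s
   0<a' : 0# < a'
   0<a : 0# < a
   h₁ : ⟪ 16 ⟫ * s ≤ ν * a'
   h₂ : ⟪ 4 ⟫ * (a' + ⟪ 2 ⟫ * s) ≤ ν * a
   h₃ : ⟪ 32 ⟫ * s ≤ ν
   ν≤1 : ν ≤ 1#
   ν≤δ : ν ≤ δ
   aδ : 1# + a ≤ (1# + δ) * (1# - s)
   a≤1 : a ≤ 1#
   64a : ⟪ 64 ⟫ * a ≤ δ
   64s : ⟪ 64 ⟫ * s ≤ δ
   0≤ξ : 0# ≤ ξ
   ξ² : ⟪ 2 ⟫ * ν ≤ ξ * ξ
   0≤κ : 0# ≤ κ
   κ≤1 : κ ≤ 1#
   κΔ : ⟪ 20 ⟫ * (κ * ((1# + ⟪ 2 ⟫ * a) * D₀)) ≤ ¼ * δ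
  Δ : ℚ
  Δ = (1# + ⟪ 2 ⟫ * a) * D₀
  β : ℚ
  β = ¼ * δ
  Λ₂ : E → ℕ → Bool
  Λ₂ = λ e c → Λ e c ∧ not (inR c)
  ps : List ℕ
  ps = filterᵇ inP cs
  field
   half : ½ * Δ ≤ K'
   K'≥ : (1# - inv 64 * δ) * D₀ ≤ K'
   room : Δ - ⟦ b ⟧ < K'
   all-lists : ∀ e → (1# - s) * D₀ ≤ avail Λ e
   R-lists : ∀ e → ξ * D₀ ≤ avail (λ e c → Λ e c ∧ inR c) e
   T-lists : ∀ e → K' ≤ avail Λ₂ e
   P-lists≥ : ∀ e → k ℕ.≤ countᵇ (λ c → Λ₂ e c ∧ inP c) ps
   P-lists≤ : ∀ e → countᵇ (Λ₂ e) ps ℕ.≤ ℓ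
   ℓ≤ : ⟦ ℓ ⟧ ≤ ⟦ k ⟧ * (1# + sixteenth * β)
   ℓb : ⟦ ℓ ⟧ + ⟦ b ⟧ ≤ sixteenth * (β * Δ)
   h≤ : ⟦ h ⟧ ≤ κ * κ * Δ * (⅛ * (⟦ k ⟧ * (β * Δ)))
   M< : ⟦ length es ⟧ * (1# + inv (suc k₀)) ^ b < (1# + inv (suc (suc k₀))) ^ h

 module _ {Λ : E → ℕ → Bool} {inR inP : ℕ → Bool} (X : Setup Λ inR inP) (win : E → Bool)
  (win-intro : ∀ e → (1# - Setup.δ X) * (1# - Setup.δ X) * n₀ ≤ size e * size e → size e * size e ≤ (1# + Setup.δ X) * (1# + Setup.δ X) * n₀ → win e ≡ true)
  (win-count : ∑[ e ∈ es ] 𝟙 (win e) ≤ (1# - Setup.δ X) * D₀) where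

  open Setup X

  coreColouring : ∀ W → (∀ e → W e ≡ true → 1# ≤ s * size e) → (∀ e → W e ≡ true → (1# - s) * D₀ ≤ nbrs W e) →
          (∀ e → W e ≡ true → ⊥) ⊎ (∃ λ e₀ → W e₀ ≡ true × (∀ e → W e ≡ true → size e₀ ≤ size e)) → Colouring W Λ
  coreColouring W big core (inj₁ none) = emptyColouring none
  coreColouring W big core (inj₂ (e₀ , W₀ , least)) = go ((1# - δ) * (1# - δ) * n₀ ≤? size e₀ * size e₀) where
   module C = Core s a' a ν 0<s 0<a' 0<a h₁ h₂ h₃ ν≤1 0<D W core e₀ W₀ least (big e₀ W₀)
   module S = SparseColouring _≟ₑ_ es es! es-all meet (Matching.meet-sym _≟ᵥ_ vs vs! vs-all es es-all inc) meet-refl cs cs!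
   0≤Δ : 0# ≤ Δ
   0≤Δ = (0≤1 ⊕ 0≤⟪ 2 ⟫ ⊗ <⇒≤ 0<a) ⊗ <⇒≤ 0<D
   β≤1 : β ≤ 1#
   β≤1 = β≤1-pure δ δ≤1
   go : Dec ((1# - δ) * (1# - δ) * n₀ ≤ size e₀ * size e₀) → Colouring W Λ
   go (yes k²) = ⊥-elim (C.window-impossible δ 0<δ δ≤1 ν≤δ aδ k² win win-intro win-count)
   go (no ¬k²) = transport (union {C.T₀} {C.W₁} {Λ₂} {λ e c → Λ e c ∧ inR c} {Λ} T₀-col W₁-col
     (λ e f c _ p q → true≢false (trans (sym (∧-true₂ (Λ f c) (Colouring.φ-list W₁-col f c q))) (not-true (∧-true₂ (Λ e c) (Colouring.φ-list T₀-col e c p)))))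
     (λ e c → ∧-true₁ (Λ e c)) (λ e c → ∧-true₁ (Λ e c))) where
    k²≤ : size e₀ * size e₀ ≤ (1# - δ) * (1# - δ) * n₀
    k²≤ = <⇒≤ (≰⇒> ¬k²)
    W₁-col : Colouring C.W₁ (λ e c → Λ e c ∧ inR c)
    W₁-col = C.W₁-degenerate ξ 0≤ξ ξ² (λ e c → Λ e c ∧ inR c) R-lists
    T₀-col : Colouring C.T₀ Λ₂
    T₀-col = S.sparseColouring C.T₀ Λ₂ inP κ Δ β K' 0≤κ κ≤1 0≤Δ (0≤¼ ⊗ <⇒≤ 0<δ) β≤1 κΔ half (C.T₀-degree a≤1) k₀ b h k ℓ
     (λ f p big → C.T₀-sparse δ 0<δ δ≤1 a≤1 64a 64s k²≤ K' K'≥ f p (∑[ g ∈ es ] 𝟙 (C.T₀ g ∧ adj f g)) (∑[ g ∈ es ] ∑[ h ∈ es ] 𝟙 (C.T₀ g ∧ adj f g) * (𝟙 (C.T₀ h ∧ adj f h) * 𝟙 (meet g h))) big (∑-nonneg es (λ g → 0≤𝟙 (C.T₀ g ∧ adj f g)))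
      (∑-mono es (λ g → ∑-mono es (λ h → *-mono (0≤𝟙 (C.T₀ g ∧ adj f g)) (0≤𝟙 (C.T₀ h ∧ meet f h) ⊗ 0≤j g h) (weaken f g) (*-monoʳ (0≤j g h) (weaken f h))))))
     (λ e _ → P-lists≥ e) (λ e _ → P-lists≤ e) (λ e _ → T-lists e) ℓ≤ ℓb h≤ M< room where
     weaken : ∀ f g → 𝟙 (C.T₀ g ∧ adj f g) ≤ 𝟙 (C.T₀ g ∧ meet f g)
     weaken f g = 𝟙-mono (C.T₀ g ∧ adj f g) (C.T₀ g ∧ meet f g) (λ q → ∧-intro (∧-true₁ (C.T₀ g) q) (∧-true₁ (meet f g) (∧-true₂ (C.T₀ g) q)))
    transport : Colouring (λ e → C.T₀ e ∨ C.W₁ e) Λ → Colouring W Λ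
    transport Y = record { φ = φ ; φ-proper = φ-proper ; φ-total = λ e p → φ-total e (trans (lem (W e) (does (size e ≤? (1# + a) * size e₀))) p) ; φ-only = λ e c p → trans (sym (lem (W e) (does (size e ≤? (1# + a) * size e₀)))) (φ-only e c p) ; φ-list = φ-list } where
     open Colouring Y
     lem : ∀ a b → (a ∧ b) ∨ (a ∧ not b) ≡ a
     lem true true = refl
     lem true false = refl
     lem false b = refl

  largeColouring : ∀ S → (∀ e → S e ≡ true → 1# ≤ s * size e) → Colouring S Λ
  largeColouring S big = reduceToCore Λ ((1# - s) * D₀) all-lists (countᵇ S es) S ℕₚ.≤-refl (λ W sub core → coreColouring W (λ e w → big e (sub e w)) core (smallest W))

-- Colouring edges of bounded size with a reserve

nearby-eq : ∀ p a b → p * (a * b) ≡ a * (b * p)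
nearby-eq = solve-∀ ring

module SubColouring {E V : Set} (_≟ₑ_ : DecidableEquality E) (_≟ᵥ_ : DecidableEquality V)
 (vs : List V) (vs! : AllPairs _≢_ vs) (vs-all : ∀ v → v ∈ vs) (es : List E) (es! : AllPairs _≢_ es) (es-all : ∀ e → e ∈ es)
 (inc : E → V → Bool) (cs : List ℕ) (cs! : AllPairs _≢_ cs) where

 open Incidence _≟ᵥ_ vs vs! inc
 open Graph _≟ₑ_ es es! es-all meet (Matching.meet-sym _≟ᵥ_ vs vs! vs-all es es-all inc) cs cs!

 module _ (r : ℚ) (1≤r : 1# ≤ r) (e : ℕ) (2≤e : 2 ℕ.≤ e) (z A : ℕ) (1≤z : 1 ℕ.≤ z) where

  open BoundedRank r 1≤r e 2≤e z A 1≤z using (Z₀; η; colour)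

  -- `colour` leaves at most `Z` edges of `S` at each vertex, hence at most `r * Z` uncoloured
  -- neighbours of an edge. The lists `R` are longer than this and disjoint from all lists `L`, so
  -- the greedy completion meets no blocked colour.
  subColouring : (S : E → Bool) (L R : E → ℕ → Bool) (Z : ℕ) (t : ℚ) → 2 ℕ.≤ Z → Z₀ ℕ.≤ Z → length vs ℕ.≤ A ℕ.* Z →
          (∀ f → S f ≡ true → size f ≤ r) → (∀ u v → u ≢ v → ∑[ f ∈ es ] i f u * i f v ≤ t) → ⟪ 2 ⟫ * t * inv Z ≤ η →
          (∀ f → S f ≡ true → z ℕ.* Z ℕ.≤ countᵇ (L f) cs) →
          (∀ v → ∑[ f ∈ es ] 𝟙 (S f) * i f v ≤ (1# - ⟪ 3 ⟫ * inv (suc e)) * (⟦ z ⟧ * ⟦ Z ⟧)) →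
          (∀ f g c → L f c ≡ true → R g c ≡ true → ⊥) → (∀ f → S f ≡ true → r * ⟦ Z ⟧ < avail R f) →
          Colouring S (λ f c → L f c ∨ R f c)
  subColouring S L R Z t 2≤Z Z₀≤Z n≤ rank codeg t≤ lists deg sep reserve = finish partialColouring where
   -- Edges outside `S` are emptied instead of removed: the edge type stays the same, and the size
   -- bound, known only on `S`, holds for all edges.
   inc' : E → V → Bool
   inc' f v = S f ∧ inc f v
   module I' = Incidence _≟ᵥ_ vs vs! inc'
   i'≤ : ∀ f v → I'.i f v ≤ i f v
   i'≤ f v = 𝟙-mono (S f ∧ inc f v) (inc f v) (∧-true₂ (S f))
   rank' : ∀ f → I'.size f ≤ r
   rank' f = go (S f) refl where
    go : ∀ b → S f ≡ b → I'.size f ≤ r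
    go true eq = ≤-trans (∑-mono vs (i'≤ f)) (rank f eq)
    go false eq = ≡≤ (trans (∑-cong vs (λ v → cong (λ b → 𝟙 (b ∧ inc f v)) eq)) (∑-0 vs)) (≤-trans 0≤1 1≤r)
   codeg' : ∀ u v → u ≢ v → ∑[ f ∈ es ] I'.i f u * I'.i f v ≤ t
   codeg' u v u≢v = ≤-trans (∑-mono es (λ f → *-mono (I'.0≤i f u) (0≤i f v) (i'≤ f u) (i'≤ f v))) (codeg u v u≢v)
   deg' : ∀ v → ∑[ f ∈ es ] I'.i f v * 𝟙 (S f) ≤ (1# - ⟪ 3 ⟫ * inv (suc e)) * (⟦ z ⟧ * ⟦ Z ⟧)
   deg' v = ≤-trans (∑-mono es (λ f → lem (S f) (inc f v))) (deg v) where
    lem : ∀ a b → 𝟙 (a ∧ b) * 𝟙 a ≤ 𝟙 a * 𝟙 b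
    lem true b = ≤-reflexive (*-comm (𝟙 b) 1#)
    lem false b = ≤-reflexive (trans (*-zeroʳ 0#) (sym (*-zeroˡ (𝟙 b))))
   Partial : Set
   Partial = Σ (E → Maybe ℕ) λ φ → (∀ f c → φ f ≡ just c → S f ≡ true) × (∀ f c → φ f ≡ just c → L f c ≡ true) × (∀ f c → φ f ≡ just c → c ∈ cs) ×
        (∀ f g c → f ≢ g → φ f ≡ just c → φ g ≡ just c → I'.meet f g ≡ false) ×
        (∀ v → ∑[ f ∈ es ] I'.i f v * 𝟙 (S f ∧ isNothing (φ f)) ≤ ⟦ Z ⟧)
   partialColouring : Partial
   partialColouring = colour _≟ₑ_ _≟ᵥ_ vs vs! vs-all es es-all inc' L cs cs! S Z 2≤Z Z₀≤Z t rank' codeg' t≤ n≤ lists deg'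
   meet' : ∀ f g → S f ≡ true → S g ≡ true → meet f g ≡ true → I'.meet f g ≡ true
   meet' f g p q m = let v , v∈ , w = any-witness (λ v → inc f v ∧ inc g v) vs m in
    any-true (λ v → (S f ∧ inc f v) ∧ (S g ∧ inc g v)) v∈ (∧-intro (∧-intro p (∧-true₁ (inc f v) w)) (∧-intro q (∧-true₂ (inc f v) w)))
   finish : Partial → Colouring S (λ f c → L f c ∨ R f c)
   finish (φ , φ-S , φ-L , φ-range , φ-proper , φ-left) = wrap (complete R us (filter-AllPairs pending es!) φ proper
     (All.map (λ {f} p → nothing-of (φ f) (∧-true₂ (S f) p)) (filter-true pending es)) (All.map (λ {f} p → fits f (∧-true₁ (S f) p)) (filter-true pending es))) where
    pending : E → Bool
    pending f = S f ∧ isNothing (φ f)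
    us : List E
    us = filterᵇ pending es
    nothing-of : ∀ (m : Maybe ℕ) → isNothing m ≡ true → m ≡ nothing
    nothing-of nothing _ = refl
    proper : Proper φ
    proper f g c a p q = true≢false (trans (sym (meet' f g (φ-S f c p) (φ-S g c q) (∧-true₁ (meet f g) a))) (φ-proper f g c (adj-irrefl f g a) p q))
    unblocked : ∀ f → blocked R φ f ≡ 0#
    unblocked f = trans (∑-cong cs (λ c → cong 𝟙 (¬true (λ h → let g , _ , q = used-elim φ (∧-true₂ (R f c) h) in sep g f c (φ-L g c q) (∧-true₁ (R f c) h))))) (∑-0 cs)
    nearby : ∀ f → S f ≡ true → ∑[ g ∈ us ] 𝟙 (adj f g) ≤ r * ⟦ Z ⟧
    nearby f Sf = ≡≤ (∑-filter pending es (λ g → 𝟙 (adj f g))) (≤-trans (∑-mono es (λ g → *-monoˡ (0≤𝟙 (pending g)) (≤-trans (𝟙-mono (adj f g) (meet f g) (∧-true₁ (meet f g))) (j≤∑ f g))))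
     (≡≤ (trans (∑-cong es (λ g → sym (∑-*ˡ vs (𝟙 (pending g)) (λ v → i f v * i g v)))) (∑-swap es vs (λ g v → 𝟙 (pending g) * (i f v * i g v))))
     (≤-trans (∑-mono vs (λ v → ≤-trans (≡≤ (trans (∑-cong es (λ g → nearby-eq (𝟙 (pending g)) (i f v) (i g v))) (∑-*ˡ es (i f v) (λ g → i g v * 𝟙 (pending g)))) (*-monoˡ (0≤i f v) (∑-mono es (λ g → lem (S g) (isNothing (φ g)) (inc g v))))) (*-monoˡ (0≤i f v) (φ-left v))))
     (≡≤ (∑-*ʳ vs ⟦ Z ⟧ (i f)) (*-monoʳ 0≤⟦ Z ⟧ (rank f Sf)))))) where
     lem : ∀ s n b → 𝟙 b * 𝟙 (s ∧ n) ≤ 𝟙 (s ∧ b) * 𝟙 (s ∧ n)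
     lem true n b = ≤-refl
     lem false n b = ≤-reflexive (trans (*-zeroʳ (𝟙 b)) (sym (*-zeroʳ 0#)))
    fits : ∀ f → S f ≡ true → (∑[ g ∈ us ] 𝟙 (adj f g)) + blocked R φ f < avail R f
    fits f Sf = ≤-<-trans (≡≤ (trans (cong ((∑[ g ∈ us ] 𝟙 (adj f g)) +_) (unblocked f)) (+-identityʳ _)) (nearby f Sf)) (reserve f Sf)
    wrap : Extension R φ us → Colouring S (λ f c → L f c ∨ R f c)
    wrap X = record { φ = ψ ; φ-proper = ψ-proper ; φ-total = tot ; φ-only = only ; φ-list = list } where
     open Extension X
     tot : ∀ f → S f ≡ true → ∃ λ c → ψ f ≡ just c
     tot f Sf = go (φ f) refl where
      go : ∀ m → φ f ≡ m → ∃ λ c → ψ f ≡ just c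
      go (just c) eq = c , ψ-extends f c eq
      go nothing eq = ψ-total f (filter-∈ pending (es-all f) (∧-intro Sf (cong isNothing eq)))
     only : ∀ f c → ψ f ≡ just c → S f ≡ true
     only f c p = go (ψ-new f c p) where
      go : φ f ≡ just c ⊎ (f ∈ us × R f c ≡ true) → S f ≡ true
      go (inj₁ q) = φ-S f c q
      go (inj₂ (m , _)) = ∧-true₁ (S f) (All.lookup (filter-true pending es) m)
     list : ∀ f c → ψ f ≡ just c → L f c ∨ R f c ≡ true
     list f c p = go (ψ-new f c p) where
      go : φ f ≡ just c ⊎ (f ∈ us × R f c ≡ true) → L f c ∨ R f c ≡ true
      go (inj₁ q) = cong (_∨ R f c) (φ-L f c q)
      go (inj₂ (_ , l)) = ∨-right (L f c) l

-- Colour classes of guaranteed size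

count-disjoint : {A : Set} (p q r : A → Bool) (xs : List A) → (∀ x → p x ≡ true → r x ≡ true) → (∀ x → q x ≡ true → r x ≡ true) →
         (∀ x → p x ≡ true → q x ≡ true → ⊥) → countᵇ p xs ℕ.+ countᵇ q xs ℕ.≤ countᵇ r xs
count-disjoint p q r [] _ _ _ = ℕ.z≤n
count-disjoint p q r (x ∷ xs) pr qr pq with p x in ep | q x in eq | r x in er
... | true | true | _ = ⊥-elim (pq x ep eq)
... | true | false | true = ℕ.s≤s (count-disjoint p q r xs pr qr pq)
... | true | false | false = ⊥-elim (true≢false (trans (sym (pr x ep)) er))
... | false | true | true = ℕₚ.≤-trans (ℕₚ.≤-reflexive (ℕₚ.+-suc (countᵇ p xs) (countᵇ q xs))) (ℕ.s≤s (count-disjoint p q r xs pr qr pq))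
... | false | true | false = ⊥-elim (true≢false (trans (sym (qr x eq)) er))
... | false | false | true = ℕₚ.m≤n⇒m≤1+n (count-disjoint p q r xs pr qr pq)
... | false | false | false = count-disjoint p q r xs pr qr pq

floor≤ : ∀ a k → ⟦ suc k ⟧ * ⟦ a ℕ/./ suc k ⟧ ≤ ⟦ a ⟧
floor≤ a k = ≡≤ (trans (*-comm ⟦ suc k ⟧ ⟦ a ℕ/./ suc k ⟧) (sym (⟦⟧-* (a ℕ/./ suc k) (suc k)))) (⟦⟧-mono (ℕ/.m/n*n≤m a (suc k)))

floor≥-eq : ∀ x k → (1# + x) * k ≡ k * (x + 1#)
floor≥-eq = solve-∀ ring

floor≥ : ∀ a k → ⟦ a ⟧ ≤ ⟦ suc k ⟧ * (⟦ a ℕ/./ suc k ⟧ + 1#)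
floor≥ a k = ≤-trans (⟦⟧-mono (ℕₚ.<⇒≤ (ℕₚ.≤-trans (ℕ.s≤s (ℕₚ.≤-reflexive (ℕ/.m≡m%n+[m/n]*n a (suc k)))) (ℕₚ.+-monoˡ-< ((a ℕ/./ suc k) ℕ.* suc k) (ℕ/.m%n<n a (suc k))))))
 (≤-reflexive (⟦⟧-* (suc (a ℕ/./ suc k)) (suc k) ⨾ cong (_* ⟦ suc k ⟧) 1+⟦ a ℕ/./ suc k ⟧ ⨾ floor≥-eq ⟦ a ℕ/./ suc k ⟧ ⟦ suc k ⟧))

∸≥ : ∀ a b → ⟦ a ⟧ ≤ ⟦ a ℕ.∸ b ⟧ + ⟦ b ⟧
∸≥ a b = ≤-trans (⟦⟧-mono (ℕₚ.≤-trans (ℕₚ.m≤n+m∸n a b) (ℕₚ.≤-reflexive (ℕₚ.+-comm b (a ℕ.∸ b))))) (≤-reflexive (⟦⟧-+ (a ℕ.∸ b) b))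

between : ℕ → ℕ → ℕ → Bool
between lo hi j = does (lo ℕ.≤? j) ∧ does (j ℕ.<? hi)

-- N classes of colours such that every list of size K has at least b colours in every class
record Classes {E : Set} (L : E → ℕ → Bool) (cs : List ℕ) (N D K : ℕ) : Set where
 field
  κ : ℕ → ℕ
  b : ℕ
  κ< : ∀ c → κ c ℕ.< N
  κ≥ : ∀ e j → j ℕ.< N → b ℕ.≤ countᵇ (λ c → L e c ∧ does (κ c ℕ.≟ j)) cs
  Nb≥ : (1# - inv N) * ⟦ D ⟧ ≤ ⟦ N ⟧ * ⟦ b ⟧
  Nb≤ : N ℕ.* b ℕ.≤ K

 interval≥ : ∀ e lo q → lo ℕ.+ q ℕ.≤ N → q ℕ.* b ℕ.≤ countᵇ (λ c → L e c ∧ between lo (lo ℕ.+ q) (κ c)) cs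
 interval≥ e lo zero h = ℕ.z≤n
 interval≥ e lo (suc q) h = ℕₚ.≤-trans (ℕₚ.+-mono-≤ (κ≥ e (lo ℕ.+ q) h') (interval≥ e lo q (ℕₚ.<⇒≤ h')))
  (count-disjoint (λ c → L e c ∧ does (κ c ℕ.≟ lo ℕ.+ q)) (λ c → L e c ∧ between lo (lo ℕ.+ q) (κ c)) (λ c → L e c ∧ between lo (lo ℕ.+ suc q) (κ c)) cs
   (λ c p → let k = ≟-true ℕ._≟_ (∧-true₂ (L e c) p) in ∧-intro (∧-true₁ (L e c) p) (∧-intro (≤-true (ℕₚ.≤-trans (ℕₚ.m≤m+n lo q) (ℕₚ.≤-reflexive (sym k)))) (<-true (ℕₚ.≤-trans (ℕ.s≤s (ℕₚ.≤-reflexive k)) (ℕₚ.≤-reflexive (sym (ℕₚ.+-suc lo q)))))))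
   (λ c p → let r = ∧-true₂ (L e c) p in ∧-intro (∧-true₁ (L e c) p) (∧-intro (∧-true₁ (does (lo ℕ.≤? κ c)) r) (<-true (ℕₚ.≤-trans (ℕₚ.m≤n⇒m≤1+n (does-true (κ c ℕ.<? lo ℕ.+ q) (∧-true₂ (does (lo ℕ.≤? κ c)) r))) (ℕₚ.≤-reflexive (sym (ℕₚ.+-suc lo q)))))))
   (λ c p r → ℕₚ.<⇒≢ (does-true (κ c ℕ.<? lo ℕ.+ q) (∧-true₂ (does (lo ℕ.≤? κ c)) (∧-true₂ (L e c) r))) (≟-true ℕ._≟_ (∧-true₂ (L e c) p)))) where
  h' : lo ℕ.+ q ℕ.< N
  h' = ℕₚ.≤-trans (ℕₚ.≤-reflexive (sym (ℕₚ.+-suc lo q))) h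
  ≤-true : ∀ {a b} → a ℕ.≤ b → does (a ℕ.≤? b) ≡ true
  ≤-true {a} {b} p = ¬false (does (a ℕ.≤? b)) refl where
   ¬false : ∀ x → does (a ℕ.≤? b) ≡ x → does (a ℕ.≤? b) ≡ true
   ¬false true eq = eq
   ¬false false eq = ⊥-elim (does-false (a ℕ.≤? b) eq p)
  <-true : ∀ {a b} → a ℕ.< b → does (a ℕ.<? b) ≡ true
  <-true p = ≤-true p

Nb≥-pure : ∀ N b h w x u D K → 0# ≤ N → h ≤ b + w * ⟪ 3 ⟫ → ⟪ 8 ⟫ * N * w ≤ h → h ≤ u * D → K ≤ N * (h + 1#) → D ≤ K + (1# + x) → ⟪ 8 ⟫ * x ≤ u * D → (1# + N) * ⟪ 2 ⟫ ≤ u * D → (1# - u) * D ≤ N * b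
Nb≥-pure N b h w x u D K 0N a₁ a₂ a₃ a₄ a₅ a₆ a₇ = by (0N ⊗ gap a₁ ⊕ 0≤⟪ 3 ⟫ ⊗ 0≤½ ⊗ 0≤½ ⊗ 0≤½ ⊗ gap a₂ ⊕ 0≤⟪ 3 ⟫ ⊗ 0≤½ ⊗ 0≤½ ⊗ 0≤½ ⊗ gap a₃ ⊕ gap a₄ ⊕ gap a₅ ⊕ 0≤⅛ ⊗ gap a₆ ⊕ 0≤½ ⊗ gap a₇) (solve (N ⸴ b ⸴ h ⸴ w ⸴ x ⸴ u ⸴ D ⸴ K ⸴ ∎) ring)

Nb≥-eq₂ : ∀ N → N * ((1# + N) * ⟪ 2 ⟫) ≡ (1# + N) * (N * ⟪ 2 ⟫)
Nb≥-eq₂ = solve-∀ ring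

Nb≥-eq₁ : ∀ N x → N * (⟪ 8 ⟫ * x) ≡ ⟪ 8 ⟫ * N * x
Nb≥-eq₁ = solve-∀ ring

scale-eq : ∀ N u y → N * u * y ≡ u * (N * y)
scale-eq = solve-∀ ring

exponent-eq' : ∀ b w → b ℕ.+ w ℕ.+ w ℕ.+ w ≡ b ℕ.+ w ℕ.* 3
exponent-eq' = ℕR.solve-∀

exponent-eq : ∀ y M w → suc y ℕ.* suc M ℕ.+ w ≡ y ℕ.* M ℕ.+ y ℕ.+ suc M ℕ.+ w
exponent-eq = ℕR.solve-∀

D≤qw-eq : ∀ w M N → (w ℕ.+ w) ℕ.* (M ℕ.* (N ℕ.* 4)) ≡ M ℕ.* (N ℕ.* 8) ℕ.* w
D≤qw-eq = ℕR.solve-∀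

D≤w-pure : ∀ D K h w N M → D ≤ ⟪ 2 ⟫ * K → K ≤ N * (h + 1#) → h ≤ M * (w + 1#) → 0# ≤ N → 1# ≤ M → 0# ≤ w → D ≤ (1# + w) * (M * (N * ⟪ 4 ⟫))
D≤w-pure D K h w N M p q r 0N s 0w = by (gap p ⊕ 0≤⟪ 2 ⟫ ⊗ gap q ⊕ 0≤⟪ 2 ⟫ ⊗ 0N ⊗ gap r ⊕ 0≤⟪ 2 ⟫ ⊗ 0N ⊗ gap s ⊕ 0≤⟪ 2 ⟫ ⊗ 0N ⊗ (gap s ⊕ 0≤1) ⊗ 0w) (solve (D ⸴ K ⸴ h ⸴ w ⸴ N ⸴ M ⸴ ∎) ring)

D≤2K-pure : ∀ D K x N → D ≤ K + (1# + x) → ⟪ 8 ⟫ * N * x ≤ D → ⟪ 4 ⟫ ≤ D → 1# ≤ N → 0# ≤ x → 0# ≤ D → D ≤ ⟪ 2 ⟫ * K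
D≤2K-pure D K x N p q r s 0x 0D = by (0≤⟪ 2 ⟫ ⊗ gap p ⊕ 0≤¼ ⊗ gap q ⊕ 0≤⟪ 2 ⟫ ⊗ gap s ⊗ 0x ⊕ 0≤½ ⊗ gap r ⊕ 0≤¼ ⊗ 0D) (solve (D ⸴ K ⸴ x ⸴ N ⸴ ∎) ring)

-- Four losses of about `D/(8N)`, one in `K` and three in `N * b`, together with the rounding stay
-- below `D/N`.
classes : ∀ N' → ∃ λ D₀ → ∀ {E : Set} (es : List E) → (∀ e → e ∈ es) → ∀ (L : E → ℕ → Bool) cs → AllPairs _≢_ cs → ∀ D → D₀ ℕ.≤ D → length es ℕ.≤ D ℕ.* D →
     (let K = D ℕ.∸ suc (D ℕ/./ (suc N' ℕ.* 8))) → (∀ e → K ℕ.≤ countᵇ (L e) cs) → Classes L cs (suc N') D K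
classes N' = D₀ , main where
 N M Λ' : ℕ
 N = suc N'
 Λ' = 7 ℕ.+ N' ℕ.* 8
 M = suc Λ'
 bt = beats M N (M ℕ.* (N ℕ.* 8))
 D₁ = proj₁ bt
 D₀ : ℕ
 D₀ = D₁ ℕ.+ (4 ℕ.+ ((suc N ℕ.* (N ℕ.* 2)) ℕ.+ suc (suc M) ℕ.* (M ℕ.* (N ℕ.* 4))))
 main : ∀ {E : Set} (es : List E) → (∀ e → e ∈ es) → ∀ (L : E → ℕ → Bool) cs → AllPairs _≢_ cs → ∀ D → D₀ ℕ.≤ D → length es ℕ.≤ D ℕ.* D →
     (let K = D ℕ.∸ suc (D ℕ/./ M)) → (∀ e → K ℕ.≤ countᵇ (L e) cs) → Classes L cs (suc N') D K
 main {E} es es-all L cs cs! D D≥ m≤ lists = finish (partition es es-all L N' Λ' cs cs! K h b lists (ℕ/.m/n*n≤m K N) M<) where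
  x K h w b : ℕ
  x = D ℕ/./ M
  K = D ℕ.∸ suc x
  h = K ℕ/./ N
  w = h ℕ/./ M
  -- One `w` covers `b / M` in the change of base, one the rounding term `M + 1`, and one the factor
  -- `length es * N` through `beats`.
  b = h ℕ.∸ w ℕ.* 3
  u Dq Nq : ℚ
  u = inv N
  Dq = ⟦ D ⟧
  Nq = ⟦ N ⟧
  D≥₁ : D₁ ℕ.≤ D
  D≥₁ = ℕₚ.≤-trans (ℕₚ.m≤m+n D₁ (4 ℕ.+ ((suc N ℕ.* (N ℕ.* 2)) ℕ.+ suc (suc M) ℕ.* (M ℕ.* (N ℕ.* 4))))) D≥
  D≥r : 4 ℕ.+ ((suc N ℕ.* (N ℕ.* 2)) ℕ.+ suc (suc M) ℕ.* (M ℕ.* (N ℕ.* 4))) ℕ.≤ D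
  D≥r = ℕₚ.≤-trans (ℕₚ.m≤n+m (4 ℕ.+ ((suc N ℕ.* (N ℕ.* 2)) ℕ.+ suc (suc M) ℕ.* (M ℕ.* (N ℕ.* 4)))) D₁) D≥
  D≥₂ : ⟪ 4 ⟫ ≤ Dq
  D≥₂ = ⟦⟧-mono (ℕₚ.≤-trans (ℕₚ.m≤m+n 4 ((suc N ℕ.* (N ℕ.* 2)) ℕ.+ suc (suc M) ℕ.* (M ℕ.* (N ℕ.* 4)))) D≥r)
  D≥rr : (suc N ℕ.* (N ℕ.* 2)) ℕ.+ suc (suc M) ℕ.* (M ℕ.* (N ℕ.* 4)) ℕ.≤ D
  D≥rr = ℕₚ.≤-trans (ℕₚ.m≤n+m ((suc N ℕ.* (N ℕ.* 2)) ℕ.+ suc (suc M) ℕ.* (M ℕ.* (N ℕ.* 4))) 4) D≥r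
  D≥₃ : (1# + Nq) * (Nq * ⟪ 2 ⟫) ≤ Dq
  D≥₃ = ≡≤ (sym (⟦⟧-* (suc N) (N ℕ.* 2) ⨾ cong₂ _*_ 1+⟦ N ⟧ (⟦⟧-* N 2))) (⟦⟧-mono (ℕₚ.≤-trans (ℕₚ.m≤m+n (suc N ℕ.* (N ℕ.* 2)) (suc (suc M) ℕ.* (M ℕ.* (N ℕ.* 4)))) D≥rr))
  D≥₄ : suc (suc M) ℕ.* (M ℕ.* (N ℕ.* 4)) ℕ.≤ D
  D≥₄ = ℕₚ.≤-trans (ℕₚ.m≤n+m (suc (suc M) ℕ.* (M ℕ.* (N ℕ.* 4))) (suc N ℕ.* (N ℕ.* 2))) D≥rr
  K≥ : Dq ≤ ⟦ K ⟧ + (1# + ⟦ x ⟧)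
  K≥ = ≤-trans (∸≥ D (suc x)) (≤-reflexive (cong (⟦ K ⟧ +_) 1+⟦ x ⟧))
  K≤D : K ℕ.≤ D
  K≤D = ℕₚ.m∸n≤m D (suc x)
  Mx : ⟪ 8 ⟫ * Nq * ⟦ x ⟧ ≤ Dq
  Mx = ≡≤ (cong (_* ⟦ x ⟧) (sym (⟦⟧-* N 8 ⨾ *-comm Nq ⟪ 8 ⟫))) (floor≤ D Λ')
  Mw : ⟪ 8 ⟫ * Nq * ⟦ w ⟧ ≤ ⟦ h ⟧
  Mw = ≡≤ (cong (_* ⟦ w ⟧) (sym (⟦⟧-* N 8 ⨾ *-comm Nq ⟪ 8 ⟫))) (floor≤ h Λ')
  1≤N : 1# ≤ Nq
  1≤N = ⟦⟧-mono {1} {N} (ℕ.s≤s ℕ.z≤n)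
  D≤2K : Dq ≤ ⟪ 2 ⟫ * ⟦ K ⟧
  D≤2K = D≤2K-pure Dq ⟦ K ⟧ ⟦ x ⟧ Nq K≥ Mx D≥₂ 1≤N 0≤⟦ x ⟧ 0≤⟦ D ⟧
  -- D ≤ 4NM(w+1)
  D≤w : D ℕ.≤ suc w ℕ.* (M ℕ.* (N ℕ.* 4))
  D≤w = ⟦⟧-cancel (≤-trans (D≤w-pure Dq ⟦ K ⟧ ⟦ h ⟧ ⟦ w ⟧ Nq ⟦ M ⟧ D≤2K (floor≥ K N') (floor≥ h Λ') 0≤⟦ N ⟧ (⟦⟧-mono {1} {M} (ℕ.s≤s ℕ.z≤n)) 0≤⟦ w ⟧)
   (≤-reflexive (sym (⟦⟧-* (suc w) (M ℕ.* (N ℕ.* 4)) ⨾ cong₂ _*_ 1+⟦ w ⟧ (⟦⟧-* M (N ℕ.* 4) ⨾ cong (⟦ M ⟧ *_) (⟦⟧-* N 4))))))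
  M<w : suc M ℕ.≤ w
  M<w = ℕₚ.≤-pred (ℕₚ.*-cancelʳ-≤ (suc (suc M)) (suc w) (M ℕ.* (N ℕ.* 4)) (ℕₚ.≤-trans D≥₄ D≤w))
  D≤qw : D ℕ.≤ M ℕ.* (N ℕ.* 8) ℕ.* w
  D≤qw = ℕₚ.≤-trans D≤w (ℕₚ.≤-trans (ℕₚ.*-monoˡ-≤ (M ℕ.* (N ℕ.* 4)) (ℕₚ.+-monoˡ-≤ w (ℕₚ.≤-trans (ℕ.s≤s ℕ.z≤n) M<w))) (ℕₚ.≤-reflexive (D≤qw-eq w M N)))
  3w≤h : w ℕ.* 3 ℕ.≤ h
  3w≤h = ℕₚ.≤-trans (ℕₚ.*-monoʳ-≤ w (ℕ.s≤s (ℕ.s≤s (ℕ.s≤s ℕ.z≤n)))) (ℕ/.m/n*n≤m h M)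
  b+3w : b ℕ.+ w ℕ.* 3 ≡ h
  b+3w = ℕₚ.m∸n+n≡m 3w≤h
  y : ℕ
  y = b ℕ/./ M
  exponent : suc y ℕ.* suc M ℕ.+ w ℕ.≤ h
  exponent = ℕₚ.≤-trans (ℕₚ.≤-reflexive (exponent-eq y M w)) (ℕₚ.≤-trans (ℕₚ.+-mono-≤ (ℕₚ.+-mono-≤ (ℕₚ.+-mono-≤ (ℕ/.m/n*n≤m b M) (ℕ/./-monoˡ-≤ M (ℕₚ.m∸n≤m h (w ℕ.* 3)))) M<w) (ℕₚ.≤-refl {w})) (ℕₚ.≤-reflexive (trans (exponent-eq' b w) b+3w)))
  l : ℚ
  l = inv (suc M)
  1≤1+l : 1# ≤ 1# + l
  1≤1+l = by (0≤inv (suc M)) refl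
  M< : ⟦ length es ℕ.* N ⟧ * (1# + inv M) ^ b < (1# + l) ^ h
  M< = <-≤-trans (≤-<-trans (*-mono 0≤⟦ length es ℕ.* N ⟧ (^-nonneg (suc y ℕ.* suc M) (0≤1 ⊕ 0≤inv (suc M))) (⟦⟧-mono (ℕₚ.≤-trans (ℕₚ.*-monoˡ-≤ N m≤) (ℕₚ.≤-reflexive (ℕₚ.*-comm (D ℕ.* D) N)))) (rebase Λ' b))
    (ℚₚ.*-monoˡ-<-pos ((1# + l) ^ (suc y ℕ.* suc M)) {{positive (<-≤-trans 0<1 (1≤^ (suc y ℕ.* suc M) 1≤1+l))}} (proj₂ bt D w D≥₁ D≤qw)))
   (≡≤ (trans (*-comm ((1# + l) ^ w) ((1# + l) ^ (suc y ℕ.* suc M))) (sym (^-+ (1# + l) (suc y ℕ.* suc M) w))) (^-≤ 1≤1+l exponent))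
  finish : (∃ λ κ → (∀ c → κ c ∈ upTo N) × (∀ e j → j ∈ upTo N → b ℕ.≤ countᵇ (λ c → L e c ∧ does (κ c ℕ.≟ j)) cs)) → Classes L cs N D K
  finish (κ , κ∈ , κ≥) = record { κ = κ ; b = b ; κ< = λ c → ∈-upTo⁻ (κ∈ c) ; κ≥ = λ e j j< → κ≥ e j (∈-upTo⁺ j<) ; Nb≥ = Nb≥ ; Nb≤ = ℕₚ.≤-trans (ℕₚ.*-monoʳ-≤ N (ℕₚ.m∸n≤m h (w ℕ.* 3))) (ℕₚ.≤-trans (ℕₚ.≤-reflexive (ℕₚ.*-comm N h)) (ℕ/.m/n*n≤m K N)) } where
   Nu : Nq * u ≡ 1#
   Nu = *inv N'
   scale : ∀ y → Nq * y ≤ Dq → y ≤ u * Dq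
   scale y p = ≡≤ (trans (sym (*-identityˡ y)) (trans (cong (_* y) (sym Nu)) (scale-eq Nq u y))) (*-monoˡ (0≤inv N) p)
   Nb≥ : (1# - u) * Dq ≤ Nq * ⟦ b ⟧
   Nb≥ = Nb≥-pure Nq ⟦ b ⟧ ⟦ h ⟧ ⟦ w ⟧ ⟦ x ⟧ u Dq ⟦ K ⟧ 0≤⟦ N ⟧ (≤-trans (∸≥ h (w ℕ.* 3)) (≤-reflexive (cong (⟦ b ⟧ +_) (⟦⟧-* w 3)))) Mw
      (scale ⟦ h ⟧ (≤-trans (floor≤ K N') (⟦⟧-mono K≤D))) (floor≥ K N') K≥
      (scale (⟪ 8 ⟫ * ⟦ x ⟧) (≡≤ (Nb≥-eq₁ Nq ⟦ x ⟧) Mx)) (scale ((1# + Nq) * ⟪ 2 ⟫) (≡≤ (Nb≥-eq₂ Nq) D≥₃))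

-- Choice of the constants

h4 h8 : ℚ
h4 = mkℚ (ℤ.+ 1) 15 (1-coprime 16)
h8 = mkℚ (ℤ.+ 1) 255 (1-coprime 256)

0≤h4 : 0# ≤ h4
0≤h4 = ℚₚ.nonNegative⁻¹ h4

0≤h8 : 0# ≤ h8
0≤h8 = ℚₚ.nonNegative⁻¹ h8

0<h4 : 0# < h4
0<h4 = ℚₚ.positive⁻¹ h4

0<h8 : 0# < h8
0<h8 = ℚₚ.positive⁻¹ h8

nonneg : ∀ q → does (0# ≤? q) ≡ true → 0# ≤ q
nonneg q = does-true (0# ≤? q)

pure-eq-5 : ∀ i q k → i * (q * k) ≡ q * (k * i)
pure-eq-5 = solve-∀ ring

small : ∀ {q} → 0# < q → ∃ λ k → inv (suc k) ≤ q
small {q} 0<q = let q' , 0<q' , qq' = inverse 0<q ; k , q'≤k = archimedean q' in k ,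
 pure q q' ⟦ suc k ⟧ (inv (suc k)) (<⇒≤ 0<q) (0≤inv (suc k)) qq' (*inv k) (≤-trans q'≤k (⟦⟧-mono (ℕₚ.n≤1+n k))) where
 pure : ∀ q q' k i → 0# ≤ q → 0# ≤ i → q * q' ≡ 1# → k * i ≡ 1# → q' ≤ k → i ≤ q
 pure q q' k i 0q 0i e f h = ≡≤ (trans (sym (*-identityʳ i)) (cong (i *_) (sym e))) (≤-trans (*-monoˡ 0i (*-monoˡ 0q h)) (≤-reflexive (trans (pure-eq-5 i q k) (trans (cong (q *_) f) (*-identityʳ q)))))

-- G, G·4H and N are the numbers of colour classes reserved for W₁, used by the saving step, and in total.
module Parameters (d' H' G' N' : ℕ) where

 d H G Y N : ℕ
 d = suc (suc d')
 H = suc H'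
 G = suc G'
 Y = G ℕ.* (H ℕ.* 4)
 N = suc N'
 δ c a ξ ν a' s u : ℚ
 u = inv N
 δ = inv d
 c = inv H
 -- The saving is about `c * D / 8`, and `3 * a * D`, the difference between the degree bound and
 -- the lists, has to be smaller. `ξ` is half the share of the `G` reserved classes, and `ν` is the
 -- largest value allowed by `2ν ≤ ξ²`.
 a = ¼ * h4 * c
 ξ = ⅛ * h8 * (δ * c)
 ν = ½ * (ξ * ξ)
 a' = ⅛ * (ν * a)
 s = h4 * (ν * a')

 0<δ : 0# < δ
 0<δ = 0<inv (suc d')
 0≤δ : 0# ≤ δ
 0≤δ = <⇒≤ 0<δ
 δ≤1 : δ ≤ 1#
 δ≤1 = inv≤1 (suc d')
 0<c : 0# < c
 0<c = 0<inv H'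
 0≤c : 0# ≤ c
 0≤c = <⇒≤ 0<c
 0<ξ : 0# < ξ
 0<ξ = <⊗ (<⊗ (<⊗ (<⊗ 0<½ 0<½) 0<½) 0<h8) (<⊗ 0<δ 0<c)
 0<ν : 0# < ν
 0<ν = <⊗ 0<½ (<⊗ 0<ξ 0<ξ)
 0<a : 0# < a
 0<a = <⊗ (<⊗ (<⊗ 0<½ 0<½) 0<h4) 0<c
 0<a' : 0# < a'
 0<a' = <⊗ (<⊗ (<⊗ 0<½ 0<½) 0<½) (<⊗ 0<ν 0<a)
 0<s : 0# < s
 0<s = <⊗ 0<h4 (<⊗ 0<ν 0<a')

-- Shares of the colours are measured in units of `u = 1/N`. About `c * D` gains are demanded; `c`
-- is of order `δ⁴` since the mean is `κ²Δ` times `kβΔ` up to a constant, with `κΔ`, `β` and `k / D`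
-- of order `δ`. The bound `4u ≤ s` lets the core tolerate three withheld classes and the rounding,
-- and the last bound keeps `ℓ` close to `k`.
Admissible : ℕ → ℕ → ℕ → ℕ → Set
Admissible d' H' G' N' = ⟦ Y ⟧ * u ≡ h8 * δ × 3 ℕ.+ G ℕ.+ Y ℕ.≤ N × c ≤ ¼ * h4 * h8 * h8 * h8 * (δ * δ * (δ * δ)) × ⟪ 4 ⟫ * u ≤ s × u ≤ ⅛ * h4 * h8 * (δ * δ) where
 open Parameters d' H' G' N'

pure-e₂-6 : ∀ δ c → ¼ * (h8 * δ) * c ≡ ¼ * h8 * (δ * c)
pure-e₂-6 = solve-∀ ring

pure-e₁-9 : ∀ G H u c → G * u * (H * c) ≡ ¼ * (G * (H * ⟪ 4 ⟫) * u) * c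
pure-e₁-9 = solve-∀ ring

pure-eq-4 : ∀ a' ν → ⟪ 4 ⟫ * (a' + ⟪ 2 ⟫ * (h4 * (ν * a'))) ≡ ⟪ 4 ⟫ * a' + ½ * ν * a'
pure-eq-4 = solve-∀ ring

u≤½-pure : ∀ u δ → u ≤ ⅛ * h4 * h8 * (δ * δ) → δ ≤ 1# → 0# ≤ δ → u ≤ ½
u≤½-pure u δ h k 0δ = by (gap h ⊕ 0≤⅛ ⊗ 0≤h4 ⊗ 0≤h8 ⊗ (gap k ⊗ (0≤1 ⊕ 0δ)) ⊕ nonneg (½ - ⅛ * h4 * h8) refl) (solve (u ⸴ δ ⸴ ∎) ring)

ξ²-eq : ∀ x → ⟪ 2 ⟫ * (½ * x) ≡ x
ξ²-eq = solve-∀ ring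

aδ-pure : ∀ a δ s → ⟪ 64 ⟫ * a ≤ δ → ⟪ 64 ⟫ * s ≤ δ → 0# ≤ s → 0# ≤ δ → δ ≤ 1# → 1# + a ≤ (1# + δ) * (1# - s)
aδ-pure a δ s h k 0s 0δ l = by (p₁ ⊗ gap h ⊕ p₂ ⊗ gap k ⊕ 0s ⊗ gap l ⊕ nonneg (1# - ¼ * h4 - ½ * h4) refl ⊗ 0δ) (solve (a ⸴ δ ⸴ s ⸴ ∎) ring) where
 p₁ : 0# ≤ ¼ * h4
 p₁ = 0≤¼ ⊗ 0≤h4
 p₂ : 0# ≤ ½ * h4
 p₂ = 0≤½ ⊗ 0≤h4

h₃-pure : ∀ ν a' a → 0# ≤ ν → a' ≤ ⅛ * a → a ≤ 1# → ⟪ 32 ⟫ * (h4 * (ν * a')) ≤ ν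
h₃-pure ν a' a 0ν h k = by (0≤⟪ 2 ⟫ ⊗ 0ν ⊗ gap h ⊕ 0≤¼ ⊗ 0ν ⊗ gap k ⊕ (0≤½ ⊕ 0≤¼) ⊗ 0ν) (solve (ν ⸴ a' ⸴ a ⸴ ∎) ring)

h₁-eq : ∀ x → ⟪ 16 ⟫ * (h4 * x) ≡ x
h₁-eq = solve-∀ ring

64s-pure : ∀ δ → 0# ≤ δ → ¼ * h4 * δ ≤ δ
64s-pure δ h = by (nonneg (1# - ¼ * h4) refl ⊗ h) (solve (δ ⸴ ∎) ring)

s≤a-pure : ∀ s a' a → s ≤ h4 * a' → a' ≤ ⅛ * a → 0# ≤ a → ⟪ 64 ⟫ * s ≤ a
s≤a-pure s a' a h k 0a = by (0≤⟪ 64 ⟫ ⊗ gap h ⊕ 0≤⟪ 4 ⟫ ⊗ gap k ⊕ 0≤½ ⊗ 0a) (solve (s ⸴ a' ⸴ a ⸴ ∎) ring)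

s≤-pure : ∀ ν a → ν ≤ 1# → 0# ≤ a → h4 * (ν * a) ≤ h4 * a
s≤-pure ν a h 0a = by (0≤h4 ⊗ gap h ⊗ 0a) (solve (ν ⸴ a ⸴ ∎) ring)

a'≤-pure : ∀ ν a → ν ≤ 1# → 0# ≤ a → ⅛ * (ν * a) ≤ ⅛ * a
a'≤-pure ν a h 0a = by (0≤⅛ ⊗ gap h ⊗ 0a) (solve (ν ⸴ a ⸴ ∎) ring)

a≤1-pure : ∀ δ → δ ≤ 1# → ¼ * h4 * δ ≤ 1#
a≤1-pure δ h = by (0≤¼ ⊗ 0≤h4 ⊗ gap h ⊕ nonneg (1# - ¼ * h4) refl) (solve (δ ⸴ ∎) ring)

a≤-pure : ∀ a δ → ⟪ 64 ⟫ * a ≤ δ → a ≤ ¼ * h4 * δ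
a≤-pure a δ h = by (0≤¼ ⊗ 0≤h4 ⊗ gap h) (solve (a ⸴ δ ⸴ ∎) ring)

64a-pure : ∀ c δ → c ≤ ½ * δ → 0# ≤ δ → ⟪ 64 ⟫ * (¼ * h4 * c) ≤ δ
64a-pure c δ h 0δ = by (gap h ⊕ 0≤½ ⊗ 0δ) (solve (c ⸴ δ ⸴ ∎) ring)

ν≤δ-pure : ∀ δ → 0# ≤ δ → ½ * δ ≤ δ
ν≤δ-pure δ h = by (0≤½ ⊗ h) (solve (δ ⸴ ∎) ring)

ν≤½δ-pure : ∀ ξ δ → 0# ≤ ξ → ξ ≤ ½ * δ → δ ≤ 1# → 0# ≤ δ → ½ * (ξ * ξ) ≤ ½ * δ
ν≤½δ-pure ξ δ 0ξ h k 0δ = by (0≤½ ⊗ (gap h ⊗ (0ξ ⊕ 0≤½ ⊗ 0δ) ⊕ 0≤¼ ⊗ 0δ ⊗ gap k ⊕ (0≤½ ⊕ 0≤¼) ⊗ 0δ)) (solve (ξ ⸴ δ ⸴ ∎) ring)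

ξ≤-pure : ∀ δ c → 0# ≤ δ → c ≤ 1# → ⅛ * h8 * (δ * c) ≤ ½ * δ
ξ≤-pure δ c 0δ h = by (0≤⅛ ⊗ 0≤h8 ⊗ 0δ ⊗ gap h ⊕ nonneg (½ - ⅛ * h8) refl ⊗ 0δ) (solve (δ ⸴ c ⸴ ∎) ring)

c≤½δ-pure : ∀ δ → 0# ≤ δ → h8 * δ ≤ ½ * δ
c≤½δ-pure δ h = by (nonneg (½ - h8) refl ⊗ h) (solve (δ ⸴ ∎) ring)

c≤δ-eq : ∀ δ → ¼ * h4 * h8 * h8 * h8 * (δ * δ * (δ * δ)) ≡ h8 * δ * (¼ * h4 * h8 * h8 * (δ * δ * δ))
c≤δ-eq = solve-∀ ring

c≤δ-cube : ∀ δ → 0# ≤ δ → δ ≤ 1# → δ * δ * δ ≤ 1#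
c≤δ-cube δ 0δ h = by (gap h ⊗ (0≤1 ⊕ 0δ ⊕ 0δ ⊗ 0δ)) (solve (δ ⸴ ∎) ring)

module Constants {d' H' G' N' : ℕ} (A : Admissible d' H' G' N') where

 open Parameters d' H' G' N' public

 Yu = proj₁ A
 N≥ = proj₁ (proj₂ A)
 c≤ = proj₁ (proj₂ (proj₂ A))
 u≤s = proj₁ (proj₂ (proj₂ (proj₂ A)))
 u≤δ² = proj₂ (proj₂ (proj₂ (proj₂ A)))

 0≤u : 0# ≤ u
 0≤u = 0≤inv N

 c≤δ : c ≤ h8 * δ
 c≤δ = ≤-trans c≤ (≡≤ (c≤δ-eq δ) (≤-trans (*-monoˡ (0≤h8 ⊗ 0≤δ) (*-mono (0≤¼ ⊗ 0≤h4 ⊗ 0≤h8 ⊗ 0≤h8) 0≤1 (<⇒≤ (does-true (¼ * h4 * h8 * h8 <? 1#) refl)) (c≤δ-cube δ 0≤δ δ≤1))) (≤-reflexive (*-identityʳ (h8 * δ)))))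
 c≤½δ : c ≤ ½ * δ
 c≤½δ = ≤-trans c≤δ (c≤½δ-pure δ 0≤δ)
 c≤1 : c ≤ 1#
 c≤1 = inv≤1 H'
 ξ≤ : ξ ≤ ½ * δ
 ξ≤ = ξ≤-pure δ c 0≤δ c≤1
 ν≤½δ : ν ≤ ½ * δ
 ν≤½δ = ν≤½δ-pure ξ δ (<⇒≤ 0<ξ) ξ≤ δ≤1 0≤δ
 ν≤δ : ν ≤ δ
 ν≤δ = ≤-trans ν≤½δ (ν≤δ-pure δ 0≤δ)
 ν≤1 : ν ≤ 1#
 ν≤1 = ≤-trans ν≤δ δ≤1
 64a : ⟪ 64 ⟫ * a ≤ δ
 64a = 64a-pure c δ c≤½δ 0≤δ
 a≤ : a ≤ ¼ * h4 * δ
 a≤ = a≤-pure a δ 64a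
 a≤1 : a ≤ 1#
 a≤1 = ≤-trans a≤ (a≤1-pure δ δ≤1)
 a'≤ : a' ≤ ⅛ * a
 a'≤ = a'≤-pure ν a ν≤1 (<⇒≤ 0<a)
 s≤ : s ≤ h4 * a'
 s≤ = s≤-pure ν a' ν≤1 (<⇒≤ 0<a')
 s≤a : ⟪ 64 ⟫ * s ≤ a
 s≤a = s≤a-pure s a' a s≤ a'≤ (<⇒≤ 0<a)
 64s : ⟪ 64 ⟫ * s ≤ δ
 64s = ≤-trans s≤a (≤-trans a≤ (64s-pure δ 0≤δ))
 h₁ : ⟪ 16 ⟫ * s ≤ ν * a'
 h₁ = ≤-reflexive (h₁-eq (ν * a'))
 h₂ : ⟪ 4 ⟫ * (a' + ⟪ 2 ⟫ * s) ≤ ν * a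
 h₂ = pure ν a a' refl a'≤ (<⇒≤ 0<ν) (<⇒≤ 0<a) where
  pure : ∀ ν a a' → a' ≡ ⅛ * (ν * a) → a' ≤ ⅛ * a → 0# ≤ ν → 0# ≤ a → ⟪ 4 ⟫ * (a' + ⟪ 2 ⟫ * (h4 * (ν * a'))) ≤ ν * a
  pure ν a a' e h 0ν 0a = ≡≤ (trans (pure-eq-4 a' ν) (cong (λ z → ⟪ 4 ⟫ * z + ½ * ν * a') e)) (by (0≤½ ⊗ 0ν ⊗ gap h ⊕ 0≤½ ⊗ (0≤1 ⊕ 0≤⟪ 6 ⟫) ⊗ (0≤⅛) ⊗ 0ν ⊗ 0a) (solve (ν ⸴ a ⸴ a' ⸴ ∎) ring))
 h₃ : ⟪ 32 ⟫ * s ≤ ν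
 h₃ = h₃-pure ν a' a (<⇒≤ 0<ν) a'≤ a≤1
 aδ : 1# + a ≤ (1# + δ) * (1# - s)
 aδ = aδ-pure a δ s 64a 64s (<⇒≤ 0<s) 0≤δ δ≤1
 ξ² : ⟪ 2 ⟫ * ν ≤ ξ * ξ
 ξ² = ≤-reflexive (ξ²-eq (ξ * ξ))
 Gu : ⟦ G ⟧ * u ≡ ¼ * h8 * (δ * c)
 Gu = pure ⟦ G ⟧ ⟦ H ⟧ u δ c (trans (cong (_* u) (sym (trans (⟦⟧-* G (H ℕ.* 4)) (cong (⟦ G ⟧ *_) (⟦⟧-* H 4))))) Yu) (*inv H') where
  pure : ∀ G H u δ c → G * (H * ⟪ 4 ⟫) * u ≡ h8 * δ → H * c ≡ 1# → G * u ≡ ¼ * h8 * (δ * c)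
  pure G H u δ c p q = sym (*-identityʳ (G * u)) ⨾ cong (λ z → G * u * z) (sym q) ⨾ pure-e₁-9 G H u c ⨾ cong (λ z → ¼ * z * c) p ⨾ pure-e₂-6 δ c
 u≤½ : u ≤ ½
 u≤½ = u≤½-pure u δ u≤δ² δ≤1 0≤δ

pure-e₁-8 : ∀ Y u d δ → Y * u * (d * δ) ≡ h8 * (Y * (d * ⟪ 256 ⟫) * u) * δ
pure-e₁-8 = solve-∀ ring

N≥-eq : ∀ Y → Y ℕ.* 3 ℕ.+ Y ℕ.+ Y ≡ Y ℕ.* 5
N≥-eq = ℕR.solve-∀

u≤s-pure : ∀ u s → u ≤ ¼ * s → ⟪ 4 ⟫ * u ≤ s
u≤s-pure u s h = by (0≤⟪ 4 ⟫ ⊗ gap h) (solve (u ⸴ s ⸴ ∎) ring)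

-- `Y * u` is prescribed exactly, so `N` is the multiple `256 * d * Y` of `Y`, and `u` is made small
-- by enlarging `G`. There is no circularity because `s` depends on `d` and `H` only.
constants : ∀ d' → ∃ λ H' → ∃ λ G' → ∃ λ N' → Admissible d' H' G' N'
constants d' = H' , G' , N' , Yu , N≥ , proj₂ pH , u≤s , u≤δ² where
 δ : ℚ
 δ = inv (suc (suc d'))
 0<δ : 0# < δ
 0<δ = 0<inv (suc d')
 pH = small {¼ * h4 * h8 * h8 * h8 * (δ * δ * (δ * δ))} (<⊗ (<⊗ (<⊗ (<⊗ (<⊗ (<⊗ 0<½ 0<½) 0<h4) 0<h8) 0<h8) 0<h8) (<⊗ (<⊗ 0<δ 0<δ) (<⊗ 0<δ 0<δ)))
 H' = proj₁ pH
 open Parameters d' H' 0 0 using (s; 0<s; d; H)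
 pG₁ = small {¼ * s} (<⊗ (<⊗ 0<½ 0<½) 0<s)
 pG₂ = small {⅛ * h4 * h8 * (δ * δ)} (<⊗ (<⊗ (<⊗ (<⊗ (<⊗ 0<½ 0<½) 0<½) 0<h4) 0<h8) (<⊗ 0<δ 0<δ))
 G' : ℕ
 G' = proj₁ pG₁ ℕ.+ proj₁ pG₂
 Y W N' : ℕ
 Y = suc G' ℕ.* (H ℕ.* 4)
 W = Y ℕ.* (d ℕ.* 256)
 N' = ℕ.pred W
 G≤Y : suc G' ℕ.≤ Y
 G≤Y = ℕₚ.≤-trans (ℕₚ.≤-reflexive (sym (ℕₚ.*-identityʳ (suc G')))) (ℕₚ.*-monoʳ-≤ (suc G') (ℕₚ.*-mono-≤ {1} {H} {1} {4} (ℕ.s≤s ℕ.z≤n) (ℕ.s≤s ℕ.z≤n)))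
 G≤W : suc G' ℕ.≤ W
 G≤W = ℕₚ.≤-trans G≤Y (ℕₚ.≤-trans (ℕₚ.≤-reflexive (sym (ℕₚ.*-identityʳ Y))) (ℕₚ.*-monoʳ-≤ Y (ℕₚ.*-mono-≤ {1} {d} {1} {256} (ℕ.s≤s ℕ.z≤n) (ℕ.s≤s ℕ.z≤n))))
 N≡ : suc N' ≡ W
 N≡ = ℕₚ.suc-pred W {{ℕ.>-nonZero (ℕₚ.≤-trans (ℕ.s≤s ℕ.z≤n) G≤W)}}
 u≤ : ∀ k → k ℕ.≤ G' → inv (suc N') ≤ inv (suc k)
 u≤ k h = inv-anti (ℕ.s≤s ℕ.z≤n) (ℕₚ.≤-trans (ℕ.s≤s h) (ℕₚ.≤-trans G≤W (ℕₚ.≤-reflexive (sym N≡))))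
 u≤s : ⟪ 4 ⟫ * inv (suc N') ≤ s
 u≤s = u≤s-pure (inv (suc N')) s (≤-trans (u≤ (proj₁ pG₁) (ℕₚ.m≤m+n (proj₁ pG₁) (proj₁ pG₂))) (proj₂ pG₁))
 u≤δ² : inv (suc N') ≤ ⅛ * h4 * h8 * (δ * δ)
 u≤δ² = ≤-trans (u≤ (proj₁ pG₂) (ℕₚ.m≤n+m (proj₁ pG₂) (proj₁ pG₁))) (proj₂ pG₂)
 u : ℚ
 u = inv (suc N')
 Yu : ⟦ Y ⟧ * u ≡ h8 * δ
 Yu = pure ⟦ Y ⟧ ⟦ d ⟧ u δ (trans (cong (_* u) (sym (trans (cong ⟦_⟧ N≡) (trans (⟦⟧-* Y (d ℕ.* 256)) (cong (⟦ Y ⟧ *_) (⟦⟧-* d 256)))))) (*inv N')) (*inv (suc d')) where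
  pure : ∀ Y d u δ → Y * (d * ⟪ 256 ⟫) * u ≡ 1# → d * δ ≡ 1# → Y * u ≡ h8 * δ
  pure Y d u δ p q = sym (*-identityʳ (Y * u)) ⨾ cong (λ z → Y * u * z) (sym q) ⨾ pure-e₁-8 Y u d δ ⨾ cong (λ z → h8 * z * δ) p ⨾ cong (_* δ) (*-identityʳ h8)
 N≥ : 3 ℕ.+ suc G' ℕ.+ Y ℕ.≤ suc N'
 N≥ = ℕₚ.≤-trans (ℕₚ.+-mono-≤ (ℕₚ.+-mono-≤ {3} {Y ℕ.* 3} (ℕₚ.*-monoˡ-≤ 3 1≤Y) G≤Y) (ℕₚ.≤-refl {Y})) (ℕₚ.≤-trans (ℕₚ.≤-reflexive (N≥-eq Y)) (ℕₚ.≤-trans (ℕₚ.*-monoʳ-≤ Y (ℕₚ.≤-trans 5≤256 256≤)) (ℕₚ.≤-reflexive (sym N≡)))) where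
  1≤Y : 1 ℕ.≤ Y
  1≤Y = ℕₚ.≤-trans (ℕ.s≤s ℕ.z≤n) G≤Y
  5≤256 : 5 ℕ.≤ 256
  5≤256 = ℕₚ.m≤m+n 5 251
  256≤ : 256 ℕ.≤ d ℕ.* 256
  256≤ = ℕₚ.m≤n*m 256 d

-- Verifying the requirements of the large edges

count-filter : {A : Set} (p q : A → Bool) (xs : List A) → countᵇ p (filterᵇ q xs) ≡ countᵇ (λ x → q x ∧ p x) xs
count-filter p q [] = refl
count-filter p q (x ∷ xs) with q x
... | true = cong (λ k → if p x then suc k else k) (count-filter p q xs)
... | false = count-filter p q xs

true-does : ∀ {P : Set} (p? : Dec P) → P → does p? ≡ true
true-does (yes _) _ = refl
true-does (no ¬p) p = ⊥-elim (¬p p)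

largeThreshold : ℕ → ℕ
largeThreshold H' = proj₁ (beats 1 1 (suc H' ℕ.* 4)) ℕ.+ suc H' ℕ.* 32

pure-e₁-10 : ∀ x → x ≡ ¼ * h4 * (⟪ 64 ⟫ * x)
pure-e₁-10 = solve-∀ ring

inv64 : inv 64 ≡ ¼ * h4
inv64 = pure (inv 64) (*inv 63) where
 pure : ∀ x → ⟪ 64 ⟫ * x ≡ 1# → x ≡ ¼ * h4
 pure x h = pure-e₁-10 x ⨾ cong (¼ * h4 *_) h ⨾ *-identityʳ (¼ * h4)

D≤qj-pure : ∀ D H h b j y → D ≤ H * (h + 1#) → h ≤ j + (1# + b) * ⟪ 2 ⟫ → ⟪ 8 ⟫ * b ≤ h → y ≤ h + 1# → ⟪ 32 ⟫ ≤ y → 0# ≤ H → D ≤ H * ⟪ 4 ⟫ * j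
D≤qj-pure D H h b j y p q r s t 0H = by (gap p ⊕ 0H ⊗ (0≤⟪ 4 ⟫ ⊗ gap q ⊕ gap r ⊕ 0≤⟪ 2 ⟫ ⊗ (gap s ⊕ gap t) ⊕ 0≤⟪ 53 ⟫)) (solve (D ⸴ H ⸴ h ⸴ b ⸴ j ⸴ y ⸴ ∎) ring)

x≤h-pure : ∀ b h y → ⟪ 8 ⟫ * b ≤ h → y ≤ h + 1# → ⟪ 32 ⟫ ≤ y → 0# ≤ h → (1# + b) * ⟪ 2 ⟫ ≤ h
x≤h-pure b h y p q r 0h = by (0≤¼ ⊗ gap p ⊕ 0≤½ ⊗ (gap q ⊕ gap r) ⊕ 0≤¼ ⊗ 0h ⊕ (0≤½ ⊗ 0≤⟪ 27 ⟫)) (solve (b ⸴ h ⸴ y ⸴ ∎) ring)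

minus1-eq : ∀ x → 0# ≡ 1# + (x - 1# - x)
minus1-eq = solve-∀ ring

h≤-e₃ : ∀ x → 1# * 1# * x ≡ x
h≤-e₃ = solve-∀ ring

h≤-e₂ : ∀ δ i D a k → h8 * (δ * i) * (h8 * (δ * i)) * ((1# + ⟪ 2 ⟫ * a) * D) * (⅛ * (k * (¼ * δ * ((1# + ⟪ 2 ⟫ * a) * D)))) ≡
   D * i * (D * i) * ((1# + ⟪ 2 ⟫ * a) * (1# + ⟪ 2 ⟫ * a) * (h4 * h8 * h8 * ½ * (δ * δ * δ) * k))
h≤-e₂ = solve-∀ ring

h≤-square : ∀ a → 0# ≤ a → 1# ≤ (1# + ⟪ 2 ⟫ * a) * (1# + ⟪ 2 ⟫ * a)
h≤-square a h = by (0≤⟪ 4 ⟫ ⊗ h ⊕ 0≤⟪ 4 ⟫ ⊗ (h ⊗ h)) (solve (a ⸴ ∎) ring)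

h≤-e₁ : ∀ δ D → ¼ * h4 * h8 * h8 * h8 * (δ * δ * (δ * δ)) * D ≡ h4 * h8 * h8 * ½ * (δ * δ * δ) * (½ * h8 * (δ * D))
h≤-e₁ = solve-∀ ring

ℓb-pure : ∀ ℓ k b h u δ c D a → ℓ ≤ u * D + k → u ≤ ⅛ * h4 * h8 * (δ * δ) → k ≤ h8 * (δ * D) → ⟪ 8 ⟫ * b ≤ h → h ≤ c * D → c ≤ h8 * δ → 0# ≤ δ → δ ≤ 1# → 0# ≤ D → 0# ≤ a →
    ℓ + b ≤ ⅛ * ½ * (¼ * δ * ((1# + ⟪ 2 ⟫ * a) * D))
ℓb-pure ℓ k b h u δ c D a p₁ p₂ p₃ p₄ p₅ p₆ 0δ p₇ 0D 0a = by (gap p₁ ⊕ gap p₂ ⊗ 0D ⊕ gap p₃ ⊕ 0≤⅛ ⊗ (gap p₄ ⊕ gap p₅ ⊕ gap p₆ ⊗ 0D) ⊕ 0≤⅛ ⊗ 0≤h4 ⊗ 0≤h8 ⊗ gap p₇ ⊗ 0δ ⊗ 0D ⊕ 0≤½ ⊗ 0≤h4 ⊗ 0δ ⊗ 0a ⊗ 0D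
   ⊕ nonneg (¼ * h4 - h8 - ⅛ * h8 - ⅛ * h4 * h8) refl ⊗ 0δ ⊗ 0D) (solve (ℓ ⸴ k ⸴ b ⸴ h ⸴ u ⸴ δ ⸴ c ⸴ D ⸴ a ⸴ ∎) ring)

ℓ≤-pure : ∀ ℓ k u δ D → ℓ ≤ u * D + k → u ≤ ⅛ * h4 * h8 * (δ * δ) → ½ * h8 * (δ * D) ≤ k → 0# ≤ δ → 0# ≤ D → ℓ ≤ k * (1# + ⅛ * ½ * (¼ * δ))
ℓ≤-pure ℓ k u δ D p q r 0δ 0D = by (gap p ⊕ gap q ⊗ 0D ⊕ 0≤¼ ⊗ 0≤h4 ⊗ 0δ ⊗ gap r) (solve (ℓ ⸴ k ⸴ u ⸴ δ ⸴ D ⸴ ∎) ring)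

room-pure : ∀ c D h b → c * D ≤ h + 1# → h ≤ ⟪ 8 ⟫ * (b + 1#) → ⟪ 32 ⟫ ≤ c * D → (1# + ⟪ 2 ⟫ * (¼ * h4 * c)) * D - b ≤ (1# - ¼ * h4 * c) * D - 1#
room-pure c D h b p q r = by (0≤⅛ ⊗ (gap p ⊕ gap q) ⊕ 0≤⟪ 5 ⟫ ⊗ (0≤¼ ⊗ 0≤h4) ⊗ gap r ⊕ 0≤⟪ 3 ⟫ ⊗ (0≤⅛)) (solve (c ⸴ D ⸴ h ⸴ b ⸴ ∎) ring)

K'≥-pure : ∀ a δ D → a ≤ ¼ * h4 * δ → 0# ≤ D → (1# - ¼ * h4 * δ) * D ≤ (1# - a) * D
K'≥-pure a δ D h 0D = by (gap h ⊗ 0D) (solve (a ⸴ δ ⸴ D ⸴ ∎) ring)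

half-pure : ∀ a δ D → ⟪ 64 ⟫ * a ≤ δ → δ ≤ 1# → 0# ≤ D → ½ * ((1# + ⟪ 2 ⟫ * a) * D) ≤ (1# - a) * D
half-pure a δ D h k 0D = by (0≤½ ⊗ h4½ ⊗ (gap h ⊕ gap k) ⊗ 0D ⊕ nonneg (½ - ½ * h4) refl ⊗ 0D) (solve (a ⸴ δ ⸴ D ⸴ ∎) ring) where
 h4½ : 0# ≤ h4
 h4½ = 0≤h4

κΔ-pure : ∀ δ a → 0# ≤ δ → a ≤ 1# → ⟪ 20 ⟫ * (h8 * δ * (1# + ⟪ 2 ⟫ * a) * 1#) ≤ ¼ * δ
κΔ-pure δ a 0δ h = by (0≤⟪ 40 ⟫ ⊗ 0≤h8 ⊗ 0δ ⊗ gap h ⊕ 0≤⟪ 4 ⟫ ⊗ 0≤h8 ⊗ 0δ) (solve (δ ⸴ a ⸴ ∎) ring)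

κΔ-eq : ∀ δ i a D → ⟪ 20 ⟫ * (h8 * (δ * i) * ((1# + ⟪ 2 ⟫ * a) * D)) ≡ ⟪ 20 ⟫ * (h8 * δ * (1# + ⟪ 2 ⟫ * a) * (D * i))
κΔ-eq = solve-∀ ring

κ≤1-pure : ∀ δ D i → D * i ≡ 1# → 0# ≤ i → 0# ≤ δ → δ ≤ 1# → 1# ≤ D → h8 * (δ * i) ≤ 1#
κ≤1-pure δ D i e 0i 0δ h k = ≤-trans (by {b = D * i} {p = h8 * (1# - δ) * i + (1# - h8) * i + (D - 1#) * i} (0≤h8 ⊗ gap h ⊗ 0i ⊕ nonneg (1# - h8) refl ⊗ 0i ⊕ gap k ⊗ 0i) (solve (δ ⸴ D ⸴ i ⸴ ∎) ring)) (≤-reflexive e)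

1≤D-pure : ∀ c D → ⟪ 32 ⟫ ≤ c * D → c ≤ 1# → 0# ≤ D → 1# ≤ D
1≤D-pure c D h k 0D = by (gap h ⊕ gap k ⊗ 0D ⊕ 0≤⟪ 31 ⟫) (solve (c ⸴ D ⸴ ∎) ring)

pure-eq-6 : ∀ H c h → c * (H * h) ≡ H * c * h
pure-eq-6 = solve-∀ ring

pure-eq-7 : ∀ H c h → H * c * h ≡ c * (H * h)
pure-eq-7 = solve-∀ ring

pure-eq-8 : ∀ H c → H * c * ⟪ 32 ⟫ ≡ c * (H * ⟪ 32 ⟫)
pure-eq-8 = solve-∀ ring

T-lists-pure : ∀ X N G B u D s δ c → N ≤ X + (⟪ 3 ⟫ + G) → (1# - u) * D ≤ N * B → B ≤ u * D → ⟪ 4 ⟫ * u ≤ s → G * u ≡ ¼ * h8 * (δ * c) → 0# ≤ G → δ ≤ 1# → 0# ≤ c →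
    ⟪ 64 ⟫ * s ≤ ¼ * h4 * c → 0# ≤ D → 0# ≤ B → (1# - ¼ * h4 * c) * D ≤ X * B
T-lists-pure X N G B u D s δ c a₁ a₂ a₃ a₄ e 0G a₅ 0c a₆ 0D 0B = ≤-trans (≤-trans step (≤-reflexive (cong (λ z → (1# - u) * D - ⟪ 3 ⟫ * B - z * D) (sym e)))) step₂ where
 step : (1# - ¼ * h4 * c) * D ≤ (1# - u) * D - ⟪ 3 ⟫ * B - ¼ * h8 * (δ * c) * D
 step = by (0≤⟪ 3 ⟫ ⊗ gap a₃ ⊕ gap a₄ ⊗ 0D ⊕ (0≤¼ ⊗ 0≤h4) ⊗ gap a₆ ⊗ 0D ⊕ 0≤¼ ⊗ 0≤h8 ⊗ gap a₅ ⊗ 0c ⊗ 0D ⊕ nonneg (¼ * h4 - ¼ * h4 * (¼ * h4) - ¼ * h8) refl ⊗ 0c ⊗ 0D) (solve (B ⸴ u ⸴ D ⸴ s ⸴ δ ⸴ c ⸴ ∎) ring)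
 step₂ : (1# - u) * D - ⟪ 3 ⟫ * B - G * u * D ≤ X * B
 step₂ = by (gap a₁ ⊗ 0B ⊕ gap a₂ ⊕ 0G ⊗ gap a₃) (solve (X ⸴ N ⸴ G ⸴ B ⸴ u ⸴ D ⸴ ∎) ring)

R-lists-pure : ∀ G u δ c D B → G * u ≡ ¼ * h8 * (δ * c) → 0# ≤ G → 0# ≤ δ * c → u ≤ ½ → 0# ≤ D → u * ((1# - u) * D) ≤ B → ⅛ * h8 * (δ * c) * D ≤ G * B
R-lists-pure G u δ c D B e 0G 0x h 0D p = ≤-trans (by {b = ¼ * h8 * (δ * c) * ((1# - u) * D)} {p = ¼ * h8 * (δ * c) * (½ - u) * D} (0≤¼ ⊗ 0≤h8 ⊗ 0x ⊗ gap h ⊗ 0D) (solve (δ ⸴ c ⸴ u ⸴ D ⸴ ∎) ring)) (≡≤ (trans (cong (_* ((1# - u) * D)) (sym e)) (*-assoc G u ((1# - u) * D))) (*-monoˡ 0G p))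

all-lists-pure : ∀ X N B u D s → N ≤ X + ⟪ 3 ⟫ → (1# - u) * D ≤ N * B → B ≤ u * D → ⟪ 4 ⟫ * u ≤ s → 0# ≤ D → 0# ≤ B → (1# - s) * D ≤ X * B
all-lists-pure X N B u D s h₁ h₂ h₃ h₄ 0D 0B = by (gap h₁ ⊗ 0B ⊕ gap h₂ ⊕ 0≤⟪ 3 ⟫ ⊗ gap h₃ ⊕ gap h₄ ⊗ 0D) (solve (X ⸴ N ⸴ B ⸴ u ⸴ D ⸴ s ⸴ ∎) ring)

ℓ≤k-pure : ∀ ℓ X N Y B k K D u → X + Y ≡ N → ℓ + X * B ≡ K → k ≡ Y * B → K ≤ D → (1# - u) * D ≤ N * B → ℓ ≤ u * D + k
ℓ≤k-pure ℓ X N Y B k K D u refl refl refl p q = by (gap p ⊕ gap q) (solve (ℓ ⸴ X ⸴ Y ⸴ B ⸴ D ⸴ u ⸴ ∎) ring)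

k≥-pure : ∀ Y u δ D B → Y * u ≡ h8 * δ → 0# ≤ Y → 0# ≤ δ → u ≤ ½ → 0# ≤ D → u * ((1# - u) * D) ≤ B → ½ * h8 * (δ * D) ≤ Y * B
k≥-pure Y u δ D B e 0Y 0δ h 0D p = ≤-trans (by {b = h8 * δ * ((1# - u) * D)} {p = h8 * δ * (½ - u) * D} (0≤h8 ⊗ 0δ ⊗ gap h ⊗ 0D) (solve (δ ⸴ u ⸴ D ⸴ ∎) ring)) (≡≤ (trans (cong (_* ((1# - u) * D)) (sym e)) (*-assoc Y u ((1# - u) * D))) (*-monoˡ 0Y p))

module LargeSetup {E V : Set} (_≟ₑ_ : DecidableEquality E) (_≟ᵥ_ : DecidableEquality V)
 (vs : List V) (vs! : AllPairs _≢_ vs) (vs-all : ∀ v → v ∈ vs) (es : List E) (es! : AllPairs _≢_ es) (es-all : ∀ e → e ∈ es)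
 (inc : E → V → Bool) (cs : List ℕ) (cs! : AllPairs _≢_ cs)
 (meet-refl : ∀ e → Incidence.meet _≟ᵥ_ vs vs! inc e e ≡ true) (nonempty : ∀ e → 1# ≤ Incidence.size _≟ᵥ_ vs vs! inc e)
 (t : ℚ) (0≤t : 0# ≤ t) (codeg : ∀ u v → u ≢ v → ∑[ e ∈ es ] Incidence.i _≟ᵥ_ vs vs! inc e u * Incidence.i _≟ᵥ_ vs vs! inc e v ≤ t)
 {d' H' G' N' : ℕ} (A : Admissible d' H' G' N')
 (D K : ℕ) (D≡ : t * ⟦ length vs ⟧ ≡ ⟦ D ⟧) (D≥ : largeThreshold H' ℕ.≤ D) (m≤ : length es ℕ.≤ D ℕ.* D) (K≤D : K ℕ.≤ D)
 (L : E → ℕ → Bool) (L≡ : ∀ e → countᵇ (L e) cs ≡ K) (C : Classes L cs (suc N') D K) where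

 open Incidence _≟ᵥ_ vs vs! inc
 open Constants A
 open Graph _≟ₑ_ es es! es-all meet (Matching.meet-sym _≟ᵥ_ vs vs! vs-all es es-all inc) cs cs! using (avail)
 open LargeColouring _≟ₑ_ _≟ᵥ_ vs vs! vs-all es es! es-all inc cs cs! meet-refl nonempty t 0≤t codeg using (Setup; D₀)
 module Cl = Classes C
 open Cl using (κ)

 Λ Λ₂ : E → ℕ → Bool
 Λ e c = L e c ∧ does (3 ℕ.≤? κ c)
 inR inP : ℕ → Bool
 inR c = does (κ c ℕ.<? 3 ℕ.+ G)
 inP c = does (N ℕ.∸ Y ℕ.≤? κ c)
 Λ₂ e c = Λ e c ∧ not (inR c)

 Dq B Nq : ℚ
 Dq = D₀
 B = ⟦ Cl.b ⟧
 Nq = ⟦ N ⟧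
 D₀≡ : D₀ ≡ ⟦ D ⟧
 D₀≡ = D≡

 NB≥ : (1# - u) * D₀ ≤ Nq * B
 NB≥ = subst (λ x → (1# - u) * x ≤ Nq * B) (sym D₀≡) Cl.Nb≥
 NB≤ : Nq * B ≤ D₀
 NB≤ = ≡≤ (sym (⟦⟧-* N Cl.b)) (≤-trans (⟦⟧-mono (ℕₚ.≤-trans Cl.Nb≤ K≤D)) (≤-reflexive (sym D₀≡)))
 0≤D : 0# ≤ D₀
 0≤D = ≤-trans 0≤⟦ D ⟧ (≤-reflexive (sym D₀≡))
 uN : u * Nq ≡ 1#
 uN = trans (*-comm u Nq) (*inv N')
 B≤ : B ≤ u * D₀
 B≤ = ≡≤ (trans (sym (*-identityˡ B)) (trans (cong (_* B) (sym uN)) (*-assoc u Nq B))) (*-monoˡ 0≤u NB≤)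
 B≥ : u * ((1# - u) * D₀) ≤ B
 B≥ = ≤-trans (*-monoˡ 0≤u NB≥) (≤-reflexive (trans (sym (*-assoc u Nq B)) (trans (cong (_* B) uN) (*-identityˡ B))))

 D≥₁ : proj₁ (beats 1 1 (H ℕ.* 4)) ℕ.≤ D
 D≥₁ = ℕₚ.≤-trans (ℕₚ.m≤m+n (proj₁ (beats 1 1 (H ℕ.* 4))) (H ℕ.* 32)) D≥
 32≤cD : ⟪ 32 ⟫ ≤ c * D₀
 32≤cD = pure ⟦ H ⟧ c D₀ (*inv H') 0≤c (≡≤ (sym (⟦⟧-* H 32)) (≤-trans (⟦⟧-mono (ℕₚ.≤-trans (ℕₚ.m≤n+m (H ℕ.* 32) (proj₁ (beats 1 1 (H ℕ.* 4)))) D≥)) (≤-reflexive (sym D₀≡)))) where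
  pure : ∀ H c D → H * c ≡ 1# → 0# ≤ c → H * ⟪ 32 ⟫ ≤ D → ⟪ 32 ⟫ ≤ c * D
  pure H c D e 0c h = ≡≤ (trans (sym (*-identityˡ ⟪ 32 ⟫)) (trans (cong (_* ⟪ 32 ⟫) (sym e)) (pure-eq-8 H c))) (*-monoˡ 0c h)

 -- `h` is the total mean demanded and `b`, an eighth of it, the saving actually used. `ℓ` bounds
 -- the palette part of a list from above: the list has `K` colours, and the `N - Y` other classes
 -- take at least `Cl.b` each.
 h b k ℓ : ℕ
 h = D ℕ/./ H
 b = h ℕ/./ 8
 k = Y ℕ.* Cl.b
 ℓ = K ℕ.∸ (N ℕ.∸ Y) ℕ.* Cl.b
 h≤cD : ⟦ h ⟧ ≤ c * D₀
 h≤cD = pure ⟦ H ⟧ c D₀ ⟦ h ⟧ (*inv H') 0≤c (≤-trans (floor≤ D H') (≤-reflexive (sym D₀≡))) where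
  pure : ∀ H c D h → H * c ≡ 1# → 0# ≤ c → H * h ≤ D → h ≤ c * D
  pure H c D h e 0c p = ≡≤ (trans (sym (*-identityˡ h)) (trans (cong (_* h) (sym e)) (pure-eq-7 H c h))) (*-monoˡ 0c p)
 cD≤h : c * D₀ ≤ ⟦ h ⟧ + 1#
 cD≤h = pure ⟦ H ⟧ c D₀ (⟦ h ⟧ + 1#) (*inv H') 0≤c (≡≤ D₀≡ (floor≥ D H')) where
  pure : ∀ H c D h → H * c ≡ 1# → 0# ≤ c → D ≤ H * h → c * D ≤ h
  pure H c D h e 0c p = ≤-trans (*-monoˡ 0c p) (≤-reflexive (trans (pure-eq-6 H c h) (trans (cong (_* h) e) (*-identityˡ h))))
 8b≤h : ⟪ 8 ⟫ * ⟦ b ⟧ ≤ ⟦ h ⟧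
 8b≤h = floor≤ h 7
 h≤8b : ⟦ h ⟧ ≤ ⟪ 8 ⟫ * (⟦ b ⟧ + 1#)
 h≤8b = floor≥ h 7

 k≡ : ⟦ k ⟧ ≡ ⟦ Y ⟧ * B
 k≡ = ⟦⟧-* Y Cl.b
 k≥ : ½ * h8 * (δ * D₀) ≤ ⟦ k ⟧
 k≥ = ≤-trans (k≥-pure ⟦ Y ⟧ u δ D₀ B Yu 0≤⟦ Y ⟧ 0≤δ u≤½ 0≤D B≥) (≤-reflexive (sym k≡))
 k≤ : ⟦ k ⟧ ≤ h8 * (δ * D₀)
 k≤ = ≡≤ k≡ (≤-trans (*-monoˡ 0≤⟦ Y ⟧ B≤) (≤-reflexive (trans (sym (*-assoc ⟦ Y ⟧ u D₀)) (trans (cong (_* D₀) Yu) (*-assoc h8 δ D₀)))))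

 Y≤N : Y ℕ.≤ N
 Y≤N = ℕₚ.≤-trans (ℕₚ.m≤n+m Y (3 ℕ.+ G)) N≥
 GY≤ : 3 ℕ.+ G ℕ.≤ N ℕ.∸ Y
 GY≤ = ℕₚ.m+n≤o⇒m≤o∸n (3 ℕ.+ G) N≥
 ℓ≤k : ⟦ ℓ ⟧ ≤ u * D₀ + ⟦ k ⟧
 ℓ≤k = ℓ≤k-pure ⟦ ℓ ⟧ ⟦ N ℕ.∸ Y ⟧ Nq ⟦ Y ⟧ B ⟦ k ⟧ ⟦ K ⟧ D₀ u
   (trans (sym (⟦⟧-+ (N ℕ.∸ Y) Y)) (cong ⟦_⟧ (ℕₚ.m∸n+n≡m Y≤N)))
   (trans (cong (⟦ ℓ ⟧ +_) (sym (⟦⟧-* (N ℕ.∸ Y) Cl.b))) (trans (sym (⟦⟧-+ ℓ ((N ℕ.∸ Y) ℕ.* Cl.b))) (cong ⟦_⟧ (ℕₚ.m∸n+n≡m (ℕₚ.≤-trans (ℕₚ.*-monoˡ-≤ Cl.b (ℕₚ.m∸n≤m N Y)) Cl.Nb≤)))))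
   k≡ (≤-trans (⟦⟧-mono K≤D) (≤-reflexive (sym D₀≡))) NB≥

 atLeast : ∀ e lo q → lo ℕ.+ q ℕ.≤ N → (P : ℕ → Bool) → (∀ c → L e c ≡ true → lo ℕ.≤ κ c → κ c ℕ.< lo ℕ.+ q → P c ≡ true) → q ℕ.* Cl.b ℕ.≤ countᵇ P cs
 atLeast e lo q h P imp = ℕₚ.≤-trans (Cl.interval≥ e lo q h) (count-mono (λ c → L e c ∧ between lo (lo ℕ.+ q) (κ c)) P cs (λ c p → let r = ∧-true₂ (L e c) p in
  imp c (∧-true₁ (L e c) p) (does-true (lo ℕ.≤? κ c) (∧-true₁ (does (lo ℕ.≤? κ c)) r)) (does-true (κ c ℕ.<? lo ℕ.+ q) (∧-true₂ (does (lo ℕ.≤? κ c)) r))))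
 atLeastℚ : ∀ (Φ : E → ℕ → Bool) e lo q → lo ℕ.+ q ℕ.≤ N → (∀ c → L e c ≡ true → lo ℕ.≤ κ c → κ c ℕ.< lo ℕ.+ q → Φ e c ≡ true) → ⟦ q ⟧ * B ≤ avail Φ e
 atLeastℚ Φ e lo q h imp = ≡≤ (sym (⟦⟧-* q Cl.b)) (≤-trans (⟦⟧-mono (atLeast e lo q h (Φ e) imp)) (≤-reflexive (sym (∑-count (Φ e) cs))))

 notR : ∀ c → 3 ℕ.+ G ℕ.≤ κ c → not (inR c) ≡ true
 notR c h = cong not (¬true (λ p → ℕₚ.<⇒≱ (does-true (κ c ℕ.<? 3 ℕ.+ G) p) h))
 3≤N : 3 ℕ.≤ N
 3≤N = ℕₚ.≤-trans (ℕₚ.m≤m+n 3 G) (ℕₚ.≤-trans (ℕₚ.m≤m+n (3 ℕ.+ G) Y) N≥)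
 3G≤N : 3 ℕ.+ G ℕ.≤ N
 3G≤N = ℕₚ.≤-trans (ℕₚ.m≤m+n (3 ℕ.+ G) Y) N≥
 below3 : ∀ {c} → 3 ℕ.≤ κ c → does (3 ℕ.≤? κ c) ≡ true
 below3 {c} = true-does (3 ℕ.≤? κ c)

 all-lists : ∀ e → (1# - s) * D₀ ≤ avail Λ e
 all-lists e = ≤-trans (all-lists-pure ⟦ N ℕ.∸ 3 ⟧ Nq B u D₀ s (∸≥ N 3) NB≥ B≤ u≤s 0≤D 0≤⟦ Cl.b ⟧)
   (atLeastℚ Λ e 3 (N ℕ.∸ 3) (ℕₚ.≤-reflexive (ℕₚ.m+[n∸m]≡n 3≤N)) (λ c l p _ → ∧-intro l (below3 p)))
 R-lists : ∀ e → ξ * D₀ ≤ avail (λ e c → Λ e c ∧ inR c) e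
 R-lists e = ≤-trans (R-lists-pure ⟦ G ⟧ u δ c D₀ B Gu 0≤⟦ G ⟧ (0≤δ ⊗ 0≤c) u≤½ 0≤D B≥)
   (atLeastℚ (λ e c → Λ e c ∧ inR c) e 3 G 3G≤N (λ c l p q → ∧-intro (∧-intro l (below3 p)) (true-does (κ c ℕ.<? 3 ℕ.+ G) q)))
 K' : ℚ
 K' = (1# - a) * D₀
 T-lists : ∀ e → K' ≤ avail Λ₂ e
 T-lists e = ≤-trans (T-lists-pure ⟦ N ℕ.∸ (3 ℕ.+ G) ⟧ Nq ⟦ G ⟧ B u D₀ s δ c (≤-trans (∸≥ N (3 ℕ.+ G)) (≤-reflexive (cong (⟦ N ℕ.∸ (3 ℕ.+ G) ⟧ +_) (⟦⟧-+ 3 G)))) NB≥ B≤ u≤s Gu 0≤⟦ G ⟧ δ≤1 0≤c 64s≤c 0≤D 0≤⟦ Cl.b ⟧)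
   (atLeastℚ Λ₂ e (3 ℕ.+ G) (N ℕ.∸ (3 ℕ.+ G)) (ℕₚ.≤-reflexive (ℕₚ.m+[n∸m]≡n 3G≤N)) (λ c l p _ → ∧-intro (∧-intro l (below3 {c} (ℕₚ.≤-trans (ℕₚ.m≤m+n 3 G) p))) (notR c p))) where
  64s≤c : ⟪ 64 ⟫ * s ≤ ¼ * h4 * c
  64s≤c = s≤a

 setup : Setup Λ inR inP
 setup = record { δ = δ ; s = s ; a' = a' ; a = a ; ν = ν ; ξ = ξ ; κ = κ₀ ; K' = K' ; k₀ = 0 ; b = b ; h = h ; k = k ; ℓ = ℓ ; 0<D = 0<D ; 0<δ = 0<δ ; δ≤1 = δ≤1 ; 0<s = 0<s ; 0<a' = 0<a' ; 0<a = 0<a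
  ; h₁ = h₁ ; h₂ = h₂ ; h₃ = h₃ ; ν≤1 = ν≤1 ; ν≤δ = ν≤δ ; aδ = aδ ; a≤1 = a≤1 ; 64a = 64a ; 64s = 64s ; 0≤ξ = <⇒≤ 0<ξ ; ξ² = ξ² ; 0≤κ = 0≤κ ; κ≤1 = κ≤1 ; κΔ = κΔ ; half = half ; K'≥ = K'≥ ; room = room
  ; all-lists = all-lists ; R-lists = R-lists ; T-lists = T-lists ; P-lists≥ = P-lists≥ ; P-lists≤ = P-lists≤ ; ℓ≤ = ℓ≤ ; ℓb = ℓb ; h≤ = h≤ ; M< = M< } where
  1≤D : 1# ≤ D₀
  1≤D = 1≤D-pure c D₀ 32≤cD c≤1 0≤D
  0<D : 0# < D₀
  0<D = <-≤-trans 0<1 1≤D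
  iD κ₀ : ℚ
  iD = proj₁ (inverse 0<D)
  D*iD : D₀ * iD ≡ 1#
  D*iD = proj₂ (proj₂ (inverse 0<D))
  0≤iD : 0# ≤ iD
  0≤iD = <⇒≤ (proj₁ (proj₂ (inverse 0<D)))
  -- As large, up to a constant, as `20κΔ ≤ β` permits, since the mean saving is quadratic in `κ`.
  κ₀ = h8 * (δ * iD)
  0≤κ : 0# ≤ κ₀
  0≤κ = 0≤h8 ⊗ (0≤δ ⊗ 0≤iD)
  κ≤1 : κ₀ ≤ 1#
  κ≤1 = κ≤1-pure δ D₀ iD D*iD 0≤iD 0≤δ δ≤1 1≤D
  κΔ : ⟪ 20 ⟫ * (κ₀ * ((1# + ⟪ 2 ⟫ * a) * D₀)) ≤ ¼ * δ
  κΔ = ≡≤ (trans (κΔ-eq δ iD a D₀) (cong (λ z → ⟪ 20 ⟫ * (h8 * δ * (1# + ⟪ 2 ⟫ * a) * z)) D*iD)) (κΔ-pure δ a 0≤δ a≤1)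
  half : ½ * ((1# + ⟪ 2 ⟫ * a) * D₀) ≤ K'
  half = half-pure a δ D₀ 64a δ≤1 0≤D
  K'≥ : (1# - inv 64 * δ) * D₀ ≤ K'
  K'≥ = ≡≤ (cong (λ z → (1# - z * δ) * D₀) inv64) (K'≥-pure a δ D₀ a≤ 0≤D)
  room : (1# + ⟪ 2 ⟫ * a) * D₀ - ⟦ b ⟧ < K'
  room = ≤-<-trans (room-pure c D₀ ⟦ h ⟧ ⟦ b ⟧ cD≤h h≤8b 32≤cD) (minus1 K') where
   minus1 : ∀ x → x - 1# < x
   minus1 x = ≰⇒> (λ p → <⇒¬≥ 0<1 (by {p = x - 1# - x} (gap p) (minus1-eq x)))
  P-lists≥ : ∀ e → k ℕ.≤ countᵇ (λ c → Λ₂ e c ∧ inP c) (filterᵇ inP cs)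
  P-lists≥ e = ℕₚ.≤-trans (atLeast e (N ℕ.∸ Y) Y (ℕₚ.≤-reflexive (ℕₚ.m∸n+n≡m Y≤N)) (λ c → inP c ∧ (Λ₂ e c ∧ inP c)) (λ c l p _ → let q = true-does (N ℕ.∸ Y ℕ.≤? κ c) p ; r = ℕₚ.≤-trans GY≤ p in
    ∧-intro q (∧-intro (∧-intro (∧-intro l (below3 {c} (ℕₚ.≤-trans (ℕₚ.m≤m+n 3 G) r))) (notR c r)) q))) (ℕₚ.≤-reflexive (sym (count-filter (λ c → Λ₂ e c ∧ inP c) inP cs)))
  P-lists≤ : ∀ e → countᵇ (Λ₂ e) (filterᵇ inP cs) ℕ.≤ ℓ
  P-lists≤ e = ℕₚ.≤-trans (ℕₚ.≤-reflexive (count-filter (Λ₂ e) inP cs)) (ℕₚ.m+n≤o⇒m≤o∸n (countᵇ (λ c → inP c ∧ Λ₂ e c) cs)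
   (ℕₚ.≤-trans (ℕₚ.+-monoʳ-≤ (countᵇ (λ c → inP c ∧ Λ₂ e c) cs) (Cl.interval≥ e 0 (N ℕ.∸ Y) (ℕₚ.m∸n≤m N Y)))
    (ℕₚ.≤-trans (count-disjoint (λ c → inP c ∧ Λ₂ e c) (λ c → L e c ∧ between 0 (N ℕ.∸ Y) (κ c)) (L e) cs (λ c p → ∧-true₁ (L e c) (∧-true₁ (Λ e c) (∧-true₂ (inP c) p))) (λ c → ∧-true₁ (L e c))
     (λ c p q → ℕₚ.<⇒≱ (does-true (κ c ℕ.<? N ℕ.∸ Y) (∧-true₂ (does (0 ℕ.≤? κ c)) (∧-true₂ (L e c) q))) (does-true (N ℕ.∸ Y ℕ.≤? κ c) (∧-true₁ (inP c) p)))) (ℕₚ.≤-reflexive (L≡ e)))))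
  β : ℚ
  β = ¼ * δ
  ℓ≤ : ⟦ ℓ ⟧ ≤ ⟦ k ⟧ * (1# + sixteenth * β)
  ℓ≤ = ℓ≤-pure ⟦ ℓ ⟧ ⟦ k ⟧ u δ D₀ ℓ≤k u≤δ² k≥ 0≤δ 0≤D
  ℓb : ⟦ ℓ ⟧ + ⟦ b ⟧ ≤ sixteenth * (β * ((1# + ⟪ 2 ⟫ * a) * D₀))
  ℓb = ℓb-pure ⟦ ℓ ⟧ ⟦ k ⟧ ⟦ b ⟧ ⟦ h ⟧ u δ c D₀ a ℓ≤k u≤δ² k≤ 8b≤h h≤cD c≤δ 0≤δ δ≤1 0≤D (<⇒≤ 0<a)
  h≤ : ⟦ h ⟧ ≤ κ₀ * κ₀ * ((1# + ⟪ 2 ⟫ * a) * D₀) * (⅛ * (⟦ k ⟧ * (β * ((1# + ⟪ 2 ⟫ * a) * D₀))))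
  h≤ = ≤-trans h≤cD (≤-trans (*-monoʳ 0≤D c≤) (≡≤ (h≤-e₁ δ D₀) (≤-trans (*-monoˡ (0≤h4 ⊗ 0≤h8 ⊗ 0≤h8 ⊗ 0≤½ ⊗ (0≤δ ⊗ 0≤δ ⊗ 0≤δ)) k≥) (≡≤ (sym (*-identityˡ X))
      (≤-trans (*-monoʳ 0≤X (h≤-square a (<⇒≤ 0<a))) (≤-reflexive (sym (trans (h≤-e₂ δ iD D₀ a ⟦ k ⟧) (cong (λ z → z * z * ((1# + ⟪ 2 ⟫ * a) * (1# + ⟪ 2 ⟫ * a) * X)) D*iD ⨾ h≤-e₃ ((1# + ⟪ 2 ⟫ * a) * (1# + ⟪ 2 ⟫ * a) * X)))))))))) where
   X : ℚ
   X = h4 * h8 * h8 * ½ * (δ * δ * δ) * ⟦ k ⟧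
   0≤X : 0# ≤ X
   0≤X = 0≤h4 ⊗ 0≤h8 ⊗ 0≤h8 ⊗ 0≤½ ⊗ (0≤δ ⊗ 0≤δ ⊗ 0≤δ) ⊗ 0≤⟦ k ⟧
  -- `rebase` turns `2 ^ b` into at most `2(b + 1)` factors `3/2`. As `b` is an eighth of `h`, the
  -- remaining `jj` factors suffice to beat the number of edges.
  M< : ⟦ length es ⟧ * (1# + inv 1) ^ b < (1# + inv 2) ^ h
  M< = <-≤-trans (≤-<-trans (*-mono 0≤⟦ length es ⟧ (^-nonneg x (0≤1 ⊕ 0≤inv 2)) (⟦⟧-mono (ℕₚ.≤-trans m≤ (ℕₚ.≤-reflexive (sym (ℕₚ.*-identityˡ (D ℕ.* D)))))) (rebase 0 b))
    (ℚₚ.*-monoˡ-<-pos ((1# + inv 2) ^ x) {{positive (<-≤-trans 0<1 (1≤^ x 1≤3/2))}} (proj₂ (beats 1 1 (H ℕ.* 4)) D jj D≥₁ D≤qj)))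
   (≡≤ (trans (*-comm ((1# + inv 2) ^ jj) ((1# + inv 2) ^ x)) (sym (^-+ (1# + inv 2) x jj))) (^-≤ 1≤3/2 (ℕₚ.≤-reflexive (ℕₚ.m+[n∸m]≡n x≤h)))) where
   x jj : ℕ
   x = suc (b ℕ/./ 1) ℕ.* 2
   jj = h ℕ.∸ x
   1≤3/2 : 1# ≤ 1# + inv 2
   1≤3/2 = by (0≤inv 2) refl
   x≡ : ⟦ x ⟧ ≡ (1# + ⟦ b ⟧) * ⟪ 2 ⟫
   x≡ = trans (⟦⟧-* (suc (b ℕ/./ 1)) 2) (cong (_* ⟪ 2 ⟫) (trans (cong (λ y → ⟦ suc y ⟧) (ℕ/.n/1≡n b)) 1+⟦ b ⟧))
   x≤h : x ℕ.≤ h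
   x≤h = ⟦⟧-cancel (≡≤ x≡ (x≤h-pure ⟦ b ⟧ ⟦ h ⟧ (c * D₀) 8b≤h cD≤h 32≤cD 0≤⟦ h ⟧))
   D≤qj : D ℕ.≤ H ℕ.* 4 ℕ.* jj
   D≤qj = ⟦⟧-cancel (≤-trans (D≤qj-pure ⟦ D ⟧ ⟦ H ⟧ ⟦ h ⟧ ⟦ b ⟧ ⟦ jj ⟧ (c * D₀) (floor≥ D H') (≤-trans (∸≥ h x) (≤-reflexive (cong (⟦ jj ⟧ +_) x≡))) 8b≤h cD≤h 32≤cD 0≤⟦ H ⟧)
     (≤-reflexive (sym (trans (⟦⟧-* (H ℕ.* 4) jj) (cong (_* ⟦ jj ⟧) (⟦⟧-* H 4))))))
--

ceiling : ∀ q → ∃ λ k → q ≤ ⟦ suc k ⟧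
ceiling q = let k , h = archimedean q in k , ≤-trans h (⟦⟧-mono (ℕₚ.n≤1+n k))

⟦⟧-cancel-* : ∀ D A z q Z → A ≡ z ℕ.* q → ⟦ D ⟧ ≤ ⟦ z ⟧ * ⟦ q ⟧ * ⟦ Z ⟧ → D ℕ.≤ A ℕ.* Z
⟦⟧-cancel-* D _ z q Z refl h = ⟦⟧-cancel (≤-trans h (≤-reflexive (sym (trans (⟦⟧-* (z ℕ.* q) Z) (cong (_* ⟦ Z ⟧) (⟦⟧-* z q))))))

Fits : (A Z₀ n D : ℕ) → ℚ → Set
Fits A Z₀ n D η = A ℕ.* (2 ℕ.+ Z₀) ℕ.≤ D × ⟪ 2 ⟫ * ⟦ A ⟧ ≤ η * ⟦ n ⟧

scaled-e₂ : ∀ A Z i → ⟪ 2 ⟫ * (A * Z) * i ≡ ⟪ 2 ⟫ * A * (Z * i)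
scaled-e₂ = solve-∀ ring

scaled-e₁ : ∀ n t i → n * (⟪ 2 ⟫ * t * i) ≡ ⟪ 2 ⟫ * (t * n) * i
scaled-e₁ = solve-∀ ring

-- Since `t * n = D ≤ A * Z`, the ratio `t / Z` is at most `A / n`. Hence a large `n` makes the
-- codegree weights small uniformly in `t`.
fits : ∀ A' {Z₀ n D : ℕ} {η : ℚ} Z t → Fits (suc A') Z₀ n D η → t * ⟦ n ⟧ ≡ ⟦ D ⟧ → 1 ℕ.≤ n → n ℕ.≤ D → D ℕ.≤ suc A' ℕ.* Z →
    2 ℕ.≤ Z × Z₀ ℕ.≤ Z × n ℕ.≤ suc A' ℕ.* Z × ⟪ 2 ⟫ * t * inv Z ≤ η
fits A' {Z₀} {n} {D} {η} Z t (D≥ , n≥) tn 1≤n n≤D D≤ = 2≤Z , ℕₚ.≤-trans (ℕₚ.m≤n+m Z₀ 2) Z≥ , ℕₚ.≤-trans n≤D D≤ , cancel-≤ (<-≤-trans 0<1 (⟦⟧-mono {1} 1≤n)) scaled where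
 A : ℕ
 A = suc A'
 Z≥ : 2 ℕ.+ Z₀ ℕ.≤ Z
 Z≥ = ℕₚ.*-cancelˡ-≤ A (ℕₚ.≤-trans D≥ D≤)
 2≤Z : 2 ℕ.≤ Z
 2≤Z = ℕₚ.≤-trans (ℕₚ.m≤m+n 2 Z₀) Z≥
 scaled : ⟦ n ⟧ * (⟪ 2 ⟫ * t * inv Z) ≤ ⟦ n ⟧ * η
 scaled = ≡≤ (trans (scaled-e₁ ⟦ n ⟧ t (inv Z)) (cong (λ z → ⟪ 2 ⟫ * z * inv Z) tn)) (≤-trans (*-monoʳ (0≤inv Z) (*-monoˡ 0≤⟪ 2 ⟫ (≤-trans (⟦⟧-mono D≤) (≤-reflexive (⟦⟧-* A Z)))))
   (≡≤ (trans (scaled-e₂ ⟦ A ⟧ ⟦ Z ⟧ (inv Z)) (trans (cong (⟪ 2 ⟫ * ⟦ A ⟧ *_) (*inv′ (ℕₚ.≤-trans (ℕ.s≤s ℕ.z≤n) 2≤Z))) (*-identityʳ (⟪ 2 ⟫ * ⟦ A ⟧)))) (≤-trans n≥ (≤-reflexive (*-comm η ⟦ n ⟧)))))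

enough-eq : ∀ η η' a → η * (a * η') ≡ η * η' * a
enough-eq = solve-∀ ring

fits-eventually : ∀ A Z₀ {η} → 0# < η → ∃ λ n₀ → ∀ n D → n₀ ℕ.≤ n → n ℕ.≤ D → Fits A Z₀ n D η
fits-eventually A Z₀ {η} 0<η = k ℕ.+ A ℕ.* (2 ℕ.+ Z₀) , λ n D h n≤D →
  ℕₚ.≤-trans (ℕₚ.m≤n+m (A ℕ.* (2 ℕ.+ Z₀)) k) (ℕₚ.≤-trans h n≤D) , ≤-trans enough (*-monoˡ (<⇒≤ 0<η) (⟦⟧-mono (ℕₚ.≤-trans (ℕₚ.m≤m+n k (A ℕ.* (2 ℕ.+ Z₀))) h))) where
 η' : ℚ
 η' = proj₁ (inverse 0<η)
 k : ℕ
 k = proj₁ (archimedean (⟪ 2 ⟫ * ⟦ A ⟧ * η'))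
 enough : ⟪ 2 ⟫ * ⟦ A ⟧ ≤ η * ⟦ k ⟧
 enough = ≡≤ (sym (trans (enough-eq η η' (⟪ 2 ⟫ * ⟦ A ⟧)) (trans (cong (_* (⟪ 2 ⟫ * ⟦ A ⟧)) (proj₂ (proj₂ (inverse 0<η)))) (*-identityˡ (⟪ 2 ⟫ * ⟦ A ⟧))))) (*-monoˡ (<⇒≤ 0<η) (proj₂ (archimedean (⟪ 2 ⟫ * ⟦ A ⟧ * η'))))

-- Edges of size at most r₁ are small, those of size in (r₁, r₀] medium, the others large.
record Parts (d' N' : ℕ) : Set where
 field
  r₁ r₀ : ℚ
  zM' zS' AM' AS' : ℕ
  r₁≡ : r₁ ≡ ⟦ suc N' ⟧ * ⟪ 16 ⟫
  r₀≡ : r₀ ≡ r₁ * (⟦ suc (suc d') ⟧ * ⟪ 64 ⟫)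
  16≤r₁ : ⟪ 16 ⟫ ≤ r₁
  r₁≤r₀ : r₁ ≤ r₀
  1≤r₁ : 1# ≤ r₁
  1≤r₀ : 1# ≤ r₀
  zM≥ : ⟪ 2 ⟫ * r₀ ≤ ⟦ suc zM' ⟧
  zS≥ : ⟪ 4 ⟫ * (r₁ * ⟦ suc N' ⟧) ≤ ⟦ suc zS' ⟧
  AM≡ : suc AM' ≡ suc zM' ℕ.* (suc N' ℕ.* 4)
  AS≡ : suc AS' ≡ suc zS' ℕ.* 2

 zM zS eS : ℕ
 zM = suc zM'
 zS = suc zS'
 eS = suc (suc d') ℕ.* 6
 2≤5 : 2 ℕ.≤ 5
 2≤5 = ℕ.s≤s (ℕ.s≤s ℕ.z≤n)
 2≤eS : 2 ℕ.≤ eS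
 2≤eS = ℕ.s≤s (ℕ.s≤s ℕ.z≤n)
 module BM = BoundedRank r₀ 1≤r₀ 5 2≤5 zM (suc AM') (ℕ.s≤s ℕ.z≤n)
 module BS = BoundedRank r₁ 1≤r₁ eS 2≤eS zS (suc AS') (ℕ.s≤s ℕ.z≤n)

parts : ∀ d' N' → Parts d' N'
parts d' N' = record { r₁ = r₁ ; r₀ = r₀ ; zM' = zM' ; zS' = zS' ; AM' = ℕ.pred (suc zM' ℕ.* (N ℕ.* 4)) ; AS' = ℕ.pred (suc zS' ℕ.* 2) ; r₁≡ = refl ; r₀≡ = refl ; 16≤r₁ = 16≤r₁ ; r₁≤r₀ = r₁≤r₀ ; 1≤r₁ = 1≤r₁ ; 1≤r₀ = ≤-trans 1≤r₁ r₁≤r₀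
  ; zM≥ = proj₂ (ceiling (⟪ 2 ⟫ * r₀)) ; zS≥ = proj₂ (ceiling (⟪ 4 ⟫ * (r₁ * ⟦ N ⟧))) ; AM≡ = positive-pred zM' (3 ℕ.+ N' ℕ.* 4) ; AS≡ = positive-pred zS' 1 } where
 d N : ℕ
 d = suc (suc d')
 N = suc N'
 1≤⟦_⟧ : ∀ k → 1# ≤ ⟦ suc k ⟧
 1≤⟦ k ⟧ = ⟦⟧-mono {1} {suc k} (ℕ.s≤s ℕ.z≤n)
 r₁ r₀ : ℚ
 -- Edges above this size have degree at most about `D/(16N)`, a small part of one colour class, and
 -- are large enough for the core argument because `4u ≤ s`.
 r₁ = ⟦ N ⟧ * ⟪ 16 ⟫
 r₀ = r₁ * (⟦ d ⟧ * ⟪ 64 ⟫)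
 16≤r₁ : ⟪ 16 ⟫ ≤ r₁
 16≤r₁ = ≡≤ (sym (*-identityˡ ⟪ 16 ⟫)) (*-monoʳ 0≤⟪ 16 ⟫ (1≤⟦ N' ⟧))
 r₁≤r₀ : r₁ ≤ r₀
 r₁≤r₀ = ≡≤ (sym (*-identityʳ r₁)) (*-monoˡ (≤-trans 0≤⟪ 16 ⟫ 16≤r₁) (*-mono {1#} {⟦ d ⟧} {1#} {⟦ 64 ⟧} 0≤1 0≤⟪ 64 ⟫ 1≤⟦ suc d' ⟧ 1≤⟦ 63 ⟧))
 1≤r₁ : 1# ≤ r₁
 1≤r₁ = ≤-trans 1≤⟦ 15 ⟧ 16≤r₁
 zM' zS' : ℕ
 -- `z` is the ratio of list length to `Z`; it is chosen so that the `r * Z` leftover neighbours fit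
 -- into a single reserved class.
 zM' = proj₁ (ceiling (⟪ 2 ⟫ * r₀))
 zS' = proj₁ (ceiling (⟪ 4 ⟫ * (r₁ * ⟦ N ⟧)))
 positive-pred : ∀ a b → suc (ℕ.pred (suc a ℕ.* suc b)) ≡ suc a ℕ.* suc b
 positive-pred a b = refl

-- Combining the three colourings

3w-eq : ∀ d δ w → ⟪ 3 ⟫ * w * (d * δ) ≡ ½ * δ * (d * ⟪ 6 ⟫ * w)
3w-eq = solve-∀ ring

pure-eq-9 : ∀ d δ x → d * δ * x ≡ h4 * (δ * (d * ⟪ 16 ⟫ * x))
pure-eq-9 = solve-∀ ring

pure-eq-10 : ∀ d δ x → d * δ * x ≡ h4 * (δ * (d * ⟪ 16 ⟫ * x))
pure-eq-10 = solve-∀ ring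

pure-eq₂-3 : ∀ N z Z → N * ((1# - ½ * 1#) * (z * Z)) ≡ ½ * (N * (z * Z))
pure-eq₂-3 = solve-∀ ring

pure-eq-11 : ∀ N z Z w → N * ((1# - ⟪ 3 ⟫ * w) * (z * Z)) ≡ N * ((1# - ½ * (⟪ 6 ⟫ * w)) * (z * Z))
pure-eq-11 = solve-∀ ring

pure-eq-12 : ∀ N u → ⟪ 64 ⟫ * (N * u) ≡ ⟪ 4 ⟫ * u * (N * ⟪ 16 ⟫)
pure-eq-12 = solve-∀ ring

reserve-pure : ∀ r N z Z B D δ → B ≤ r * Z → ½ * D ≤ N * B → ⟪ 4 ⟫ * (r * N) ≤ z → z * Z ≤ D - h4 * (δ * D) → 0# ≤ N → 0# ≤ Z → 0# ≤ δ → 1# ≤ D → 1# ≤ 0#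
reserve-pure r N z Z B D δ p q h k 0N 0Z 0δ l = by (0≤⟪ 4 ⟫ ⊗ 0N ⊗ gap p ⊕ 0≤⟪ 4 ⟫ ⊗ gap q ⊕ gap h ⊗ 0Z ⊕ gap k ⊕ gap l ⊕ 0≤h4 ⊗ (0δ ⊗ (gap l ⊕ 0≤1))) (solve (r ⸴ N ⸴ z ⸴ Z ⸴ B ⸴ D ⸴ δ ⸴ ∎) ring)

degree-pure : ∀ δ D x w → ⟪ 3 ⟫ * w ≤ ½ * δ → (1# - ⟪ 2 ⟫ * h4 * δ) * D ≤ x → 0# ≤ δ → δ ≤ 1# → 0# ≤ D → 0# ≤ x → (1# - δ) * D ≤ (1# - ⟪ 3 ⟫ * w) * x
degree-pure δ D x w p q 0δ r 0D 0x = by (gap p ⊗ 0x ⊕ (0≤½ ⊗ gap r ⊕ 0≤½) ⊗ gap q ⊕ 0≤⟪ 3 ⟫ ⊗ (0≤⅛) ⊗ 0δ ⊗ 0D ⊕ 0≤h4 ⊗ 0δ ⊗ 0δ ⊗ 0D) (solve (δ ⸴ D ⸴ x ⸴ w ⸴ ∎) ring)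

lists-pure : ∀ δ s D a b l → (1# - s) * D ≤ a → b ≤ ½ * h4 * (δ * D) → ⟪ 64 ⟫ * s ≤ δ → a ≤ b + l → 0# ≤ δ → 0# ≤ D → D - h4 * (δ * D) ≤ l
lists-pure δ s D a b l p q r h 0δ 0D = by (gap p ⊕ gap q ⊕ 0≤¼ ⊗ 0≤h4 ⊗ gap r ⊗ 0D ⊕ gap h ⊕ 0≤¼ ⊗ 0≤h4 ⊗ 0δ ⊗ 0D) (solve (δ ⸴ s ⸴ D ⸴ a ⸴ b ⸴ l ⸴ ∎) ring)

D≤AZ-pure : ∀ δ D x → (1# - ⟪ 2 ⟫ * h4 * δ) * D ≤ x → δ ≤ 1# → 0# ≤ D → D ≤ ⟪ 2 ⟫ * x
D≤AZ-pure δ D x h k 0D = by (0≤⟪ 2 ⟫ ⊗ gap h ⊕ 0≤⟪ 4 ⟫ ⊗ 0≤h4 ⊗ gap k ⊗ 0D ⊕ nonneg (1# - ⟪ 4 ⟫ * h4) refl ⊗ 0D) (solve (δ ⸴ D ⸴ x ⸴ ∎) ring)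

D≤AZ-eq : ∀ z Z → ⟪ 2 ⟫ * (z * Z) ≡ z * ⟪ 2 ⟫ * Z
D≤AZ-eq = solve-∀ ring

zZ≥-pure : ∀ D Q y z Z δ → D ≤ Q + (1# + y) → Q ≤ z * (Z + 1#) → y ≤ h4 * (δ * D) → 1# + z ≤ h4 * (δ * D) → (1# - ⟪ 2 ⟫ * h4 * δ) * D ≤ z * Z
zZ≥-pure D Q y z Z δ a₁ a₂ a₃ a₄ = by (gap a₁ ⊕ gap a₂ ⊕ gap a₃ ⊕ gap a₄) (solve (D ⸴ Q ⸴ y ⸴ z ⸴ Z ⸴ δ ⸴ ∎) ring)

Q≤-pure : ∀ Q y D x → Q + (1# + y) ≡ D → x ≤ y + 1# → Q ≤ D - x
Q≤-pure Q y D x refl h = by (gap h) (solve (Q ⸴ y ⸴ x ⸴ ∎) ring)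

1+y≤D-pure : ∀ y z δ D → y ≤ h4 * (δ * D) → 1# + z ≤ h4 * (δ * D) → 0# ≤ z → δ ≤ 1# → 0# ≤ D → 1# + y ≤ D
1+y≤D-pure y z δ D p q 0z r 0D = by (gap p ⊕ gap q ⊕ 0z ⊕ 0≤⟪ 2 ⟫ ⊗ 0≤h4 ⊗ gap r ⊗ 0D ⊕ nonneg (1# - ⟪ 2 ⟫ * h4) refl ⊗ 0D) (solve (y ⸴ z ⸴ δ ⸴ D ⸴ ∎) ring)

pure-eq₂-4 : ∀ r D → ⟪ 2 ⟫ * (r * (1# * D)) ≡ ⟪ 2 ⟫ * (r * D)
pure-eq₂-4 = solve-∀ ring

pure-eq-13 : ∀ r d δ D → r * (d * ⟪ 64 ⟫) * (½ * h4 * (δ * D)) ≡ ⟪ 2 ⟫ * (r * (d * δ * D))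
pure-eq-13 = solve-∀ ring

nbrs≤-eq : ∀ p a b → p * (a * b) ≡ a * (p * b)
nbrs≤-eq = solve-∀ ring

reserve-pure-2 : ∀ r z Z B → B ≤ r * Z → z * Z ≤ B → ⟪ 2 ⟫ * r ≤ z → 1# ≤ r → 1# ≤ Z → 1# ≤ 0#
reserve-pure-2 r z Z B p q h k l = by (gap p ⊕ gap q ⊕ gap h ⊗ (gap l ⊕ 0≤1) ⊕ gap k ⊗ (gap l ⊕ 0≤1) ⊕ gap l) (solve (r ⸴ z ⸴ Z ⸴ B ⸴ ∎) ring)

D≤zZ-pure : ∀ D N B z Z → ½ * D ≤ N * B → B ≤ z * (Z + 1#) → z * (N * ⟪ 4 ⟫) ≤ D → 0# ≤ N → D ≤ z * (N * ⟪ 4 ⟫) * Z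
D≤zZ-pure D N B z Z p q r 0N = by (0≤⟪ 4 ⟫ ⊗ gap p ⊕ 0≤⟪ 4 ⟫ ⊗ 0N ⊗ gap q ⊕ gap r) (solve (D ⸴ N ⸴ B ⸴ z ⸴ Z ⸴ ∎) ring)

half-D-pure : ∀ u D x → u ≤ ½ → 0# ≤ D → (1# - u) * D ≤ x → ½ * D ≤ x
half-D-pure u D x h 0D k = by (gap h ⊗ 0D ⊕ gap k) (solve (u ⸴ D ⸴ x ⸴ ∎) ring)

module Assembly {E V : Set} (_≟ₑ_ : DecidableEquality E) (_≟ᵥ_ : DecidableEquality V)
 (vs : List V) (vs! : AllPairs _≢_ vs) (vs-all : ∀ v → v ∈ vs) (es : List E) (es! : AllPairs _≢_ es) (es-all : ∀ e → e ∈ es)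
 (inc : E → V → Bool) (cs : List ℕ) (cs! : AllPairs _≢_ cs)
 (meet-refl : ∀ e → Incidence.meet _≟ᵥ_ vs vs! inc e e ≡ true) (nonempty : ∀ e → 1# ≤ Incidence.size _≟ᵥ_ vs vs! inc e)
 (t : ℚ) (0≤t : 0# ≤ t) (codeg : ∀ u v → u ≢ v → ∑[ e ∈ es ] Incidence.i _≟ᵥ_ vs vs! inc e u * Incidence.i _≟ᵥ_ vs vs! inc e v ≤ t)
 {d' H' G' N' : ℕ} (A : Admissible d' H' G' N') (P : Parts d' N')
 (D K : ℕ) (D≡ : t * ⟦ length vs ⟧ ≡ ⟦ D ⟧) (D≥ : largeThreshold H' ℕ.≤ D) (m≤ : length es ℕ.≤ D ℕ.* D) (K≤D : K ℕ.≤ D)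
 (L : E → ℕ → Bool) (L≡ : ∀ e → countᵇ (L e) cs ≡ K) (C : Classes L cs (suc N') D K)
 (1≤n : 1 ℕ.≤ length vs) (n≤D : length vs ℕ.≤ D) (fitsM : Fits (suc (Parts.AM' P)) (Parts.BM.Z₀ P) (length vs) D (Parts.BM.η P)) (fitsS : Fits (suc (Parts.AS' P)) (Parts.BS.Z₀ P) (length vs) D (Parts.BS.η P))
 (zS≤ : suc (Parts.zS P) ℕ.* (suc (suc d') ℕ.* 16) ℕ.≤ D) (deg : ∀ v → ∑[ e ∈ es ] Incidence.i _≟ᵥ_ vs vs! inc e v ≤ (1# - inv (suc (suc d'))) * ⟦ D ⟧) (win : E → Bool)
 (win-intro : ∀ e → (1# - inv (suc (suc d'))) * (1# - inv (suc (suc d'))) * ⟦ length vs ⟧ ≤ Incidence.size _≟ᵥ_ vs vs! inc e * Incidence.size _≟ᵥ_ vs vs! inc e → Incidence.size _≟ᵥ_ vs vs! inc e * Incidence.size _≟ᵥ_ vs vs! inc e ≤ (1# + inv (suc (suc d'))) * (1# + inv (suc (suc d'))) * ⟦ length vs ⟧ → win e ≡ true)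
 (win-count : ∑[ e ∈ es ] 𝟙 (win e) ≤ (1# - inv (suc (suc d'))) * ⟦ D ⟧) where

 open Incidence _≟ᵥ_ vs vs! inc
 open Constants A
 open Parts P
 open LargeSetup _≟ₑ_ _≟ᵥ_ vs vs! vs-all es es! es-all inc cs cs! meet-refl nonempty t 0≤t codeg A D K D≡ D≥ m≤ K≤D L L≡ C using (Λ; inR; inP; setup; all-lists; module Cl)
 open Cl using (κ)
 open Graph _≟ₑ_ es es! es-all meet (Matching.meet-sym _≟ᵥ_ vs vs! vs-all es es-all inc) cs cs!
 open LargeColouring _≟ₑ_ _≟ᵥ_ vs vs! vs-all es es! es-all inc cs cs! meet-refl nonempty t 0≤t codeg using (D₀; largeColouring)
 module SC = SubColouring _≟ₑ_ _≟ᵥ_ vs vs! vs-all es es! es-all inc cs cs!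
 open Counting _≟ᵥ_ vs vs! vs-all es inc using (dg; dg≤)

 isSmall isMedium isLarge : E → Bool
 isSmall e = does (size e ≤? r₁)
 isMedium e = not (isSmall e) ∧ does (size e ≤? r₀)
 isLarge e = not (does (size e ≤? r₀))

 medium≥ : ∀ e → isMedium e ≡ true → r₁ ≤ size e
 medium≥ e h = <⇒≤ (≰⇒> (does-false (size e ≤? r₁) (not-true (∧-true₁ (not (isSmall e)) h))))
 large≥ : ∀ e → isLarge e ≡ true → r₀ ≤ size e
 large≥ e h = <⇒≤ (≰⇒> (does-false (size e ≤? r₀) (not-true h)))

 Dq B : ℚ
 Dq = ⟦ D ⟧
 B = ⟦ Cl.b ⟧
 0≤Dq : 0# ≤ Dq
 0≤Dq = 0≤⟦ D ⟧
 1≤Dq : 1# ≤ Dq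
 1≤Dq = ⟦⟧-mono {1} (ℕₚ.≤-trans 1≤n n≤D)
 half-D : ½ * Dq ≤ ⟦ N ⟧ * B
 half-D = half-D-pure u Dq (⟦ N ⟧ * B) u≤½ 0≤Dq Cl.Nb≥
 3≤N : 3 ℕ.≤ N
 3≤N = ℕₚ.≤-trans (ℕₚ.m≤m+n 3 G) (ℕₚ.≤-trans (ℕₚ.m≤m+n (3 ℕ.+ G) Y) N≥)
 inClass : ℕ → E → ℕ → Bool
 inClass x e c = L e c ∧ does (κ c ℕ.≟ x)
 class≥ : ∀ e x → x ℕ.< 3 → Cl.b ℕ.≤ countᵇ (inClass x e) cs
 class≥ e x h = Cl.κ≥ e x (ℕₚ.≤-trans h 3≤N)
 class≥ℚ : ∀ e x → x ℕ.< 3 → B ≤ avail (inClass x) e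
 class≥ℚ e x h = ≤-trans (⟦⟧-mono (class≥ e x h)) (≤-reflexive (sym (∑-count (inClass x e) cs)))
 class-sep : ∀ {x y} → x ≢ y → ∀ e f c → inClass x e c ≡ true → inClass y f c ≡ true → ⊥
 class-sep {x} {y} x≢y e f c p q = x≢y (trans (sym (≟-true ℕ._≟_ {κ c} {x} (∧-true₂ (L e c) p))) (≟-true ℕ._≟_ {κ c} {y} (∧-true₂ (L f c) q)))
 class-sep-Λ : ∀ {x} → x ℕ.< 3 → ∀ e f c → Λ e c ≡ true → inClass x f c ≡ true → ⊥
 class-sep-Λ {x} h e f c p q = ℕₚ.<⇒≱ h (ℕₚ.≤-trans {3} {κ c} {x} (does-true (3 ℕ.≤? κ c) (∧-true₂ (L e c) p)) (ℕₚ.≤-reflexive (≟-true ℕ._≟_ {κ c} {x} (∧-true₂ (L f c) q))))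

 largeC : Colouring isLarge Λ
 largeC = largeColouring setup win win-intro (subst (λ x → ∑[ e ∈ es ] 𝟙 (win e) ≤ (1# - δ) * x) (sym D≡) win-count) isLarge (λ e l → ≤-trans 1≤sr₀ (*-monoˡ (<⇒≤ 0<s) (large≥ e l))) where
  1≤sr₀ : 1# ≤ s * r₀
  1≤sr₀ = ≤-trans (pure ⟦ N ⟧ u s r₁ r₁≡ (*inv N') u≤s 0≤⟦ N ⟧) (*-monoˡ (<⇒≤ 0<s) r₁≤r₀) where
   pure : ∀ N u s r → r ≡ N * ⟪ 16 ⟫ → N * u ≡ 1# → ⟪ 4 ⟫ * u ≤ s → 0# ≤ N → 1# ≤ s * r
   pure N u s _ refl e h 0N = ≤-trans (≤-trans (nonneg-step) (≤-reflexive (trans (cong (⟪ 64 ⟫ *_) (sym e)) (pure-eq-12 N u)))) (by (0≤⟪ 16 ⟫ ⊗ 0N ⊗ gap h) (solve (N ⸴ u ⸴ s ⸴ ∎) ring)) where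
    nonneg-step : 1# ≤ ⟪ 64 ⟫ * 1#
    nonneg-step = does-true (1# ≤? ⟪ 64 ⟫ * 1#) refl

 Dg≤ : ∀ W k → (∀ e → W e ≡ true → k ≤ size e) → ∀ v → dg nonempty t 0≤t codeg W v * (k - 1#) ≤ Dq
 Dg≤ W k h v = ≤-trans (dg≤ nonempty t 0≤t codeg W k h v) (≤-reflexive D≡)

 module Medium where
  Z : ℕ
  Z = Cl.b ℕ/./ zM
  AD : zM ℕ.* (N ℕ.* 4) ℕ.≤ D
  AD = ℕₚ.≤-trans (ℕₚ.≤-reflexive (sym AM≡)) (ℕₚ.≤-trans (ℕₚ.m≤m*n (suc AM') (2 ℕ.+ BM.Z₀)) (proj₁ fitsM))
  D≤zZ : Dq ≤ ⟦ zM ⟧ * (⟦ N ⟧ * ⟪ 4 ⟫) * ⟦ Z ⟧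
  D≤zZ = D≤zZ-pure Dq ⟦ N ⟧ B ⟦ zM ⟧ ⟦ Z ⟧ half-D (floor≥ Cl.b zM') (≡≤ (sym (trans (⟦⟧-* zM (N ℕ.* 4)) (cong (⟦ zM ⟧ *_) (⟦⟧-* N 4)))) (⟦⟧-mono AD)) 0≤⟦ N ⟧
  D≤AZ : D ℕ.≤ suc AM' ℕ.* Z
  D≤AZ = ⟦⟧-cancel-* D (suc AM') zM (N ℕ.* 4) Z AM≡ (≤-trans D≤zZ (≤-reflexive (cong (λ x → ⟦ zM ⟧ * x * ⟦ Z ⟧) (sym (⟦⟧-* N 4)))))
  F : 2 ℕ.≤ Z × BM.Z₀ ℕ.≤ Z × length vs ℕ.≤ suc AM' ℕ.* Z × ⟪ 2 ⟫ * t * inv Z ≤ BM.η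
  F = fits AM' {BM.Z₀} {length vs} {D} {BM.η} Z t fitsM D≡ 1≤n n≤D D≤AZ
  -- Medium edges have size at least `r₁ = 16N`, so at most about `D/(16N)` of them contain a
  -- vertex, while class 0 holds about `D/N` colours. This ratio leaves room for the crude error
  -- `3/6`.
  degree : ∀ v x → dg nonempty t 0≤t codeg isMedium v ≡ x → x ≤ (1# - ⟪ 3 ⟫ * inv 6) * (⟦ zM ⟧ * ⟦ Z ⟧)
  degree v x e = pure ⟦ N ⟧ x Dq ⟦ zM ⟧ ⟦ Z ⟧ (inv 6) r₁ r₁≡ (0<⟦ N' ⟧) (⟦⟧-mono {1} {N} (ℕ.s≤s ℕ.z≤n)) (subst (0# ≤_) e (∑-nonneg es (λ f → 0≤𝟙 (isMedium f) ⊗ 0≤i f v))) (*inv 5) (subst (λ y → y * (r₁ - 1#) ≤ Dq) e (Dg≤ isMedium r₁ medium≥ v)) D≤zZ where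
   pure : ∀ N x D z Z w r → r ≡ N * ⟪ 16 ⟫ → 0# < N → 1# ≤ N → 0# ≤ x → ⟪ 6 ⟫ * w ≡ 1# → x * (r - 1#) ≤ D → D ≤ z * (N * ⟪ 4 ⟫) * Z → x ≤ (1# - ⟪ 3 ⟫ * w) * (z * Z)
   pure N x D z Z w _ refl 0N 1N 0x e p q = cancel-≤ 0N (≤-trans main (≤-reflexive (sym (trans (pure-eq-11 N z Z w) (trans (cong (λ y → N * ((1# - ½ * y) * (z * Z))) e) (pure-eq₂-3 N z Z)))))) where
    main : N * x ≤ ½ * (N * (z * Z))
    main = by (0≤⅛ ⊗ (gap p ⊕ gap q) ⊕ 0≤⅛ ⊗ 0x ⊗ (0≤⟪ 8 ⟫ ⊗ gap 1N ⊕ 0≤⟪ 7 ⟫)) (solve (N ⸴ x ⸴ D ⸴ z ⸴ Z ⸴ ∎) ring)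
  reserve : ∀ f → isMedium f ≡ true → r₀ * ⟦ Z ⟧ < avail (inClass 1) f
  reserve f _ = ≰⇒> (λ h → <⇒¬≥ 0<1 (reserve-pure-2 r₀ ⟦ zM ⟧ ⟦ Z ⟧ B (≤-trans (class≥ℚ f 1 (ℕ.s≤s (ℕ.s≤s ℕ.z≤n))) h) (floor≤ Cl.b zM') zM≥ 1≤r₀ (⟦⟧-mono {1} (ℕₚ.≤-trans (ℕ.s≤s ℕ.z≤n) (proj₁ F)))))
  colouring : Colouring isMedium (λ e c → inClass 0 e c ∨ inClass 1 e c)
  colouring = SC.subColouring r₀ 1≤r₀ 5 2≤5 zM (suc AM') (ℕ.s≤s ℕ.z≤n) isMedium (inClass 0) (inClass 1) Z t (proj₁ F) (proj₁ (proj₂ F)) (proj₁ (proj₂ (proj₂ F)))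
   (λ f h → does-true (size f ≤? r₀) (∧-true₂ (not (isSmall f)) h)) codeg (proj₂ (proj₂ (proj₂ F)))
   (λ f _ → ℕₚ.≤-trans (ℕₚ.≤-trans (ℕₚ.≤-reflexive (ℕₚ.*-comm zM Z)) (ℕ/.m/n*n≤m Cl.b zM)) (class≥ f 0 (ℕ.s≤s ℕ.z≤n)))
   (λ v → degree v (dg nonempty t 0≤t codeg isMedium v) refl) (class-sep (λ ())) reserve

 mediumC = Medium.colouring

 φL : E → Maybe ℕ
 φL = Colouring.φ largeC
 LS : E → ℕ → Bool
 LS f c = Λ f c ∧ not (used φL f c)

 -- A small edge has at most `r₁` vertices, each on at most `D/(r₀ - 1)` large edges; as `r₀` is
 -- `64 * d` times `r₁`, the total is at most `δD/32`.
 blocked-large : ∀ f → isSmall f ≡ true → blocked Λ φL f ≤ ½ * h4 * (δ * Dq)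
 blocked-large f Sf = ≤-trans (blocked≤ Λ φL f isLarge (Colouring.φ-only largeC)) (pure r₁ ⟦ d ⟧ δ Dq r₀ r₀≡ (nbrs isLarge f) (size f) (*inv (suc d')) 16≤r₁ r₁≤r₀ 0≤Dq (∑-nonneg es (λ g → 0≤𝟙 (isLarge g ∧ adj f g))) (does-true (size f ≤? r₁) Sf) meets) where
  dgL : V → ℚ
  dgL = dg nonempty t 0≤t codeg isLarge
  x₀ : ℚ
  x₀ = r₀ - 1#
  0≤x₀ : 0# ≤ x₀
  0≤x₀ = gap 1≤r₀
  nbrs≤ : nbrs isLarge f ≤ ∑[ v ∈ vs ] i f v * dgL v
  nbrs≤ = ≤-trans (∑-mono es (λ g → ≡≤ (𝟙-∧ (isLarge g) (adj f g)) (*-monoˡ (0≤𝟙 (isLarge g)) (≤-trans (𝟙-mono (adj f g) (meet f g) (∧-true₁ (meet f g))) (j≤∑ f g)))))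
   (≤-reflexive (trans (∑-cong es (λ g → sym (∑-*ˡ vs (𝟙 (isLarge g)) (λ v → i f v * i g v)))) (trans (∑-swap es vs (λ g v → 𝟙 (isLarge g) * (i f v * i g v)))
    (∑-cong vs (λ v → trans (∑-cong es (λ g → nbrs≤-eq (𝟙 (isLarge g)) (i f v) (i g v))) (∑-*ˡ es (i f v) (λ g → 𝟙 (isLarge g) * i g v)))))))
  meets : nbrs isLarge f * (r₀ - 1#) ≤ size f * Dq
  meets = ≤-trans (*-monoʳ 0≤x₀ nbrs≤) (≡≤ (sym (∑-*ʳ vs x₀ (λ v → i f v * dgL v))) (≤-trans (∑-mono vs (λ v → ≡≤ (*-assoc (i f v) (dgL v) x₀) (*-monoˡ (0≤i f v) (Dg≤ isLarge r₀ large≥ v)))) (≤-reflexive (∑-*ʳ vs Dq (i f)))))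
  pure : ∀ r d δ D r' → r' ≡ r * (d * ⟪ 64 ⟫) → ∀ x s → d * δ ≡ 1# → ⟪ 16 ⟫ ≤ r → r ≤ r' → 0# ≤ D → 0# ≤ x → s ≤ r → x * (r' - 1#) ≤ s * D → x ≤ ½ * h4 * (δ * D)
  pure r d δ D _ refl x s e 16r rr 0D 0x p q = cancel-≤ (<-≤-trans 0<1 (≤-trans (does-true (1# ≤? ⟪ 16 ⟫) refl) (≤-trans 16r rr))) (≤-trans main (≤-reflexive (sym (trans (pure-eq-13 r d δ D) (trans (cong (λ y → ⟪ 2 ⟫ * (r * (y * D))) e) (pure-eq₂-4 r D)))))) where
   main : r * (d * ⟪ 64 ⟫) * x ≤ ⟪ 2 ⟫ * (r * D)
   main = by (0≤⟪ 2 ⟫ ⊗ gap q ⊕ 0≤⟪ 2 ⟫ ⊗ gap p ⊗ 0D ⊕ (gap rr ⊕ gap 16r ⊕ 0≤⟪ 14 ⟫) ⊗ 0x) (solve (r ⸴ d ⸴ D ⸴ x ⸴ s ⸴ ∎) ring)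

 module Small where
  k y Q Z : ℕ
  k = 15 ℕ.+ suc d' ℕ.* 16
  y = D ℕ/./ suc k
  Q = D ℕ.∸ suc y
  Z = Q ℕ/./ zS
  16d : ⟦ suc k ⟧ ≡ ⟦ d ⟧ * ⟪ 16 ⟫
  16d = ⟦⟧-* d 16
  dδ : ⟦ d ⟧ * δ ≡ 1#
  dδ = *inv (suc d')
  scale : ∀ x → ⟦ d ⟧ * ⟪ 16 ⟫ * x ≤ Dq → x ≤ h4 * (δ * Dq)
  scale x h = pure ⟦ d ⟧ δ x Dq dδ 0≤δ h where
   pure : ∀ d δ x D → d * δ ≡ 1# → 0# ≤ δ → d * ⟪ 16 ⟫ * x ≤ D → x ≤ h4 * (δ * D)
   pure d δ x D e 0δ h = ≡≤ (trans (sym (*-identityˡ x)) (trans (cong (_* x) (sym e)) (pure-eq-10 d δ x))) (*-monoˡ 0≤h4 (*-monoˡ 0δ h))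
  y≤ : ⟦ y ⟧ ≤ h4 * (δ * Dq)
  y≤ = scale ⟦ y ⟧ (≡≤ (cong (_* ⟦ y ⟧) (sym 16d)) (floor≤ D k))
  1+z≤ : 1# + ⟦ zS ⟧ ≤ h4 * (δ * Dq)
  1+z≤ = scale (1# + ⟦ zS ⟧) (≡≤ (trans (*-comm (⟦ d ⟧ * ⟪ 16 ⟫) (1# + ⟦ zS ⟧)) (sym (trans (⟦⟧-* (suc zS) (d ℕ.* 16)) (cong₂ _*_ 1+⟦ zS ⟧ (⟦⟧-* d 16))))) (⟦⟧-mono zS≤))
  y≥ : h4 * (δ * Dq) ≤ ⟦ y ⟧ + 1#
  y≥ = pure ⟦ d ⟧ δ (⟦ y ⟧ + 1#) Dq dδ 0≤δ (≤-trans (floor≥ D k) (≤-reflexive (cong (_* (⟦ y ⟧ + 1#)) 16d))) where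
   pure : ∀ d δ x D → d * δ ≡ 1# → 0# ≤ δ → D ≤ d * ⟪ 16 ⟫ * x → h4 * (δ * D) ≤ x
   pure d δ x D e 0δ h = ≤-trans (*-monoˡ 0≤h4 (*-monoˡ 0δ h)) (≤-reflexive (sym (trans (sym (*-identityˡ x)) (trans (cong (_* x) (sym e)) (pure-eq-9 d δ x)))))
  1+y≤D : suc y ℕ.≤ D
  1+y≤D = ⟦⟧-cancel (≡≤ (1+⟦ y ⟧) (1+y≤D-pure ⟦ y ⟧ ⟦ zS ⟧ δ Dq y≤ 1+z≤ 0≤⟦ zS ⟧ δ≤1 0≤Dq))
  Q≤ : ⟦ Q ⟧ ≤ Dq - h4 * (δ * Dq)
  Q≤ = Q≤-pure ⟦ Q ⟧ ⟦ y ⟧ Dq (h4 * (δ * Dq)) (trans (cong (⟦ Q ⟧ +_) (sym 1+⟦ y ⟧)) (trans (sym (⟦⟧-+ Q (suc y))) (cong ⟦_⟧ (ℕₚ.m∸n+n≡m 1+y≤D)))) y≥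
  zZ : ℚ
  zZ = ⟦ zS ⟧ * ⟦ Z ⟧
  zZ≥ : (1# - ⟪ 2 ⟫ * h4 * δ) * Dq ≤ zZ
  zZ≥ = zZ≥-pure Dq ⟦ Q ⟧ ⟦ y ⟧ ⟦ zS ⟧ ⟦ Z ⟧ δ (≤-trans (∸≥ D (suc y)) (≤-reflexive (cong (⟦ Q ⟧ +_) 1+⟦ y ⟧))) (floor≥ Q zS') y≤ 1+z≤
  zZ≤Q : zZ ≤ ⟦ Q ⟧
  zZ≤Q = floor≤ Q zS'
  D≤AZ : D ℕ.≤ suc AS' ℕ.* Z
  D≤AZ = ⟦⟧-cancel-* D (suc AS') zS 2 Z AS≡ (≤-trans (D≤AZ-pure δ Dq zZ zZ≥ δ≤1 0≤Dq) (≤-reflexive (D≤AZ-eq ⟦ zS ⟧ ⟦ Z ⟧)))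
  F : 2 ℕ.≤ Z × BS.Z₀ ℕ.≤ Z × length vs ℕ.≤ suc AS' ℕ.* Z × ⟪ 2 ⟫ * t * inv Z ≤ BS.η
  F = fits AS' {BS.Z₀} {length vs} {D} {BS.η} Z t fitsS D≡ 1≤n n≤D D≤AZ
  -- The list loses at most `s * D` to the withheld classes and `δD/32` to large neighbours, while
  -- `Q` leaves room for a loss of about `δD/16`.
  lists : ∀ f → isSmall f ≡ true → zS ℕ.* Z ℕ.≤ countᵇ (LS f) cs
  lists f Sf = ⟦⟧-cancel (≡≤ (⟦⟧-* zS Z) (≤-trans zZ≤Q (≤-trans Q≤ (≤-trans (lists-pure δ s Dq (avail Λ f) (blocked Λ φL f) (avail LS f) (subst (λ x → (1# - s) * x ≤ avail Λ f) D≡ (all-lists f)) (blocked-large f Sf) 64s split 0≤δ 0≤Dq) (≤-reflexive (∑-count (LS f) cs)))))) where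
   split : avail Λ f ≤ blocked Λ φL f + avail LS f
   split = ≤-trans (∑-mono cs (λ c → lem (Λ f c) (used φL f c))) (≤-reflexive (∑-+ cs (λ c → 𝟙 (Λ f c ∧ used φL f c)) (λ c → 𝟙 (LS f c)))) where
    lem : ∀ a b → 𝟙 a ≤ 𝟙 (a ∧ b) + 𝟙 (a ∧ not b)
    lem true true = does-true (1# ≤? 1# + 0#) refl
    lem true false = does-true (1# ≤? 0# + 1#) refl
    lem false b = does-true (0# ≤? 0# + 0#) refl
  -- `eS = 6d` makes `3/(eS + 1)` at most `½ * δ`, and `z * Z` falls short of `D` by at most `δD/8`,
  -- so the degree `(1 - δ)D` still fits.
  degree : ∀ v → ∑[ f ∈ es ] 𝟙 (isSmall f) * i f v ≤ (1# - ⟪ 3 ⟫ * inv (suc eS)) * (⟦ zS ⟧ * ⟦ Z ⟧)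
  degree v = ≤-trans (∑-mono es (λ f → ≤-trans (*-monoʳ (0≤i f v) (𝟙≤1 (isSmall f))) (≤-reflexive (*-identityˡ (i f v))))) (≤-trans (deg v)
    (degree-pure δ Dq zZ (inv (suc eS)) (3w ⟦ d ⟧ δ (inv (suc eS)) dδ (trans (cong (_* inv (suc eS)) (sym (trans 1+⟦ eS ⟧ (cong (1# +_) (⟦⟧-* d 6))))) (*inv eS)) 0≤δ (0≤inv (suc eS))) zZ≥ 0≤δ δ≤1 0≤Dq (0≤⟦ zS ⟧ ⊗ 0≤⟦ Z ⟧))) where
   3w : ∀ d δ w → d * δ ≡ 1# → (1# + d * ⟪ 6 ⟫) * w ≡ 1# → 0# ≤ δ → 0# ≤ w → ⟪ 3 ⟫ * w ≤ ½ * δ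
   3w d δ w e f 0δ 0w = ≡≤ (trans (sym (*-identityʳ (⟪ 3 ⟫ * w))) (trans (cong (⟪ 3 ⟫ * w *_) (sym e)) (3w-eq d δ w))) (≤-trans (*-monoˡ (0≤½ ⊗ 0δ) (by {a = d * ⟪ 6 ⟫ * w} {b = (1# + d * ⟪ 6 ⟫) * w} 0w (solve (d ⸴ w ⸴ ∎) ring))) (≤-reflexive (trans (cong (½ * δ *_) f) (*-identityʳ (½ * δ)))))
  reserve : ∀ f → isSmall f ≡ true → r₁ * ⟦ Z ⟧ < avail (inClass 2) f
  reserve f _ = ≰⇒> (λ h → <⇒¬≥ 0<1 (reserve-pure r₁ ⟦ N ⟧ ⟦ zS ⟧ ⟦ Z ⟧ B Dq δ (≤-trans (class≥ℚ f 2 (ℕ.s≤s (ℕ.s≤s (ℕ.s≤s ℕ.z≤n)))) h) half-D zS≥ (≤-trans zZ≤Q Q≤) 0≤⟦ N ⟧ 0≤⟦ Z ⟧ 0≤δ 1≤Dq))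
  colouring : Colouring isSmall (λ e c → LS e c ∨ inClass 2 e c)
  colouring = SC.subColouring r₁ 1≤r₁ eS 2≤eS zS (suc AS') (ℕ.s≤s ℕ.z≤n) isSmall LS (inClass 2) Z t (proj₁ F) (proj₁ (proj₂ F)) (proj₁ (proj₂ (proj₂ F)))
   (λ f h → does-true (size f ≤? r₁) h) codeg (proj₂ (proj₂ (proj₂ F))) lists degree
   (λ f g c p q → class-sep-Λ (ℕ.s≤s (ℕ.s≤s (ℕ.s≤s ℕ.z≤n))) f g c (∧-true₁ (Λ f c) p) q) reserve

 smallC = Small.colouring

 -- Large and medium edges use different classes. Small edges share the colours of `Λ` with large
 -- ones, but the colours used on large neighbours were removed from their lists beforehand.
 everything : Colouring (λ e → (isLarge e ∨ isMedium e) ∨ isSmall e) L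
 everything = union {Λ₁ = L} {Λ = L} LM smallC sep₂ (λ _ _ p → p) (λ e c p → [ (λ q → ∧-true₁ (L e c) (∧-true₁ (Λ e c) q)) , ∧-true₁ (L e c) ]′ (∨-true (LS e c) p)) where
  module M = Colouring mediumC
  module S = Colouring smallC
  module LC = Colouring largeC
  in01 : ∀ e f c → Λ e c ≡ true → inClass 0 f c ∨ inClass 1 f c ≡ true → ⊥
  in01 e f c p q = [ class-sep-Λ (ℕ.s≤s ℕ.z≤n) e f c p , class-sep-Λ (ℕ.s≤s (ℕ.s≤s ℕ.z≤n)) e f c p ]′ (∨-true (inClass 0 f c) q)
  LM : Colouring (λ e → isLarge e ∨ isMedium e) L
  LM = union {Λ = L} largeC mediumC (λ e f c _ p q → in01 e f c (LC.φ-list e c p) (M.φ-list f c q)) (λ e c → ∧-true₁ (L e c))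
    (λ e c p → [ ∧-true₁ (L e c) , ∧-true₁ (L e c) ]′ (∨-true (inClass 0 e c) p))
  sep₂ : ∀ e f c → adj e f ≡ true → Colouring.φ LM e ≡ just c → S.φ f ≡ just c → ⊥
  sep₂ e f c a p q = go (isLarge e) p where
   fS : LS f c ≡ true ⊎ inClass 2 f c ≡ true
   fS = ∨-true (LS f c) (S.φ-list f c q)
   go : ∀ b → (if b then LC.φ e else M.φ e) ≡ just c → ⊥
   go true w = [ (λ r → true≢false (trans (sym (used-intro φL (adj-sym e f a) w)) (not-true (∧-true₂ (Λ f c) r)))) , class-sep-Λ (ℕ.s≤s (ℕ.s≤s (ℕ.s≤s ℕ.z≤n))) e f c (LC.φ-list e c w) ]′ fS
   go false w = [ (λ r → in01 f e c (∧-true₁ (Λ f c) r) (M.φ-list e c w)) , (λ r → [ (λ z → class-sep (λ ()) e f c z r) , (λ z → class-sep (λ ()) e f c z r) ]′ (∨-true (inClass 0 e c) (M.φ-list e c w))) ]′ fS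

 everyEdge : ∀ e → (isLarge e ∨ isMedium e) ∨ isSmall e ≡ true
 everyEdge e = lem (does (size e ≤? r₀)) (isSmall e) where
  lem : ∀ a b → (not a ∨ (not b ∧ a)) ∨ b ≡ true
  lem false b = refl
  lem true true = refl
  lem true false = refl

-- Passage to hypergraphs and the final choice of constants

open import Data.Fin using (Fin; zero; suc)
import Data.Fin.Properties as Finₚ
open import Data.Fin.Subset using (Subset; ∣_∣)
open import Data.Fin.Subset.Properties using (_∈?_)
open import Data.List using (length; take; upTo; allFin; tabulate)
open import Data.List.Membership.Propositional.Properties using (∈-upTo⁺; ∈-allFin)
open import Data.List.Properties using (length-tabulate; length-take)
open import Data.List.Relation.Unary.Unique.Propositional.Properties using (upTo⁺; take⁺; allFin⁺)
open import Data.Rational.Properties using (positive⁻¹)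
import Data.Vec as Vec
import Data.Vec.Properties as Vecₚ
open import Defs using (Hypergraph; V; m; nonempty; degree; codeg; windowCount; sqrtLowerB; sqrtUpperB; MaxDegreeAtMost; CodegreeAtMost; ListColourable; ListChromaticIndexAtMost) renaming (Proper to ProperColouring)

∣tabulate∣ : ∀ {A : Set} {k} (f : A → Bool) (g : Fin k → A) → ∣ Vec.tabulate (λ x → f (g x)) ∣ ≡ countᵇ f (tabulate g)
∣tabulate∣ {k = zero} f g = refl
∣tabulate∣ {k = suc k} f g with f (g zero)
... | true = cong suc (∣tabulate∣ f (λ x → g (suc x)))
... | false = ∣tabulate∣ f (λ x → g (suc x))

does-∈? : ∀ {n} x (p : Subset n) → does (x ∈? p) ≡ Vec.lookup p x
does-∈? zero (true Vec.∷ p) = refl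
does-∈? zero (false Vec.∷ p) = refl
does-∈? (suc x) (b Vec.∷ p) = does-∈? x p

∣p∣≡count : ∀ {n} (p : Subset n) → ∣ p ∣ ≡ countᵇ (λ v → does (v ∈? p)) (allFin n)
∣p∣≡count p = trans (cong ∣_∣ (sym (Vecₚ.tabulate∘lookup p))) (trans (cong ∣_∣ (Vecₚ.tabulate-cong (λ v → sym (does-∈? v p)))) (∣tabulate∣ (λ v → does (v ∈? p)) (λ v → v)))

∈-take : ∀ {A : Set} {x : A} k xs → x ∈ take k xs → x ∈ xs
∈-take (suc k) (y ∷ xs) (here p) = here p
∈-take (suc k) (y ∷ xs) (there p) = there (∈-take k xs p)

bounded : ∀ {A : Set} (f : A → ℕ) xs → ∃ λ b → ∀ x → x ∈ xs → f x ℕ.≤ b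
bounded f [] = 0 , λ _ ()
bounded {A} f (x ∷ xs) = f x ℕ.⊔ proj₁ (bounded f xs) , bound where
 bound : ∀ y → y ∈ x ∷ xs → f y ℕ.≤ f x ℕ.⊔ proj₁ (bounded f xs)
 bound y (here refl) = ℕₚ.m≤m⊔n (f x) (proj₁ (bounded f xs))
 bound y (there p) = ℕₚ.≤-trans (proj₂ (bounded f xs) y p) (ℕₚ.m≤n⊔m (f x) (proj₁ (bounded f xs)))

member : List ℕ → ℕ → Bool
member xs c = anyᵇ (λ x → does (c ℕ.≟ x)) xs

count-member : ∀ {xs cs} → AllPairs _≢_ xs → AllPairs _≢_ cs → (∀ x → x ∈ xs → x ∈ cs) → countᵇ (member xs) cs ≡ length xs
count-member {xs} {cs} xs! cs! sub = ℕₚ.≤-antisym (⟦⟧-cancel upper) (lower xs! sub) where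
 upper : ⟦ countᵇ (member xs) cs ⟧ ≤ ⟦ length xs ⟧
 upper = ≡≤ (sym (∑-count (member xs) cs)) (≤-trans (∑-mono cs (λ c → any≤∑ (λ x → does (c ℕ.≟ x)) xs)) (≡≤ (∑-swap cs xs (λ c x → 𝟙 (does (c ℕ.≟ x))))
  (≤-trans (∑-mono xs (λ x → ∑-delta ℕ._≟_ cs! x)) (≤-reflexive (trans (∑-const xs 1#) (*-identityʳ ⟦ length xs ⟧))))))
 lower : ∀ {xs} → AllPairs _≢_ xs → (∀ x → x ∈ xs → x ∈ cs) → length xs ℕ.≤ countᵇ (member xs) cs
 lower [] _ = ℕ.z≤n
 lower {x ∷ xs} (x∉ ∷ xs!) sub = ℕₚ.≤-trans (ℕₚ.+-mono-≤ {1} (ℕₚ.≤-trans (ℕ.s≤s ℕ.z≤n) (count-strict (λ _ → false) (λ c → does (c ℕ.≟ x)) (λ _ ()) (sub x (here refl)) refl (≟-refl ℕ._≟_ x))) (lower xs! (λ y p → sub y (there p))))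
  (count-disjoint (λ c → does (c ℕ.≟ x)) (member xs) (member (x ∷ xs)) cs (λ c p → any-true (λ y → does (c ℕ.≟ y)) {x ∷ xs} (here refl) p)
   (λ c p → let y , y∈ , q = any-witness (λ y → does (c ℕ.≟ y)) xs p in any-true (λ y → does (c ℕ.≟ y)) {x ∷ xs} (there y∈) q)
   (λ c p q → let y , y∈ , r = any-witness (λ y → does (c ℕ.≟ y)) xs q in All.lookup x∉ y∈ (trans (sym (≟-true ℕ._≟_ {c} {x} p)) (≟-true ℕ._≟_ {c} {y} r))))

window-intro-low : ∀ δ δ' n → δ' ≤ δ → 0# ≤ 1# - δ → 0# ≤ n → (1# - δ) * (1# - δ) * n ≤ (1# - δ') * (1# - δ') * n
window-intro-low δ δ' n h 0δ 0n = by (gap h ⊗ (0≤⟪ 2 ⟫ ⊗ 0δ ⊕ gap h) ⊗ 0n) (solve (δ ⸴ δ' ⸴ n ⸴ ∎) ring)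

window-intro-upper : ∀ δ δ' n → δ' ≤ δ → 0# ≤ δ' → 0# ≤ n → (1# + δ') * (1# + δ') * n ≤ (1# + δ) * (1# + δ) * n
window-intro-upper δ δ' n h 0δ 0n = by (gap h ⊗ (0≤⟪ 2 ⟫ ⊕ 0≤⟪ 2 ⟫ ⊗ 0δ ⊕ gap h) ⊗ 0n) (solve (δ ⸴ δ' ⸴ n ⸴ ∎) ring)

module _ {n : ℕ} (H : Hypergraph n) where

 inc : Fin (m H) → Fin n → Bool
 inc e v = does (v ∈? V H e)

 open Incidence Finₚ._≟_ (allFin n) (allFin⁺ n) inc

 inc-vertex : ∀ e → inc e (proj₁ (nonempty H e)) ≡ true
 inc-vertex e = true-does (proj₁ (nonempty H e) ∈? V H e) (proj₂ (nonempty H e))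

 meet-common : ∀ e f v → inc e v ≡ true → inc f v ≡ true → meet e f ≡ true
 meet-common e f v p q = any-true (λ v → inc e v ∧ inc f v) (∈-allFin v) (∧-intro p q)

 size≡ : ∀ e → size e ≡ ⟦ ∣ V H e ∣ ⟧
 size≡ e = trans (∑-count (inc e) (allFin n)) (cong ⟦_⟧ (sym (∣p∣≡count (V H e))))

 1≤size : ∀ e → 1# ≤ size e
 1≤size e = ≡≤ (cong 𝟙 (sym (inc-vertex e))) (∑-∈ (i e) (0≤i e) (∈-allFin (proj₁ (nonempty H e))))

 degree≡ : ∀ v → ∑[ e ∈ allFin (m H) ] i e v ≡ ⟦ degree H v ⟧
 degree≡ v = trans (∑-count (λ e → inc e v) (allFin (m H))) (cong ⟦_⟧ (sym (∣tabulate∣ (λ e → inc e v) (λ e → e))))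

 codeg≡ : ∀ u v → ∑[ e ∈ allFin (m H) ] i e u * i e v ≡ ⟦ codeg H u v ⟧
 codeg≡ u v = trans (∑-cong (allFin (m H)) (λ e → sym (𝟙-∧ (inc e u) (inc e v)))) (trans (∑-count (λ e → inc e u ∧ inc e v) (allFin (m H))) (cong ⟦_⟧ (sym (∣tabulate∣ (λ e → inc e u ∧ inc e v) (λ e → e)))))

 -- Double counting of incidences, every edge having a vertex. The exponential potentials are
 -- compared with this polynomial bound.
 edges≤ : ∀ D → n ℕ.≤ D → (∀ v → ⟦ degree H v ⟧ ≤ ⟦ D ⟧) → length (allFin (m H)) ℕ.≤ D ℕ.* D
 edges≤ D n≤D deg = ⟦⟧-cancel (≡≤ (trans (sym (*-identityʳ ⟦ length (allFin (m H)) ⟧)) (sym (∑-const (allFin (m H)) 1#))) (≤-trans (∑-mono (allFin (m H)) 1≤size)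
  (≡≤ (∑-swap (allFin (m H)) (allFin n) i) (≤-trans (∑-mono (allFin n) (λ v → ≡≤ (degree≡ v) (deg v)))
  (≡≤ (∑-const (allFin n) ⟦ D ⟧) (≤-trans (*-monoʳ 0≤⟦ D ⟧ (⟦⟧-mono (ℕₚ.≤-trans (ℕₚ.≤-reflexive (length-tabulate {n = n} (λ v → v))) n≤D))) (≤-reflexive (sym (⟦⟧-* D D)))))))))

 no-edges : (∀ v → ⟦ degree H v ⟧ ≤ 0#) → Fin (m H) → ⊥
 no-edges deg e = <⇒¬≥ 0<1 (≡≤ (cong 𝟙 (sym (inc-vertex e))) (≤-trans (∑-∈ (λ f → i f v) (λ f → 0≤i f v) (∈-allFin e)) (≡≤ (degree≡ v) (deg v)))) where
  v : Fin n
  v = proj₁ (nonempty H e)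

 window : ℚ → Fin (m H) → Bool
 window δ e = sqrtLowerB (1# - δ) n ∣ V H e ∣ ∧ sqrtUpperB ∣ V H e ∣ (1# + δ) n

 window-count : ∀ δ → ∑[ e ∈ allFin (m H) ] 𝟙 (window δ e) ≡ ⟦ windowCount δ H ⟧
 window-count δ = trans (∑-count (window δ) (allFin (m H))) (cong ⟦_⟧ (sym (∣tabulate∣ (window δ) (λ e → e))))

 -- The window grows with `δ`, so the edges in the window of the smaller `δ'` are all counted. If
 -- `1# - δ` is not positive, comparing squares is of no use and the first alternative of
 -- `sqrtLowerB` applies.
 window-intro : ∀ δ δ' → δ' ≤ δ → 0# ≤ δ' → ∀ e → (1# - δ') * (1# - δ') * ⟦ n ⟧ ≤ size e * size e → size e * size e ≤ (1# + δ') * (1# + δ') * ⟦ n ⟧ → window δ e ≡ true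
 window-intro δ δ' h 0δ' e p q = ∧-intro lower (∧-intro (true-does (0# ≤? 1# + δ) (0≤1 ⊕ ≤-trans 0δ' h)) (true-does (k * k ≤? (1# + δ) * (1# + δ) * ⟦ n ⟧) (≤-trans (≡≤ (cong (λ x → x * x) (sym (size≡ e))) q) (window-intro-upper δ δ' ⟦ n ⟧ h 0δ' 0≤⟦ n ⟧)))) where
  k : ℚ
  k = ⟦ ∣ V H e ∣ ⟧
  lower : sqrtLowerB (1# - δ) n ∣ V H e ∣ ≡ true
  lower = go (1# - δ ≤? 0#) where
   go : Dec (1# - δ ≤ 0#) → sqrtLowerB (1# - δ) n ∣ V H e ∣ ≡ true
   go (yes r) = cong (_∨ does ((1# - δ) * (1# - δ) * ⟦ n ⟧ ≤? k * k)) (true-does (1# - δ ≤? 0#) r)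
   go (no r) = ∨-right (does (1# - δ ≤? 0#)) (true-does ((1# - δ) * (1# - δ) * ⟦ n ⟧ ≤? k * k) (≤-trans (window-intro-low δ δ' ⟦ n ⟧ h (<⇒≤ (≰⇒> r)) 0≤⟦ n ⟧) (≤-trans p (≤-reflexive (cong (λ x → x * x) (size≡ e))))))

deg≤D-pure : ∀ δ D → 0# ≤ δ → 0# ≤ D → (1# - δ) * D ≤ D
deg≤D-pure δ D p q = by (p ⊗ q) (solve (δ ⸴ D ⸴ ∎) ring)

module ListColour {d' H' G' N' : ℕ} (A : Admissible d' H' G' N') (P : Parts d' N') {n : ℕ} (H : Hypergraph n) (t : ℕ) where

 open Constants A using (δ; N; d)
 open Parts P using (AM'; AS'; zS; module BM; module BS)

 D K : ℕ
 D = t ℕ.* n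
 K = D ℕ.∸ suc (D ℕ/./ (N ℕ.* 8))

 Enough : Set
 Enough = 1 ℕ.≤ n × n ℕ.≤ D × proj₁ (classes N') ℕ.≤ D × largeThreshold H' ℕ.≤ D × suc zS ℕ.* (d ℕ.* 16) ℕ.≤ D ×
      Fits (suc AM') BM.Z₀ n D BM.η × Fits (suc AS') BS.Z₀ n D BS.η

 open Incidence Finₚ._≟_ (allFin n) (allFin⁺ n) (inc H) using (size)

 listColourable : Enough → (∀ v → ⟦ degree H v ⟧ ≤ (1# - δ) * ⟦ D ⟧) → CodegreeAtMost H t → (win : Fin (m H) → Bool) →
  (∀ e → (1# - δ) * (1# - δ) * ⟦ n ⟧ ≤ size e * size e → size e * size e ≤ (1# + δ) * (1# + δ) * ⟦ n ⟧ → win e ≡ true) →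
  ∑[ e ∈ allFin (m H) ] 𝟙 (win e) ≤ (1# - δ) * ⟦ D ⟧ → ListColourable H K
 listColourable (1≤n , n≤D , cl , lt , zs , fM , fS) deg codeg≤ win win-intro win-count C C! K≤ = φ , φ∈ , proper where
  es = allFin (m H)
  vs = allFin n
  len : length vs ≡ n
  len = length-tabulate {n = n} (λ v → v)
  xs : Fin (m H) → List ℕ
  -- The upper bound on the palette part of a list requires lists of length exactly `K`.
  xs e = take K (C e)
  top : Fin (m H) → ℕ
  top e = proj₁ (bounded (λ c → c) (xs e))
  M : ℕ
  M = proj₁ (bounded top es)
  cs : List ℕ
  cs = upTo (suc M)
  L : Fin (m H) → ℕ → Bool
  L e = member (xs e)
  in-cs : ∀ e x → x ∈ xs e → x ∈ cs
  in-cs e x p = ∈-upTo⁺ (ℕ.s≤s (ℕₚ.≤-trans (proj₂ (bounded (λ c → c) (xs e)) x p) (proj₂ (bounded top es) e (∈-allFin e))))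
  L≡ : ∀ e → countᵇ (L e) cs ≡ K
  L≡ e = trans (count-member (take⁺ K (C! e)) (upTo⁺ (suc M)) (in-cs e)) (trans (length-take K (C e)) (ℕₚ.m≤n⇒m⊓n≡m (K≤ e)))
  deg≤D : ∀ v → ⟦ degree H v ⟧ ≤ ⟦ D ⟧
  deg≤D v = ≤-trans (deg v) (deg≤D-pure δ ⟦ D ⟧ (Constants.0≤δ A) 0≤⟦ D ⟧)
  m≤ : length es ℕ.≤ D ℕ.* D
  m≤ = edges≤ H D n≤D deg≤D
  module Asm = Assembly Finₚ._≟_ Finₚ._≟_ vs (allFin⁺ n) ∈-allFin es (allFin⁺ (m H)) ∈-allFin (inc H) cs (upTo⁺ (suc M))
   (λ e → meet-common H e e (proj₁ (nonempty H e)) (inc-vertex H e) (inc-vertex H e)) (1≤size H) ⟦ t ⟧ 0≤⟦ t ⟧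
   (λ u v u≢v → ≡≤ (codeg≡ H u v) (⟦⟧-mono (codeg≤ u v u≢v))) A P D K
   (trans (cong (λ k → ⟦ t ⟧ * ⟦ k ⟧) len) (sym (⟦⟧-* t n))) lt m≤ (ℕₚ.m∸n≤m D (suc (D ℕ/./ (N ℕ.* 8)))) L L≡
   (proj₂ (classes N') es ∈-allFin L cs (upTo⁺ (suc M)) D cl m≤ (λ e → ℕₚ.≤-reflexive (sym (L≡ e))))
   (subst (1 ℕ.≤_) (sym len) 1≤n) (subst (ℕ._≤ D) (sym len) n≤D) (subst (λ k → Fits (suc AM') BM.Z₀ k D BM.η) (sym len) fM) (subst (λ k → Fits (suc AS') BS.Z₀ k D BS.η) (sym len) fS)
   zs (λ v → ≡≤ (degree≡ H v) (deg v)) win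
   (λ e → subst (λ k → (1# - δ) * (1# - δ) * ⟦ k ⟧ ≤ size e * size e → size e * size e ≤ (1# + δ) * (1# + δ) * ⟦ k ⟧ → win e ≡ true) (sym len) (win-intro e)) win-count
  module G = Graph Finₚ._≟_ es (allFin⁺ (m H)) ∈-allFin (Incidence.meet Finₚ._≟_ vs (allFin⁺ n) (inc H)) (Matching.meet-sym Finₚ._≟_ vs (allFin⁺ n) ∈-allFin es ∈-allFin (inc H)) cs (upTo⁺ (suc M))
  module X = G.Colouring Asm.everything
  φ : Fin (m H) → ℕ
  φ e = proj₁ (X.φ-total e (Asm.everyEdge e))
  φ≡ : ∀ e → X.φ e ≡ just (φ e)
  φ≡ e = proj₂ (X.φ-total e (Asm.everyEdge e))
  φ∈ : ∀ e → φ e ∈ C e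
  φ∈ e = let x , x∈ , q = any-witness (λ x → does (φ e ℕ.≟ x)) (xs e) (X.φ-list e (φ e) (φ≡ e)) in subst (_∈ C e) (sym (≟-true ℕ._≟_ {φ e} {x} q)) (∈-take K (C e) x∈)
  proper : ProperColouring H φ
  proper e f e≢f (v , v∈e , v∈f) same = X.φ-proper e f (φ e) (G.adj-intro (meet-common H e f v (true-does (v ∈? V H e) v∈e) (true-does (v ∈? V H f) v∈f)) e≢f) (φ≡ e) (trans (φ≡ f) (cong just (sym same)))

pure-e₂-7 : ∀ σ k x → σ * (k * (x + 1#)) ≡ k * σ * (x + 1#)
pure-e₂-7 = solve-∀ ring

pure-e₁-11 : ∀ K x → K ≡ K + (1# + x) - (x + 1#)
pure-e₁-11 = solve-∀ ring

x+1≤D-pure : ∀ x k D → k * x ≤ D → ⟪ 2 ⟫ ≤ k → 0# ≤ x → ⟪ 2 ⟫ ≤ D → 1# + x ≤ D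
x+1≤D-pure x k D p q 0x r = by (0≤½ ⊗ (gap p ⊕ gap q ⊗ 0x ⊕ gap r)) (solve (x ⸴ k ⸴ D ⸴ ∎) ring)

weaken-pure : ∀ δ₀ δ t n → δ ≤ δ₀ → 0# ≤ t → 0# ≤ n → (1# - δ₀) * t * n ≤ (1# - δ) * (t * n)
weaken-pure δ₀ δ t n h 0t 0n = by (gap h ⊗ 0t ⊗ 0n) (solve (δ₀ ⸴ δ ⸴ t ⸴ n ⸴ ∎) ring)

colour-eq : ∀ s n → (1# - s) * 0# * n ≡ 0#
colour-eq = solve-∀ ring

theorem1p5 : (δ : ℚ) → Positive δ →
    Σ ℕ λ n₀ → Σ ℚ λ σ → Positive σ ×
    ((n t : ℕ) → n₀ ℕ.≤ n → (H : Hypergraph n) →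
    MaxDegreeAtMost H ((1# - δ) * ⟦ t ⟧ * ⟦ n ⟧) →
    CodegreeAtMost H t →
    ⟦ windowCount δ H ⟧ ≤ (1# - δ) * ⟦ t ⟧ * ⟦ n ⟧ →
    ListChromaticIndexAtMost H ((1# - σ) * ⟦ t ⟧ * ⟦ n ⟧))
theorem1p5 δ₀ δ₀>0 = go (constants d') where
 0<δ₀ : 0# < δ₀
 0<δ₀ = positive⁻¹ δ₀ {{δ₀>0}}
 d' : ℕ
 d' = proj₁ (small 0<δ₀)
 δ : ℚ
 -- `δ₀` is replaced by a smaller reciprocal of an integer, so that the numbers of colour classes
 -- can be matched to it exactly.
 δ = inv (suc (suc d'))
 δ≤ : δ ≤ δ₀
 δ≤ = ≤-trans (inv-anti (ℕ.s≤s ℕ.z≤n) (ℕₚ.n≤1+n (suc d'))) (proj₂ (small 0<δ₀))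
 Goal : Set
 Goal = Σ ℕ λ n₀ → Σ ℚ λ σ → Positive σ ×
  ((n t : ℕ) → n₀ ℕ.≤ n → (H : Hypergraph n) → MaxDegreeAtMost H ((1# - δ₀) * ⟦ t ⟧ * ⟦ n ⟧) → CodegreeAtMost H t →
   ⟦ windowCount δ₀ H ⟧ ≤ (1# - δ₀) * ⟦ t ⟧ * ⟦ n ⟧ → ListChromaticIndexAtMost H ((1# - σ) * ⟦ t ⟧ * ⟦ n ⟧))
 go : (∃ λ H' → ∃ λ G' → ∃ λ N' → Admissible d' H' G' N') → Goal
 go (H' , G' , N' , A) = withParts (parts d' N') where
  withParts : Parts d' N' → Goal
  -- `σ = 1/(8N)` matches the list length `K = D - 1 - D/(8N)`, where the subtracted 1 makes up for
  -- the rounded division.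
  withParts P = n₀ , inv (suc N' ℕ.* 8) , positive (0<inv (7 ℕ.+ N' ℕ.* 8)) , colour where
   open Parts P using (AM'; AS'; zS; module BM; module BS)
   fM = fits-eventually (suc AM') BM.Z₀ BM.0<η
   fS = fits-eventually (suc AS') BS.Z₀ BS.0<η
   a b c e f n₀ : ℕ
   a = proj₁ (classes N')
   b = largeThreshold H'
   c = suc zS ℕ.* (suc (suc d') ℕ.* 16)
   e = proj₁ fM
   f = proj₁ fS
   n₀ = 2 ℕ.+ (a ℕ.+ (b ℕ.+ (c ℕ.+ (e ℕ.+ f))))
   colour : (n t : ℕ) → n₀ ℕ.≤ n → (H : Hypergraph n) → MaxDegreeAtMost H ((1# - δ₀) * ⟦ t ⟧ * ⟦ n ⟧) → CodegreeAtMost H t →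
    ⟦ windowCount δ₀ H ⟧ ≤ (1# - δ₀) * ⟦ t ⟧ * ⟦ n ⟧ → ListChromaticIndexAtMost H ((1# - inv (suc N' ℕ.* 8)) * ⟦ t ⟧ * ⟦ n ⟧)
   -- For `t = 0` all degrees are 0, so there are no edges and lists of length 0 suffice.
   colour n zero n≥ H deg codeg≤ win = 0 , ≤-reflexive (sym (colour-eq (inv (suc N' ℕ.* 8)) ⟦ n ⟧)) , λ _ _ _ → (λ e → ⊥-elim (empty e)) , (λ e → ⊥-elim (empty e)) , λ e → ⊥-elim (empty e) where
    empty : Fin (m H) → ⊥
    empty = no-edges H (λ v → ≤-trans (deg v) (≤-reflexive (colour-eq δ₀ ⟦ n ⟧)))
   colour n (suc t') n≥ H deg codeg≤ win = K , K≤ , listColourable (ℕₚ.≤-trans (ℕ.s≤s ℕ.z≤n) 2≤n , n≤D , ℕₚ.≤-trans a≤ n≤D , ℕₚ.≤-trans b≤ n≤D , ℕₚ.≤-trans c≤ n≤D , proj₂ fM n D e≤ n≤D , proj₂ fS n D f≤ n≤D)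
     (λ v → ≤-trans (deg v) weaken) codeg≤ (window H δ₀) (window-intro H δ₀ δ δ≤ (0≤inv (suc (suc d')))) (≡≤ (window-count H δ₀) (≤-trans win weaken)) where
    t : ℕ
    t = suc t'
    open ListColour A P H t using (D; K; listColourable)
    2≤n : 2 ℕ.≤ n
    2≤n = ℕₚ.≤-trans (ℕₚ.m≤m+n 2 (a ℕ.+ (b ℕ.+ (c ℕ.+ (e ℕ.+ f))))) n≥
    r₁ : a ℕ.+ (b ℕ.+ (c ℕ.+ (e ℕ.+ f))) ℕ.≤ n
    r₁ = ℕₚ.≤-trans (ℕₚ.m≤n+m (a ℕ.+ (b ℕ.+ (c ℕ.+ (e ℕ.+ f)))) 2) n≥
    a≤ : a ℕ.≤ n
    a≤ = ℕₚ.m+n≤o⇒m≤o a r₁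
    r₂ : b ℕ.+ (c ℕ.+ (e ℕ.+ f)) ℕ.≤ n
    r₂ = ℕₚ.m+n≤o⇒n≤o a r₁
    b≤ : b ℕ.≤ n
    b≤ = ℕₚ.m+n≤o⇒m≤o b r₂
    r₃ : c ℕ.+ (e ℕ.+ f) ℕ.≤ n
    r₃ = ℕₚ.m+n≤o⇒n≤o b r₂
    c≤ : c ℕ.≤ n
    c≤ = ℕₚ.m+n≤o⇒m≤o c r₃
    r₄ : e ℕ.+ f ℕ.≤ n
    r₄ = ℕₚ.m+n≤o⇒n≤o c r₃
    e≤ : e ℕ.≤ n
    e≤ = ℕₚ.m+n≤o⇒m≤o e r₄
    f≤ : f ℕ.≤ n
    f≤ = ℕₚ.m+n≤o⇒n≤o e r₄
    n≤D : n ℕ.≤ D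
    n≤D = ℕₚ.m≤n*m n t
    weaken : (1# - δ₀) * ⟦ t ⟧ * ⟦ n ⟧ ≤ (1# - δ) * ⟦ D ⟧
    weaken = ≤-trans (weaken-pure δ₀ δ ⟦ t ⟧ ⟦ n ⟧ δ≤ 0≤⟦ t ⟧ 0≤⟦ n ⟧) (≤-reflexive (cong ((1# - δ) *_) (sym (⟦⟧-* t n))))
    σ : ℚ
    σ = inv (suc N' ℕ.* 8)
    x k' : ℕ
    k' = 7 ℕ.+ N' ℕ.* 8
    x = D ℕ/./ suc k'
    x+1≤D : suc x ℕ.≤ D
    x+1≤D = ⟦⟧-cancel (≡≤ (1+⟦ x ⟧) (x+1≤D-pure ⟦ x ⟧ ⟦ suc k' ⟧ ⟦ D ⟧ (floor≤ D k') (⟦⟧-mono {2} {suc k'} (ℕ.s≤s (ℕ.s≤s ℕ.z≤n))) 0≤⟦ x ⟧ (⟦⟧-mono {2} (ℕₚ.≤-trans 2≤n n≤D))))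
    K≤ : ⟦ K ⟧ ≤ (1# - σ) * ⟦ t ⟧ * ⟦ n ⟧
    K≤ = ≤-trans (pure ⟦ K ⟧ ⟦ x ⟧ ⟦ D ⟧ ⟦ suc k' ⟧ σ (trans (cong (⟦ K ⟧ +_) (sym 1+⟦ x ⟧)) (trans (sym (⟦⟧-+ K (suc x))) (cong ⟦_⟧ (ℕₚ.m∸n+n≡m x+1≤D)))) (floor≥ D k') (*inv k') (0≤inv (suc k')))
      (≤-reflexive (trans (cong ((1# - σ) *_) (⟦⟧-* t n)) (sym (*-assoc (1# - σ) ⟦ t ⟧ ⟦ n ⟧)))) where
     pure : ∀ K x D k σ → K + (1# + x) ≡ D → D ≤ k * (x + 1#) → k * σ ≡ 1# → 0# ≤ σ → K ≤ (1# - σ) * D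
     pure K x D k σ e h f 0σ = ≡≤ (trans (pure-e₁-11 K x) (cong (_- (x + 1#)) e)) (≤-trans (step (≤-trans (*-monoˡ 0σ h) (≤-reflexive (trans (pure-e₂-7 σ k x) (trans (cong (_* (x + 1#)) f) (*-identityˡ (x + 1#))))))) ≤-refl) where
      step : σ * D ≤ x + 1# → D - (x + 1#) ≤ (1# - σ) * D
      step h = by (gap h) (solve (σ ⸴ D ⸴ x ⸴ ∎) ring)
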